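{- Let $k,s,m$ be positive integers such that $k$ is even, $k\ge 2$, $s\le n^{k/2}$ and $n^{k/2}\le m\le\mathrm{poly}(n)$. There is a randomized algorithm that, given $k$ independent uniformly random vectors $w^1,\ldots,w^k\in[m]^n$ and a target $t$ (that may be adversarially chosen depending on the lists), finds $s_i\in w^i$ (for $i=1,\ldots,k$) satisfying $\sum_{i=1}^k s_i=t$, if they exist, with constant probability using $\tilde{O}(n^{3k/4}/\sqrt{s})$ time and $O(s\log n)$ space. The algorithm assumes random read-only access to a random function $h:[km]\to[n^{k/2}]$.
   Context: $[a]=\{1,\ldots,a\}$. Here $s_i\in w^i$ means that $s_i$ is one of the $n$ entries of the vector (list) $w^i$, and $t$ is an integer; $k$ is regarded as a constant. The input is accessed by random read-only access and is not counted in the space usage. Random read-only access to a random function $h$ means that $h$ is chosen uniformly at random among all functions with the given domain and codomain, any evaluation of $h$ can be read in constant time, and the storage of $h$ is not counted in the space usage. The notation $\tilde{O}(T)$ means $O(T\cdot\mathrm{polylog}(T))$. "With constant probability" means with probability at least some positive constant. -}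

module Defs where

open import Data.Fin using (Fin; toℕ; fromℕ<)
open import Data.Integer as ℤ using (ℤ; +_)
open import Data.Integer.DivMod using (_%ℕ_; n%ℕd<d)
open import Data.List as List using (List; []; _∷_; _++_; length; filter; allFin; cartesianProduct; cartesianProductWith)
open import Data.Nat
open import Data.Nat.Logarithm using (⌊log₂_⌋)
open import Data.Nat.Properties using (m^n≢0; _<?_; _≟_)
open import Data.Product using (∃-syntax; _×_; _,_)
open import Data.Rational as ℚ using (ℚ; 0ℚ)
open import Data.Vec as Vec using (Vec; []; _∷_; lookup; tabulate; _[_]≔_; concat; sum)
open import Data.Vec.Membership.DecPropositional _≟_ using (_∈_; _∈?_; find; lose)
open import Data.Vec.Relation.Binary.Pointwise.Inductive as Pointwise using (Pointwise; []; _∷_)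
open import Data.Vec.Relation.Unary.Any using (Any; any?)
open import Function using (_∘_)
open import Relation.Binary.PropositionalEquality using (_≡_)
open import Relation.Nullary using (Dec; yes; no)
open import Relation.Nullary.Decidable using (map′; _×-dec_; _→-dec_)
open import Relation.Unary using (Decidable)

-- Out-of-range positions give the default value.
lookupOr : ∀ {A : Set} {n} → A → Vec A n → ℕ → A
lookupOr {n = n} d xs i with i <? n
... | yes i<n = lookup xs (fromℕ< i<n)
... | no  _   = d

-- An element of Fin a stands for an element of [a] = {1,…,a}.
value : ∀ {a} → Fin a → ℕ
value x = suc (toℕ x)

------------------------------------------------------------------------
-- A randomized word RAM with control flow given by blocks.

-- Registers are the memory cells with fixed addresses.
Reg : Set
Reg = ℕ

data Op : Set where
  add sub mul quot rem less : Op

-- A register name on the right of := or between brackets stands for its content.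
data Instr : Set where
  const : Reg → ℕ → Instr                    -- dst := literal
  arith : Op → Reg → Reg → Reg → Instr       -- dst := a op b
  load  : Reg → Reg → Instr                  -- dst := mem[a]
  store : Reg → Reg → Instr                  -- mem[a] := b
  input : Reg → Reg → Instr                  -- dst := read-only input at a
  hash  : Reg → Reg → Instr                  -- dst := h(a)
  rand  : Reg → Instr                        -- dst := fresh uniform word
  ifnz  : Reg → List Instr → List Instr → Instr
  while : Reg → List Instr → Instr           -- repeat while the register is nonzero

Program : Set
Program = List Instr

-- The two random-access read-only data sources.
record Env : Set where
  field
    inputAt : ℕ → ℤ
    hashAt  : ℕ → ℕ

-- The memory consists of S words of W bits each.
module Machine (W S : ℕ) where

  private instance
    2^W≢0 : NonZero (2 ^ W)
    2^W≢0 = m^n≢0 2 W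

  Word : Set
  Word = Fin (2 ^ W)

  -- Residue modulo 2^W.
  word : ℤ → Word
  word z = fromℕ< (n%ℕd<d z (2 ^ W))

  Memory : Set
  Memory = Vec Word S

  -- Accesses outside the memory read 0 and write nothing.
  read : Memory → ℕ → ℕ
  read μ a = toℕ (lookupOr (word (+ 0)) μ a)

  write : Memory → ℕ → Word → Memory
  write μ a v with a <? S
  ... | yes a<S = μ [ fromℕ< a<S ]≔ v
  ... | no  _   = μ

  eval : Op → ℕ → ℕ → ℤ
  eval add  x y       = + (x + y)
  eval sub  x y       = + x ℤ.- + y
  eval mul  x y       = + (x * y)
  eval quot x zero    = + 0
  eval quot x (suc y) = + (x / suc y)
  eval rem  x zero    = + 0
  eval rem  x (suc y) = + (x % suc y)
  eval less x y with x <? y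
  ... | yes _ = + 1
  ... | no  _ = + 0

  -- The code still to be executed plays the role of the program counter: for a
  -- fixed program it ranges over a finite set, independent of W, S and the input.
  record Config : Set where
    constructor ⟨_,_⟩
    field
      code   : List Instr
      memory : Memory

  open Config public

  Halted : Config → Set
  Halted σ = code σ ≡ []

  -- One time step; the first word is the random word available in this step.
  step : Env → Word → Config → Config
  step ε r ⟨ [] , μ ⟩                = ⟨ [] , μ ⟩
  step ε r ⟨ const d c     ∷ κ , μ ⟩ = ⟨ κ , write μ d (word (+ c)) ⟩
  step ε r ⟨ arith o d a b ∷ κ , μ ⟩ = ⟨ κ , write μ d (word (eval o (read μ a) (read μ b))) ⟩
  step ε r ⟨ load d a      ∷ κ , μ ⟩ = ⟨ κ , write μ d (word (+ read μ (read μ a))) ⟩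
  step ε r ⟨ store a b     ∷ κ , μ ⟩ = ⟨ κ , write μ (read μ a) (word (+ read μ b)) ⟩
  step ε r ⟨ input d a     ∷ κ , μ ⟩ = ⟨ κ , write μ d (word (Env.inputAt ε (read μ a))) ⟩
  step ε r ⟨ hash d a      ∷ κ , μ ⟩ = ⟨ κ , write μ d (word (+ Env.hashAt ε (read μ a))) ⟩
  step ε r ⟨ rand d        ∷ κ , μ ⟩ = ⟨ κ , write μ d r ⟩
  step ε r ⟨ ifnz a p q    ∷ κ , μ ⟩ with read μ a
  ... | zero  = ⟨ q ++ κ , μ ⟩
  ... | suc _ = ⟨ p ++ κ , μ ⟩
  step ε r ⟨ while a p     ∷ κ , μ ⟩ with read μ a
  ... | zero  = ⟨ κ , μ ⟩
  ... | suc _ = ⟨ p ++ while a p ∷ κ , μ ⟩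

  steps : ∀ {T} → Env → Vec Word T → Config → Config
  steps ε []       σ = σ
  steps ε (r ∷ rs) σ = steps ε rs (step ε r σ)

  start : Program → Config
  start P = ⟨ P , Vec.replicate S (word (+ 0)) ⟩

  -- The output consists of the contents of the first k cells.
  output : ∀ k → Config → Vec ℕ k
  output k σ = tabulate (λ i → read (memory σ) (toℕ i))

------------------------------------------------------------------------
-- Instances of k-Sum

Lists : ℕ → ℕ → ℕ → Set
Lists k n m = Vec (Vec (Fin m) n) k

HashFun : ℕ → ℕ → Set
HashFun a b = Vec (Fin b) a

values : ∀ {k n m} → Lists k n m → Vec (Vec ℕ n) k
values = Vec.map (Vec.map value)

Picks : ∀ {k n} → Vec ℕ k → Vec (Vec ℕ n) k → Set
Picks = Pointwise (λ x l → x ∈ l)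

IsSolution : ∀ {k n m} → Lists k n m → ℤ → Vec ℕ k → Set
IsSolution w t xs = Picks xs (values w) × (+ sum xs ≡ t)

Solvable : ∀ {k n m} → Lists k n m → ℤ → Set
Solvable {k} w t = ∃[ xs ] IsSolution {k} w t xs

isSolution? : ∀ {k n m} (w : Lists k n m) t → Decidable (IsSolution w t)
isSolution? w t xs = Pointwise.decidable (λ x l → x ∈? l) xs (values w) ×-dec (+ sum xs ℤ.≟ t)

choice? : ∀ {k n} {P : Vec ℕ k → Set} → Decidable P → (v : Vec (Vec ℕ n) k) →
          Dec (∃[ xs ] (Picks xs v × P xs))
choice? P? [] = map′ (λ p → [] , [] , p) (λ { ([] , [] , p) → p }) (P? [])
choice? {P = P} P? (l ∷ v) = map′ join split (any? (λ x → choice? (P? ∘ (x ∷_)) v) l)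
  where
  Extends : ℕ → Set
  Extends x = ∃[ xs ] (Picks xs v × P (x ∷ xs))

  join : Any Extends l → ∃[ xs ] (Picks xs (l ∷ v) × P xs)
  join a with find a
  ... | x , x∈l , xs , xs∈v , p = x ∷ xs , x∈l ∷ xs∈v , p

  split : ∃[ xs ] (Picks xs (l ∷ v) × P xs) → Any Extends l
  split (x ∷ xs , x∈l ∷ xs∈v , p) = lose x∈l (xs , xs∈v , p)

solvable? : ∀ {k n m} (w : Lists k n m) t → Dec (Solvable w t)
solvable? w t = choice? (λ xs → + sum xs ℤ.≟ t) (values w)

-- Input addresses 0,…,3 hold n, m, s, t, and address 4 + (i·n + j) holds
-- w^{i+1}_{j+1}.  A word read from the input is reduced modulo 2^W, which
-- matters only for targets t outside the range of a machine word.
env : ∀ {k n m N} (s : ℕ) → Lists k n m → ℤ → HashFun (k * m) N → Env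
env {k} {n} {m} s w t h = record { inputAt = inputAt ; hashAt = hashAt }
  where
  inputAt : ℕ → ℤ
  inputAt 0 = + n
  inputAt 1 = + m
  inputAt 2 = + s
  inputAt 3 = t
  inputAt (suc (suc (suc (suc a)))) = + lookupOr 0 (concat (values w)) a

  hashAt : ℕ → ℕ
  hashAt 0       = 0
  hashAt (suc v) = lookupOr 0 (Vec.map value h) v

------------------------------------------------------------------------
-- Uniform probability on finite sample spaces

vectors : ∀ {A : Set} → List A → ∀ n → List (Vec A n)
vectors xs zero    = [] ∷ []
vectors xs (suc n) = cartesianProductWith _∷_ xs (vectors xs n)

-- The list enumerates the sample space without repetitions.
Pr : ∀ {A : Set} {E : A → Set} → List A → Decidable E → ℚ
Pr []         E? = 0ℚ
Pr Ω@(_ ∷ Ω′) E? = (+ length (filter E? Ω)) ℚ./ suc (length Ω′)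

module _ (W S T k n m N : ℕ) where

  open Machine W S

  Outcome : Set
  Outcome = Lists k n m × HashFun (k * m) N × Vec Word T

  outcomes : List Outcome
  outcomes =
    cartesianProduct (vectors (vectors (allFin m) n) k)
      (cartesianProduct (vectors (allFin N) (k * m))
        (vectors (allFin (2 ^ W)) T))

  final : Program → (s : ℕ) → Lists k n m → ℤ → HashFun (k * m) N → Vec Word T → Config
  final P s w t h r = steps (env s w t h) r (start P)

  AlwaysHalts : Program → ℕ → Set
  AlwaysHalts P s = ∀ w t h r → Halted (final P s w t h r)

  Success : Program → ℕ → (Lists k n m → ℤ) → Outcome → Set
  Success P s τ (w , h , r) =
    Solvable w (τ w) → IsSolution w (τ w) (output k (final P s w (τ w) h r))

  success? : ∀ P s τ → Decidable (Success P s τ)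
  success? P s τ (w , h , r) =
    solvable? w (τ w) →-dec isSolution? w (τ w) (output k (final P s w (τ w) h r))

  -- τ is the adversary choosing the target after seeing the lists.
  successProbability : Program → ℕ → (Lists k n m → ℤ) → ℚ
  successProbability P s τ = Pr outcomes (success? P s τ)

------------------------------------------------------------------------
-- Resource bounds

-- The number of bits of n, i.e. Θ(log n), but nonzero also for n = 1.
bits : ℕ → ℕ
bits n = suc ⌊log₂ n ⌋

-- T ≤ C · x · (log x)^e for the real number x = (a/b)^{1/4}, raised to the fourth
-- power to clear the roots.  The logarithm is that of x⁴, i.e. 4 log x, and bits
-- keeps it positive for x = 1; both only affect the constant C.
Õ-root⁴ : (C e a b T : ℕ) → .{{NonZero b}} → Set
Õ-root⁴ C e a b T = T ^ 4 * b ≤ (C * bits (a / b) ^ e) ^ 4 * a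

-- T = Õ(n^{3k/4} / √s)
TimeBound : (C e k n s T : ℕ) → .{{NonZero s}} → Set
TimeBound C e k n s T = Õ-root⁴ C e (n ^ (3 * k)) (s ^ 2) T {{m^n≢0 s 2}}

-- S words of W bits amount to O(s log n) bits.
SpaceBound : (C n s W S : ℕ) → Set
SpaceBound C n s W S = S * W ≤ C * (s * bits n)

-- Let K = k / 2 and N = n ^ K. An index below N selects one entry from each of K lists. Half of the N vertices stand
-- for indices into the first K lists, the others for indices into the last K lists, after a random shift of the
-- indices; the value z v of a vertex is the sum selected, or t minus it, modulo k m. The walks v ↦ h (z v) from two
-- vertices merge as soon as they reach the two halves of a solution, whose values agree. A run stores the ends of c
-- walks of ℓ steps in a table of O(c) cells, then follows c further walks until they reach a stored end, and replays
-- the two walks to find out where they merge. It succeeds if one walk of each phase reaches its half of the solution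
-- and nothing else collides. As long as c ℓ² is a small fraction of N this has probability about (c ℓ)² / N² times the
-- number of pairs of halves with the value of the solution, by resampling h at the two queries that lead there. For
-- fixed h the runs are independent, and the second moment over h of the probability that a run succeeds shows that
-- it is typically of the order of its mean. The number γ of halves with that value is unknown and the bound on
-- collisions needs c γ = O(s), so c runs through O(log s) scales. In random lists the expected number of
-- coincidences among the half sums is O(N).

module Submission where

open import Defs
open import Data.Bool as Bool using (Bool; true; false; if_then_else_)
open import Data.Empty using (⊥)
open import Data.Fin as Fin using (Fin; zero; suc; toℕ; fromℕ<)
open import Data.Fin.Patterns using (0F; 1F; 2F; 3F; 4F; 5F; 6F)
open import Data.Fin.Properties using (any?; all?; nonZeroIndex; toℕ<n; toℕ-injective; toℕ-fromℕ<; fromℕ<-toℕ; fromℕ<-cong; toℕ-combine)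
open import Data.Integer as ℤ using (ℤ)
import Data.Integer.Properties as ℤP
open import Data.List as List using (List; []; _∷_; _++_; length; filter; allFin; cartesianProduct; cartesianProductWith; map; tabulate)
open import Data.List.Membership.DecPropositional using (_∈?_)
open import Data.List.Membership.Propositional using (_∈_; _∉_)
open import Data.List.Membership.Propositional.Properties using (∈-allFin; ∈-++⁺ˡ; ∈-++⁺ʳ; ∈-++⁻)
open import Data.List.Properties using (length-map; length-++; length-tabulate; ++-assoc; ++-identityʳ)
open import Data.List.Relation.Unary.Any using (here; there)
open import Data.Nat
open import Data.Nat.DivMod
open import Data.Nat.Divisibility using (_∣_; divides)
open import Data.Nat.Logarithm using (⌊log₂_⌋; ⌊log₂⌋-mono-≤; ⌊log₂[2^n]⌋≡n)
open import Data.Nat.Properties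
open ≤-Reasoning using (begin_; begin-equality_; begin-strict_; step-≡-⟩; step-≡-⟨; step-≤; step-<; _∎)
open import Data.Nat.Tactic.RingSolver using (solve-∀)
open import Data.Product using (Σ; Σ-syntax; ∃; ∃-syntax; _×_; _,_; proj₁; proj₂)
open import Data.Rational as ℚ using (ℚ; 0ℚ)
import Data.Rational.Properties as ℚP
import Data.Rational.Unnormalised as ℚᵘ
import Data.Rational.Unnormalised.Properties as ℚᵘP
open import Data.Sum using (_⊎_; inj₁; inj₂; [_,_]′)
open import Data.Unit using (⊤; tt)
open import Data.Vec as Vec using (Vec; []; _∷_; lookup; _[_]≔_)
import Data.Vec.Membership.Propositional as Vec∈
open import Data.Vec.Membership.Propositional.Properties using (∈-lookup)
open import Data.Vec.Properties using ([]≔-idempotent; []≔-lookup; lookup∘update; lookup∘update′; lookup-map; lookup∘tabulate; lookup-concat; tabulate-cong; tabulate∘lookup; take++drop≡id; lookup-replicate; lookup-splitAt)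
import Data.Vec.Relation.Binary.Pointwise.Inductive as Pointwise
open import Data.Vec.Relation.Unary.All using (All; []; _∷_)
open import Data.Vec.Relation.Unary.All.Properties using (++⁺)
import Data.Vec.Relation.Unary.Any as VecAny
import Data.Vec.Relation.Unary.Any.Properties as VecAnyP
open import Function using (_∘_; id; case_of_)
open import Relation.Binary.Definitions using (tri<; tri≈; tri>)
open import Relation.Binary.PropositionalEquality hiding (J)
open import Relation.Nullary using (Dec; yes; no; ¬_; contradiction; ¬?)
open import Relation.Nullary.Decidable using (_×-dec_; _→-dec_; map′)
open import Relation.Unary using (Decidable)

-- Probabilities are counts over finite sample spaces with cleared denominators, so every estimate
-- is an inequality between natural numbers. A value of h may be resampled only under an event that
-- ignores it. Therefore `Undisturbed` follows the walk from the left half i separately and never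
-- looks at the answers of the two decisive queries; arriving at both halves then costs exactly a
-- factor N². The obstacle in the second moment is that h cannot be renewed between runs, and in one
-- fixed graph the number of short walks into a given vertex may be far from its mean. The shifts,
-- drawn anew in each run, change the vertices that carry the value of the solution, so that
-- vertices visited by one run are rarely targets of another. They also give every half its chance
-- to lie on the proper side of the vertices. Entries are at least 1, hence sums of k entries lie
-- between 1 and k m, and congruence modulo k m is equality: any two halves with the common value
-- form a solution. The analysis needs N above a constant. Below it, a single uniform guess of two
-- indices succeeds with constant probability, and the program starts with one.

≡-≤ : ∀ {a b c : ℕ} → a ≡ b → b ≤ c → a ≤ c
≡-≤ refl le = le

≤-≡ : ∀ {a b c : ℕ} → a ≤ b → b ≡ c → a ≤ c
≤-≡ le refl = le

*-swap : ∀ x y z → x * (y * z) ≡ y * (x * z)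
*-swap = solve-∀

-- Finite sums

∑ : {A : Set} → List A → (A → ℕ) → ℕ
∑ []       f = 0
∑ (x ∷ xs) f = f x + ∑ xs f

𝟙 : {P : Set} → Dec P → ℕ
𝟙 (yes _) = 1
𝟙 (no  _) = 0

module _ {A : Set} where

  ∑-cong : (xs : List A) {f g : A → ℕ} → (∀ x → f x ≡ g x) → ∑ xs f ≡ ∑ xs g
  ∑-cong []       e = refl
  ∑-cong (x ∷ xs) e = cong₂ _+_ (e x) (∑-cong xs e)

  ∑-mono : (xs : List A) {f g : A → ℕ} → (∀ x → f x ≤ g x) → ∑ xs f ≤ ∑ xs g
  ∑-mono []       e = z≤n
  ∑-mono (x ∷ xs) e = +-mono-≤ (e x) (∑-mono xs e)

  ∑-+ : (xs : List A) (f g : A → ℕ) → ∑ xs (λ x → f x + g x) ≡ ∑ xs f + ∑ xs g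
  ∑-+ []       f g = refl
  ∑-+ (x ∷ xs) f g = trans (cong (f x + g x +_) (∑-+ xs f g)) (interchange (f x) (g x) (∑ xs f) (∑ xs g))
    where
    interchange : ∀ a b c d → a + b + (c + d) ≡ a + c + (b + d)
    interchange = solve-∀

  ∑-*ˡ : (xs : List A) (c : ℕ) (f : A → ℕ) → ∑ xs (λ x → c * f x) ≡ c * ∑ xs f
  ∑-*ˡ []       c f = sym (*-zeroʳ c)
  ∑-*ˡ (x ∷ xs) c f = trans (cong (c * f x +_) (∑-*ˡ xs c f)) (sym (*-distribˡ-+ c (f x) (∑ xs f)))

  ∑-*ʳ : (xs : List A) (c : ℕ) (f : A → ℕ) → ∑ xs (λ x → f x * c) ≡ ∑ xs f * c
  ∑-*ʳ xs c f = trans (∑-cong xs (λ x → *-comm (f x) c)) (trans (∑-*ˡ xs c f) (*-comm c (∑ xs f)))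

  ∑-const : (xs : List A) (c : ℕ) → ∑ xs (λ _ → c) ≡ length xs * c
  ∑-const []       c = refl
  ∑-const (x ∷ xs) c = cong (c +_) (∑-const xs c)

  ∑-zero : (xs : List A) → ∑ xs (λ _ → 0) ≡ 0
  ∑-zero xs = trans (∑-const xs 0) (*-zeroʳ (length xs))

  ∑-++ : (xs ys : List A) (f : A → ℕ) → ∑ (xs ++ ys) f ≡ ∑ xs f + ∑ ys f
  ∑-++ []       ys f = refl
  ∑-++ (x ∷ xs) ys f = trans (cong (f x +_) (∑-++ xs ys f)) (sym (+-assoc (f x) _ _))

  ∑-∈ : (xs : List A) (f : A → ℕ) {x : A} → x ∈ xs → f x ≤ ∑ xs f
  ∑-∈ (x ∷ xs) f (here refl) = m≤m+n (f x) _
  ∑-∈ (y ∷ xs) f (there i)   = ≤-trans (∑-∈ xs f i) (m≤n+m _ (f y))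

  ∑-bound : (xs : List A) (f : A → ℕ) {c : ℕ} → (∀ x → f x ≤ c) → ∑ xs f ≤ length xs * c
  ∑-bound xs f {c} f≤c = ≤-≡ (∑-mono xs f≤c) (∑-const xs c)

  length-filter : {P : A → Set} (P? : Decidable P) (xs : List A) →
                  length (filter P? xs) ≡ ∑ xs (λ x → 𝟙 (P? x))
  length-filter P? [] = refl
  length-filter P? (x ∷ xs) with P? x
  ... | yes _ = cong suc (length-filter P? xs)
  ... | no  _ = length-filter P? xs

module _ {A B : Set} where

  ∑-swap : (xs : List A) (ys : List B) (f : A → B → ℕ) →
           ∑ xs (λ x → ∑ ys (f x)) ≡ ∑ ys (λ y → ∑ xs (λ x → f x y))
  ∑-swap []       ys f = sym (∑-zero ys)
  ∑-swap (x ∷ xs) ys f =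
    trans (cong (∑ ys (f x) +_) (∑-swap xs ys f)) (sym (∑-+ ys (f x) (λ y → ∑ xs (λ x → f x y))))

  ∑-map : (g : A → B) (xs : List A) (f : B → ℕ) → ∑ (map g xs) f ≡ ∑ xs (f ∘ g)
  ∑-map g []       f = refl
  ∑-map g (x ∷ xs) f = cong (f (g x) +_) (∑-map g xs f)

  ∑-*-∑ : (xs : List A) (ys : List B) (f : A → ℕ) (g : B → ℕ) →
          ∑ xs (λ x → ∑ ys (λ y → f x * g y)) ≡ ∑ xs f * ∑ ys g
  ∑-*-∑ xs ys f g = trans (∑-cong xs (λ x → ∑-*ˡ ys (f x) g)) (∑-*ʳ xs (∑ ys g) f)

∑-cartesianProductWith : {A B C : Set} (g : A → B → C) (xs : List A) (ys : List B) (f : C → ℕ) →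
                         ∑ (cartesianProductWith g xs ys) f ≡ ∑ xs (λ x → ∑ ys (λ y → f (g x y)))
∑-cartesianProductWith g []       ys f = refl
∑-cartesianProductWith g (x ∷ xs) ys f =
  trans (∑-++ (map (g x) ys) _ f) (cong₂ _+_ (∑-map (g x) ys f) (∑-cartesianProductWith g xs ys f))

∑-× : {A B : Set} (xs : List A) (ys : List B) (f : A × B → ℕ) →
      ∑ (cartesianProduct xs ys) f ≡ ∑ xs (λ x → ∑ ys (λ y → f (x , y)))
∑-× xs ys f = ∑-cartesianProductWith _,_ xs ys f

∑-tabulate : {A : Set} (n : ℕ) (g : Fin n → A) (f : A → ℕ) → ∑ (tabulate g) f ≡ ∑ (allFin n) (f ∘ g)
∑-tabulate zero    g f = refl
∑-tabulate (suc n) g f =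
  cong (f (g zero) +_) (trans (∑-tabulate n (g ∘ suc) f) (sym (∑-tabulate n suc (f ∘ g))))

∑-allFin-suc : (n : ℕ) (f : Fin (suc n) → ℕ) → ∑ (allFin (suc n)) f ≡ f zero + ∑ (allFin n) (f ∘ suc)
∑-allFin-suc n f = cong (f zero +_) (∑-tabulate n suc f)

length-allFin : ∀ n → length (allFin n) ≡ n
length-allFin n = length-tabulate {n = n} id

module _ {P : Set} where

  𝟙-yes : (P? : Dec P) → P → 𝟙 P? ≡ 1
  𝟙-yes (yes _) p = refl
  𝟙-yes (no ¬p) p = contradiction p ¬p

  𝟙-no : (P? : Dec P) → ¬ P → 𝟙 P? ≡ 0
  𝟙-no (yes p) ¬p = contradiction p ¬p
  𝟙-no (no _)  ¬p = refl

  𝟙-holds : (P? : Dec P) → 𝟙 P? ≢ 0 → P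
  𝟙-holds (yes p) _ = p
  𝟙-holds (no _)  n = contradiction refl n

  𝟙≤1 : (P? : Dec P) → 𝟙 P? ≤ 1
  𝟙≤1 (yes _) = ≤-refl
  𝟙≤1 (no _)  = z≤n

  𝟙≤ : (P? : Dec P) {n : ℕ} → (P → 1 ≤ n) → 𝟙 P? ≤ n
  𝟙≤ (yes p) f = f p
  𝟙≤ (no _)  f = z≤n

  𝟙*≤ : (P? : Dec P) {n m : ℕ} → (P → n ≤ m) → 𝟙 P? * n ≤ m
  𝟙*≤ (yes p) {n} f = ≡-≤ (+-identityʳ n) (f p)
  𝟙*≤ (no _)  f = z≤n

  𝟙+𝟙¬ : (P? : Dec P) → 𝟙 P? + 𝟙 (¬? P?) ≡ 1
  𝟙+𝟙¬ (yes _) = refl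
  𝟙+𝟙¬ (no _)  = refl

𝟙-mono : {P Q : Set} (P? : Dec P) (Q? : Dec Q) → (P → Q) → 𝟙 P? ≤ 𝟙 Q?
𝟙-mono P? Q? f = 𝟙≤ P? (λ p → ≤-reflexive (sym (𝟙-yes Q? (f p))))

𝟙-cong : {P Q : Set} (P? : Dec P) (Q? : Dec Q) → (P → Q) → (Q → P) → 𝟙 P? ≡ 𝟙 Q?
𝟙-cong P? Q? f g = ≤-antisym (𝟙-mono P? Q? f) (𝟙-mono Q? P? g)

𝟙-× : {P Q : Set} (P? : Dec P) (Q? : Dec Q) → 𝟙 (P? ×-dec Q?) ≡ 𝟙 P? * 𝟙 Q?
𝟙-× (yes _) (yes _) = refl
𝟙-× (yes _) (no _)  = refl
𝟙-× (no _)  (yes _) = refl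
𝟙-× (no _)  (no _)  = refl

∑-∃ : {A : Set} {P : A → Set} (P? : Decidable P) (xs : List A) →
      ∑ xs (λ x → 𝟙 (P? x)) ≢ 0 → ∃[ x ] P x
∑-∃ P? []       n = contradiction refl n
∑-∃ P? (x ∷ xs) n with P? x
... | yes p = x , p
... | no  _ = ∑-∃ P? xs n

∑-δ : ∀ {n} (x : Fin n) (f : Fin n → ℕ) → ∑ (allFin n) (λ y → 𝟙 (y Fin.≟ x) * f y) ≡ f x
∑-δ {suc n} zero f =
  trans (∑-allFin-suc n (λ y → 𝟙 (y Fin.≟ zero) * f y))
        (trans (cong (f zero + 0 +_) (∑-zero (allFin n))) (trans (+-identityʳ _) (+-identityʳ _)))
∑-δ {suc n} (suc x) f =
  trans (∑-allFin-suc n (λ y → 𝟙 (y Fin.≟ suc x) * f y))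
        (trans (∑-cong (allFin n) (λ y → cong (_* f (suc y))
                 (𝟙-cong (suc y Fin.≟ suc x) (y Fin.≟ x) (λ { refl → refl }) (cong suc))))
               (∑-δ x (f ∘ suc)))

∑-δ₁ : ∀ {n} (x : Fin n) → ∑ (allFin n) (λ y → 𝟙 (y Fin.≟ x)) ≡ 1
∑-δ₁ {n} x = trans (∑-cong (allFin n) (λ y → sym (*-identityʳ _))) (∑-δ x (λ _ → 1))

∑-unique : ∀ {n} (f : Fin n → ℕ) → (∀ x → f x ≤ 1) → (∀ x y → f x ≢ 0 → f y ≢ 0 → x ≡ y) → ∑ (allFin n) f ≤ 1
∑-unique {zero}  f f≤1 uniq = z≤n
∑-unique {suc n} f f≤1 uniq = ≡-≤ (∑-allFin-suc n f) (go (f zero) refl)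
  where
  rest : ∑ (allFin n) (f ∘ suc) ≤ 1
  rest = ∑-unique (f ∘ suc) (f≤1 ∘ suc) λ x y p q → case uniq (suc x) (suc y) p q of λ { refl → refl }

  go : ∀ k → f zero ≡ k → k + ∑ (allFin n) (f ∘ suc) ≤ 1
  go zero    e = rest
  go (suc k) e = ≡-≤ (trans (cong (suc k +_)
    (trans (∑-cong (allFin n) none) (∑-zero (allFin n)))) (trans (+-identityʳ (suc k)) (sym e))) (f≤1 zero)
    where
    none : ∀ x → f (suc x) ≡ 0
    none x with f (suc x) in e′
    ... | zero  = refl
    ... | suc _ with () ← uniq zero (suc x) (λ e″ → 1+n≢0 (trans (sym e) e″)) (λ e″ → 1+n≢0 (trans (sym e′) e″))

∑-injective : ∀ {n} (σ : Fin n → Fin n) → (∀ x y → σ x ≡ σ y → x ≡ y) →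
              (f : Fin n → ℕ) → ∑ (allFin n) (f ∘ σ) ≤ ∑ (allFin n) f
∑-injective {n} σ inj f = begin
  ∑ (allFin n) (f ∘ σ)
    ≡⟨ ∑-cong (allFin n) (λ x → ∑-δ (σ x) f) ⟨
  ∑ (allFin n) (λ x → ∑ (allFin n) (λ y → 𝟙 (y Fin.≟ σ x) * f y))
    ≡⟨ ∑-swap (allFin n) (allFin n) _ ⟩
  ∑ (allFin n) (λ y → ∑ (allFin n) (λ x → 𝟙 (y Fin.≟ σ x) * f y))
    ≤⟨ ∑-mono (allFin n) (λ y → ≡-≤ (∑-*ʳ (allFin n) (f y) _)
         (≤-≡ (*-monoˡ-≤ (f y) (hits y)) (*-identityˡ (f y)))) ⟩
  ∑ (allFin n) f ∎
  where
  hits : ∀ y → ∑ (allFin n) (λ x → 𝟙 (y Fin.≟ σ x)) ≤ 1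
  hits y = ∑-unique _ (λ x → 𝟙≤1 (y Fin.≟ σ x))
    (λ x x′ p q → inj x x′ (trans (sym (𝟙-holds (y Fin.≟ σ x) p)) (𝟙-holds (y Fin.≟ σ x′) q)))

-- Sums over vectors

module _ {A : Set} (xs : List A) where

  ∑-vectors-suc : ∀ n (f : Vec A (suc n) → ℕ) →
                  ∑ (vectors xs (suc n)) f ≡ ∑ xs (λ x → ∑ (vectors xs n) (λ v → f (x ∷ v)))
  ∑-vectors-suc n f = ∑-cartesianProductWith _∷_ xs (vectors xs n) f

  length-vectors : ∀ n → length (vectors xs n) ≡ length xs ^ n
  length-vectors zero    = refl
  length-vectors (suc n) = begin-equality
    length (vectors xs (suc n)) ≡⟨ *-identityʳ _ ⟨
    length (vectors xs (suc n)) * 1 ≡⟨ ∑-const (vectors xs (suc n)) 1 ⟨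
    ∑ (vectors xs (suc n)) (λ _ → 1) ≡⟨ ∑-vectors-suc n (λ _ → 1) ⟩
    ∑ xs (λ x → ∑ (vectors xs n) (λ _ → 1)) ≡⟨ ∑-const xs _ ⟩
    length xs * ∑ (vectors xs n) (λ _ → 1) ≡⟨ cong (length xs *_) (∑-const (vectors xs n) 1) ⟩
    length xs * (length (vectors xs n) * 1) ≡⟨ cong (length xs *_) (*-identityʳ _) ⟩
    length xs * length (vectors xs n) ≡⟨ cong (length xs *_) (length-vectors n) ⟩
    length xs * length xs ^ n ∎

  ∑-vectors-++ : ∀ m n (f : Vec A (m + n) → ℕ) →
                 ∑ (vectors xs (m + n)) f ≡ ∑ (vectors xs m) (λ u → ∑ (vectors xs n) (λ v → f (u Vec.++ v)))
  ∑-vectors-++ zero    n f = sym (+-identityʳ _)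
  ∑-vectors-++ (suc m) n f = begin-equality
    ∑ (vectors xs (suc m + n)) f
      ≡⟨ ∑-vectors-suc (m + n) f ⟩
    ∑ xs (λ x → ∑ (vectors xs (m + n)) (λ v → f (x ∷ v)))
      ≡⟨ ∑-cong xs (λ x → ∑-vectors-++ m n (λ v → f (x ∷ v))) ⟩
    ∑ xs (λ x → ∑ (vectors xs m) (λ u → ∑ (vectors xs n) (λ v → f (x ∷ u Vec.++ v))))
      ≡⟨ ∑-vectors-suc m _ ⟨
    ∑ (vectors xs (suc m)) (λ u → ∑ (vectors xs n) (λ v → f (u Vec.++ v))) ∎

  -- Exchanging an entry with an independent sample preserves the joint distribution.
  ∑-exchange : ∀ {n} (i : Fin n) (F : Vec A n → A → ℕ) →
               ∑ (vectors xs n) (λ v → ∑ xs (λ y → F (v [ i ]≔ y) (lookup v i)))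
               ≡ ∑ (vectors xs n) (λ v → ∑ xs (F v))
  ∑-exchange {suc n} zero F = begin-equality
    ∑ (vectors xs (suc n)) (λ v → ∑ xs (λ y → F (v [ zero ]≔ y) (lookup v zero)))
      ≡⟨ ∑-vectors-suc n _ ⟩
    ∑ xs (λ x → ∑ (vectors xs n) (λ v → ∑ xs (λ y → F (y ∷ v) x)))
      ≡⟨ ∑-cong xs (λ x → ∑-swap (vectors xs n) xs _) ⟩
    ∑ xs (λ x → ∑ xs (λ y → ∑ (vectors xs n) (λ v → F (y ∷ v) x)))
      ≡⟨ ∑-swap xs xs _ ⟩
    ∑ xs (λ y → ∑ xs (λ x → ∑ (vectors xs n) (λ v → F (y ∷ v) x)))
      ≡⟨ ∑-cong xs (λ y → ∑-swap xs (vectors xs n) _) ⟩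
    ∑ xs (λ y → ∑ (vectors xs n) (λ v → ∑ xs (F (y ∷ v))))
      ≡⟨ ∑-vectors-suc n _ ⟨
    ∑ (vectors xs (suc n)) (λ v → ∑ xs (F v)) ∎
  ∑-exchange {suc n} (suc i) F = begin-equality
    ∑ (vectors xs (suc n)) (λ v → ∑ xs (λ y → F (v [ suc i ]≔ y) (lookup v (suc i))))
      ≡⟨ ∑-vectors-suc n _ ⟩
    ∑ xs (λ x → ∑ (vectors xs n) (λ v → ∑ xs (λ y → F (x ∷ v [ i ]≔ y) (lookup v i))))
      ≡⟨ ∑-cong xs (λ x → ∑-exchange i (λ v → F (x ∷ v))) ⟩
    ∑ xs (λ x → ∑ (vectors xs n) (λ v → ∑ xs (F (x ∷ v))))
      ≡⟨ ∑-vectors-suc n _ ⟨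
    ∑ (vectors xs (suc n)) (λ v → ∑ xs (F v)) ∎

  ∑-vectors-lookup : ∀ {n} (i : Fin n) (f : A → ℕ) →
                     length xs * ∑ (vectors xs n) (λ v → f (lookup v i)) ≡ length (vectors xs n) * ∑ xs f
  ∑-vectors-lookup {n} i f = begin-equality
    length xs * ∑ (vectors xs n) (λ v → f (lookup v i))
      ≡⟨ ∑-*ˡ (vectors xs n) (length xs) _ ⟨
    ∑ (vectors xs n) (λ v → length xs * f (lookup v i))
      ≡⟨ ∑-cong (vectors xs n) (λ v → ∑-const xs _) ⟨
    ∑ (vectors xs n) (λ v → ∑ xs (λ _ → f (lookup v i)))
      ≡⟨ ∑-exchange i (λ _ → f) ⟩
    ∑ (vectors xs n) (λ v → ∑ xs f)
      ≡⟨ ∑-const (vectors xs n) _ ⟩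
    length (vectors xs n) * ∑ xs f ∎

-- Random functions

functions : ∀ N M → List (HashFun M N)
functions N M = vectors (allFin N) M

length-functions : ∀ N M → length (functions N M) ≡ N ^ M
length-functions N M = trans (length-vectors (allFin N) M) (cong (_^ M) (length-allFin N))

module _ {N M : ℕ} where

  -- Deferred decision: a value that B, X and κ do not depend on may be drawn afresh.
  resample : (B : HashFun M N → ℕ) (X : HashFun M N → Fin M) (κ : HashFun M N → Fin N → ℕ) →
    (∀ h y → B h ≢ 0 → B (h [ X h ]≔ y) ≡ B h × X (h [ X h ]≔ y) ≡ X h
                      × (∀ u → κ (h [ X h ]≔ y) u ≡ κ h u)) →
    N * ∑ (functions N M) (λ h → B h * κ h (lookup h (X h)))
    ≡ ∑ (functions N M) (λ h → B h * ∑ (allFin N) (κ h))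
  resample B X κ inv = begin-equality
    N * ∑ Hs (λ h → B h * κ h (lookup h (X h)))
      -- The queried point depends on h, so the sum is split over its possible values x; for each of
      -- them a fixed entry is exchanged.
      ≡⟨ cong (N *_) (trans (∑-cong Hs (λ h → sym (atX h (lookup h)))) (∑-swap Hs (allFin M) _)) ⟩
    N * ∑ (allFin M) (λ x → ∑ Hs (λ h → A x h (lookup h x)))
      ≡⟨ ∑-*ˡ (allFin M) N _ ⟨
    ∑ (allFin M) (λ x → N * ∑ Hs (λ h → A x h (lookup h x)))
      ≡⟨ ∑-cong (allFin M) fixed ⟩
    ∑ (allFin M) (λ x → ∑ Hs (λ h → ∑ (allFin N) (A x h)))
      ≡⟨ ∑-swap (allFin M) Hs _ ⟩
    ∑ Hs (λ h → ∑ (allFin M) (λ x → ∑ (allFin N) (A x h)))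
      ≡⟨ ∑-cong Hs (λ h → trans (∑-swap (allFin M) (allFin N) _)
           (trans (∑-cong (allFin N) (λ u → atX h (λ _ → u))) (∑-*ˡ (allFin N) (B h) (κ h)))) ⟩
    ∑ Hs (λ h → B h * ∑ (allFin N) (κ h)) ∎
    where
    Hs = functions N M

    A : Fin M → HashFun M N → Fin N → ℕ
    A x h u = 𝟙 (x Fin.≟ X h) * (B h * κ h u)

    atX : ∀ h (f : Fin M → Fin N) → ∑ (allFin M) (λ x → A x h (f x)) ≡ B h * κ h (f (X h))
    atX h f = ∑-δ (X h) (λ x → B h * κ h (f x))

    A-active : ∀ x h y u → x ≡ X h → B h ≢ 0 → A x (h [ x ]≔ y) u ≡ A x h u
    A-active x h y u refl nz with inv h y nz
    ... | e₁ , e₂ , e₃ = cong₂ _*_ (cong (λ x′ → 𝟙 (x Fin.≟ x′)) e₂) (cong₂ _*_ e₁ (e₃ u))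

    A-inert : ∀ x h u → ¬ (x ≡ X h × B h ≢ 0) → A x h u ≡ 0
    A-inert x h u no-hit with x Fin.≟ X h | B h ≟ 0
    ... | no _  | _     = refl
    ... | yes e | no nz = contradiction (e , nz) no-hit
    ... | yes e | yes z = trans (+-identityʳ _) (cong (_* κ h u) z)

    active? : ∀ x h → Dec (x ≡ X h × B h ≢ 0)
    active? x h = (x Fin.≟ X h) ×-dec ¬? (B h ≟ 0)

    invariant : ∀ x h y u → A x (h [ x ]≔ y) u ≡ A x h u
    invariant x h y u with active? x h | active? x (h [ x ]≔ y)
    ... | yes (e , nz) | _     = A-active x h y u e nz
    ... | no n | no n′         = trans (A-inert x _ u n′) (sym (A-inert x h u n))
    -- The update is undone by a second one, which starts from an active function.
    ... | no n | yes (e , nz)  = sym (trans (cong (λ g → A x g u) (sym back)) (A-active x _ (lookup h x) u e nz))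
      where
      back : (h [ x ]≔ y) [ x ]≔ lookup h x ≡ h
      back = trans ([]≔-idempotent h x) ([]≔-lookup h x)

    fixed : ∀ x → N * ∑ Hs (λ h → A x h (lookup h x)) ≡ ∑ Hs (λ h → ∑ (allFin N) (A x h))
    fixed x = begin-equality
      N * ∑ Hs (λ h → A x h (lookup h x))
        ≡⟨ ∑-*ˡ Hs N _ ⟨
      ∑ Hs (λ h → N * A x h (lookup h x))
        ≡⟨ ∑-cong Hs (λ h → trans (cong (_* A x h (lookup h x)) (sym (length-allFin N)))
                                  (sym (∑-const (allFin N) _))) ⟩
      ∑ Hs (λ h → ∑ (allFin N) (λ y → A x h (lookup h x)))
        ≡⟨ ∑-cong Hs (λ h → ∑-cong (allFin N) (λ y → sym (invariant x h y (lookup h x)))) ⟩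
      ∑ Hs (λ h → ∑ (allFin N) (λ y → A x (h [ x ]≔ y) (lookup h x)))
        ≡⟨ ∑-exchange (allFin N) x (A x) ⟩
      ∑ Hs (λ h → ∑ (allFin N) (A x h)) ∎

  resample-hit : (B : HashFun M N → ℕ) (X : HashFun M N → Fin M) (target : Fin N) →
    (∀ h y → B h ≢ 0 → B (h [ X h ]≔ y) ≡ B h × X (h [ X h ]≔ y) ≡ X h) →
    N * ∑ (functions N M) (λ h → B h * 𝟙 (lookup h (X h) Fin.≟ target)) ≡ ∑ (functions N M) B
  resample-hit B X target inv =
    trans (resample B X (λ _ y → 𝟙 (y Fin.≟ target))
            (λ h y nz → proj₁ (inv h y nz) , proj₂ (inv h y nz) , λ _ → refl))
          (∑-cong (functions N M) (λ h → trans (cong (B h *_) (∑-δ₁ target)) (*-identityʳ (B h))))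

-- Walks

Fresh : ∀ {M} → List (Fin M) → Set
Fresh []       = ⊤
Fresh (x ∷ xs) = x ∉ xs × Fresh xs

fresh? : ∀ {M} → Decidable (Fresh {M})
fresh? []       = yes tt
fresh? (x ∷ xs) = ¬? (_∈?_ Fin._≟_ x xs) ×-dec fresh? xs

module _ {N M : ℕ} (z : Fin N → Fin M) where

  walk : HashFun M N → Fin N → ℕ → Fin N
  walk h v zero    = v
  walk h v (suc t) = lookup h (z (walk h v t))

  -- The values queried by the first t steps, latest first, in front of earlier queries.
  trace : HashFun M N → Fin N → ℕ → List (Fin M) → List (Fin M)
  trace h v zero    acc = acc
  trace h v (suc t) acc = z (walk h v t) ∷ trace h v t acc

  walk-∈-trace : ∀ h v {t l} acc → t < l → z (walk h v t) ∈ trace h v l acc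
  walk-∈-trace h v {t} {suc l} acc t<1+l with t ≟ l
  ... | yes refl = here refl
  ... | no  t≢l  = there (walk-∈-trace h v acc (≤∧≢⇒< (m<1+n⇒m≤n t<1+l) t≢l))

  ∈-trace-walk : ∀ h v {x} l acc → x ∈ trace h v l acc → (∃[ t ] t < l × x ≡ z (walk h v t)) ⊎ x ∈ acc
  ∈-trace-walk h v zero    acc i           = inj₂ i
  ∈-trace-walk h v (suc l) acc (here refl) = inj₁ (l , ≤-refl , refl)
  ∈-trace-walk h v (suc l) acc (there i) with ∈-trace-walk h v l acc i
  ... | inj₁ (t , t<l , e) = inj₁ (t , m<n⇒m<1+n t<l , e)
  ... | inj₂ i′            = inj₂ i′

  acc-∈-trace : ∀ h v {x} l acc → x ∈ acc → x ∈ trace h v l acc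
  acc-∈-trace h v zero    acc i = i
  acc-∈-trace h v (suc l) acc i = there (acc-∈-trace h v l acc i)

  fresh-prefix : ∀ h v {t l} acc → t ≤ l → Fresh (trace h v l acc) → Fresh (trace h v t acc)
  fresh-prefix h v {t} {l} acc t≤l f with t ≟ l
  ... | yes refl = f
  fresh-prefix h v {t} {zero}  acc z≤n f | no t≢l = f
  fresh-prefix h v {t} {suc l} acc t≤l f | no t≢l =
    fresh-prefix h v acc (m<1+n⇒m≤n (≤∧≢⇒< t≤l t≢l)) (proj₂ f)

  fresh-acc : ∀ h v l acc → Fresh (trace h v l acc) → Fresh acc
  fresh-acc h v l acc = fresh-prefix h v {0} {l} acc z≤n

  fresh-∉ : ∀ h v {t l} acc → t < l → Fresh (trace h v l acc) → z (walk h v t) ∉ trace h v t acc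
  fresh-∉ h v acc t<l f = proj₁ (fresh-prefix h v acc t<l f)

  fresh-disjoint : ∀ h v {t l} acc → t < l → Fresh (trace h v l acc) → z (walk h v t) ∉ acc
  fresh-disjoint h v {t} acc t<l f i = fresh-∉ h v acc t<l f (acc-∈-trace h v t acc i)

  -- If the visits took place at different times, the earlier one would lie in the trace before the
  -- later one.
  first-visit : ∀ h v {x t t′} acc → x ∉ trace h v t acc → x ∉ trace h v t′ acc →
                z (walk h v t) ≡ x → z (walk h v t′) ≡ x → t ≡ t′
  first-visit h v {x} {t} {t′} acc n n′ e e′ with <-cmp t t′
  ... | tri≈ _ t≡t′ _ = t≡t′
  ... | tri< t<t′ _ _ = contradiction (subst (_∈ trace h v t′ acc) e (walk-∈-trace h v acc t<t′)) n′
  ... | tri> _ _ t′<t = contradiction (subst (_∈ trace h v t acc) e′ (walk-∈-trace h v acc t′<t)) n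

  module _ (h : HashFun M N) (x : Fin M) (y : Fin N) where

    walk-update : ∀ v {l} acc → x ∉ trace h v l acc → ∀ {t} → t ≤ l → walk (h [ x ]≔ y) v t ≡ walk h v t
    walk-update v acc n {zero}  _   = refl
    walk-update v {l} acc n {suc t} t<l = trans
      (cong (λ u → lookup (h [ x ]≔ y) (z u)) (walk-update v acc n (<⇒≤ t<l)))
      (lookup∘update′ (λ e → n (subst (_∈ trace h v l acc) e (walk-∈-trace h v acc t<l))) h y)

    trace-update : ∀ v {l} {acc acc′} → acc′ ≡ acc → x ∉ trace h v l acc →
                   ∀ {t} → t ≤ l → trace (h [ x ]≔ y) v t acc′ ≡ trace h v t acc
    trace-update v e n {zero}  _   = e
    trace-update v {acc = acc} e n {suc t} t<l =
      cong₂ _∷_ (cong z (walk-update v acc n (<⇒≤ t<l))) (trace-update v e n (<⇒≤ t<l))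

-- Collisions of walks

module Collisions {N M : ℕ} (z : Fin N → Fin M) where

  Hs : List (HashFun M N)
  Hs = functions N M

  μ : Fin M → ℕ
  μ x = ∑ (allFin N) (λ v → 𝟙 (z v Fin.≟ x))

  -- The second frequency moment of z, that is, the sum of the squares of `μ`, written as a sum over
  -- vertices.
  F₂ : ℕ
  F₂ = ∑ (allFin N) (λ v → μ (z v))

  occ : List (Fin M) → Fin N → ℕ
  occ xs y = ∑ xs (λ x → 𝟙 (z y Fin.≟ x))

  wt : List (Fin M) → ℕ
  wt xs = ∑ xs μ

  ∑-occ : ∀ xs → ∑ (allFin N) (occ xs) ≡ wt xs
  ∑-occ xs = ∑-swap (allFin N) xs _

  fr nf : List (Fin M) → ℕ
  fr xs = 𝟙 (fresh? xs)
  nf xs = 𝟙 (¬? (fresh? xs))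

  -- A collision is charged to the first query that repeats an earlier one. The factor `fr xs`
  -- records that the trace was fresh until then, which is the situation where the next vertex can
  -- be resampled.
  nf-∷ : ∀ y xs → nf (z y ∷ xs) ≤ nf xs + fr xs * occ xs y
  nf-∷ y xs = 𝟙≤ (¬? (fresh? (z y ∷ xs))) (λ stale → split stale (fresh? xs))
    where
    hit : Fresh xs → ¬ Fresh (z y ∷ xs) → 1 ≤ occ xs y
    hit f stale with _∈?_ Fin._≟_ (z y) xs
    ... | no n  = contradiction (n , f) stale
    ... | yes i = ≡-≤ (sym (𝟙-yes (z y Fin.≟ z y) refl)) (∑-∈ xs _ i)

    split : ¬ Fresh (z y ∷ xs) → Dec (Fresh xs) → 1 ≤ nf xs + fr xs * occ xs y
    split stale (no n)  = ≡-≤ (sym (𝟙-yes (¬? (fresh? xs)) n)) (m≤m+n (nf xs) _)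
    split stale (yes f) = ≤-trans (hit f stale) (≤-trans
      (≤-reflexive (trans (sym (*-identityˡ (occ xs y))) (cong (_* occ xs y) (sym (𝟙-yes (fresh? xs) f)))))
      (m≤n+m _ (nf xs)))

  fr-tail : ∀ x xs → fr (x ∷ xs) ≤ fr xs
  fr-tail x xs = 𝟙-mono (fresh? (x ∷ xs)) (fresh? xs) proj₂

  -- The walk from v runs against a background `acc h` of earlier queries. It may depend on h,
  -- provided that changing h outside of it leaves it alone.
  module From (acc : HashFun M N → List (Fin M))
              (stable : ∀ h x y → x ∉ acc h → acc (h [ x ]≔ y) ≡ acc h)
              (v : Fin N) where

    tr : ℕ → HashFun M N → List (Fin M)
    tr t h = trace z h v t (acc h)

    tr-update : ∀ h x y {l} → x ∉ tr l h → ∀ {t} → t ≤ l → tr t (h [ x ]≔ y) ≡ tr t h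
    tr-update h x y {l} n = trace-update z h x y v (stable h x y (λ i → n (acc-∈-trace z h v l (acc h) i))) n

    resample-walk : ∀ t (κ : HashFun M N → Fin N → ℕ) →
      (∀ h x y → x ∉ tr t h → ∀ u → κ (h [ x ]≔ y) u ≡ κ h u) →
      N * ∑ Hs (λ h → fr (tr (suc t) h) * κ h (walk z h v (suc t)))
      ≡ ∑ Hs (λ h → fr (tr (suc t) h) * ∑ (allFin N) (κ h))
    resample-walk t κ κ-stable = resample (λ h → fr (tr (suc t) h)) (λ h → z (walk z h v t)) κ inv
      where
      inv : ∀ h y → fr (tr (suc t) h) ≢ 0 → _
      inv h y nz = cong fr (cong₂ _∷_ query (tr-update h X y X∉ ≤-refl)) , query , κ-stable h X y X∉
        where
        X = z (walk z h v t)

        X∉ : X ∉ tr t h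
        X∉ = proj₁ (𝟙-holds (fresh? (tr (suc t) h)) nz)

        query : z (walk z (h [ X ]≔ y) v t) ≡ X
        query = cong z (walk-update z h X y v (acc h) X∉ ≤-refl)

    -- The sums of multiplicities of the visited values that govern the next collision.
    G : ℕ → ℕ
    G t = ∑ Hs (λ h → fr (tr t h) * wt (tr t h))

    G-step : ∀ t → G (suc t) ≤ ∑ Hs (λ h → fr (tr t h) * μ (z (walk z h v t))) + G t
    G-step t = ≤-≡ (∑-mono Hs (λ h → ≤-≡ (*-monoˡ-≤ (wt (tr (suc t) h)) (fr-tail _ (tr t h)))
                                                  (*-distribˡ-+ (fr (tr t h)) _ _)))
                       (∑-+ Hs _ _)

    visit-start : N * ∑ Hs (λ h → fr (tr 0 h) * μ (z v)) ≤ length Hs * (N * μ (z v))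
    visit-start = begin
      N * ∑ Hs (λ h → fr (tr 0 h) * μ (z v))
        ≤⟨ *-monoʳ-≤ N (∑-bound Hs _ (λ h → 𝟙*≤ (fresh? (tr 0 h)) (λ _ → ≤-refl))) ⟩
      N * (length Hs * μ (z v))
        ≡⟨ *-swap N (length Hs) (μ (z v)) ⟩
      length Hs * (N * μ (z v)) ∎

    -- After at least one step the current vertex is the answer of a new query, hence uniform, and
    -- its multiplicity is F₂ / N on average. The start is fixed and contributes its own
    -- multiplicity.
    visit-later : ∀ t → N * ∑ Hs (λ h → fr (tr (suc t) h) * μ (z (walk z h v (suc t)))) ≤ length Hs * F₂
    visit-later t = ≤-trans
      (≤-reflexive (resample-walk t (λ _ u → μ (z u)) (λ _ _ _ _ _ → refl)))
      (∑-bound Hs _ (λ h → 𝟙*≤ (fresh? (tr (suc t) h)) (λ _ → ≤-refl)))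

    G-bound : ∀ t → N * G t ≤ N * G 0 + length Hs * (N * μ (z v) + t * F₂)
    G-bound zero = m≤m+n _ _
    G-bound (suc zero) = begin
      N * G 1 ≤⟨ *-monoʳ-≤ N (G-step 0) ⟩
      N * (∑ Hs (λ h → fr (tr 0 h) * μ (z v)) + G 0) ≡⟨ *-distribˡ-+ N _ (G 0) ⟩
      N * ∑ Hs (λ h → fr (tr 0 h) * μ (z v)) + N * G 0 ≤⟨ +-monoˡ-≤ _ visit-start ⟩
      length Hs * (N * μ (z v)) + N * G 0 ≡⟨ +-comm _ (N * G 0) ⟩
      N * G 0 + length Hs * (N * μ (z v))
        ≤⟨ +-monoʳ-≤ (N * G 0) (*-monoʳ-≤ (length Hs) (m≤m+n _ _)) ⟩
      N * G 0 + length Hs * (N * μ (z v) + 1 * F₂) ∎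
    G-bound (suc (suc t)) = begin
      N * G (2 + t) ≤⟨ *-monoʳ-≤ N (G-step (suc t)) ⟩
      N * (visits + G (suc t)) ≡⟨ *-distribˡ-+ N visits _ ⟩
      N * visits + N * G (suc t) ≤⟨ +-mono-≤ (visit-later t) (G-bound (suc t)) ⟩
      length Hs * F₂ + (N * G 0 + length Hs * (N * μ (z v) + (1 + t) * F₂))
        ≡⟨ rearrange (length Hs) F₂ (N * G 0) (N * μ (z v)) t ⟩
      N * G 0 + length Hs * (N * μ (z v) + (2 + t) * F₂) ∎
      where
      visits = ∑ Hs (λ h → fr (tr (suc t) h) * μ (z (walk z h v (suc t))))
      rearrange : ∀ l f g m t → l * f + (g + l * (m + (1 + t) * f)) ≡ g + l * (m + (2 + t) * f)
      rearrange = solve-∀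

    -- The number of functions for which the walk has met a collision before step t.
    U : ℕ → ℕ
    U t = ∑ Hs (λ h → nf (tr t h))

    U-step : ∀ t → U (suc t) ≤ U t + ∑ Hs (λ h → fr (tr t h) * occ (tr t h) (walk z h v t))
    U-step t = ≤-≡ (∑-mono Hs (λ h → nf-∷ (walk z h v t) (tr t h))) (∑-+ Hs _ _)

    -- The vertex after 1 + t steps can be resampled and repeats a recorded value with probability
    -- `wt` / N. The start vertex is not an answer of h, hence the offset.
    U-later : ∀ t → N * U (2 + t) ≤ N * U (1 + t) + G (1 + t)
    U-later t = begin
      N * U (2 + t) ≤⟨ *-monoʳ-≤ N (U-step (1 + t)) ⟩
      N * (U (1 + t) + hits) ≡⟨ *-distribˡ-+ N (U (1 + t)) hits ⟩
      N * U (1 + t) + N * hits ≡⟨ cong (N * U (1 + t) +_) resampled ⟩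
      N * U (1 + t) + G (1 + t) ∎
      where
      hits = ∑ Hs (λ h → fr (tr (suc t) h) * occ (tr (suc t) h) (walk z h v (suc t)))

      inv : ∀ h y → fr (tr (suc t) h) ≢ 0 → let h′ = h [ z (walk z h v t) ]≔ y in
            fr (tr (suc t) h′) ≡ fr (tr (suc t) h) × z (walk z h′ v t) ≡ z (walk z h v t)
            × (∀ u → occ (tr (suc t) h′) u ≡ occ (tr (suc t) h) u)
      inv h y nz = cong fr same , query , λ u → cong (λ xs → occ xs u) same
        where
        X = z (walk z h v t)

        X∉ : X ∉ tr t h
        X∉ = proj₁ (𝟙-holds (fresh? (tr (suc t) h)) nz)

        query : z (walk z (h [ X ]≔ y) v t) ≡ X
        query = cong z (walk-update z h X y v (acc h) X∉ ≤-refl)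

        same : tr (suc t) (h [ X ]≔ y) ≡ tr (suc t) h
        same = cong₂ _∷_ query (tr-update h X y X∉ ≤-refl)

      resampled : N * hits ≡ G (1 + t)
      resampled = trans
        (resample (λ h → fr (tr (suc t) h)) (λ h → z (walk z h v t)) (λ h → occ (tr (suc t) h)) inv)
        (∑-cong Hs (λ h → cong (fr (tr (suc t) h) *_) (∑-occ (tr (suc t) h))))

  trace-stable : ∀ s l h x y → x ∉ trace z h s l [] → trace z (h [ x ]≔ y) s l [] ≡ trace z h s l []
  trace-stable s l h x y n = trace-update z h x y s {acc = []} refl n ≤-refl

  -- Two walks, of l steps from s and of l′ steps from a uniformly random s′.
  module Pair (s : Fin N) (l : ℕ) where

    module I = From (λ _ → []) (λ _ _ _ _ → refl) s
    module II (s′ : Fin N) = From (λ h → trace z h s l []) (trace-stable s l) s′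

    m = N * μ (z s)
    Hn = length Hs

    G₀ : I.G 0 ≡ 0
    G₀ = ∑-zero Hs

    U₀ : I.U 0 ≡ 0
    U₀ = ∑-zero Hs

    GI : ∀ t → N * I.G t ≤ Hn * (m + t * F₂)
    GI t = ≤-≡ (I.G-bound t) (cong (_+ Hn * (m + t * F₂)) (trans (cong (N *_) G₀) (*-zeroʳ N)))

    U₁ : I.U 1 ≡ 0
    U₁ = n≤0⇒n≡0 (≤-≡ (I.U-step 0) (cong₂ _+_ U₀ (trans (∑-cong Hs (λ _ → refl)) (∑-zero Hs))))

    UI : ∀ t → N * (N * I.U t) ≤ Hn * (t * (m + t * F₂))
    UI zero = ≡-≤ (trans (cong (λ u → N * (N * u)) U₀)
                (trans (cong (N *_) (*-zeroʳ N)) (*-zeroʳ N))) z≤n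
    UI (suc zero) = ≡-≤ (trans (cong (λ u → N * (N * u)) U₁)
                (trans (cong (N *_) (*-zeroʳ N)) (*-zeroʳ N))) z≤n
    UI (suc (suc t)) = begin
      N * (N * I.U (2 + t)) ≤⟨ *-monoʳ-≤ N (I.U-later t) ⟩
      N * (N * I.U (1 + t) + I.G (1 + t)) ≡⟨ *-distribˡ-+ N _ _ ⟩
      N * (N * I.U (1 + t)) + N * I.G (1 + t) ≤⟨ +-mono-≤ (UI (suc t)) (GI (suc t)) ⟩
      Hn * ((1 + t) * (m + (1 + t) * F₂)) + Hn * (m + (1 + t) * F₂)
        ≡⟨ rearrange Hn (m + (1 + t) * F₂) t ⟩
      Hn * ((2 + t) * (m + (1 + t) * F₂))
        ≤⟨ *-monoʳ-≤ Hn (*-monoʳ-≤ (2 + t) (+-monoʳ-≤ m (*-monoˡ-≤ F₂ (n≤1+n (suc t))))) ⟩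
      Hn * ((2 + t) * (m + (2 + t) * F₂)) ∎
      where
      rearrange : ∀ h a t → h * ((1 + t) * a) + h * a ≡ h * ((2 + t) * a)
      rearrange = solve-∀

    ∑s : (Fin N → ℕ) → ℕ
    ∑s = ∑ (allFin N)

    -- Averaging over s′ makes the second start as harmless as any later vertex: its multiplicity
    -- averages to F₂ / N. This is the 1 in l + 1 + t.
    GII : ∀ t → ∑s (λ s′ → II.G s′ t) ≤ Hn * (m + (l + 1 + t) * F₂)
    GII t = *-cancelˡ-≤ N {{nonZeroIndex s}} (begin
      N * ∑s (λ s′ → II.G s′ t)
        ≡⟨ ∑-*ˡ (allFin N) N _ ⟨
      ∑s (λ s′ → N * II.G s′ t)
        ≤⟨ ∑-mono (allFin N) (λ s′ → II.G-bound s′ t) ⟩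
      ∑s (λ s′ → N * I.G l + Hn * (N * μ (z s′) + t * F₂))
        ≤⟨ ∑-mono (allFin N) (λ s′ → +-monoˡ-≤ (Hn * (N * μ (z s′) + t * F₂)) (GI l)) ⟩
      ∑s (λ s′ → Hn * (m + l * F₂) + Hn * (N * μ (z s′) + t * F₂))
        ≡⟨ ∑-cong (allFin N) (λ s′ → rearrange₁ Hn m (l * F₂) N (μ (z s′)) (t * F₂)) ⟩
      ∑s (λ s′ → Hn * (m + l * F₂ + t * F₂) + Hn * N * μ (z s′))
        ≡⟨ trans (∑-+ (allFin N) _ _) (cong₂ _+_ (trans (∑-const (allFin N) _)
             (cong (_* (Hn * (m + l * F₂ + t * F₂))) (length-allFin N))) (∑-*ˡ (allFin N) (Hn * N) _)) ⟩
      N * (Hn * (m + l * F₂ + t * F₂)) + Hn * N * F₂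
        ≡⟨ rearrange₂ N Hn m l t F₂ ⟩
      N * (Hn * (m + (l + 1 + t) * F₂)) ∎)
      where
      rearrange₁ : ∀ h m a n u b → h * (m + a) + h * (n * u + b) ≡ h * (m + a + b) + h * n * u
      rearrange₁ = solve-∀
      rearrange₂ : ∀ n h m l t f → n * (h * (m + l * f + t * f)) + h * n * f ≡ n * (h * (m + (l + 1 + t) * f))
      rearrange₂ = solve-∀

    UII₁ : ∑s (λ s′ → II.U s′ 1) ≤ N * I.U l + I.G l
    UII₁ = begin
      ∑s (λ s′ → II.U s′ 1)
        ≤⟨ ∑-mono (allFin N) (λ s′ → II.U-step s′ 0) ⟩
      ∑s (λ s′ → I.U l + ∑ Hs (λ h → fr (I.tr l h) * occ (I.tr l h) s′))
        ≡⟨ trans (∑-+ (allFin N) _ _) (cong₂ _+_ (trans (∑-const (allFin N) _) (cong (_* I.U l) (length-allFin N)))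
             (trans (∑-swap (allFin N) Hs _) (∑-cong Hs (λ h → trans (∑-*ˡ (allFin N) (fr (I.tr l h)) _)
               (cong (fr (I.tr l h) *_) (∑-occ (I.tr l h))))))) ⟩
      N * I.U l + I.G l ∎

    -- A birthday bound: each of l + 1 + t queries meets an earlier one with probability at most (μ
    -- (z s) + (l + 1 + t) F₂ / N) / N. The term μ (z s) remains because s is not averaged.
    collision-bound : ∀ t → N * ∑s (λ s′ → II.U s′ t) ≤ Hn * ((l + 1 + t) * (m + (l + 1 + t) * F₂))
    collision-bound zero = begin
      N * ∑s (λ s′ → II.U s′ 0)
        ≡⟨ cong (N *_) (trans (∑-const (allFin N) _) (cong (_* I.U l) (length-allFin N))) ⟩
      N * (N * I.U l)
        ≤⟨ UI l ⟩
      Hn * (l * (m + l * F₂))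
        ≤⟨ *-monoʳ-≤ Hn (*-mono-≤ l≤ (+-monoʳ-≤ m (*-monoˡ-≤ F₂ l≤))) ⟩
      Hn * ((l + 1 + 0) * (m + (l + 1 + 0) * F₂)) ∎
      where
      l≤ : l ≤ l + 1 + 0
      l≤ = ≤-trans (m≤m+n l 1) (m≤m+n (l + 1) 0)
    collision-bound (suc zero) = begin
      N * ∑s (λ s′ → II.U s′ 1) ≤⟨ *-monoʳ-≤ N UII₁ ⟩
      N * (N * I.U l + I.G l) ≡⟨ *-distribˡ-+ N _ _ ⟩
      N * (N * I.U l) + N * I.G l ≤⟨ +-mono-≤ (UI l) (GI l) ⟩
      Hn * (l * (m + l * F₂)) + Hn * (m + l * F₂) ≡⟨ rearrange Hn l (m + l * F₂) ⟩
      Hn * ((l + 1) * (m + l * F₂))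
        ≤⟨ *-monoʳ-≤ Hn (*-mono-≤ (m≤m+n (l + 1) 1) (+-monoʳ-≤ m (*-monoˡ-≤ F₂
             (≤-trans (m≤m+n l 1) (m≤m+n (l + 1) 1))))) ⟩
      Hn * ((l + 1 + 1) * (m + (l + 1 + 1) * F₂)) ∎
      where
      rearrange : ∀ h l a → h * (l * a) + h * a ≡ h * ((l + 1) * a)
      rearrange = solve-∀
    collision-bound (suc (suc t)) = begin
      N * ∑s (λ s′ → II.U s′ (2 + t))
        ≡⟨ ∑-*ˡ (allFin N) N _ ⟨
      ∑s (λ s′ → N * II.U s′ (2 + t))
        ≤⟨ ∑-mono (allFin N) (λ s′ → II.U-later s′ t) ⟩
      ∑s (λ s′ → N * II.U s′ (1 + t) + II.G s′ (1 + t))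
        ≡⟨ trans (∑-+ (allFin N) _ _) (cong (_+ ∑s (λ s′ → II.G s′ (1 + t))) (∑-*ˡ (allFin N) N _)) ⟩
      N * ∑s (λ s′ → II.U s′ (1 + t)) + ∑s (λ s′ → II.G s′ (1 + t))
        ≤⟨ +-mono-≤ (collision-bound (suc t)) (GII (suc t)) ⟩
      Hn * (a * (m + a * F₂)) + Hn * (m + a * F₂)
        ≡⟨ rearrange Hn a (m + a * F₂) ⟩
      Hn * (suc a * (m + a * F₂))
        ≤⟨ *-monoʳ-≤ Hn (*-mono-≤ 1+a≤ (+-monoʳ-≤ m (*-monoˡ-≤ F₂ (≤-trans (n≤1+n a) 1+a≤)))) ⟩
      Hn * ((l + 1 + (2 + t)) * (m + (l + 1 + (2 + t)) * F₂)) ∎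
      where
      a = l + 1 + suc t
      1+a≤ : suc a ≤ l + 1 + (2 + t)
      1+a≤ = ≤-reflexive (sym (+-suc (l + 1) (suc t)))
      rearrange : ∀ h l a → h * (l * a) + h * a ≡ h * (suc l * a)
      rearrange = solve-∀

-- The event that a run finds a given solution

trace-[] : ∀ {N M} (z : Fin N → Fin M) h v {x} l acc → x ∈ trace z h v l [] → x ∈ trace z h v l acc
trace-[] z h v (suc l) acc (here e)  = here e
trace-[] z h v (suc l) acc (there i) = there (trace-[] z h v l acc i)

fresh-apart : ∀ {N M} (z : Fin N → Fin M) h v {x} l acc → Fresh (trace z h v l acc) → x ∈ acc → x ∉ trace z h v l []
fresh-apart z h v (suc l) acc (n , f) x∈ (here refl) = n (acc-∈-trace z h v l acc x∈)
fresh-apart z h v (suc l) acc (n , f) x∈ (there i)   = fresh-apart z h v l acc f x∈ i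

-- The query of a step is determined by the answers before it. So one more step than the hypothesis
-- covers is unchanged, even if its query is x itself; this keeps a query in place while its answer
-- is redrawn.
trace-same : ∀ {N M} (z : Fin N → Fin M) h x y v {l acc acc′} → x ∉ trace z h v l [] → acc′ ≡ acc →
             ∀ {t} → t ≤ suc l → trace z (h [ x ]≔ y) v t acc′ ≡ trace z h v t acc
trace-same z h x y v n e {zero}  _   = e
trace-same z h x y v n e {suc t} t≤l =
  cong₂ _∷_ (cong z (walk-update z h x y v [] n (m<1+n⇒m≤n t≤l))) (trace-same z h x y v n e (<⇒≤ t≤l))

record Run (N M c : ℕ) : Set where
  field
    cells r : ℕ
    {{cells≢0}} : NonZero cells
    z : Fin N → Fin M
    as bs : Fin c → Fin N

  -- A walk of the second phase takes up to 2 ℓ steps; `L` counts their queries and the value of the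
  -- vertex reached at the end.
  ℓ L : ℕ
  ℓ = suc r
  L = suc (ℓ + ℓ)

  cell : Fin N → ℕ
  cell v = value v % cells

  module _ (a b : Fin c) (p q : Fin r) (i : Fin N) where

    -- The walk from i up to the vertex where the chain of a ends if it visits i after suc p steps.
    tail : ℕ
    tail = r ∸ toℕ p

    -- P and Q include the query that leads to the first and the second half of the solution.
    P Q : ℕ
    P = suc (toℕ p)
    Q = suc (toℕ q)

    traceA traceB traceI : HashFun M N → List (Fin M) → List (Fin M)
    traceA h = trace z h (as a) P
    traceB h = trace z h (bs b) Q
    traceI h = trace z h i (suc tail)

    -- Freshness is asked of two walks at a time. This suffices for correctness and lets the union
    -- bound work with pairs of walks.
    Avoids : HashFun M N → Fin N → Set
    Avoids h s = Fresh (trace z h s L (traceI h [])) × Fresh (trace z h s L (traceA h []))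
               × Fresh (trace z h s L (traceB h []))

    avoids? : ∀ h s → Dec (Avoids h s)
    avoids? h s = fresh? _ ×-dec fresh? _ ×-dec fresh? _

    -- No field depends on the answers of the last queries of `traceA` and `traceB`: what follows a
    -- visit of i is described by the walk from i. The field `ends` keeps the other chains out of
    -- the table cell in which the chain of a is stored.
    record Undisturbed (h : HashFun M N) : Set where
      field
        ab    : Fresh (traceB h (traceA h []))
        ia    : Fresh (traceA h (traceI h []))
        ib    : Fresh (traceB h (traceI h []))
        as-ok : ∀ x → x ≢ a → Avoids h (as x)
        bs-ok : ∀ x → x ≢ b → Avoids h (bs x)
        ends  : ∀ x → x ≢ a → cell (walk z h (as x) ℓ) ≢ cell (walk z h i tail)

    abstract
      undisturbed? : Decidable Undisturbed
      undisturbed? h = map′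
        (λ { (f , g , k , u , v , w) → record { ab = f ; ia = g ; ib = k ; as-ok = u ; bs-ok = v ; ends = w } })
        (λ u → let open Undisturbed u in ab , ia , ib , as-ok , bs-ok , ends)
        (fresh? _ ×-dec fresh? _ ×-dec fresh? _
         ×-dec all? (λ x → ¬? (x Fin.≟ a) →-dec avoids? h (as x))
         ×-dec all? (λ x → ¬? (x Fin.≟ b) →-dec avoids? h (bs x))
         ×-dec all? (λ x → ¬? (x Fin.≟ a) →-dec ¬? (cell (walk z h (as x) ℓ) ≟ cell (walk z h i tail))))

    -- The value x may be the last query of one of the two decisive chains, as its answer enters no
    -- trace; hence their traces stop one step earlier here.
    module _ (h : HashFun M N) (x : Fin M) (y : Fin N)
             (x∉a : x ∉ trace z h (as a) (toℕ p) []) (x∉b : x ∉ trace z h (bs b) (toℕ q) [])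
             (x∉i : x ∉ traceI h [])
             (x∉as : ∀ w → w ≢ a → x ∉ trace z h (as w) L []) (x∉bs : ∀ w → w ≢ b → x ∉ trace z h (bs w) L []) where

      private
        h′ = h [ x ]≔ y

        sameA : ∀ {acc acc′} → acc′ ≡ acc → traceA h′ acc′ ≡ traceA h acc
        sameA e = trace-same z h x y (as a) x∉a e ≤-refl

        sameB : ∀ {acc acc′} → acc′ ≡ acc → traceB h′ acc′ ≡ traceB h acc
        sameB e = trace-same z h x y (bs b) x∉b e ≤-refl

        sameI : traceI h′ [] ≡ traceI h []
        sameI = trace-same z h x y i x∉i refl (n≤1+n (suc tail))

        avoids : ∀ s → x ∉ trace z h s L [] → Avoids h s → Avoids h′ s
        avoids s n (f , g , k) =
          subst Fresh (sym (same sameI)) f , subst Fresh (sym (same (sameA refl))) g , subst Fresh (sym (same (sameB refl))) k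
          where
          same : ∀ {acc acc′} → acc′ ≡ acc → trace z h′ s L acc′ ≡ trace z h s L acc
          same e = trace-same z h x y s n e (n≤1+n L)

      undisturbed-update : Undisturbed h → Undisturbed h′
      undisturbed-update u = record
        { ab    = subst Fresh (sym (sameB (sameA refl))) ab
        ; ia    = subst Fresh (sym (sameA sameI)) ia
        ; ib    = subst Fresh (sym (sameB sameI)) ib
        ; as-ok = λ w w≢a → avoids (as w) (x∉as w w≢a) (as-ok w w≢a)
        ; bs-ok = λ w w≢b → avoids (bs w) (x∉bs w w≢b) (bs-ok w w≢b)
        ; ends  = λ w w≢a e → ends w w≢a (trans (cong cell (sym (walk-update z h x y (as w) [] (x∉as w w≢a)
                    (≤-trans (m≤m+n ℓ ℓ) (n≤1+n _))))) (trans e (cong cell (walk-update z h x y i [] x∉i (n≤1+n tail)))))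
        }
        where open Undisturbed u

    -- The two decisive answers are redrawn one after the other. The one of b comes first: its query
    -- is new to the chain of a, so the arrival of that chain at i is not affected.
    arrivals : (j : Fin N) →
      N * (N * ∑ (functions N M) (λ h → 𝟙 (undisturbed? h) * 𝟙 (walk z h (as a) P Fin.≟ i) * 𝟙 (walk z h (bs b) Q Fin.≟ j)))
      ≡ ∑ (functions N M) (λ h → 𝟙 (undisturbed? h))
    arrivals j = trans
      (cong (N *_) (resample-hit (λ h → 𝟙 (undisturbed? h) * 𝟙 (walk z h (as a) P Fin.≟ i))
                                 (λ h → z (walk z h (bs b) (toℕ q))) j invB))
      (resample-hit (λ h → 𝟙 (undisturbed? h)) (λ h → z (walk z h (as a) (toℕ p))) i invA)
      where
      module _ (h : HashFun M N) (u : Undisturbed h) where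
        open Undisturbed u

        x₁ x₂ : Fin M
        x₁ = z (walk z h (as a) (toℕ p))
        x₂ = z (walk z h (bs b) (toℕ q))

        x₁∈ : ∀ acc → x₁ ∈ traceA h acc
        x₁∈ acc = here refl

        updateA : ∀ y → Undisturbed (h [ x₁ ]≔ y)
        updateA y = undisturbed-update h x₁ y
          (λ i → fresh-∉ z h (as a) (traceI h []) ≤-refl ia (trace-[] z h (as a) (toℕ p) _ i))
          (λ i → fresh-apart z h (bs b) Q _ ab (x₁∈ []) (there i))
          (fresh-disjoint z h (as a) (traceI h []) ≤-refl ia)
          (λ w w≢a → fresh-apart z h (as w) L _ (proj₁ (proj₂ (as-ok w w≢a))) (x₁∈ []))
          (λ w w≢b → fresh-apart z h (bs w) L _ (proj₁ (proj₂ (bs-ok w w≢b))) (x₁∈ []))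
          u

        x₂∉A : x₂ ∉ traceA h []
        x₂∉A = fresh-disjoint z h (bs b) (traceA h []) ≤-refl ab

        updateB : ∀ y → Undisturbed (h [ x₂ ]≔ y)
        updateB y = undisturbed-update h x₂ y
          (λ i → x₂∉A (there i))
          (λ i → fresh-∉ z h (bs b) (traceI h []) ≤-refl ib (trace-[] z h (bs b) (toℕ q) _ i))
          (fresh-disjoint z h (bs b) (traceI h []) ≤-refl ib)
          (λ w w≢a → fresh-apart z h (as w) L _ (proj₂ (proj₂ (as-ok w w≢a))) (here refl))
          (λ w w≢b → fresh-apart z h (bs w) L _ (proj₂ (proj₂ (bs-ok w w≢b))) (here refl))
          u

      invA : ∀ h y → 𝟙 (undisturbed? h) ≢ 0 → let x = z (walk z h (as a) (toℕ p)) in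
        𝟙 (undisturbed? (h [ x ]≔ y)) ≡ 𝟙 (undisturbed? h) × z (walk z (h [ x ]≔ y) (as a) (toℕ p)) ≡ x
      invA h y nz = trans (𝟙-yes (undisturbed? _) (updateA h u y)) (sym (𝟙-yes (undisturbed? h) u)) ,
        cong z (walk-update z h _ y (as a) (traceI h []) (fresh-∉ z h (as a) (traceI h []) ≤-refl ia) ≤-refl)
        where
        u = 𝟙-holds (undisturbed? h) nz
        open Undisturbed u

      invB : ∀ h y → 𝟙 (undisturbed? h) * 𝟙 (walk z h (as a) P Fin.≟ i) ≢ 0 → let x = z (walk z h (bs b) (toℕ q)) in
        𝟙 (undisturbed? (h [ x ]≔ y)) * 𝟙 (walk z (h [ x ]≔ y) (as a) P Fin.≟ i)
          ≡ 𝟙 (undisturbed? h) * 𝟙 (walk z h (as a) P Fin.≟ i)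
        × z (walk z (h [ x ]≔ y) (bs b) (toℕ q)) ≡ x
      invB h y nz = cong₂ _*_
          (trans (𝟙-yes (undisturbed? _) (updateB h u y)) (sym (𝟙-yes (undisturbed? h) u)))
          (cong (λ v → 𝟙 (v Fin.≟ i)) (walk-update z h _ y (as a) [] (x₂∉A h u) ≤-refl)) ,
        cong z (walk-update z h _ y (bs b) (traceI h []) (fresh-∉ z h (bs b) (traceI h []) ≤-refl ib) ≤-refl)
        where
        u = 𝟙-holds (undisturbed? h) (λ e → nz (cong (_* 𝟙 (walk z h (as a) P Fin.≟ i)) e))
        open Undisturbed u

-- The probability of being disturbed

∑≡0 : ∀ {n} (f : Fin n → ℕ) → ∑ (allFin n) f ≡ 0 → ∀ x → f x ≡ 0
∑≡0 {n} f e x = n≤0⇒n≡0 (≤-≡ (∑-∈ (allFin n) f (∈-allFin x)) e)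

𝟙≡0 : {P : Set} (P? : Dec P) → 𝟙 P? ≡ 0 → ¬ P
𝟙≡0 (no n) _ = n

𝟙¬≡0 : {P : Set} (P? : Dec P) → 𝟙 (¬? P?) ≡ 0 → P
𝟙¬≡0 (yes p) _ = p

𝟙*≡0 : {P : Set} (P? : Dec P) {n : ℕ} → 𝟙 P? * n ≡ 0 → P → n ≡ 0
𝟙*≡0 (yes _) e _ = trans (sym (+-identityʳ _)) e
𝟙*≡0 (no ¬p) e p = contradiction p ¬p

∑∑-lookup : ∀ {A : Set} (xs : List A) {n} {i j : Fin n} → i ≢ j → (f : A → A → ℕ) →
  length xs * (length xs * ∑ (vectors xs n) (λ v → f (lookup v i) (lookup v j)))
  ≡ length (vectors xs n) * ∑ xs (λ x → ∑ xs (f x))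
∑∑-lookup xs {n} {i} {j} i≢j f = trans (cong (length xs *_) (begin-equality
  length xs * ∑ (vectors xs n) (λ v → f (lookup v i) (lookup v j))
    ≡⟨ ∑-*ˡ (vectors xs n) (length xs) _ ⟨
  ∑ (vectors xs n) (λ v → length xs * f (lookup v i) (lookup v j))
    ≡⟨ ∑-cong (vectors xs n) (λ v → trans (sym (∑-const xs _))
         (∑-cong xs (λ y → cong (λ x → f x (lookup v j)) (sym (lookup∘update′ i≢j v y))))) ⟩
  ∑ (vectors xs n) (λ v → ∑ xs (λ y → f (lookup (v [ j ]≔ y) i) (lookup v j)))
    ≡⟨ ∑-exchange xs j (λ v → f (lookup v i)) ⟩
  ∑ (vectors xs n) (λ v → ∑ xs (f (lookup v i))) ∎))
  (∑-vectors-lookup xs i (λ x → ∑ xs (f x)))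

-- N² times an upper bound for the probability that something interferes with a given solution.
disturbance : (N c r γ F K : ℕ) → ℕ
disturbance N c r γ F K = (T₂ + (T₁ + T₁)) + (c * (T₁ + (T₂ + T₂)) + (c * (T₁ + (T₂ + T₂)) + c * (N * K)))
  where
  D T₁ T₂ : ℕ
  D = 4 * suc r
  T₁ = 2 * (D * (N * γ + D * F))
  T₂ = 8 * (D * D * F)

record Disturbance : Set where
  field
    {N M c q} cells r : ℕ
    {{cells≢0}} : NonZero cells
    {{q≢0}} : NonZero q
    z : Fin N → Fin M
    -- Starts are random words reduced modulo N, which are uniform only up to the factor 2 of
    -- `st-bound`.
    st : Fin q → Fin N
    st-bound : ∀ f → N * ∑ (allFin q) (f ∘ st) ≤ 2 * q * ∑ (allFin N) f
    a b : Fin c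
    p p′ : Fin r
    i : Fin N
    γ F K : ℕ
    μ≤γ : Collisions.μ z (z i) ≤ γ
    F₂≤F : Collisions.F₂ z ≤ F
    K-bound : ∀ κ → ∑ (allFin N) (λ y → 𝟙 (value y % cells ≟ κ)) ≤ K

  open Collisions z

  Starts : Set
  Starts = Vec (Fin q) c

  starts : List Starts
  starts = vectors (allFin q) c

  from : Starts → Fin c → Fin N
  from A x = st (lookup A x)

  run : (A B : Starts) → Run N M c
  run A B = record { cells = cells ; r = r ; z = z ; as = from A ; bs = from B }

  private
    ℓ L : ℕ
    ℓ = suc r
    L = suc (ℓ + ℓ)
    instance
      N≢0 : NonZero N
      N≢0 = nonZeroIndex i

  Hn = length Hs
  -- Two walks involve at most 3 ℓ + 2 queries, which is at most 4 ℓ as r ≥ 1. `T₁` belongs to pairs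
  -- with the fixed vertex i and `T₂` to pairs of random starts. The 8 is 2 · 2 for the two starts
  -- times 2 for two equal terms.
  D = 4 * ℓ
  T₁ = 2 * (D * (N * γ + D * F))
  T₂ = 8 * (D * D * F)

  single : ∀ s l l′ → l + 1 + l′ ≤ D →
    N * (N * ∑ (allFin q) (λ u → ∑ Hs (λ h → nf (trace z h (st u) l′ (trace z h s l [])))))
    ≤ 2 * q * (Hn * (D * (N * μ (z s) + D * F)))
  single s l l′ le = begin
    N * (N * ∑ (allFin q) (λ u → U (st u))) ≤⟨ *-monoʳ-≤ N (st-bound U) ⟩
    N * (2 * q * ∑ (allFin N) U) ≡⟨ *-swap N (2 * q) _ ⟩
    2 * q * (N * ∑ (allFin N) U) ≤⟨ *-monoʳ-≤ (2 * q) (Pair.collision-bound s l l′) ⟩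
    2 * q * (Hn * ((l + 1 + l′) * (N * μ (z s) + (l + 1 + l′) * F₂)))
      ≤⟨ *-monoʳ-≤ (2 * q) (*-monoʳ-≤ Hn (*-mono-≤ le (+-monoʳ-≤ (N * μ (z s)) (*-mono-≤ le F₂≤F)))) ⟩
    2 * q * (Hn * (D * (N * μ (z s) + D * F))) ∎
    where
    U : Fin N → ℕ
    U s′ = ∑ Hs (λ h → nf (trace z h s′ l′ (trace z h s l [])))

  -- Averaging `single` over the first start replaces the multiplicity of its value by F₂ / N, which
  -- the term with F already dominates.
  double : ∀ l l′ → l + 1 + l′ ≤ D →
    N * (N * ∑ (allFin q) (λ u → ∑ (allFin q) (λ u′ → ∑ Hs (λ h → nf (trace z h (st u′) l′ (trace z h (st u) l []))))))
    ≤ q * q * (Hn * T₂)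
  double l l′ le = *-cancelˡ-≤ N (begin
    N * (N * (N * ∑ (allFin q) (λ u → g (st u))))
      ≡⟨ cong (N *_) (trans (cong (N *_) (sym (∑-*ˡ (allFin q) N _))) (sym (∑-*ˡ (allFin q) N _))) ⟩
    N * ∑ (allFin q) (λ u → N * (N * g (st u)))
      ≤⟨ *-monoʳ-≤ N (∑-mono (allFin q) (λ u → single (st u) l l′ le)) ⟩
    N * ∑ (allFin q) (λ u → 2 * q * (Hn * (D * (N * μ (z (st u)) + D * F))))
      ≤⟨ st-bound (λ s → 2 * q * (Hn * (D * (N * μ (z s) + D * F)))) ⟩
    2 * q * ∑ (allFin N) (λ s → 2 * q * (Hn * (D * (N * μ (z s) + D * F))))
      ≡⟨ cong (2 * q *_) (trans (∑-cong (allFin N) (λ s → expand q Hn D N (μ (z s)) F)) (trans (∑-+ (allFin N) _ _)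
           (cong₂ _+_ (∑-*ˡ (allFin N) (2 * q * Hn * D * N) _) (trans (∑-const (allFin N) _)
             (cong (_* (2 * q * Hn * D * D * F)) (length-allFin N)))))) ⟩
    2 * q * (2 * q * Hn * D * N * F₂ + N * (2 * q * Hn * D * D * F))
      ≤⟨ *-monoʳ-≤ (2 * q) (+-monoˡ-≤ _ (*-mono-≤ {2 * q * Hn * D * N} (≤-trans
           (≤-reflexive (sym (*-identityʳ _))) (*-monoʳ-≤ (2 * q * Hn * D * N) (s≤s {0} z≤n))) F₂≤F)) ⟩
    2 * q * (2 * q * Hn * D * N * D * F + N * (2 * q * Hn * D * D * F))
      ≡⟨ collect q Hn D N F ⟩
    N * (q * q * (Hn * T₂)) ∎)
    where
    g : Fin N → ℕ
    g s = ∑ (allFin q) (λ u′ → ∑ Hs (λ h → nf (trace z h (st u′) l′ (trace z h s l []))))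
    expand : ∀ q h d n m f → 2 * q * (h * (d * (n * m + d * f))) ≡ 2 * q * h * d * n * m + 2 * q * h * d * d * f
    expand = solve-∀
    collect : ∀ q h d n f → 2 * q * (2 * q * h * d * n * d * f + n * (2 * q * h * d * d * f))
                            ≡ n * (q * q * (h * (8 * (d * d * f))))
    collect = solve-∀

  -- The last query of the chain is new with respect to the walk from i, so the chain ends in a
  -- uniform vertex, and at most K vertices share a cell.
  ends-bound : ∀ s → N * ∑ Hs (λ h → fr (trace z h s ℓ (trace z h i (suc (r ∸ toℕ p)) []))
                                     * 𝟙 (value (walk z h s ℓ) % cells ≟ value (walk z h i (r ∸ toℕ p)) % cells))
                     ≤ Hn * K
  ends-bound s = begin
    N * ∑ Hs (λ h → fr (From.tr acc stable s ℓ h) * κ h (walk z h s ℓ))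
      ≡⟨ From.resample-walk acc stable s r κ κ-stable ⟩
    ∑ Hs (λ h → fr (From.tr acc stable s ℓ h) * ∑ (allFin N) (κ h))
      ≤⟨ ∑-bound Hs _ (λ h → 𝟙*≤ (fresh? (From.tr acc stable s ℓ h)) (λ _ → K-bound (value (walk z h i (r ∸ toℕ p)) % cells))) ⟩
    Hn * K ∎
    where
    acc : HashFun M N → List (Fin M)
    acc h = trace z h i (suc (r ∸ toℕ p)) []
    stable = trace-stable i (suc (r ∸ toℕ p))
    κ : HashFun M N → Fin N → ℕ
    κ h y = 𝟙 (value y % cells ≟ value (walk z h i (r ∸ toℕ p)) % cells)
    κ-stable : ∀ h x y → x ∉ From.tr acc stable s r h → ∀ u → κ (h [ x ]≔ y) u ≡ κ h u
    κ-stable h x y n u = cong (λ v → 𝟙 (value u % cells ≟ value v % cells))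
      (walk-update z h x y i [] (λ j → n (acc-∈-trace z h s r (acc h) j)) (n≤1+n _))

  private
    P Q tl : ℕ
    P = suc (toℕ p)
    Q = suc (toℕ p′)
    tl = suc (r ∸ toℕ p)

    P≤r : P ≤ r
    P≤r = toℕ<n p

    Q≤r : Q ≤ r
    Q≤r = toℕ<n p′

    tl≤ : tl ≤ ℓ
    tl≤ = s≤s (m∸n≤m r (toℕ p))

    room : ∀ {l l′} → l ≤ ℓ → l′ ≤ ℓ + ℓ + 1 → l + 1 + l′ ≤ D
    room {l} {l′} l≤ l′≤ = begin
      l + 1 + l′ ≤⟨ +-mono-≤ (+-monoˡ-≤ 1 l≤) l′≤ ⟩
      ℓ + 1 + (ℓ + ℓ + 1) ≡⟨ lhs r ⟩
      5 + 3 * r ≤⟨ +-monoʳ-≤ 4 (+-monoˡ-≤ (3 * r) (≤-trans (s≤s z≤n) P≤r)) ⟩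
      4 + (r + 3 * r) ≡⟨ rhs r ⟩
      D ∎
      where
      lhs : ∀ r → suc r + 1 + (suc r + suc r + 1) ≡ 5 + 3 * r
      lhs = solve-∀
      rhs : ∀ r → 4 + (r + 3 * r) ≡ 4 * suc r
      rhs = solve-∀

    ≤L : ∀ {l} → l ≤ r → l ≤ ℓ + ℓ + 1
    ≤L l≤ = ≤-trans l≤ (≤-trans (n≤1+n r) (≤-trans (m≤m+n ℓ ℓ) (m≤m+n _ 1)))

    L≤ : L ≤ ℓ + ℓ + 1
    L≤ = ≤-reflexive (+-comm 1 (ℓ + ℓ))

  V = length starts

  -- N² times a total over all starts and functions, compared to what a probability of κ / N² would give.
  Rare : (Starts → Starts → HashFun M N → ℕ) → ℕ → Set
  Rare f κ = N * (N * ∑ starts (λ A → ∑ starts (λ B → ∑ Hs (f A B)))) ≤ V * (V * (Hn * κ))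

  rare-+ : ∀ {f g κ κ′} → Rare f κ → Rare g κ′ → Rare (λ A B h → f A B h + g A B h) (κ + κ′)
  rare-+ {f} {g} {κ} {κ′} u v = begin
    N * (N * ∑ starts (λ A → ∑ starts (λ B → ∑ Hs (λ h → f A B h + g A B h))))
      ≡⟨ cong (λ s → N * (N * s)) (trans (∑-cong starts (λ A → trans (∑-cong starts (λ B → ∑-+ Hs _ _)) (∑-+ starts _ _)))
           (∑-+ starts _ _)) ⟩
    N * (N * (S f + S g))
      ≡⟨ dist N (S f) (S g) ⟩
    N * (N * S f) + N * (N * S g)
      ≤⟨ +-mono-≤ u v ⟩
    V * (V * (Hn * κ)) + V * (V * (Hn * κ′))
      ≡⟨ undist V Hn κ κ′ ⟩
    V * (V * (Hn * (κ + κ′))) ∎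
    where
    S : (Starts → Starts → HashFun M N → ℕ) → ℕ
    S f = ∑ starts (λ A → ∑ starts (λ B → ∑ Hs (f A B)))
    dist : ∀ n a b → n * (n * (a + b)) ≡ n * (n * a) + n * (n * b)
    dist = solve-∀
    undist : ∀ v h a b → v * (v * (h * a)) + v * (v * (h * b)) ≡ v * (v * (h * (a + b)))
    undist = solve-∀

  rare-0 : ∀ {f κ} → (∀ A B h → f A B h ≡ 0) → Rare f κ
  rare-0 {f} e = ≡-≤ (trans (cong (λ s → N * (N * s))
    (trans (∑-cong starts (λ A → trans (∑-cong starts (λ B → trans (∑-cong Hs (e A B)) (∑-zero Hs))) (∑-zero starts)))
           (∑-zero starts))) (trans (cong (N *_) (*-zeroʳ N)) (*-zeroʳ N))) z≤n

  rare-∑ : ∀ {n} {f : Fin n → _} {κ} → (∀ x → Rare (f x) κ) → Rare (λ A B h → ∑ (allFin n) (λ x → f x A B h)) (n * κ)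
  rare-∑ {zero}  e = rare-0 (λ _ _ _ → refl)
  rare-∑ {suc n} {f} {κ} e = ≡-≤ (cong (λ s → N * (N * s))
      (∑-cong starts (λ A → ∑-cong starts (λ B → ∑-cong Hs (λ h → ∑-allFin-suc n (λ x → f x A B h))))))
    (rare-+ {f zero} {λ A B h → ∑ (allFin n) (λ x → f (suc x) A B h)} {κ} {n * κ} (e zero) (rare-∑ {n} (e ∘ suc)))

  rare-guard : ∀ {X : Set} (X? : Dec X) {f κ} → (X → Rare f κ) → Rare (λ A B h → 𝟙 X? * f A B h) κ
  rare-guard (yes x) {f} {κ} e = subst (λ s → N * (N * s) ≤ V * (V * (Hn * κ)))
    (∑-cong starts (λ A → ∑-cong starts (λ B → ∑-cong Hs (λ h → sym (+-identityʳ _))))) (e x)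
  rare-guard (no _)  e = rare-0 (λ _ _ _ → refl)

  rare-swap : ∀ {f κ} → Rare f κ → Rare (λ A B → f B A) κ
  rare-swap {f} {κ} e = subst (λ s → N * (N * s) ≤ V * (V * (Hn * κ))) (∑-swap starts starts _) e

  private
    q≡ : length (allFin q) ≡ q
    q≡ = length-allFin q

  -- It suffices to sum over the random words that F depends on.
  rare-words : ∀ {F : Starts → Starts → HashFun M N → ℕ} {g : Fin q → Fin q → HashFun M N → ℕ} {κ} →
    q * (q * ∑ starts (λ A → ∑ starts (λ B → ∑ Hs (F A B)))) ≡ V * (V * ∑ (allFin q) (λ u → ∑ (allFin q) (λ u′ → ∑ Hs (g u u′)))) →
    N * (N * ∑ (allFin q) (λ u → ∑ (allFin q) (λ u′ → ∑ Hs (g u u′)))) ≤ q * q * (Hn * κ) → Rare F κ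
  rare-words {κ = κ} e le = *-cancelˡ-≤ q (*-cancelˡ-≤ q
    (≡-≤ (swap₄ q N _) (≡-≤ (cong (λ s → N * (N * s)) e) (≡-≤ (swap₄ N V _)
      (≤-≡ (*-monoʳ-≤ V (*-monoʳ-≤ V le)) (fin q V (Hn * κ)))))))
    where
    swap₄ : ∀ a b s → a * (a * (b * (b * s))) ≡ b * (b * (a * (a * s)))
    swap₄ = solve-∀
    fin : ∀ q v s → v * (v * (q * q * s)) ≡ q * (q * (v * (v * s)))
    fin = solve-∀

  average : ∀ (g : Fin q → ℕ) x → q * ∑ starts (λ A → g (lookup A x)) ≡ V * ∑ (allFin q) g
  average g x = trans (cong (_* ∑ starts (λ A → g (lookup A x))) (sym q≡)) (∑-vectors-lookup (allFin q) x g)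

  rare-AB : ∀ (f : Fin q → Fin q → HashFun M N → ℕ) {κ} x y →
            N * (N * ∑ (allFin q) (λ u → ∑ (allFin q) (λ u′ → ∑ Hs (f u u′)))) ≤ q * q * (Hn * κ) →
            Rare (λ A B → f (lookup A x) (lookup B y)) κ
  rare-AB f {κ} x y = rare-words {λ A B → f (lookup A x) (lookup B y)} {f} {κ} (begin-equality
    q * (q * ∑ starts (λ A → ∑ starts (λ B → g (lookup A x) (lookup B y))))
      ≡⟨ cong (q *_) (trans (sym (∑-*ˡ starts q _)) (trans (∑-cong starts (λ A → average (g (lookup A x)) y)) (∑-*ˡ starts V _))) ⟩
    q * (V * ∑ starts (λ A → G (lookup A x)))
      ≡⟨ trans (*-swap q V _) (cong (V *_) (average G x)) ⟩
    V * (V * ∑ (allFin q) G) ∎)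
    where
    g : Fin q → Fin q → ℕ
    g u u′ = ∑ Hs (f u u′)
    G : Fin q → ℕ
    G u = ∑ (allFin q) (g u)

  rare-A : ∀ (f : Fin q → HashFun M N → ℕ) {κ} x →
           N * (N * ∑ (allFin q) (λ u → ∑ Hs (f u))) ≤ q * (Hn * κ) → Rare (λ A B → f (lookup A x)) κ
  rare-A f {κ} x le = rare-AB (λ u _ → f u) {κ} x x (begin
    N * (N * ∑ (allFin q) (λ u → ∑ (allFin q) (λ _ → ∑ Hs (f u))))
      ≡⟨ cong (λ s → N * (N * s)) (trans (∑-cong (allFin q) (λ u → trans (∑-const (allFin q) _) (cong (_* ∑ Hs (f u)) q≡))) (∑-*ˡ (allFin q) q _)) ⟩
    N * (N * (q * ∑ (allFin q) (λ u → ∑ Hs (f u))))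
      ≡⟨ out N q _ ⟩
    q * (N * (N * ∑ (allFin q) (λ u → ∑ Hs (f u))))
      ≤⟨ *-monoʳ-≤ q le ⟩
    q * (q * (Hn * κ))
      ≡⟨ *-assoc q q _ ⟨
    q * q * (Hn * κ) ∎)
    where
    out : ∀ n q s → n * (n * (q * s)) ≡ q * (n * (n * s))
    out = solve-∀

  rare-AA : ∀ (f : Fin q → Fin q → HashFun M N → ℕ) {κ} {x y} → x ≢ y →
            N * (N * ∑ (allFin q) (λ u → ∑ (allFin q) (λ u′ → ∑ Hs (f u u′)))) ≤ q * q * (Hn * κ) →
            Rare (λ A B → f (lookup A x) (lookup A y)) κ
  rare-AA f {κ} {x} {y} x≢y = rare-words {λ A B → f (lookup A x) (lookup A y)} {f} {κ} (begin-equality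
    q * (q * ∑ starts (λ A → ∑ starts (λ B → g (lookup A x) (lookup A y))))
      ≡⟨ cong (λ s → q * (q * s)) (trans (∑-cong starts (λ A → ∑-const starts _)) (∑-*ˡ starts V _)) ⟩
    q * (q * (V * ∑ starts (λ A → g (lookup A x) (lookup A y))))
      ≡⟨ trans (cong (q *_) (*-swap q V _)) (*-swap q V _) ⟩
    V * (q * (q * ∑ starts (λ A → g (lookup A x) (lookup A y))))
      ≡⟨ cong (V *_) (trans (cong₂ (λ a b → a * (b * S)) (sym q≡) (sym q≡)) (∑∑-lookup (allFin q) x≢y g)) ⟩
    V * (V * ∑ (allFin q) (λ u → ∑ (allFin q) (g u))) ∎)
    where
    g : Fin q → Fin q → ℕ
    g u u′ = ∑ Hs (f u u′)
    S = ∑ starts (λ A → g (lookup A x) (lookup A y))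

  single-i : ∀ l′ → l′ ≤ ℓ + ℓ + 1 →
    N * (N * ∑ (allFin q) (λ u → ∑ Hs (λ h → nf (trace z h (st u) l′ (trace z h i tl []))))) ≤ q * (Hn * T₁)
  single-i l′ le = begin
    N * (N * ∑ (allFin q) (λ u → ∑ Hs (λ h → nf (trace z h (st u) l′ (trace z h i tl [])))))
      ≤⟨ single i tl l′ (room tl≤ le) ⟩
    2 * q * (Hn * (D * (N * μ (z i) + D * F)))
      ≤⟨ *-monoʳ-≤ (2 * q) (*-monoʳ-≤ Hn (*-monoʳ-≤ D (+-monoˡ-≤ (D * F) (*-monoʳ-≤ N μ≤γ)))) ⟩
    2 * q * (Hn * (D * (N * γ + D * F)))
      ≡⟨ rearrange q Hn _ ⟩
    q * (Hn * T₁) ∎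
    where
    rearrange : ∀ q h a → 2 * q * (h * a) ≡ q * (h * (2 * a))
    rearrange = solve-∀

  private
    avoid : Starts → Starts → HashFun M N → Fin N → ℕ
    avoid A B h s = nf (trace z h s L (trace z h i tl [])) + (nf (trace z h s L (trace z h (from A a) P []))
                    + nf (trace z h s L (trace z h (from B b) Q [])))

    same-cell : HashFun M N → Fin N → ℕ
    same-cell h s = 𝟙 (value (walk z h s ℓ) % cells ≟ value (walk z h i (r ∸ toℕ p)) % cells)

    bad-ab bad-ia bad-ib bad-as bad-bs bad-ends : Starts → Starts → HashFun M N → ℕ
    bad-ab A B h = nf (trace z h (from B b) Q (trace z h (from A a) P []))
    bad-ia A B h = nf (trace z h (from A a) P (trace z h i tl []))
    bad-ib A B h = nf (trace z h (from B b) Q (trace z h i tl []))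
    bad-as A B h = ∑ (allFin c) (λ x → 𝟙 (¬? (x Fin.≟ a)) * avoid A B h (from A x))
    bad-bs A B h = ∑ (allFin c) (λ x → 𝟙 (¬? (x Fin.≟ b)) * avoid A B h (from B x))
    -- Chains whose trace is not fresh are already counted by `bad-as`.
    bad-ends A B h = ∑ (allFin c) (λ x → 𝟙 (¬? (x Fin.≟ a)) *
                       (fr (trace z h (from A x) ℓ (trace z h i tl [])) * same-cell h (from A x)))

  bad : Starts → Starts → HashFun M N → ℕ
  bad A B h = (bad-ab A B h + (bad-ia A B h + bad-ib A B h)) + (bad-as A B h + (bad-bs A B h + bad-ends A B h))

  nf≡0 : ∀ xs → nf xs ≡ 0 → Fresh xs
  nf≡0 xs = 𝟙¬≡0 (fresh? xs)

  bad-0 : ∀ A B h → bad A B h ≡ 0 → Run.Undisturbed (run A B) a b p p′ i h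
  bad-0 A B h e = record
    { ab    = nf≡0 (trace z h (from B b) Q (trace z h (from A a) P [])) (m+n≡0⇒m≡0 (bad-ab A B h) e₁)
    ; ia    = nf≡0 (trace z h (from A a) P (trace z h i tl [])) (m+n≡0⇒m≡0 (bad-ia A B h) e₂)
    ; ib    = nf≡0 (trace z h (from B b) Q (trace z h i tl [])) (m+n≡0⇒n≡0 (bad-ia A B h) e₂)
    ; as-ok = as-ok
    ; bs-ok = λ x x≢b → avoids (from B x) (𝟙*≡0 (¬? (x Fin.≟ b)) (∑≡0 _ (m+n≡0⇒m≡0 (bad-bs A B h) e₄) x) x≢b)
    ; ends  = λ x x≢a → 𝟙≡0 (_ ≟ _) (𝟙*≡0 (fresh? (trace z h (from A x) ℓ (trace z h i tl [])))
                (𝟙*≡0 (¬? (x Fin.≟ a)) (∑≡0 _ (m+n≡0⇒n≡0 (bad-bs A B h) e₄) x) x≢a)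
                (fresh-prefix z h (from A x) _ (≤-trans (m≤m+n ℓ ℓ) (n≤1+n _)) (proj₁ (as-ok x x≢a))))
    }
    where
    open Run (run A B) using (Avoids)
    e₁ = m+n≡0⇒m≡0 (bad-ab A B h + (bad-ia A B h + bad-ib A B h)) e
    e₂ = m+n≡0⇒n≡0 (bad-ab A B h) e₁
    e₃ = m+n≡0⇒n≡0 (bad-ab A B h + (bad-ia A B h + bad-ib A B h)) e
    e₄ = m+n≡0⇒n≡0 (bad-as A B h) e₃

    avoids : ∀ s → avoid A B h s ≡ 0 → Avoids a b p p′ i h s
    avoids s e = nf≡0 (trace z h s L (trace z h i tl [])) (m+n≡0⇒m≡0 i-part e) ,
                 nf≡0 (trace z h s L (trace z h (from A a) P [])) (m+n≡0⇒m≡0 a-part (m+n≡0⇒n≡0 i-part e)) ,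
                 nf≡0 (trace z h s L (trace z h (from B b) Q [])) (m+n≡0⇒n≡0 a-part (m+n≡0⇒n≡0 i-part e))
      where
      i-part = nf (trace z h s L (trace z h i tl []))
      a-part = nf (trace z h s L (trace z h (from A a) P []))

    as-ok : ∀ x → x ≢ a → Avoids a b p p′ i h (from A x)
    as-ok x x≢a = avoids (from A x) (𝟙*≡0 (¬? (x Fin.≟ a)) (∑≡0 _ (m+n≡0⇒m≡0 (bad-as A B h) e₃) x) x≢a)

  bad-covers : ∀ A B h → 1 ≤ 𝟙 (Run.undisturbed? (run A B) a b p p′ i h) + bad A B h
  bad-covers A B h with bad A B h | bad-0 A B h
  ... | suc k | _ = ≤-trans (s≤s z≤n) (m≤n+m (suc k) _)
  ... | zero  | u = ≡-≤ (sym (𝟙-yes (Run.undisturbed? (run A B) a b p p′ i h) (u refl))) (m≤m+n _ 0)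

  κ = disturbance N c r γ F K

  rare-bad : Rare bad κ
  rare-bad =
    rare-+ {λ A B h → bad-ab A B h + (bad-ia A B h + bad-ib A B h)}
           {λ A B h → bad-as A B h + (bad-bs A B h + bad-ends A B h)} {T₂ + (T₁ + T₁)}
      (rare-+ {bad-ab} {λ A B h → bad-ia A B h + bad-ib A B h} {T₂}
        (rare-AB (λ u u′ h → nf (trace z h (st u′) Q (trace z h (st u) P []))) a b
          (double P Q (room (≤-trans P≤r (n≤1+n r)) (≤L Q≤r))))
        (rare-+ {bad-ia} {bad-ib} {T₁} {T₁} (i-A P a (≤L P≤r)) (i-B Q b (≤L Q≤r))))
      (rare-+ {bad-as} {λ A B h → bad-bs A B h + bad-ends A B h} {c * TA}
        (rare-∑ {c} {κ = TA} (λ x → rare-guard (¬? (x Fin.≟ a)) {λ A B h → avoid A B h (from A x)} {TA} (λ x≢a →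
          rare-avoid (λ A B → from A x) (i-A L x L≤)
            (rare-AA (λ u u′ h → nf (trace z h (st u′) L (trace z h (st u) P []))) (x≢a ∘ sym) (double P L roomL))
            (rare-swap {λ B A h → nf (trace z h (from A x) L (trace z h (from B b) Q []))} {T₂}
              (rare-AB (λ u u′ h → nf (trace z h (st u′) L (trace z h (st u) Q []))) b x (double Q L roomL′))))))
        (rare-+ {bad-bs} {bad-ends} {c * TA} {c * (N * K)}
          (rare-∑ {c} {κ = TA} (λ x → rare-guard (¬? (x Fin.≟ b)) {λ A B h → avoid A B h (from B x)} {TA} (λ x≢b →
            rare-avoid (λ A B → from B x) (i-B L x L≤)
              (rare-AB (λ u u′ h → nf (trace z h (st u′) L (trace z h (st u) P []))) a x (double P L roomL))
              (rare-swap {λ B A h → nf (trace z h (from B x) L (trace z h (from B b) Q []))} {T₂}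
                (rare-AA (λ u u′ h → nf (trace z h (st u′) L (trace z h (st u) Q []))) (x≢b ∘ sym) (double Q L roomL′))))))
          (rare-∑ {c} {κ = N * K} (λ x → rare-guard (¬? (x Fin.≟ a))
            {λ A B h → fr (trace z h (from A x) ℓ (trace z h i tl [])) * same-cell h (from A x)} {N * K}
            (λ _ → rare-E x)))))
    where
    TA = T₁ + (T₂ + T₂)

    rare-avoid : (s : Starts → Starts → Fin N) →
      Rare (λ A B h → nf (trace z h (s A B) L (trace z h i tl []))) T₁ →
      Rare (λ A B h → nf (trace z h (s A B) L (trace z h (from A a) P []))) T₂ →
      Rare (λ A B h → nf (trace z h (s A B) L (trace z h (from B b) Q []))) T₂ →
      Rare (λ A B h → avoid A B h (s A B)) TA
    rare-avoid s u v w = rare-+ {λ A B h → nf (trace z h (s A B) L (trace z h i tl []))}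
      {λ A B h → nf (trace z h (s A B) L (trace z h (from A a) P [])) + nf (trace z h (s A B) L (trace z h (from B b) Q []))}
      {T₁} u (rare-+ {λ A B h → nf (trace z h (s A B) L (trace z h (from A a) P []))}
                     {λ A B h → nf (trace z h (s A B) L (trace z h (from B b) Q []))} {T₂} {T₂} v w)

    roomL = room (≤-trans P≤r (n≤1+n r)) L≤
    roomL′ = room (≤-trans Q≤r (n≤1+n r)) L≤

    i-A : ∀ l′ x → l′ ≤ ℓ + ℓ + 1 → Rare (λ A B h → nf (trace z h (st (lookup A x)) l′ (trace z h i tl []))) T₁
    i-A l′ x le = rare-A (λ u h → nf (trace z h (st u) l′ (trace z h i tl []))) x (single-i l′ le)

    i-B : ∀ l′ x → l′ ≤ ℓ + ℓ + 1 → Rare (λ A B h → nf (trace z h (st (lookup B x)) l′ (trace z h i tl []))) T₁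
    i-B l′ x le = rare-swap {κ = T₁} (i-A l′ x le)

    rare-E : ∀ x → Rare (λ A B h → fr (trace z h (st (lookup A x)) ℓ (trace z h i tl []))
       * 𝟙 (value (walk z h (st (lookup A x)) ℓ) % cells ≟ value (walk z h i (r ∸ toℕ p)) % cells)) (N * K)
    rare-E x = rare-A f x (begin
      N * (N * ∑ (allFin q) (λ u → ∑ Hs (f u)))
        ≡⟨ cong (N *_) (sym (∑-*ˡ (allFin q) N _)) ⟩
      N * ∑ (allFin q) (λ u → N * ∑ Hs (f u))
        ≤⟨ *-monoʳ-≤ N (∑-bound (allFin q) _ (λ u → ends-bound (st u))) ⟩
      N * (length (allFin q) * (Hn * K))
        ≡⟨ cong (λ l → N * (l * (Hn * K))) q≡ ⟩
      N * (q * (Hn * K))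
        ≡⟨ rearrange N q Hn K ⟩
      q * (Hn * (N * K)) ∎)
      where
      f : Fin q → HashFun M N → ℕ
      f u h = fr (trace z h (st u) ℓ (trace z h i tl []))
              * 𝟙 (value (walk z h (st u) ℓ) % cells ≟ value (walk z h i (r ∸ toℕ p)) % cells)
      rearrange : ∀ n q h k → n * (q * (h * k)) ≡ q * (h * (n * k))
      rearrange = solve-∀

  undisturbed-likely : 2 * κ ≤ N * N →
    V * (V * Hn) ≤ 2 * ∑ starts (λ A → ∑ starts (λ B → ∑ Hs (λ h → 𝟙 (Run.undisturbed? (run A B) a b p p′ i h))))
  undisturbed-likely small = +-cancelʳ-≤ (V * (V * Hn)) _ _ (begin
    V * (V * Hn) + V * (V * Hn) ≡⟨ cong (V * (V * Hn) +_) (sym (+-identityʳ _)) ⟩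
    2 * (V * (V * Hn)) ≤⟨ *-monoʳ-≤ 2 covered ⟩
    2 * (S + Sbad) ≡⟨ *-distribˡ-+ 2 S Sbad ⟩
    2 * S + 2 * Sbad ≤⟨ +-monoʳ-≤ (2 * S) few ⟩
    2 * S + V * (V * Hn) ∎)
    where
    S = ∑ starts (λ A → ∑ starts (λ B → ∑ Hs (λ h → 𝟙 (Run.undisturbed? (run A B) a b p p′ i h))))
    Sbad = ∑ starts (λ A → ∑ starts (λ B → ∑ Hs (bad A B)))

    covered : V * (V * Hn) ≤ S + Sbad
    covered = begin
      V * (V * Hn)
        ≡⟨ trans (∑-const starts _) (cong (V *_) (trans (∑-const starts _) (cong (V *_)
             (trans (∑-const Hs 1) (*-identityʳ Hn))))) ⟨
      ∑ starts (λ A → ∑ starts (λ B → ∑ Hs (λ h → 1)))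
        ≤⟨ ∑-mono starts (λ A → ∑-mono starts (λ B → ∑-mono Hs (bad-covers A B))) ⟩
      ∑ starts (λ A → ∑ starts (λ B → ∑ Hs (λ h → 𝟙 (Run.undisturbed? (run A B) a b p p′ i h) + bad A B h)))
        ≡⟨ trans (∑-cong starts (λ A → trans (∑-cong starts (λ B → ∑-+ Hs _ _)) (∑-+ starts _ _))) (∑-+ starts _ _) ⟩
      S + Sbad ∎

    few : 2 * Sbad ≤ V * (V * Hn)
    few = *-cancelˡ-≤ N (*-cancelˡ-≤ N (begin
      N * (N * (2 * Sbad)) ≡⟨ rearrange N Sbad ⟩
      2 * (N * (N * Sbad)) ≤⟨ *-monoʳ-≤ 2 rare-bad ⟩
      2 * (V * (V * (Hn * κ))) ≡⟨ rearrange₂ V Hn κ ⟩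
      V * (V * (Hn * (2 * κ))) ≤⟨ *-monoʳ-≤ V (*-monoʳ-≤ V (*-monoʳ-≤ Hn small)) ⟩
      V * (V * (Hn * (N * N))) ≡⟨ rearrange₃ V Hn N ⟩
      N * (N * (V * (V * Hn))) ∎))
      where
      rearrange : ∀ n s → n * (n * (2 * s)) ≡ 2 * (n * (n * s))
      rearrange = solve-∀
      rearrange₂ : ∀ v h k → 2 * (v * (v * (h * k))) ≡ v * (v * (h * (2 * k)))
      rearrange₂ = solve-∀
      rearrange₃ : ∀ v h n → v * (v * (h * (n * n))) ≡ n * (n * (v * (v * h)))
      rearrange₃ = solve-∀

-- Two runs with the same function

module _ {N M : ℕ} (z : Fin N → Fin M) (z* : Fin M) where

  -- Excluding z* makes the arrival at a vertex of value z* the first visit of that value, so that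
  -- the target determines the number of steps.
  Apart : List (Fin M) → List (Fin M) → Set
  Apart us vs = (Fresh us × z* ∉ us) × (Fresh vs × z* ∉ vs) × (∀ x → x ∈ us → x ∉ vs)

  apart? : ∀ us vs → Dec (Apart us vs)
  apart? us vs = (fresh? us ×-dec ¬? (_∈?_ Fin._≟_ z* us)) ×-dec (fresh? vs ×-dec ¬? (_∈?_ Fin._≟_ z* vs))
                 ×-dec all? (λ x → _∈?_ Fin._≟_ x us →-dec ¬? (_∈?_ Fin._≟_ x vs))

  Clean : (s : Fin N) (p : ℕ) (t : Fin N) (q : ℕ) → HashFun M N → Set
  Clean s p t q h = Apart (trace z h s (suc p) []) (trace z h t (suc q) [])

  clean? : ∀ s p t q → Decidable (Clean s p t q)
  clean? s p t q h = apart? (trace z h s (suc p) []) (trace z h t (suc q) [])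

  clean-sym : ∀ {s p t q h} → Clean s p t q h → Clean t q s p h
  clean-sym (u , v , w) = v , u , λ x i j → w x j i

  clean-update : ∀ {s p t q} h y → Clean s p t q h → Clean s p t q (h [ z (walk z h t q) ]≔ y)
  clean-update {s} {p} {t} {q} h y c@(_ , ((n , _) , _) , w) = subst₂ Apart
    (sym (trace-same z h (z (walk z h t q)) y s {suc p} {[]} {[]} (λ i → w _ i (here refl)) refl {suc p} (n≤1+n _)))
    (sym (trace-same z h (z (walk z h t q)) y t {q} {[]} {[]} n refl {suc q} ≤-refl)) c

  -- `S` lists the queries that determine the factor A. The guard G holds only where the decisive
  -- query is new to `S` and to its own walk, and it does not depend on the answer.
  arrival : (S : HashFun M N → List (Fin M)) (A : HashFun M N → ℕ) →
    (∀ h x y → x ∉ S h → A (h [ x ]≔ y) ≡ A h) →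
    ∀ (t : Fin N) (q : ℕ) (j : Fin N) {G : HashFun M N → Set} (G? : Decidable G) →
    (∀ h → G h → z (walk z h t q) ∉ S h × z (walk z h t q) ∉ trace z h t q []
                 × (∀ y → G (h [ z (walk z h t q) ]≔ y))) →
    N * ∑ (functions N M) (λ h → A h * 𝟙 (G? h) * 𝟙 (walk z h t (suc q) Fin.≟ j))
    ≡ ∑ (functions N M) (λ h → A h * 𝟙 (G? h))
  arrival S A A-stable t q j G? ok = resample-hit (λ h → A h * 𝟙 (G? h)) (λ h → z (walk z h t q)) j inv
    where
    inv : ∀ h y → A h * 𝟙 (G? h) ≢ 0 → _ × _
    inv h y nz = cong₂ _*_ (A-stable h _ y (proj₁ (ok h g)))
                   (trans (𝟙-yes (G? _) (proj₂ (proj₂ (ok h g)) y)) (sym (𝟙-yes (G? h) g))) ,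
                 cong z (walk-update z h _ y t [] (proj₁ (proj₂ (ok h g))) ≤-refl)
      where
      g = 𝟙-holds (G? h) (λ e → nz (trans (cong (A h *_) e) (*-zeroʳ (A h))))

  arrival-≤ : (S : HashFun M N → List (Fin M)) (A : HashFun M N → ℕ) →
    (∀ h x y → x ∉ S h → A (h [ x ]≔ y) ≡ A h) →
    ∀ (t : Fin N) (q : ℕ) (j : Fin N) {G H : HashFun M N → Set} (G? : Decidable G) (H? : Decidable H) →
    (∀ h → H h → G h × walk z h t (suc q) ≡ j) →
    (∀ h → G h → z (walk z h t q) ∉ S h × z (walk z h t q) ∉ trace z h t q []
                 × (∀ y → G (h [ z (walk z h t q) ]≔ y))) →
    N * ∑ (functions N M) (λ h → A h * 𝟙 (H? h)) ≤ ∑ (functions N M) (λ h → A h * 𝟙 (G? h))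
  arrival-≤ S A A-stable t q j G? H? from ok = ≤-≡ (*-monoʳ-≤ N (∑-mono (functions N M) (λ h → ≤-≡ (*-monoʳ-≤ (A h)
      (≤-≡ (𝟙-mono (H? h) (G? h ×-dec (walk z h t (suc q) Fin.≟ j)) (from h)) (𝟙-× (G? h) _))) (sym (*-assoc (A h) _ _)))))
    (arrival S A A-stable t q j G? ok)

  Hit : (s : Fin N) (p : ℕ) (i : Fin N) (t : Fin N) (q : ℕ) (j : Fin N) → HashFun M N → Set
  Hit s p i t q j h = Clean s p t q h × walk z h s (suc p) ≡ i × walk z h t (suc q) ≡ j

  hit? : ∀ s p i t q j → Decidable (Hit s p i t q j)
  hit? s p i t q j h = clean? s p t q h ×-dec (walk z h s (suc p) Fin.≟ i) ×-dec (walk z h t (suc q) Fin.≟ j)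

  hit-bound : ∀ s p i t q j → N * (N * ∑ (functions N M) (λ h → 𝟙 (hit? s p i t q j h))) ≤ length (functions N M)
  hit-bound s p i t q j = begin
    N * (N * ∑ Hs (λ h → 𝟙 (hit? s p i t q j h)))
      ≡⟨ cong (λ x → N * (N * x)) (∑-cong Hs (λ h → sym (*-identityˡ _))) ⟩
    N * (N * ∑ Hs (λ h → 1 * 𝟙 (hit? s p i t q j h)))
      ≤⟨ *-monoʳ-≤ N (arrival-≤ (λ _ → []) (λ _ → 1) (λ _ _ _ _ → refl) t q j one? (hit? s p i t q j) (λ { _ (c , u , v) → (c , u) , v }) ok₁) ⟩
    N * ∑ Hs (λ h → 1 * 𝟙 (one? h))
      ≤⟨ arrival-≤ (λ _ → []) (λ _ → 1) (λ _ _ _ _ → refl) s p i (clean? s p t q) one? (λ _ → id) ok₂ ⟩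
    ∑ Hs (λ h → 1 * 𝟙 (clean? s p t q h))
      ≤⟨ ∑-bound Hs _ (λ h → ≡-≤ (*-identityˡ _) (𝟙≤1 (clean? s p t q h))) ⟩
    length Hs * 1
      ≡⟨ *-identityʳ _ ⟩
    length Hs ∎
    where
    Hs = functions N M

    one? : Decidable (λ h → Clean s p t q h × walk z h s (suc p) ≡ i)
    one? h = clean? s p t q h ×-dec (walk z h s (suc p) Fin.≟ i)

    ok₁ : ∀ h → Clean s p t q h × walk z h s (suc p) ≡ i → _ × _ × _
    ok₁ h (c@(_ , ((n , _) , _) , w) , e) = (λ ()) , n , λ y → clean-update h y c ,
      trans (walk-update z h _ y s {suc p} [] (λ k → w _ k (here refl)) ≤-refl) e

    ok₂ : ∀ h → Clean s p t q h → _ × _ × _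
    ok₂ h c@(((n , _) , _) , _) = (λ ()) , n , λ y → clean-sym (clean-update h y (clean-sym c))

  -- Only answers of h are listed, so the start is left out.
  visited : HashFun M N → Fin N → ℕ → List (Fin N)
  visited h v zero    = []
  visited h v (suc t) = walk z h v (suc t) ∷ visited h v t

  length-visited : ∀ h v t → length (visited h v t) ≡ t
  length-visited h v zero    = refl
  length-visited h v (suc t) = cong suc (length-visited h v t)

  known-visited : ∀ h v t {x} → x ∈ trace z h v t [] → lookup h x ∈ visited h v t
  known-visited h v (suc t) (here refl) = here refl
  known-visited h v (suc t) (there i)   = there (known-visited h v t i)

  visited-update : ∀ h x y v {l} → x ∉ trace z h v l [] → ∀ {t} → t ≤ l → visited (h [ x ]≔ y) v t ≡ visited h v t
  visited-update h x y v n {zero}  _   = refl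
  visited-update h x y v n {suc t} t≤l = cong₂ _∷_ (walk-update z h x y v [] n t≤l) (visited-update h x y v n (<⇒≤ t≤l))

record TwoRuns (N M : ℕ) : Set where
  field
    r : ℕ
    z* : Fin M
    z₁ z₂ : Fin N → Fin M
    s₁ t₁ i₁ j₁ s₂ t₂ i₂ j₂ : Fin N
    p₁ q₁ : ℕ
    z₂-i₂ : z₂ i₂ ≡ z*
    z₂-j₂ : z₂ j₂ ≡ z*

  Hs = functions N M

  first : HashFun M N → ℕ
  first h = 𝟙 (hit? z₁ z* s₁ p₁ i₁ t₁ q₁ j₁ h)

  second : Fin r → Fin r → HashFun M N → ℕ
  second p q h = 𝟙 (hit? z₂ z* s₂ (toℕ p) i₂ t₂ (toℕ q) j₂ h)

  queried : HashFun M N → List (Fin M)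
  queried h = trace z₁ h s₁ (suc p₁) [] ++ trace z₁ h t₁ (suc q₁) []

  reached : HashFun M N → List (Fin N)
  reached h = visited z₁ z* h s₁ (suc p₁) ++ visited z₁ z* h t₁ (suc q₁)

  _∈ᴺ_ : (v : Fin N) (vs : List (Fin N)) → Dec (v ∈ vs)
  _∈ᴺ_ = _∈?_ Fin._≟_

  _∈ᴹ_ : (v : Fin M) (vs : List (Fin M)) → Dec (v ∈ vs)
  _∈ᴹ_ = _∈?_ Fin._≟_

  known : ∀ h {x} → x ∈ queried h → lookup h x ∈ reached h
  known h {x} i with ∈-++⁻ (trace z₁ h s₁ (suc p₁) []) i
  ... | inj₁ k = ∈-++⁺ˡ (known-visited z₁ z* h s₁ (suc p₁) k)
  ... | inj₂ k = ∈-++⁺ʳ (visited z₁ z* h s₁ (suc p₁)) (known-visited z₁ z* h t₁ (suc q₁) k)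

  module _ (h : HashFun M N) (x : Fin M) (y : Fin N) (n : x ∉ queried h) where
    private
      nₛ : x ∉ trace z₁ h s₁ (suc p₁) []
      nₛ i = n (∈-++⁺ˡ i)
      nₜ : x ∉ trace z₁ h t₁ (suc q₁) []
      nₜ i = n (∈-++⁺ʳ (trace z₁ h s₁ (suc p₁) []) i)
      eₛ : trace z₁ (h [ x ]≔ y) s₁ (suc p₁) [] ≡ trace z₁ h s₁ (suc p₁) []
      eₛ = trace-same z₁ h x y s₁ {suc p₁} nₛ refl (n≤1+n _)
      eₜ : trace z₁ (h [ x ]≔ y) t₁ (suc q₁) [] ≡ trace z₁ h t₁ (suc q₁) []
      eₜ = trace-same z₁ h x y t₁ {suc q₁} nₜ refl (n≤1+n _)

    queried-update : queried (h [ x ]≔ y) ≡ queried h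
    queried-update = cong₂ _++_ eₛ eₜ

    reached-update : reached (h [ x ]≔ y) ≡ reached h
    reached-update = cong₂ _++_ (visited-update z₁ z* h x y s₁ nₛ ≤-refl) (visited-update z₁ z* h x y t₁ nₜ ≤-refl)

    first-update : first (h [ x ]≔ y) ≡ first h
    first-update = trans (cong₂ (λ us vs → 𝟙 (hit′ us vs (walk z₁ h′ s₁ (suc p₁)) (walk z₁ h′ t₁ (suc q₁)))) eₛ eₜ)
      (cong₂ (λ v w → 𝟙 (hit′ (trace z₁ h s₁ (suc p₁) []) (trace z₁ h t₁ (suc q₁) []) v w))
        (walk-update z₁ h x y s₁ {suc p₁} [] nₛ ≤-refl) (walk-update z₁ h x y t₁ {suc q₁} [] nₜ ≤-refl))
      where
      h′ = h [ x ]≔ y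
      hit′ : ∀ us vs v w → Dec (Apart z₁ z* us vs × v ≡ i₁ × w ≡ j₁)
      hit′ us vs v w = apart? z₁ z* us vs ×-dec (v Fin.≟ i₁) ×-dec (w Fin.≟ j₁)

  ¬known? : (s : Fin N) (p : ℕ) → Decidable (λ h → z₂ (walk z₂ h s p) ∉ queried h)
  ¬known? s p h = ¬? (z₂ (walk z₂ h s p) ∈ᴹ queried h)

  first-time : ∀ (s i : Fin N) → z₂ i ≡ z* → ∀ h →
    ∑ (allFin r) (λ p → 𝟙 (¬? (z* ∈ᴹ trace z₂ h s (suc (toℕ p)) []) ×-dec (walk z₂ h s (suc (toℕ p)) Fin.≟ i))) ≤ 1
  first-time s i e h = ∑-unique _ (λ p → 𝟙≤1 (P? p)) (λ p p′ u v → uniq p p′ (𝟙-holds (P? p) u) (𝟙-holds (P? p′) v))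
    where
    P? : (p : Fin r) → Dec (z* ∉ trace z₂ h s (suc (toℕ p)) [] × walk z₂ h s (suc (toℕ p)) ≡ i)
    P? p = ¬? (z* ∈ᴹ trace z₂ h s (suc (toℕ p)) []) ×-dec (walk z₂ h s (suc (toℕ p)) Fin.≟ i)

    uniq : ∀ p p′ → z* ∉ trace z₂ h s (suc (toℕ p)) [] × walk z₂ h s (suc (toℕ p)) ≡ i →
           z* ∉ trace z₂ h s (suc (toℕ p′)) [] × walk z₂ h s (suc (toℕ p′)) ≡ i → p ≡ p′
    uniq p p′ (n , u) (n′ , u′) = toℕ-injective (suc-injective
      (first-visit z₂ h s [] n n′ (trans (cong z₂ u) e) (trans (cong z₂ u′) e)))

  -- A walk of the second run reaches its target by a query that is new, in front of any factor A that is settled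
  -- by the first run.
  module _ (A : HashFun M N → ℕ) (A-stable : ∀ h x y → x ∉ queried h → A (h [ x ]≔ y) ≡ A h) where

    fresh-arrival : ∀ (s i : Fin N) (p : ℕ) (t j : Fin N) (q : ℕ) →
      N * ∑ Hs (λ h → A h * 𝟙 (hit? z₂ z* s p i t q j h ×-dec ¬known? t q h))
      ≤ ∑ Hs (λ h → A h * 𝟙 (¬? (z* ∈ᴹ trace z₂ h s (suc p) []) ×-dec (walk z₂ h s (suc p) Fin.≟ i)))
    fresh-arrival s i p t j q = ≤-trans
      (arrival-≤ z₂ z* queried A A-stable t q j G? (λ h → hit? z₂ z* s p i t q j h ×-dec ¬known? t q h)
        (λ { _ ((c , u , v) , n) → (c , u , n) , v }) ok)
      (∑-mono Hs (λ h → *-monoʳ-≤ (A h) (𝟙-mono (G? h) (¬? (z* ∈ᴹ trace z₂ h s (suc p) []) ×-dec (walk z₂ h s (suc p) Fin.≟ i))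
        (λ { (((_ , n) , _) , u , _) → n , u }))))
      where
      G : HashFun M N → Set
      G h = Clean z₂ z* s p t q h × walk z₂ h s (suc p) ≡ i × z₂ (walk z₂ h t q) ∉ queried h

      G? : Decidable G
      G? h = clean? z₂ z* s p t q h ×-dec (walk z₂ h s (suc p) Fin.≟ i) ×-dec ¬known? t q h

      ok : ∀ h → G h → _ × _ × _
      ok h (c@(_ , ((n , _) , _) , w) , u , k) = k , n , λ y → clean-update z₂ z* h y c ,
        trans (walk-update z₂ h _ y s {suc p} [] (λ l → w _ l (here refl)) ≤-refl) u ,
        subst₂ _∉_ (cong z₂ (sym (walk-update z₂ h _ y t [] n ≤-refl))) (sym (queried-update h _ y k)) k

    fresh-arrivals : ∀ p q →
      N * (N * ∑ Hs (λ h → A h * 𝟙 (hit? z₂ z* s₂ p i₂ t₂ q j₂ h ×-dec ¬known? s₂ p h ×-dec ¬known? t₂ q h)))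
      ≤ ∑ Hs A
    fresh-arrivals p q = begin
      N * (N * ∑ Hs (λ h → A h * 𝟙 (both? h)))
        ≤⟨ *-monoʳ-≤ N (arrival-≤ z₂ z* queried A A-stable t₂ q j₂ G? both? (λ { _ ((c , u , v) , n , n′) → (c , u , n , n′) , v }) ok) ⟩
      N * ∑ Hs (λ h → A h * 𝟙 (G? h))
        ≤⟨ arrival-≤ z₂ z* queried A A-stable s₂ p i₂ G′? G? (λ { _ (((f , _) , _) , u , n , _) → (f , n) , u }) ok′ ⟩
      ∑ Hs (λ h → A h * 𝟙 (G′? h))
        ≤⟨ ∑-mono Hs (λ h → ≤-≡ (*-monoʳ-≤ (A h) (𝟙≤1 (G′? h))) (*-identityʳ _)) ⟩
      ∑ Hs A ∎
      where
      both? : Decidable (λ h → Hit z₂ z* s₂ p i₂ t₂ q j₂ h × z₂ (walk z₂ h s₂ p) ∉ queried h × z₂ (walk z₂ h t₂ q) ∉ queried h)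
      both? h = hit? z₂ z* s₂ p i₂ t₂ q j₂ h ×-dec ¬known? s₂ p h ×-dec ¬known? t₂ q h

      G G′ : HashFun M N → Set
      G h = Clean z₂ z* s₂ p t₂ q h × walk z₂ h s₂ (suc p) ≡ i₂
          × z₂ (walk z₂ h s₂ p) ∉ queried h × z₂ (walk z₂ h t₂ q) ∉ queried h
      G′ h = Fresh (trace z₂ h s₂ (suc p) []) × z₂ (walk z₂ h s₂ p) ∉ queried h

      G? : Decidable G
      G? h = clean? z₂ z* s₂ p t₂ q h ×-dec (walk z₂ h s₂ (suc p) Fin.≟ i₂) ×-dec ¬known? s₂ p h ×-dec ¬known? t₂ q h

      G′? : Decidable G′
      G′? h = fresh? _ ×-dec ¬known? s₂ p h

      ok : ∀ h → G h → _ × _ × _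
      ok h (c@(_ , ((n , _) , _) , w) , u , k′ , k) = k , n , λ y → clean-update z₂ z* h y c ,
        trans (walk-update z₂ h _ y s₂ {suc p} [] x∉ ≤-refl) u ,
        subst₂ _∉_ (cong z₂ (sym (walk-update z₂ h _ y s₂ {suc p} [] x∉ (n≤1+n p)))) (sym (queried-update h _ y k)) k′ ,
        subst₂ _∉_ (cong z₂ (sym (walk-update z₂ h _ y t₂ [] n ≤-refl))) (sym (queried-update h _ y k)) k
        where
        x∉ : z₂ (walk z₂ h t₂ q) ∉ trace z₂ h s₂ (suc p) []
        x∉ l = w _ l (here refl)

      ok′ : ∀ h → G′ h → _ × _ × _
      ok′ h (f@(n , _) , k) = k , n , λ y →
        subst Fresh (sym (trace-same z₂ h _ y s₂ {p} n refl ≤-refl)) f ,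
        subst₂ _∉_ (cong z₂ (sym (walk-update z₂ h _ y s₂ [] n ≤-refl))) (sym (queried-update h _ y k)) k

  private
    Rs = allFin r

    i∈ j∈ : HashFun M N → ℕ
    i∈ h = 𝟙 (i₂ ∈ᴺ reached h)
    j∈ h = 𝟙 (j₂ ∈ᴺ reached h)

    i∈-stable : ∀ h x y → x ∉ queried h → i∈ (h [ x ]≔ y) ≡ i∈ h
    i∈-stable h x y n = cong (λ vs → 𝟙 (i₂ ∈ᴺ vs)) (reached-update h x y n)

    j∈-stable : ∀ h x y → x ∉ queried h → j∈ (h [ x ]≔ y) ≡ j∈ h
    j∈-stable h x y n = cong (λ vs → 𝟙 (j₂ ∈ᴺ vs)) (reached-update h x y n)

    both? : ∀ p q h → Dec _
    both? p q h = hit? z₂ z* s₂ p i₂ t₂ q j₂ h ×-dec ¬known? s₂ p h ×-dec ¬known? t₂ q h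

    new-t? : ∀ p q h → Dec _
    new-t? p q h = hit? z₂ z* s₂ p i₂ t₂ q j₂ h ×-dec ¬known? t₂ q h

    new-s? : ∀ p q h → Dec _
    new-s? p q h = hit? z₂ z* t₂ q j₂ s₂ p i₂ h ×-dec ¬known? s₂ p h

  T₀ T₁ T₂ T₃ : Fin r → Fin r → HashFun M N → ℕ
  T₀ p q h = first h * 𝟙 (both? (toℕ p) (toℕ q) h)
  T₁ p q h = first h * i∈ h * 𝟙 (new-t? (toℕ p) (toℕ q) h)
  T₂ p q h = first h * j∈ h * 𝟙 (new-s? (toℕ p) (toℕ q) h)
  T₃ p q h = first h * i∈ h * j∈ h * second p q h

  -- The cases distinguish which of the two decisive queries of the second run were already made by
  -- the first one. A known query leads to a vertex that the first run has reached; this is the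
  -- source of the factors `i∈` and `j∈`.
  split : ∀ h p q → first h * second p q h ≤ T₀ p q h + T₁ p q h + T₂ p q h + T₃ p q h
  split h p q = ≡-≤ (*-comm (first h) _) (𝟙*≤ (hit? z₂ z* s₂ (toℕ p) i₂ t₂ (toℕ q) j₂ h)
    (λ hit → cases hit (z₂ (walk z₂ h s₂ (toℕ p)) ∈ᴹ queried h) (z₂ (walk z₂ h t₂ (toℕ q)) ∈ᴹ queried h)))
    where
    P = toℕ p
    Q = toℕ q
    u₀ = T₀ p q h
    u₁ = T₁ p q h
    u₂ = T₂ p q h
    u₃ = T₃ p q h

    keep : ∀ {n} {X : Set} (X? : Dec X) → X → first h ≤ n → first h ≤ n * 𝟙 X?
    keep {n} X? x le = ≤-≡ le (trans (sym (*-identityʳ n)) (cong (n *_) (sym (𝟙-yes X? x))))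

    cases : Hit z₂ z* s₂ P i₂ t₂ Q j₂ h → Dec (z₂ (walk z₂ h s₂ P) ∈ queried h) →
            Dec (z₂ (walk z₂ h t₂ Q) ∈ queried h) → first h ≤ T₀ p q h + T₁ p q h + T₂ p q h + T₃ p q h
    cases hit@(c , u , v) (no n) (no n′) = ≤-trans (keep (both? P Q h) (hit , n , n′) ≤-refl)
                            (≤-trans (m≤m+n u₀ u₁) (≤-trans (m≤m+n (u₀ + u₁) u₂) (m≤m+n (u₀ + u₁ + u₂) u₃)))
    cases hit@(c , u , v) (yes k) (no n) = ≤-trans (keep (new-t? P Q h) (hit , n) (keep (i₂ ∈ᴺ reached h) (subst (_∈ reached h) u (known h k)) ≤-refl))
                            (≤-trans (m≤n+m u₁ u₀) (≤-trans (m≤m+n (u₀ + u₁) u₂) (m≤m+n (u₀ + u₁ + u₂) u₃)))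
    cases hit@(c , u , v) (no n) (yes l) = ≤-trans (keep (new-s? P Q h) ((clean-sym z₂ z* c , v , u) , n)
                              (keep (j₂ ∈ᴺ reached h) (subst (_∈ reached h) v (known h l)) ≤-refl))
                            (≤-trans (m≤n+m u₂ (u₀ + u₁)) (m≤m+n (u₀ + u₁ + u₂) u₃))
    cases hit@(c , u , v) (yes k) (yes l) = ≤-trans (keep (hit? z₂ z* s₂ P i₂ t₂ Q j₂ h) hit (keep (j₂ ∈ᴺ reached h) (subst (_∈ reached h) v (known h l))
                              (keep (i₂ ∈ᴺ reached h) (subst (_∈ reached h) u (known h k)) ≤-refl))) (m≤n+m u₃ (u₀ + u₁ + u₂))

  F Kᵢ Kⱼ Kᵢⱼ : ℕ
  F   = ∑ Hs first
  Kᵢ  = ∑ Hs (λ h → first h * i∈ h)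
  Kⱼ  = ∑ Hs (λ h → first h * j∈ h)
  Kᵢⱼ = ∑ Hs (λ h → first h * i∈ h * j∈ h)

  private
    length-Rs : length Rs ≡ r
    length-Rs = length-allFin r

    ∑∑-const≤ : ∀ (f : Fin r → Fin r → ℕ) {c} → (∀ p q → f p q ≤ c) → ∑ Rs (λ p → ∑ Rs (f p)) ≤ r * (r * c)
    ∑∑-const≤ f {c} le = ≤-≡ (∑-bound Rs _ (λ p → ∑-bound Rs (f p) (le p)))
      (cong₂ (λ a b → a * (b * c)) length-Rs length-Rs)

    at-first? : (s i : Fin N) (h : HashFun M N) (p : Fin r) →
                Dec (z* ∉ trace z₂ h s (suc (toℕ p)) [] × walk z₂ h s (suc (toℕ p)) ≡ i)
    at-first? s i h p = ¬? (z* ∈ᴹ trace z₂ h s (suc (toℕ p)) []) ×-dec (walk z₂ h s (suc (toℕ p)) Fin.≟ i)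

    at-first : (s i : Fin N) → HashFun M N → Fin r → ℕ
    at-first s i h p = 𝟙 (at-first? s i h p)

  both-new : N * (N * ∑ Rs (λ p → ∑ Rs (λ q → ∑ Hs (λ h → first h * 𝟙 (both? (toℕ p) (toℕ q) h))))) ≤ r * (r * F)
  both-new = ≡-≤ (trans (cong (N *_) (sym (trans (∑-cong Rs (λ p → ∑-*ˡ Rs N _)) (∑-*ˡ Rs N _))))
                                         (sym (trans (∑-cong Rs (λ p → ∑-*ˡ Rs N _)) (∑-*ˡ Rs N _))))
    (∑∑-const≤ _ (λ p q → fresh-arrivals first first-update (toℕ p) (toℕ q)))

  -- One walk arrives by a new query, for each of r lengths; the length of the other one is then determined.
  one-new : (A : HashFun M N → ℕ) → (∀ h x y → x ∉ queried h → A (h [ x ]≔ y) ≡ A h) →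
    ∀ s i → z₂ i ≡ z* → ∀ t j →
    N * ∑ Rs (λ q → ∑ Rs (λ p → ∑ Hs (λ h → A h * 𝟙 (hit? z₂ z* s (toℕ p) i t (toℕ q) j h ×-dec ¬known? t (toℕ q) h))))
    ≤ r * ∑ Hs A
  one-new A A-stable s i e t j = begin
    N * ∑ Rs (λ q → ∑ Rs (λ p → ∑ Hs (f q p)))
      ≡⟨ trans (∑-cong Rs (λ q → ∑-*ˡ Rs N _)) (∑-*ˡ Rs N _) ⟨
    ∑ Rs (λ q → ∑ Rs (λ p → N * ∑ Hs (f q p)))
      ≤⟨ ∑-mono Rs (λ q → ∑-mono Rs (λ p → fresh-arrival A A-stable s i (toℕ p) t j (toℕ q))) ⟩
    ∑ Rs (λ q → ∑ Rs (λ p → ∑ Hs (λ h → A h * at-first s i h p)))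
      ≤⟨ ∑-bound Rs _ (λ q → ≡-≤ (trans (∑-swap Rs Hs _) (∑-cong Hs (λ h → ∑-*ˡ Rs (A h) _)))
           (∑-mono Hs (λ h → ≤-≡ (*-monoʳ-≤ (A h) (first-time s i e h)) (*-identityʳ _)))) ⟩
    length Rs * ∑ Hs A
      ≡⟨ cong (_* ∑ Hs A) length-Rs ⟩
    r * ∑ Hs A ∎
    where
    f : Fin r → Fin r → HashFun M N → ℕ
    f q p h = A h * 𝟙 (hit? z₂ z* s (toℕ p) i t (toℕ q) j h ×-dec ¬known? t (toℕ q) h)

  -- Nothing can be resampled here, but the first visit of z* determines both lengths, so at most
  -- one pair of lengths counts.
  none-new : ∑ Rs (λ p → ∑ Rs (λ q → ∑ Hs (λ h → first h * i∈ h * j∈ h * second p q h))) ≤ Kᵢⱼ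
  none-new = begin
    ∑ Rs (λ p → ∑ Rs (λ q → ∑ Hs (λ h → A h * second p q h)))
      ≡⟨ trans (∑-cong Rs (λ p → ∑-swap Rs Hs _)) (∑-swap Rs Hs _) ⟩
    ∑ Hs (λ h → ∑ Rs (λ p → ∑ Rs (λ q → A h * second p q h)))
      ≡⟨ ∑-cong Hs (λ h → trans (∑-cong Rs (λ p → ∑-*ˡ Rs (A h) _)) (∑-*ˡ Rs (A h) _)) ⟩
    ∑ Hs (λ h → A h * ∑ Rs (λ p → ∑ Rs (λ q → second p q h)))
      ≤⟨ ∑-mono Hs (λ h → ≤-≡ (*-monoʳ-≤ (A h) (once h)) (*-identityʳ _)) ⟩
    ∑ Hs A ∎
    where
    A : HashFun M N → ℕ
    A h = first h * i∈ h * j∈ h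

    once : ∀ h → ∑ Rs (λ p → ∑ Rs (λ q → second p q h)) ≤ 1
    once h = begin
      ∑ Rs (λ p → ∑ Rs (λ q → second p q h))
        ≤⟨ ∑-mono Rs (λ p → ∑-mono Rs (λ q → ≤-trans
             (𝟙-mono (hit? z₂ z* s₂ (toℕ p) i₂ t₂ (toℕ q) j₂ h) (at-first? s₂ i₂ h p ×-dec at-first? t₂ j₂ h q)
               (λ { (((_ , n) , (_ , n′) , _) , u , v) → (n , u) , n′ , v }))
             (≤-reflexive (𝟙-× (at-first? s₂ i₂ h p) (at-first? t₂ j₂ h q))))) ⟩
      ∑ Rs (λ p → ∑ Rs (λ q → at-first s₂ i₂ h p * at-first t₂ j₂ h q))
        ≡⟨ ∑-*-∑ Rs Rs _ _ ⟩
      ∑ Rs (at-first s₂ i₂ h) * ∑ Rs (at-first t₂ j₂ h)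
        ≤⟨ *-mono-≤ (first-time s₂ i₂ z₂-i₂ h) (first-time t₂ j₂ z₂-j₂ h) ⟩
      1 ∎

  -- The four cases recombine into a product with one factor for each target: r possible times of a
  -- new query, or one known query, which spares the factor 1 / N. The product form allows averaging
  -- over the two shifts of the second run separately.
  both-hit : N * (N * ∑ (cartesianProduct Rs Rs) (λ { (p , q) → ∑ Hs (λ h → first h * second p q h) }))
             ≤ ∑ Hs (λ h → first h * ((r + N * i∈ h) * (r + N * j∈ h)))
  both-hit = begin
    N * (N * ∑ (cartesianProduct Rs Rs) (λ { (p , q) → ∑ Hs (λ h → first h * second p q h) }))
      ≡⟨ cong (λ s → N * (N * s)) (∑-× Rs Rs _) ⟩
    N * (N * S (λ p q h → first h * second p q h))
      ≤⟨ *-monoʳ-≤ N (*-monoʳ-≤ N (∑-mono Rs (λ p → ∑-mono Rs (λ q → ∑-mono Hs (λ h → split h p q))))) ⟩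
    N * (N * S (λ p q h → T₀ p q h + T₁ p q h + T₂ p q h + T₃ p q h))
      ≡⟨ cong (λ s → N * (N * s)) (trans (S-+ _ T₃) (cong (_+ S T₃) (trans (S-+ _ T₂) (cong (_+ S T₂) (S-+ T₀ T₁))))) ⟩
    N * (N * (S T₀ + S T₁ + S T₂ + S T₃))
      ≡⟨ dist N (S T₀) (S T₁) (S T₂) (S T₃) ⟩
    N * (N * S T₀) + N * (N * S T₁) + N * (N * S T₂) + N * (N * S T₃)
      ≤⟨ +-mono-≤ (+-mono-≤ (+-mono-≤ both-new (*-monoʳ-≤ N new-t)) (*-monoʳ-≤ N new-s)) (*-monoʳ-≤ N (*-monoʳ-≤ N none-new)) ⟩
    r * (r * F) + N * (r * Kᵢ) + N * (r * Kⱼ) + N * (N * Kᵢⱼ)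
      ≡⟨ cong₂ _+_ (cong₂ _+_ (cong₂ _+_ (in₂ r r first) (in₂ N r _)) (in₂ N r _)) (in₂ N N _) ⟩
    ∑ Hs (λ h → r * (r * first h)) + ∑ Hs (λ h → N * (r * (first h * i∈ h))) + ∑ Hs (λ h → N * (r * (first h * j∈ h)))
      + ∑ Hs (λ h → N * (N * (first h * i∈ h * j∈ h)))
      ≡⟨ trans (cong (_+ ∑ Hs (λ h → N * (N * (first h * i∈ h * j∈ h)))) (trans (cong (_+ ∑ Hs (λ h → N * (r * (first h * j∈ h))))
           (sym (∑-+ Hs _ _))) (sym (∑-+ Hs _ _)))) (sym (∑-+ Hs _ _)) ⟩
    ∑ Hs (λ h → r * (r * first h) + N * (r * (first h * i∈ h)) + N * (r * (first h * j∈ h)) + N * (N * (first h * i∈ h * j∈ h)))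
      ≡⟨ ∑-cong Hs (λ h → product N r (first h) (i∈ h) (j∈ h)) ⟩
    ∑ Hs (λ h → first h * ((r + N * i∈ h) * (r + N * j∈ h))) ∎
    where
    S : (Fin r → Fin r → HashFun M N → ℕ) → ℕ
    S f = ∑ Rs (λ p → ∑ Rs (λ q → ∑ Hs (f p q)))

    S-+ : ∀ f g → S (λ p q h → f p q h + g p q h) ≡ S f + S g
    S-+ f g = trans (∑-cong Rs (λ p → trans (∑-cong Rs (λ q → ∑-+ Hs _ _)) (∑-+ Rs _ _))) (∑-+ Rs _ _)

    in₂ : ∀ a b f → a * (b * ∑ Hs f) ≡ ∑ Hs (λ h → a * (b * f h))
    in₂ a b f = trans (cong (a *_) (sym (∑-*ˡ Hs b f))) (sym (∑-*ˡ Hs a _))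

    product : ∀ n r f i j → r * (r * f) + n * (r * (f * i)) + n * (r * (f * j)) + n * (n * (f * i * j)) ≡ f * ((r + n * i) * (r + n * j))
    product = solve-∀

    dist : ∀ n a b c d → n * (n * (a + b + c + d)) ≡ n * (n * a) + n * (n * b) + n * (n * c) + n * (n * d)
    dist = solve-∀

    new-t : N * S T₁ ≤ r * Kᵢ
    new-t = ≡-≤ (cong (N *_) (∑-swap Rs Rs (λ p q → ∑ Hs (T₁ p q))))
      (one-new (λ h → first h * i∈ h) (λ h x y n → cong₂ _*_ (first-update h x y n) (i∈-stable h x y n)) s₂ i₂ z₂-i₂ t₂ j₂)

    new-s : N * S T₂ ≤ r * Kⱼ
    new-s = one-new (λ h → first h * j∈ h) (λ h x y n → cong₂ _*_ (first-update h x y n) (j∈-stable h x y n)) t₂ j₂ z₂-j₂ s₂ i₂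

-- One run of the algorithm

∑-factor : {A B : Set} (xs : List A) (ys : List B) (a : A → ℕ) (f : A → B → ℕ) →
           ∑ xs (λ x → a x * ∑ ys (f x)) ≡ ∑ ys (λ y → ∑ xs (λ x → a x * f x y))
∑-factor xs ys a f = trans (∑-cong xs (λ x → sym (∑-*ˡ ys (a x) (f x)))) (∑-swap xs ys _)

∑-*-× : {A B : Set} (xs : List A) (ys : List B) (f : A → ℕ) (g : B → ℕ) →
        ∑ (cartesianProduct xs ys) (λ { (x , y) → f x * g y }) ≡ ∑ xs f * ∑ ys g
∑-*-× xs ys f g = trans (∑-× xs ys _) (∑-*-∑ xs ys f g)

length-× : {A B : Set} (xs : List A) (ys : List B) → length (cartesianProduct xs ys) ≡ length xs * length ys
length-× []       ys = refl
length-× (x ∷ xs) ys = trans (length-++ (map (x ,_) ys)) (cong₂ _+_ (length-map (x ,_) ys) (length-× xs ys))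

-- The absence of repetitions, expressed through sums so that it passes to cartesian products.
AtMostOne : {A : Set} → List A → Set
AtMostOne {A} xs = ∀ (f : A → ℕ) → (∀ x → f x ≤ 1) → (∀ x y → f x ≢ 0 → f y ≢ 0 → x ≡ y) → ∑ xs f ≤ 1

∑≢0 : {A : Set} (xs : List A) (f : A → ℕ) → ∑ xs f ≢ 0 → ∃[ x ] f x ≢ 0
∑≢0 []       f nz = contradiction refl nz
∑≢0 (x ∷ xs) f nz with f x ≟ 0
... | no fx≢0 = x , fx≢0
... | yes e   = ∑≢0 xs f (λ e′ → nz (cong₂ _+_ e e′))

atMostOne-× : {A B : Set} (xs : List A) (ys : List B) → AtMostOne xs → AtMostOne ys → AtMostOne (cartesianProduct xs ys)
atMostOne-× xs ys hx hy f f≤1 uniq = ≡-≤ (∑-× xs ys f) (hx (λ x → ∑ ys (λ y → f (x , y)))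
  (λ x → hy (λ y → f (x , y)) (λ y → f≤1 (x , y)) (λ y y′ u v → cong proj₂ (uniq _ _ u v)))
  (λ x x′ u v → cong proj₁ (uniq _ _ (proj₂ (∑≢0 ys (λ y → f (x , y)) u)) (proj₂ (∑≢0 ys (λ y → f (x′ , y)) v)))))

∑-fibres : ∀ {n m} (z : Fin n → Fin m) (g : Fin m → ℕ) →
           ∑ (allFin n) (g ∘ z) ≡ ∑ (allFin m) (λ x → ∑ (allFin n) (λ v → 𝟙 (z v Fin.≟ x)) * g x)
∑-fibres {n} {m} z g = begin-equality
  ∑ (allFin n) (g ∘ z)
    ≡⟨ ∑-cong (allFin n) (λ v → ∑-δ (z v) g) ⟨
  ∑ (allFin n) (λ v → ∑ (allFin m) (λ x → 𝟙 (x Fin.≟ z v) * g x))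
    ≡⟨ ∑-swap (allFin n) (allFin m) _ ⟩
  ∑ (allFin m) (λ x → ∑ (allFin n) (λ v → 𝟙 (x Fin.≟ z v) * g x))
    ≡⟨ ∑-cong (allFin m) (λ x → trans (∑-*ʳ (allFin n) (g x) _) (cong (_* g x) (∑-cong (allFin n)
         (λ v → 𝟙-cong (x Fin.≟ z v) (z v Fin.≟ x) sym sym)))) ⟩
  ∑ (allFin m) (λ x → ∑ (allFin n) (λ v → 𝟙 (z v Fin.≟ x)) * g x) ∎

∑-square : {A B : Set} (xs : List A) (ys : List B) (f : A → B → ℕ) (k W : ℕ) →
           (∀ y y′ → k * ∑ xs (λ x → f x y * f x y′) ≤ W) →
           k * ∑ xs (λ x → ∑ ys (f x) * ∑ ys (f x)) ≤ length ys * (length ys * W)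
∑-square xs ys f k W le = begin
  k * ∑ xs (λ x → ∑ ys (f x) * ∑ ys (f x))
    ≡⟨ cong (k *_) (∑-cong xs (λ x → ∑-*-∑ ys ys (f x) (f x))) ⟨
  k * ∑ xs (λ x → ∑ ys (λ y → ∑ ys (λ y′ → f x y * f x y′)))
    ≡⟨ cong (k *_) (trans (∑-swap xs ys _) (∑-cong ys (λ y → ∑-swap xs ys _))) ⟩
  k * ∑ ys (λ y → ∑ ys (λ y′ → ∑ xs (λ x → f x y * f x y′)))
    ≡⟨ trans (sym (∑-*ˡ ys k _)) (∑-cong ys (λ y → sym (∑-*ˡ ys k _))) ⟩
  ∑ ys (λ y → ∑ ys (λ y′ → k * ∑ xs (λ x → f x y * f x y′)))
    ≤⟨ ∑-bound ys _ (λ y → ∑-bound ys _ (le y)) ⟩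
  length ys * (length ys * W) ∎

square-sum : ∀ a b → (a + b) * (a + b) ≤ 2 * (a * a + b * b)
square-sum a b = ≡-≤ (expand a b) (≤-≡ (+-monoʳ-≤ (a * a + b * b) cross) (double a b))
  where
  2ab : ∀ a b → a ≤ b → 2 * (a * b) ≤ a * a + b * b
  2ab a b a≤b with b ∸ a | m+[n∸m]≡n a≤b
  ... | d | refl = ≤-≡ (m≤m+n _ (d * d)) (expand a d)
    where
    expand : ∀ a d → 2 * (a * (a + d)) + d * d ≡ a * a + (a + d) * (a + d)
    expand = solve-∀
  expand : ∀ a b → (a + b) * (a + b) ≡ a * a + b * b + 2 * (a * b)
  expand = solve-∀
  double : ∀ a b → a * a + b * b + (a * a + b * b) ≡ 2 * (a * a + b * b)
  double = solve-∀
  cross : 2 * (a * b) ≤ a * a + b * b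
  cross with ≤-total a b
  ... | inj₁ le = 2ab a b le
  ... | inj₂ le = ≡-≤ (cong (2 *_) (*-comm a b))
                    (≤-≡ (2ab b a le) (+-comm (b * b) (a * a)))

-- Residues

module _ {n : ℕ} .{{_ : NonZero n}} where

  %-+ : ∀ {a b} c → a % n ≡ b % n → (a + c) % n ≡ (b + c) % n
  %-+ {a} {b} c e = trans (%-distribˡ-+ a c n) (trans (cong (λ x → (x + c % n) % n) e) (sym (%-distribˡ-+ b c n)))

  %-cancel : ∀ {a b} c → (a + c) % n ≡ (b + c) % n → a % n ≡ b % n
  %-cancel {a} {b} c e = trans (sym (restore a)) (trans (%-+ (c * (n ∸ 1)) e) (restore b))
    where
    -- Adding c · (n - 1) completes c to a multiple of n and so replaces a subtraction.
    restore : ∀ x → (x + c + c * (n ∸ 1)) % n ≡ x % n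
    restore x = trans (cong (_% n) (trans (+-assoc x c _) (cong (x +_) (trans (sym (*-suc c (n ∸ 1)))
      (cong (c *_) (m+[n∸m]≡n (>-nonZero⁻¹ n))))))) ([m+kn]%n≡m%n x c n)

  %-injective : ∀ {a b} c → a < n → b < n → (a + c) % n ≡ (b + c) % n → a ≡ b
  %-injective c a<n b<n e = trans (sym (m<n⇒m%n≡m a<n)) (trans (%-cancel c e) (m<n⇒m%n≡m b<n))

∑-allFin-+ : ∀ a b (g : ℕ → ℕ) → ∑ (allFin (a + b)) (g ∘ toℕ) ≡ ∑ (allFin a) (g ∘ toℕ) + ∑ (allFin b) (λ x → g (a + toℕ x))
∑-allFin-+ zero    b g = refl
∑-allFin-+ (suc a) b g = trans (∑-allFin-suc (a + b) (g ∘ toℕ)) (trans (cong (g 0 +_) (∑-allFin-+ a b (g ∘ suc)))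
  (trans (sym (+-assoc (g 0) _ _)) (cong (_+ ∑ (allFin b) (λ x → g (suc a + toℕ x))) (sym (∑-allFin-suc a (g ∘ toℕ))))))

∑-allFin-mono : ∀ {a b} (g : ℕ → ℕ) → a ≤ b → ∑ (allFin a) (g ∘ toℕ) ≤ ∑ (allFin b) (g ∘ toℕ)
∑-allFin-mono {a} {b} g a≤b = subst (λ b → ∑ (allFin a) (g ∘ toℕ) ≤ ∑ (allFin b) (g ∘ toℕ)) (m+[n∸m]≡n a≤b)
  (≤-≡ (m≤m+n _ _) (sym (∑-allFin-+ a (b ∸ a) g)))

module Periodic (n : ℕ) .{{_ : NonZero n}} (g : ℕ → ℕ) (periodic : ∀ x → g (n + x) ≡ g x) (q : ℕ) where

  period total : ℕ
  period = ∑ (allFin n) (g ∘ toℕ)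
  total = ∑ (allFin q) (g ∘ toℕ)

  ∑-periods : ∀ a b → ∑ (allFin (a * n + b)) (g ∘ toℕ) ≡ a * period + ∑ (allFin b) (g ∘ toℕ)
  ∑-periods zero    b = refl
  ∑-periods (suc a) b = trans (cong (λ l → ∑ (allFin l) (g ∘ toℕ)) (+-assoc n (a * n) b))
    (trans (∑-allFin-+ n (a * n + b) g) (trans (cong (period +_) (trans (∑-cong (allFin (a * n + b)) (λ x → periodic (toℕ x))) (∑-periods a b)))
      (sym (+-assoc period (a * period) _))))

  total≡ : total ≡ q / n * period + ∑ (allFin (q % n)) (g ∘ toℕ)
  total≡ = trans (cong (λ l → ∑ (allFin l) (g ∘ toℕ)) (trans (m≡m%n+[m/n]*n q n) (+-comm (q % n) _))) (∑-periods (q / n) (q % n))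

  total≤ : total ≤ suc (q / n) * period
  total≤ = ≡-≤ total≡ (≤-≡ (+-monoʳ-≤ (q / n * period) (∑-allFin-mono g (<⇒≤ (m%n<n q n))))
    (+-comm (q / n * period) period))

  total≥ : q / n * period ≤ total
  total≥ = ≤-≡ (m≤m+n _ _) (sym total≡)

  -- The hypothesis n ≤ q absorbs the incomplete last period. Together with `lower` it shows that a
  -- random word reduced modulo n is uniform up to a factor 2.
  upper : n ≤ q → n * total ≤ 2 * q * period
  upper n≤q = begin
    n * total ≤⟨ *-monoʳ-≤ n total≤ ⟩
    n * (suc (q / n) * period) ≡⟨ shift n (q / n) period ⟩
    (n + q / n * n) * period ≤⟨ *-monoˡ-≤ period (+-mono-≤ n≤q (m/n*n≤m q n)) ⟩
    (q + q) * period ≡⟨ cong (_* period) (cong (q +_) (sym (+-identityʳ q))) ⟩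
    2 * q * period ∎
    where
    shift : ∀ n a p → n * (suc a * p) ≡ (n + a * n) * p
    shift = solve-∀

  lower : n ≤ q → q * period ≤ 2 * n * total
  lower n≤q = begin
    q * period ≡⟨ cong (_* period) (m≡m%n+[m/n]*n q n) ⟩
    (q % n + q / n * n) * period ≤⟨ *-monoˡ-≤ period (+-monoˡ-≤ (q / n * n) (<⇒≤ (m%n<n q n))) ⟩
    (n + q / n * n) * period ≤⟨ *-monoˡ-≤ period (+-monoˡ-≤ (q / n * n) (m≤n*m n (q / n) {{>-nonZero (m≥n⇒m/n>0 n≤q)}})) ⟩
    (q / n * n + q / n * n) * period ≡⟨ shift n (q / n) period ⟩
    2 * n * (q / n * period) ≤⟨ *-monoʳ-≤ (2 * n) total≥ ⟩
    2 * n * total ∎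
    where
    shift : ∀ n a p → (a * n + a * n) * p ≡ 2 * n * (a * p)
    shift = solve-∀

residue : (N : ℕ) .{{_ : NonZero N}} → ℕ → Fin N
residue N x = fromℕ< (m%n<n x N)

module _ {N : ℕ} .{{_ : NonZero N}} (f : Fin N → ℕ) {q : ℕ} (N≤q : N ≤ q) where

  private
    g : ℕ → ℕ
    g x = f (residue N x)

    periodic : ∀ x → g (N + x) ≡ g x
    periodic x = cong f (toℕ-injective (trans (toℕ-fromℕ< _) (trans ([m+n]%m≡n%m x) (sym (toℕ-fromℕ< _)))))
      where
      [m+n]%m≡n%m : ∀ x → (N + x) % N ≡ x % N
      [m+n]%m≡n%m x = trans (cong (_% N) (+-comm N x)) ([m+n]%n≡m%n x N)

    period≡ : ∑ (allFin N) (g ∘ toℕ) ≡ ∑ (allFin N) f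
    period≡ = ∑-cong (allFin N) (λ v → cong f (toℕ-injective (trans (toℕ-fromℕ< _) (m<n⇒m%n≡m (toℕ<n v)))))

  residue-upper : N * ∑ (allFin q) (λ u → f (residue N (toℕ u))) ≤ 2 * q * ∑ (allFin N) f
  residue-upper = subst (λ s → N * ∑ (allFin q) (g ∘ toℕ) ≤ 2 * q * s) period≡ (Periodic.upper N g periodic q N≤q)

  residue-lower : q * ∑ (allFin N) f ≤ 2 * N * ∑ (allFin q) (λ u → f (residue N (toℕ u)))
  residue-lower = subst (λ s → q * s ≤ 2 * N * ∑ (allFin q) (g ∘ toℕ)) period≡ (Periodic.lower N g periodic q N≤q)

cell-count : ∀ N cells .{{_ : NonZero cells}} κ → ∑ (allFin N) (λ y → 𝟙 (value y % cells ≟ κ)) ≤ suc (N / cells)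
cell-count N cells κ = ≤-trans (Periodic.total≤ cells g periodic N) (≤-≡ (*-monoʳ-≤ (suc (N / cells)) one) (*-identityʳ _))
  where
  g : ℕ → ℕ
  g x = 𝟙 (suc x % cells ≟ κ)
  periodic : ∀ x → g (cells + x) ≡ g x
  periodic x = cong (λ y → 𝟙 (y ≟ κ)) (trans (cong (_% cells) (trans (cong suc (+-comm cells x)) refl)) ([m+n]%n≡m%n (suc x) cells))
  one : ∑ (allFin cells) (g ∘ toℕ) ≤ 1
  one = ∑-unique (g ∘ toℕ) (λ x → 𝟙≤1 (suc (toℕ x) % cells ≟ κ)) (λ x y p q → toℕ-injective (%-injective 1 (toℕ<n x) (toℕ<n y)
    (trans (cong (_% cells) (+-comm (toℕ x) 1)) (trans (trans (𝟙-holds (value x % cells ≟ κ) p) (sym (𝟙-holds (value y % cells ≟ κ) q)))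
      (cong (_% cells) (+-comm 1 (toℕ y)))))))

square-≤ : ∀ {x y} → x * x ≤ y * y → x ≤ y
square-≤ {x} {y} le = ≮⇒≥ (λ y<x → <⇒≱ (*-mono-< y<x y<x) le)

abstract
  -- `C₀` is 256² · 32: collisions require 256 c ℓ γ ≤ N, where γ² ≤ 32 N and `C₀` cmax ℓ² ≤ N. The
  -- factor 8 in `C₁` ensures 4 `C₀` cmax ≤ N for large N, and thereby r ≥ 1.
  C₀ C₁ : ℕ
  C₀ = 2097152
  C₁ = 8 * C₀

  C₀≥ : 2097152 ≤ C₀
  C₀≥ = ≤-refl

  8C₀≤C₁ : 8 * C₀ ≤ C₁
  8C₀≤C₁ = ≤-refl

instance
  C₀≢0 : NonZero C₀
  C₀≢0 = >-nonZero (≤-trans (≤ᵇ⇒≤ 1 2097152 tt) C₀≥)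

  C₁≢0 : NonZero C₁
  C₁≢0 = >-nonZero (≤-trans (>-nonZero⁻¹ (8 * C₀) {{m*n≢0 8 C₀}}) 8C₀≤C₁)

abstract
  -- 4 k₁ (k₁ k₂) for the moment constants k₁ = 72 and k₂ = 144.
  loss : ℕ
  loss = 4 * 72 * (72 * 144)

  loss-def : 4 * 72 * (72 * 144) ≡ loss
  loss-def = refl

-- Independent repetitions

module Repeat {A Y : Set} (hs : List A) (ys : List Y) (X : A → Y → ℕ) (X≤1 : ∀ h y → X h y ≤ 1) where

  Hits : ∀ {R} → A → Vec Y R → Set
  Hits h v = ∃[ i ] X h (lookup v i) ≢ 0

  hits? : ∀ {R} h (v : Vec Y R) → Dec (Hits h v)
  hits? h v = any? (λ i → ¬? (X h (lookup v i) ≟ 0))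

  B : ℕ
  B = length ys

  p : A → ℕ
  p h = ∑ ys (X h)

  H : ℕ → A → ℕ
  H R h = ∑ (vectors ys R) (λ v → 𝟙 (hits? h v))

  -- Inclusion-exclusion for the first attempt and the rest, with the product moved to the left side
  -- to avoid subtraction.
  hits-∷ : ∀ {R} h y (v : Vec Y R) → 𝟙 (hits? h (y ∷ v)) + X h y * 𝟙 (hits? h v) ≡ X h y + 𝟙 (hits? h v)
  hits-∷ h y v = go (X h y) refl (X≤1 h y)
    where
    ys′ = 𝟙 (hits? h (y ∷ v))
    vs′ = 𝟙 (hits? h v)

    later : X h y ≡ 0 → Hits h (y ∷ v) → Hits h v
    later e (zero  , n) = contradiction e n
    later e (suc i , n) = i , n

    count : ∀ x → x ≤ 1 → X h y ≡ x → ys′ + x * vs′ ≡ x + vs′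
    count zero          _       e = trans (+-identityʳ _) (𝟙-cong (hits? h (y ∷ v)) (hits? h v) (later e) (λ { (i , n) → suc i , n }))
    count (suc zero)    _       e = cong₂ _+_ (𝟙-yes (hits? h (y ∷ v)) (zero , λ e′ → 1+n≢0 (trans (sym e) e′))) (+-identityʳ _)
    count (suc (suc _)) (s≤s ())

    go : ∀ x → X h y ≡ x → x ≤ 1 → ys′ + X h y * vs′ ≡ X h y + vs′
    go x e le = subst (λ x → ys′ + x * vs′ ≡ x + vs′) (sym e) (count x le e)

  recurrence : ∀ R h → H (suc R) h + p h * H R h ≡ p h * B ^ R + B * H R h
  recurrence R h = begin-equality
    H (suc R) h + p h * H R h
      ≡⟨ cong₂ _+_ (∑-vectors-suc ys R _) (sym (∑-*-∑ ys (vectors ys R) (X h) _)) ⟩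
    ∑ ys (λ y → ∑ (vectors ys R) (λ v → 𝟙 (hits? h (y ∷ v)))) + ∑ ys (λ y → ∑ (vectors ys R) (λ v → X h y * 𝟙 (hits? h v)))
      ≡⟨ trans (sym (∑-+ ys _ _)) (∑-cong ys (λ y → trans (sym (∑-+ (vectors ys R) _ _)) (∑-cong (vectors ys R) (hits-∷ h y)))) ⟩
    ∑ ys (λ y → ∑ (vectors ys R) (λ v → X h y + 𝟙 (hits? h v)))
      ≡⟨ ∑-cong ys (λ y → trans (∑-+ (vectors ys R) _ _) (cong (_+ H R h) (trans (∑-const (vectors ys R) (X h y))
           (trans (cong (_* X h y) (length-vectors ys R)) (*-comm (B ^ R) (X h y)))))) ⟩
    ∑ ys (λ y → X h y * B ^ R + H R h)
      ≡⟨ trans (∑-+ ys _ _) (cong₂ _+_ (∑-*ʳ ys (B ^ R) (X h)) (∑-const ys (H R h))) ⟩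
    p h * B ^ R + B * H R h ∎

  H-upper : ∀ R h → B * H R h ≤ R * p h * B ^ R
  H-upper zero    h = ≤-reflexive (trans (cong (B *_) (cong (_+ 0) (𝟙-no (hits? h []) (λ ())))) (*-zeroʳ B))
  H-upper (suc R) h = begin
    B * H (suc R) h ≤⟨ *-monoʳ-≤ B (≤-≡ (m≤m+n _ (p h * H R h)) (recurrence R h)) ⟩
    B * (p h * B ^ R + B * H R h) ≡⟨ cong (λ x → B * (p h * B ^ R + x)) refl ⟩
    B * (p h * B ^ R + B * H R h) ≤⟨ *-monoʳ-≤ B (+-monoʳ-≤ (p h * B ^ R) (H-upper R h)) ⟩
    B * (p h * B ^ R + R * p h * B ^ R) ≡⟨ rearrange B (p h) (B ^ R) R ⟩
    suc R * p h * B ^ suc R ∎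
    where
    rearrange : ∀ b p e r → b * (p * e + r * p * e) ≡ suc r * p * (b * e)
    rearrange = solve-∀

  -- The first two terms of inclusion-exclusion.
  H-lower : ∀ R h → 2 * R * p h * B * B ^ R ≤ 2 * B * B * H R h + R * R * (p h * p h) * B ^ R
  H-lower zero    h = z≤n
  H-lower (suc R) h = +-cancelʳ-≤ (2 * B * B * (P * H R h)) _ _ (begin
    2 * suc R * P * B * (B * b) + 2 * B * B * (P * H R h)
      ≤⟨ +-monoʳ-≤ (2 * suc R * P * B * (B * b)) (≡-≤ (regroup B P (H R h)) (*-monoʳ-≤ (2 * B * P) (H-upper R h))) ⟩
    2 * suc R * P * B * (B * b) + 2 * B * P * (R * P * b)
      ≤⟨ m≤m+n _ (B * (P * P * b)) ⟩
    2 * suc R * P * B * (B * b) + 2 * B * P * (R * P * b) + B * (P * P * b)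
      ≡⟨ expand R P B b ⟩
    2 * B * B * (P * b) + B * (2 * R * P * B * b) + (2 * R + 1) * (P * P) * (B * b)
      ≤⟨ +-monoˡ-≤ _ (+-monoʳ-≤ (2 * B * B * (P * b)) (*-monoʳ-≤ B (H-lower R h))) ⟩
    2 * B * B * (P * b) + B * (2 * B * B * H R h + R * R * (P * P) * b) + (2 * R + 1) * (P * P) * (B * b)
      ≡⟨ collect R P B b (H R h) ⟩
    2 * B * B * (P * b + B * H R h) + suc R * suc R * (P * P) * (B * b)
      ≡⟨ cong (λ x → 2 * B * B * x + suc R * suc R * (P * P) * (B * b)) (recurrence R h) ⟨
    2 * B * B * (H (suc R) h + P * H R h) + suc R * suc R * (P * P) * (B * b)
      ≡⟨ shift B P (H (suc R) h) (H R h) (suc R * suc R * (P * P) * (B * b)) ⟩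
    2 * B * B * H (suc R) h + suc R * suc R * (P * P) * (B * b) + 2 * B * B * (P * H R h) ∎)
    where
    P = p h
    b = B ^ R
    regroup : ∀ b p x → 2 * b * b * (p * x) ≡ 2 * b * p * (b * x)
    regroup = solve-∀
    expand : ∀ r p b e → 2 * suc r * p * b * (b * e) + 2 * b * p * (r * p * e) + b * (p * p * e)
             ≡ 2 * b * b * (p * e) + b * (2 * r * p * b * e) + (2 * r + 1) * (p * p) * (b * e)
    expand = solve-∀
    collect : ∀ r p b e x → 2 * b * b * (p * e) + b * (2 * b * b * x + r * r * (p * p) * e) + (2 * r + 1) * (p * p) * (b * e)
              ≡ 2 * b * b * (p * e + b * x) + suc r * suc r * (p * p) * (b * e)
    collect = solve-∀
    shift : ∀ b p x y z → 2 * b * b * (x + p * y) + z ≡ 2 * b * b * x + z + 2 * b * b * (p * y)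
    shift = solve-∀

  -- k₁ and k₂ bound the first two moments of the number of successful y; R is of the order of the inverse
  -- of the success probability Γ / N².
  hits-likely : ∀ N Γ R k₁ k₂ .{{_ : NonZero N}} →
    B * Γ * length hs ≤ k₁ * (N * (N * ∑ hs p)) →
    N * (N * (N * N)) * ∑ hs (λ h → p h * p h) ≤ k₂ * (B * Γ) * (B * Γ) * length hs →
    R * Γ * (k₁ * k₂) ≤ N * N → N * N ≤ 2 * (R * Γ * (k₁ * k₂)) →
    length hs * B ^ R ≤ 4 * k₁ * (k₁ * k₂) * ∑ hs (H R)
  hits-likely N Γ R k₁ k₂ first second R≤ R≥ = go B refl
    where
    S₁ = ∑ hs p
    S₂ = ∑ hs (λ h → p h * p h)
    SH = ∑ hs (H R)
    Hn = length hs

    summed : 2 * R * B * B ^ R * S₁ ≤ 2 * B * B * SH + R * R * B ^ R * S₂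
    summed = begin
      2 * R * B * B ^ R * S₁
        ≡⟨ ∑-*ˡ hs (2 * R * B * B ^ R) p ⟨
      ∑ hs (λ h → 2 * R * B * B ^ R * p h)
        ≤⟨ ∑-mono hs (λ h → ≡-≤ (r₁ R B (B ^ R) (p h)) (≤-≡ (H-lower R h) (r₂ B (H R h) R (p h) (B ^ R)))) ⟩
      ∑ hs (λ h → 2 * B * B * H R h + R * R * B ^ R * (p h * p h))
        ≡⟨ trans (∑-+ hs _ _) (cong₂ _+_ (∑-*ˡ hs (2 * B * B) _) (∑-*ˡ hs (R * R * B ^ R) _)) ⟩
      2 * B * B * SH + R * R * B ^ R * S₂ ∎
      where
      r₁ : ∀ r b e p → 2 * r * b * e * p ≡ 2 * r * p * b * e
      r₁ = solve-∀
      r₂ : ∀ b h r p e → 2 * b * b * h + r * r * (p * p) * e ≡ 2 * b * b * h + r * r * e * (p * p)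
      r₂ = solve-∀

    main : B * (B * (2 * R * Γ * (N * N) * (B ^ R * Hn))) ≤ B * (B * (2 * k₁ * (N * (N * (N * N))) * SH + R * Γ * (N * N) * (B ^ R * Hn)))
    main = begin
      B * (B * (2 * R * Γ * (N * N) * (B ^ R * Hn)))
        ≡⟨ r₁ B R Γ N (B ^ R) Hn ⟩
      2 * R * B * B ^ R * (N * N) * (B * Γ * Hn)
        ≤⟨ *-monoʳ-≤ (2 * R * B * B ^ R * (N * N)) first ⟩
      2 * R * B * B ^ R * (N * N) * (k₁ * (N * (N * S₁)))
        ≡⟨ r₂ (2 * R * B * B ^ R) N k₁ S₁ ⟩
      k₁ * (N * (N * (N * N))) * (2 * R * B * B ^ R * S₁)
        ≤⟨ *-monoʳ-≤ (k₁ * (N * (N * (N * N)))) summed ⟩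
      k₁ * (N * (N * (N * N))) * (2 * B * B * SH + R * R * B ^ R * S₂)
        ≡⟨ r₃ k₁ (N * (N * (N * N))) B SH R (B ^ R) S₂ ⟩
      B * (B * (2 * k₁ * (N * (N * (N * N))) * SH)) + k₁ * R * R * B ^ R * (N * (N * (N * N)) * S₂)
        ≤⟨ +-monoʳ-≤ _ (*-monoʳ-≤ (k₁ * R * R * B ^ R) second) ⟩
      B * (B * (2 * k₁ * (N * (N * (N * N))) * SH)) + k₁ * R * R * B ^ R * (k₂ * (B * Γ) * (B * Γ) * Hn)
        ≡⟨ cong (B * (B * (2 * k₁ * (N * (N * (N * N))) * SH)) +_) (r₄ k₁ R (B ^ R) k₂ B Γ Hn) ⟩
      B * (B * (2 * k₁ * (N * (N * (N * N))) * SH)) + B * (B * (R * Γ * (R * Γ * (k₁ * k₂)) * (B ^ R * Hn)))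
        -- By `R≤` the quadratic term is at most half of the linear one.
        ≤⟨ +-monoʳ-≤ _ (*-monoʳ-≤ B (*-monoʳ-≤ B (*-monoˡ-≤ (B ^ R * Hn) (*-monoʳ-≤ (R * Γ) R≤)))) ⟩
      B * (B * (2 * k₁ * (N * (N * (N * N))) * SH)) + B * (B * (R * Γ * (N * N) * (B ^ R * Hn)))
        ≡⟨ r₅ B (2 * k₁ * (N * (N * (N * N))) * SH) (R * Γ * (N * N) * (B ^ R * Hn)) ⟩
      B * (B * (2 * k₁ * (N * (N * (N * N))) * SH + R * Γ * (N * N) * (B ^ R * Hn))) ∎
      where
      r₁ : ∀ b r g n e h → b * (b * (2 * r * g * (n * n) * (e * h))) ≡ 2 * r * b * e * (n * n) * (b * g * h)
      r₁ = solve-∀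
      r₂ : ∀ a n k s → a * (n * n) * (k * (n * (n * s))) ≡ k * (n * (n * (n * n))) * (a * s)
      r₂ = solve-∀
      r₃ : ∀ k n b s r e t → k * n * (2 * b * b * s + r * r * e * t) ≡ b * (b * (2 * k * n * s)) + k * r * r * e * (n * t)
      r₃ = solve-∀
      r₄ : ∀ k r e l b g h → k * r * r * e * (l * (b * g) * (b * g) * h) ≡ b * (b * (r * g * (r * g * (k * l)) * (e * h)))
      r₄ = solve-∀
      r₅ : ∀ b x y → b * (b * x) + b * (b * y) ≡ b * (b * (x + y))
      r₅ = solve-∀

    enough : 2 * R * Γ * (N * N) * (B ^ R * Hn) ≤ 2 * k₁ * (N * (N * (N * N))) * SH + R * Γ * (N * N) * (B ^ R * Hn) →
             Hn * B ^ R ≤ 4 * k₁ * (k₁ * k₂) * SH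
    enough le = *-cancelˡ-≤ N (*-cancelˡ-≤ N (begin
      N * (N * (Hn * B ^ R))
        ≡⟨ r₁ N Hn (B ^ R) ⟩
      N * N * (B ^ R * Hn)
        ≤⟨ *-monoˡ-≤ (B ^ R * Hn) R≥ ⟩
      2 * (R * Γ * (k₁ * k₂)) * (B ^ R * Hn)
        ≡⟨ r₂ (R * Γ) (k₁ * k₂) (B ^ R * Hn) ⟩
      2 * (k₁ * k₂) * (R * Γ * (B ^ R * Hn))
        ≤⟨ *-monoʳ-≤ (2 * (k₁ * k₂)) step ⟩
      2 * (k₁ * k₂) * (2 * k₁ * (N * (N * SH)))
        ≡⟨ r₃ (k₁ * k₂) k₁ N SH ⟩
      N * (N * (4 * k₁ * (k₁ * k₂) * SH)) ∎))
      where
      r₁ : ∀ n h e → n * (n * (h * e)) ≡ n * n * (e * h)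
      r₁ = solve-∀
      r₂ : ∀ g k e → 2 * (g * k) * e ≡ 2 * k * (g * e)
      r₂ = solve-∀
      r₃ : ∀ k l n s → 2 * k * (2 * l * (n * (n * s))) ≡ n * (n * (4 * l * k * s))
      r₃ = solve-∀
      step : R * Γ * (B ^ R * Hn) ≤ 2 * k₁ * (N * (N * SH))
      step = *-cancelˡ-≤ N (*-cancelˡ-≤ N (+-cancelʳ-≤ (R * Γ * (N * N) * (B ^ R * Hn)) _ _ (begin
        N * (N * (R * Γ * (B ^ R * Hn))) + R * Γ * (N * N) * (B ^ R * Hn)
          ≡⟨ s₁ N R Γ (B ^ R * Hn) ⟩
        2 * R * Γ * (N * N) * (B ^ R * Hn)
          ≤⟨ le ⟩
        2 * k₁ * (N * (N * (N * N))) * SH + R * Γ * (N * N) * (B ^ R * Hn)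
          ≡⟨ cong (_+ R * Γ * (N * N) * (B ^ R * Hn)) (s₂ k₁ N SH) ⟩
        N * (N * (2 * k₁ * (N * (N * SH)))) + R * Γ * (N * N) * (B ^ R * Hn) ∎)))
        where
        s₁ : ∀ n r g e → n * (n * (r * g * e)) + r * g * (n * n) * e ≡ 2 * r * g * (n * n) * e
        s₁ = solve-∀
        s₂ : ∀ k n s → 2 * k * (n * (n * (n * n))) * s ≡ n * (n * (2 * k * (n * (n * s))))
        s₂ = solve-∀

    go : ∀ b → B ≡ b → Hn * B ^ R ≤ 4 * k₁ * (k₁ * k₂) * SH
    go (suc b) e = enough (*-cancelˡ-≤ B {{nz}} (*-cancelˡ-≤ B {{nz}} main))
      where
      nz : NonZero B
      nz = subst NonZero (sym e) _
    go zero e = ≡-≤ (trans (cong (Hn *_) (power R refl)) (*-zeroʳ Hn)) z≤n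
      where
      power : ∀ R′ → R ≡ R′ → B ^ R ≡ 0
      power (suc R′) refl = cong (_* B ^ R′) e
      power zero     refl = contradiction (n≤0⇒n≡0 R≥) (≢-nonZero⁻¹ (N * N) {{m*n≢0 N N}})

  H≤ : ∀ R h → H R h ≤ B ^ R
  H≤ R h = ≤-≡ (∑-bound (vectors ys R) _ (λ v → 𝟙≤1 (hits? h v))) (trans (*-identityʳ _) (length-vectors ys R))

  H-suc : ∀ R h → B * H R h ≤ H (suc R) h
  H-suc R h = +-cancelˡ-≤ (p h * B ^ R) _ _ (≡-≤ (sym (recurrence R h))
    (≤-≡ (+-monoʳ-≤ (H (suc R) h) (*-monoʳ-≤ (p h) (H≤ R h))) (+-comm (H (suc R) h) _)))

  H-mono : ∀ d R h → B ^ d * H R h ≤ H (d + R) h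
  H-mono zero    R h = ≤-reflexive (+-identityʳ _)
  H-mono (suc d) R h = ≡-≤ (*-assoc B (B ^ d) (H R h)) (≤-trans (*-monoʳ-≤ B (H-mono d R h)) (H-suc (d + R) h))

  likely-mono : ∀ {R R′ C} → R ≤ R′ → length hs * B ^ R ≤ C * ∑ hs (H R) → length hs * B ^ R′ ≤ C * ∑ hs (H R′)
  likely-mono {R} {R′} {C} R≤R′ le = begin
    length hs * B ^ R′ ≡⟨ cong (λ x → length hs * B ^ x) (m∸n+n≡m R≤R′) ⟨
    length hs * B ^ (d + R) ≡⟨ trans (cong (length hs *_) (^-distribˡ-+-* B d R)) (*-swap (length hs) (B ^ d) (B ^ R)) ⟩
    B ^ d * (length hs * B ^ R) ≤⟨ *-monoʳ-≤ (B ^ d) le ⟩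
    B ^ d * (C * ∑ hs (H R)) ≡⟨ trans (*-swap (B ^ d) C _) (cong (C *_) (sym (∑-*ˡ hs (B ^ d) (H R)))) ⟩
    C * ∑ hs (λ h → B ^ d * H R h) ≤⟨ *-monoʳ-≤ C (∑-mono hs (H-mono d R)) ⟩
    C * ∑ hs (H (d + R)) ≡⟨ cong (λ x → C * ∑ hs (H x)) (m∸n+n≡m R≤R′) ⟩
    C * ∑ hs (H R′) ∎
    where
    d = R′ ∸ R

-- Indices of the two halves are hidden behind the vertices by random shifts rd u and rd w.
record Setup : Set where
  field
    {N M q} c r : ℕ
    {{N≢0}} : NonZero N
    {{q≢0}} : NonZero q
    {{c≢0}} : NonZero c
    zL zR  : Fin N → Fin M
    z*     : Fin M
    left   : Fin N → Bool
    rd     : Fin q → Fin N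
    item   : Fin N → Fin N → Fin N
    rd-upper : ∀ f → N * ∑ (allFin q) (f ∘ rd) ≤ 2 * q * ∑ (allFin N) f
    rd-lower : ∀ f → q * ∑ (allFin N) f ≤ 2 * N * ∑ (allFin q) (f ∘ rd)
    item-injectiveʳ : ∀ ρ v w → item ρ v ≡ item ρ w → v ≡ w
    item-injectiveˡ : ∀ v ρ σ → item ρ v ≡ item σ v → ρ ≡ σ
    lefts  : N ≤ 3 * ∑ (allFin N) (λ v → 𝟙 (left v Bool.≟ true))
    rights : N ≤ 3 * ∑ (allFin N) (λ v → 𝟙 (left v Bool.≟ false))

  -- With 16 c cells the probability that one of c chains ends in a given cell stays below 1 / 8,
  -- once 16 c ≤ N.
  cells : ℕ
  cells = 16 * c

  instance
    cells≢0 : NonZero cells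
    cells≢0 = m*n≢0 16 c

  Hs = functions N M
  Hn = length Hs

  mL mR : Fin M → ℕ
  mL x = ∑ (allFin N) (λ I → 𝟙 (zL I Fin.≟ x))
  mR x = ∑ (allFin N) (λ J → 𝟙 (zR J Fin.≟ x))

  zz : Fin q → Fin q → Fin N → Fin M
  zz u w v = if left v then zL (item (rd u) v) else zR (item (rd w) v)

  module _ (u w : Fin q) where
    open Collisions (zz u w) using (μ; F₂)

    μ-bound : ∀ x → μ x ≤ mL x + mR x
    μ-bound x = begin
      ∑ (allFin N) (λ v → 𝟙 (zz u w v Fin.≟ x))
        ≤⟨ ∑-mono (allFin N) (λ v → either (left v) (zL (item (rd u) v)) (zR (item (rd w) v))) ⟩
      ∑ (allFin N) (λ v → 𝟙 (zL (item (rd u) v) Fin.≟ x) + 𝟙 (zR (item (rd w) v) Fin.≟ x))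
        ≡⟨ ∑-+ (allFin N) _ _ ⟩
      ∑ (allFin N) (λ v → 𝟙 (zL (item (rd u) v) Fin.≟ x)) + ∑ (allFin N) (λ v → 𝟙 (zR (item (rd w) v) Fin.≟ x))
        ≤⟨ +-mono-≤ (∑-injective (item (rd u)) (item-injectiveʳ (rd u)) (λ I → 𝟙 (zL I Fin.≟ x)))
                    (∑-injective (item (rd w)) (item-injectiveʳ (rd w)) (λ J → 𝟙 (zR J Fin.≟ x))) ⟩
      mL x + mR x ∎
      where
      either : ∀ b (y y′ : Fin M) → 𝟙 ((if b then y else y′) Fin.≟ x) ≤ 𝟙 (y Fin.≟ x) + 𝟙 (y′ Fin.≟ x)
      either true  y y′ = m≤m+n _ _
      either false y y′ = m≤n+m _ (𝟙 (y Fin.≟ x))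

    F₂-bound : F₂ ≤ 2 * (∑ (allFin N) (mL ∘ zL) + ∑ (allFin N) (mR ∘ zR))
    F₂-bound = begin
      ∑ (allFin N) (μ ∘ zz u w)
        ≡⟨ ∑-fibres (zz u w) μ ⟩
      ∑ (allFin M) (λ x → μ x * μ x)
        ≤⟨ ∑-mono (allFin M) (λ x → ≤-trans (*-mono-≤ (μ-bound x) (μ-bound x)) (square-sum (mL x) (mR x))) ⟩
      ∑ (allFin M) (λ x → 2 * (mL x * mL x + mR x * mR x))
        ≡⟨ trans (∑-*ˡ (allFin M) 2 _) (cong (2 *_) (∑-+ (allFin M) _ _)) ⟩
      2 * (∑ (allFin M) (λ x → mL x * mL x) + ∑ (allFin M) (λ x → mR x * mR x))
        ≡⟨ cong (2 *_) (cong₂ _+_ (∑-fibres zL mL) (∑-fibres zR mR)) ⟨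
      2 * (∑ (allFin N) (mL ∘ zL) + ∑ (allFin N) (mR ∘ zR)) ∎

  -- A random shift carries a uniformly random index to each vertex.
  module _ (ζ : Fin N → Fin M) (b : Bool) where

    m : ℕ
    m = ∑ (allFin N) (λ I → 𝟙 (ζ I Fin.≟ z*))

    gold? : (u : Fin q) (i : Fin N) → Dec (left i ≡ b × ζ (item (rd u) i) ≡ z*)
    gold? u i = (left i Bool.≟ b) ×-dec (ζ (item (rd u) i) Fin.≟ z*)

    at-upper : ∀ i → N * ∑ (allFin q) (λ u → 𝟙 (gold? u i)) ≤ 2 * q * m
    at-upper i = begin
      N * ∑ (allFin q) (λ u → 𝟙 (gold? u i))
        ≤⟨ *-monoʳ-≤ N (∑-mono (allFin q) (λ u → 𝟙-mono (gold? u i) (ζ (item (rd u) i) Fin.≟ z*) proj₂)) ⟩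
      N * ∑ (allFin q) (λ u → 𝟙 (ζ (item (rd u) i) Fin.≟ z*))
        ≤⟨ rd-upper (λ ρ → 𝟙 (ζ (item ρ i) Fin.≟ z*)) ⟩
      2 * q * ∑ (allFin N) (λ ρ → 𝟙 (ζ (item ρ i) Fin.≟ z*))
        ≤⟨ *-monoʳ-≤ (2 * q) (∑-injective (λ ρ → item ρ i) (item-injectiveˡ i) (λ I → 𝟙 (ζ I Fin.≟ z*))) ⟩
      2 * q * m ∎

    upper : ∑ (allFin q) (λ u → ∑ (allFin N) (λ i → 𝟙 (gold? u i))) ≤ 2 * q * m
    upper = *-cancelˡ-≤ N (begin
      N * ∑ (allFin q) (λ u → ∑ (allFin N) (λ i → 𝟙 (gold? u i)))
        ≡⟨ trans (cong (N *_) (∑-swap (allFin q) (allFin N) _)) (sym (∑-*ˡ (allFin N) N _)) ⟩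
      ∑ (allFin N) (λ i → N * ∑ (allFin q) (λ u → 𝟙 (gold? u i)))
        ≤⟨ ∑-bound (allFin N) _ at-upper ⟩
      length (allFin N) * (2 * q * m)
        ≡⟨ cong (_* (2 * q * m)) (length-allFin N) ⟩
      N * (2 * q * m) ∎)

    upper-among : (vs : List (Fin N)) →
      N * ∑ (allFin q) (λ u → ∑ (allFin N) (λ i → 𝟙 (gold? u i) * 𝟙 (_∈?_ Fin._≟_ i vs))) ≤ length vs * (2 * q * m)
    upper-among vs = begin
      N * ∑ (allFin q) (λ u → ∑ (allFin N) (λ i → 𝟙 (gold? u i) * 𝟙 (_∈?_ Fin._≟_ i vs)))
        ≤⟨ *-monoʳ-≤ N (∑-mono (allFin q) (λ u → ∑-mono (allFin N) (λ i → *-monoʳ-≤ (𝟙 (gold? u i)) (listed i)))) ⟩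
      N * ∑ (allFin q) (λ u → ∑ (allFin N) (λ i → 𝟙 (gold? u i) * ∑ vs (λ v → 𝟙 (i Fin.≟ v))))
        ≡⟨ cong (N *_) (trans (∑-cong (allFin q) (λ u → trans (∑-cong (allFin N) (λ i → sym (∑-*ˡ vs (𝟙 (gold? u i)) _)))
             (∑-swap (allFin N) vs _))) (∑-swap (allFin q) vs _)) ⟩
      N * ∑ vs (λ v → ∑ (allFin q) (λ u → ∑ (allFin N) (λ i → 𝟙 (gold? u i) * 𝟙 (i Fin.≟ v))))
        ≡⟨ cong (N *_) (∑-cong vs (λ v → ∑-cong (allFin q) (λ u → trans (∑-cong (allFin N) (λ i → *-comm (𝟙 (gold? u i)) _))
             (∑-δ v (λ i → 𝟙 (gold? u i)))))) ⟩
      N * ∑ vs (λ v → ∑ (allFin q) (λ u → 𝟙 (gold? u v)))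
        ≡⟨ ∑-*ˡ vs N _ ⟨
      ∑ vs (λ v → N * ∑ (allFin q) (λ u → 𝟙 (gold? u v)))
        ≤⟨ ∑-bound vs _ at-upper ⟩
      length vs * (2 * q * m) ∎
      where
      listed : ∀ i → 𝟙 (_∈?_ Fin._≟_ i vs) ≤ ∑ vs (λ v → 𝟙 (i Fin.≟ v))
      listed i = 𝟙≤ (_∈?_ Fin._≟_ i vs) (λ i∈ → ≡-≤ (sym (𝟙-yes (i Fin.≟ i) refl)) (∑-∈ vs _ i∈))

    -- An injection of `Fin N` into itself is onto. Instead of an inverse, the inequality for
    -- injections is applied to the complement of the set in question.
    covers : ∀ i → m ≤ ∑ (allFin N) (λ ρ → 𝟙 (ζ (item ρ i) Fin.≟ z*))
    covers i = +-cancelʳ-≤ (S (λ I → 𝟙 (¬? (ζ I Fin.≟ z*)))) _ _ (begin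
      S (λ I → 𝟙 (ζ I Fin.≟ z*)) + S (λ I → 𝟙 (¬? (ζ I Fin.≟ z*)))
        ≡⟨ total (λ I → ζ I) ⟩
      S (λ _ → 1)
        ≡⟨ total (λ ρ → ζ (item ρ i)) ⟨
      S (λ ρ → 𝟙 (ζ (item ρ i) Fin.≟ z*)) + S (λ ρ → 𝟙 (¬? (ζ (item ρ i) Fin.≟ z*)))
        ≤⟨ +-monoʳ-≤ _ (∑-injective (λ ρ → item ρ i) (item-injectiveˡ i) (λ I → 𝟙 (¬? (ζ I Fin.≟ z*)))) ⟩
      S (λ ρ → 𝟙 (ζ (item ρ i) Fin.≟ z*)) + S (λ I → 𝟙 (¬? (ζ I Fin.≟ z*))) ∎)
      where
      S = ∑ (allFin N)
      total : ∀ (g : Fin N → Fin M) → S (λ I → 𝟙 (g I Fin.≟ z*)) + S (λ I → 𝟙 (¬? (g I Fin.≟ z*))) ≡ S (λ _ → 1)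
      total g = trans (sym (∑-+ (allFin N) _ _)) (∑-cong (allFin N) (λ I → 𝟙+𝟙¬ (g I Fin.≟ z*)))

    -- The constant 6 is 3 · 2: at least a third of the vertices lie on the required side, and `rd`
    -- is uniform up to a factor 2.
    lower : N ≤ 3 * ∑ (allFin N) (λ v → 𝟙 (left v Bool.≟ b)) → q * m ≤ 6 * ∑ (allFin q) (λ u → ∑ (allFin N) (λ i → 𝟙 (gold? u i)))
    lower many = *-cancelˡ-≤ N (begin
      N * (q * m)
        ≤⟨ *-monoˡ-≤ (q * m) many ⟩
      3 * S (λ i → 𝟙 (left i Bool.≟ b)) * (q * m)
        ≡⟨ trans (*-assoc 3 (S (λ i → 𝟙 (left i Bool.≟ b))) (q * m))
             (cong (3 *_) (sym (∑-*ʳ (allFin N) (q * m) (λ i → 𝟙 (left i Bool.≟ b))))) ⟩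
      3 * S (λ i → 𝟙 (left i Bool.≟ b) * (q * m))
        ≤⟨ *-monoʳ-≤ 3 (∑-mono (allFin N) (λ i → *-monoʳ-≤ (𝟙 (left i Bool.≟ b)) (≤-trans
             (*-monoʳ-≤ q (covers i)) (rd-lower (λ ρ → 𝟙 (ζ (item ρ i) Fin.≟ z*)))))) ⟩
      3 * S (λ i → 𝟙 (left i Bool.≟ b) * (2 * N * ∑ (allFin q) (λ u → 𝟙 (ζ (item (rd u) i) Fin.≟ z*))))
        ≡⟨ cong (3 *_) (trans (∑-cong (allFin N) (λ i → trans (rearrange (𝟙 (left i Bool.≟ b)) N _)
             (cong (2 * N *_) (trans (sym (∑-*ˡ (allFin q) (𝟙 (left i Bool.≟ b)) _))
               (∑-cong (allFin q) (λ u → sym (𝟙-× (left i Bool.≟ b) _))))))) (∑-*ˡ (allFin N) (2 * N) _)) ⟩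
      3 * (2 * N * S (λ i → ∑ (allFin q) (λ u → 𝟙 (gold? u i))))
        ≡⟨ trans (collect N _) (cong (λ s → N * (6 * s)) (∑-swap (allFin N) (allFin q) _)) ⟩
      N * (6 * ∑ (allFin q) (λ u → S (λ i → 𝟙 (gold? u i)))) ∎)
      where
      S = ∑ (allFin N)
      rearrange : ∀ a n s → a * (2 * n * s) ≡ 2 * n * (a * s)
      rearrange = solve-∀
      collect : ∀ n s → 3 * (2 * n * s) ≡ n * (6 * s)
      collect = solve-∀

  goldL? : (u : Fin q) (i : Fin N) → Dec (left i ≡ true × zL (item (rd u) i) ≡ z*)
  goldL? = gold? zL true

  goldR? : (w : Fin q) (j : Fin N) → Dec (left j ≡ false × zR (item (rd w) j) ≡ z*)
  goldR? = gold? zR false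

  -- The vertices i and j carry, each on its side, halves with the value z*. This depends on the
  -- shifts alone and not on h.
  IsGold : (u w : Fin q) (i j : Fin N) → Set
  IsGold u w i j = (left i ≡ true × zL (item (rd u) i) ≡ z*) × (left j ≡ false × zR (item (rd w) j) ≡ z*)

  gold-zz : ∀ u w {i j} → IsGold u w i j → zz u w i ≡ z* × zz u w j ≡ z*
  gold-zz u w {i} {j} ((l , e) , (l′ , e′)) = trans (pick i l) e , trans (pick j l′) e′
    where
    pick : ∀ v {b} → left v ≡ b → zz u w v ≡ (if b then zL (item (rd u) v) else zR (item (rd w) v))
    pick v = cong (λ b → if b then zL (item (rd u) v) else zR (item (rd w) v))

  z*∈ : ∀ {u w i j} → IsGold u w i j → ∀ h t → z* ∈ trace (zz u w) h i (suc t) []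
  z*∈ {u} {w} {i} g h t = subst (_∈ trace (zz u w) h i (suc t) []) (proj₁ (gold-zz u w g)) (walk-∈-trace (zz u w) h i {0} [] (s≤s z≤n))

  Starts Draw Place Gold : Set
  Starts = Vec (Fin q) c
  Draw = (Fin q × Fin q) × (Starts × Starts)
  Place = (Fin c × Fin c) × (Fin r × Fin r) × (Fin N × Fin N)
  Gold = (Fin q × Fin q) × (Fin N × Fin N)

  starts : List Starts
  starts = vectors (allFin q) c

  QQ : List (Fin q × Fin q)
  QQ = cartesianProduct (allFin q) (allFin q)

  NN : List (Fin N × Fin N)
  NN = cartesianProduct (allFin N) (allFin N)

  RR : List (Fin r × Fin r)
  RR = cartesianProduct (allFin r) (allFin r)

  CC : List (Fin c × Fin c)
  CC = cartesianProduct (allFin c) (allFin c)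

  SS : List (Starts × Starts)
  SS = cartesianProduct starts starts

  draws : List Draw
  draws = cartesianProduct QQ SS

  places : List Place
  places = cartesianProduct CC (cartesianProduct RR NN)

  golds : List Gold
  golds = cartesianProduct QQ NN

  places-unique : AtMostOne places
  places-unique = atMostOne-× CC (cartesianProduct RR NN) (square c) (atMostOne-× RR NN (square r) (square N))
    where
    square : ∀ n → AtMostOne (cartesianProduct (allFin n) (allFin n))
    square n = atMostOne-× (allFin n) (allFin n) ∑-unique ∑-unique

  -- Γ / N² is, up to constants, the success probability of a run: c² pairs of chains, r² pairs of
  -- lengths, and all pairs of halves with the value z*.
  V B Γ : ℕ
  V = length starts
  B = length draws
  Γ = c * c * (r * r) * (mL z* * mR z*)

  B≡ : B ≡ q * q * (V * V)
  B≡ = trans (length-× QQ SS) (cong₂ _*_ (trans (length-× (allFin q) (allFin q)) (cong₂ _*_ (length-allFin q) (length-allFin q)))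
    (length-× starts starts))

  from : Starts → Fin c → Fin N
  from A x = rd (lookup A x)

  run : Draw → Run N M c
  run ((u , w) , (A , B)) = record { cells = cells ; r = r ; z = zz u w ; as = from A ; bs = from B }

  -- The chain of a in the first phase reaches the left half i of a solution after suc p steps, the chain of b
  -- in the second phase reaches its right half j after suc p′ steps, and no coincidence interferes.
  Found : Draw → HashFun M N → Place → Set
  Found y@((u , w) , (A , B)) h ((a , b) , (p , p′) , (i , j)) =
    IsGold u w i j
    × Run.Undisturbed (run y) a b p p′ i h
    × walk (zz u w) h (from A a) (suc (toℕ p)) ≡ i × walk (zz u w) h (from B b) (suc (toℕ p′)) ≡ j

  abstract
    found? : ∀ y h → Decidable (Found y h)
    found? y@((u , w) , (A , B)) h ((a , b) , (p , p′) , (i , j)) =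
      (goldL? u i ×-dec goldR? w j) ×-dec Run.undisturbed? (run y) a b p p′ i h
      ×-dec (walk (zz u w) h (from A a) (suc (toℕ p)) Fin.≟ i) ×-dec (walk (zz u w) h (from B b) (suc (toℕ p′)) Fin.≟ j)

  X : HashFun M N → Draw → ℕ
  X h y = ∑ places (λ π → 𝟙 (found? y h π))

  module _ {u w : Fin q} {A B : Starts} {h : HashFun M N} where

    private
      z = zz u w
      y : Draw
      y = (u , w) , (A , B)

    -- Only the chains of the solution query z*, hence its place is determined.
    not-a : ∀ {a b p p′ i j s} → Found y h ((a , b) , (p , p′) , (i , j)) → Run.Avoids (run y) a b p p′ i h s →
            z* ∉ trace z h s (Run.L (run y)) []
    not-a {i = i} {s = s} (gs , _) (f , _) = fresh-apart z h s _ (trace z h i _ []) f (z*∈ gs h _)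

    reach : ∀ s (p : Fin r) {v} → walk z h s (suc (toℕ p)) ≡ v → z v ≡ z* →
            z* ∈ trace z h s (Run.L (run y)) []
    reach s p e g = subst (_∈ trace z h s (Run.L (run y)) []) (trans (cong z e) g) (walk-∈-trace z h s {suc (toℕ p)} []
      (s≤s (≤-trans (toℕ<n p) (≤-trans (n≤1+n r) (m≤m+n (suc r) (suc r))))))

    clean-a : ∀ {a b p p′ i j} → Found y h ((a , b) , (p , p′) , (i , j)) → z* ∉ trace z h (from A a) (suc (toℕ p)) []
    clean-a {a} {p = p} {i = i} (gs , und , _) = fresh-apart z h (from A a) _ (trace z h i _ []) (Run.Undisturbed.ia und) (z*∈ gs h _)

    clean-b : ∀ {a b p p′ i j} → Found y h ((a , b) , (p , p′) , (i , j)) → z* ∉ trace z h (from B b) (suc (toℕ p′)) []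
    clean-b {b = b} {p = p} {i = i} (gs , und , _) = fresh-apart z h (from B b) _ (trace z h i _ []) (Run.Undisturbed.ib und) (z*∈ gs h _)

    found-unique : ∀ π π′ → Found y h π → Found y h π′ → π ≡ π′
    found-unique ((a , b) , (p , p′) , (i , j)) ((c , d) , (s , s′) , (k , l)) f@(gs , und , e , e′) g@(gs′ , und′ , e₁ , e₁′)
      with a Fin.≟ c | b Fin.≟ d
    ... | no a≢c | _ = contradiction (reach (from A c) s e₁ (proj₁ (gold-zz u w gs′)))
                         (not-a {s = from A c} f (Run.Undisturbed.as-ok und c (a≢c ∘ sym)))
    ... | _ | no b≢d = contradiction (reach (from B d) s′ e₁′ (proj₂ (gold-zz u w gs′)))
                         (not-a {s = from B d} f (Run.Undisturbed.bs-ok und d (b≢d ∘ sym)))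
    ... | yes refl | yes refl
      with toℕ-injective (suc-injective (first-visit z h (from A a) {z*} [] (clean-a f) (clean-a g)
             (trans (cong z e) (proj₁ (gold-zz u w gs))) (trans (cong z e₁) (proj₁ (gold-zz u w gs′)))))
         | toℕ-injective (suc-injective (first-visit z h (from B b) {z*} [] (clean-b f) (clean-b g)
             (trans (cong z e′) (proj₂ (gold-zz u w gs))) (trans (cong z e₁′) (proj₂ (gold-zz u w gs′)))))
    ... | refl | refl with trans (sym e) e₁ | trans (sym e′) e₁′
    ... | refl | refl = refl

  X≤1 : ∀ h y → X h y ≤ 1
  X≤1 h y@((u , w) , (A , B)) = places-unique _ (λ π → 𝟙≤1 (found? y h π))
    (λ π π′ m n → found-unique {u} {w} {A} {B} {h} π π′ (𝟙-holds (found? y h π) m) (𝟙-holds (found? y h π′) n))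

  gL gR : Fin q → Fin N → ℕ
  gL u i = 𝟙 (goldL? u i)
  gR w j = 𝟙 (goldR? w j)

  weight : Gold → ℕ
  weight ((u , w) , (i , j)) = gL u i * gR w j

  gold-pair : ∀ {u w i j} {m n} → (left i ≡ true × zL (item (rd u) i) ≡ z* → left j ≡ false × zR (item (rd w) j) ≡ z* → m ≤ n) →
              weight ((u , w) , (i , j)) * m ≤ weight ((u , w) , (i , j)) * n
  gold-pair {u} {w} {i} {j} {m} {n} f = subst (λ x → x * m ≤ x * n) (𝟙-× (goldL? u i) (goldR? w j)) (by (goldL? u i ×-dec goldR? w j))
    where
    by : (d : Dec _) → 𝟙 d * m ≤ 𝟙 d * n
    by (yes (gl , gr)) = *-monoʳ-≤ 1 (f gl gr)
    by (no _)          = z≤n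

  separate : (α β : Fin N → ℕ) → ∑ golds (λ π@(_ , (i , j)) → weight π * (α i * β j))
             ≡ ∑ (allFin q) (λ u → ∑ (allFin N) (λ i → gL u i * α i)) * ∑ (allFin q) (λ w → ∑ (allFin N) (λ j → gR w j * β j))
  separate α β = trans (∑-× QQ NN _) (trans (∑-cong QQ (λ { (u , w) → trans (∑-cong NN (λ { (i , j) →
    interchange (gL u i) (gR w j) (α i) (β j) })) (∑-*-× (allFin N) (allFin N) (λ i → gL u i * α i) (λ j → gR w j * β j)) })) (∑-*-× (allFin q) (allFin q) _ _))
    where
    interchange : ∀ g h a b → g * h * (a * b) ≡ g * a * (h * b)
    interchange = solve-∀

  GL = ∑ (allFin q) (λ u → ∑ (allFin N) (gL u))
  GR = ∑ (allFin q) (λ w → ∑ (allFin N) (gR w))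

  ∑-weight : ∑ golds weight ≡ GL * GR
  ∑-weight = trans (∑-cong golds (λ π → sym (*-identityʳ (weight π)))) (trans (separate (λ _ → 1) (λ _ → 1))
    (cong₂ _*_ (ones gL) (ones gR)))
    where
    ones : (g : Fin q → Fin N → ℕ) → ∑ (allFin q) (λ u → ∑ (allFin N) (λ i → g u i * 1)) ≡ ∑ (allFin q) (λ u → ∑ (allFin N) (g u))
    ones g = ∑-cong (allFin q) (λ u → ∑-cong (allFin N) (λ i → *-identityʳ _))

  module _ (γ F K : ℕ) (γ≥ : mL z* + mR z* ≤ γ)
           (F≥ : 2 * (∑ (allFin N) (mL ∘ zL) + ∑ (allFin N) (mR ∘ zR)) ≤ F)
           (K-bound : ∀ κ → ∑ (allFin N) (λ y → 𝟙 (value y % cells ≟ κ)) ≤ K)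
           (small : 2 * disturbance N c r γ F K ≤ N * N) where

    -- For a gold pair a run is undisturbed with probability at least 1 / 2, and `arrivals` turns
    -- this into 1 / (2 N²) for being undisturbed and arriving at both vertices.
    place-likely : ∀ (ab : Fin c × Fin c) (pp : Fin r × Fin r) (π@((u , w) , (i , j)) : Gold) → weight π * (V * (V * Hn))
      ≤ weight π * (2 * (N * (N * ∑ SS (λ AB → ∑ Hs (λ h → 𝟙 (found? ((u , w) , AB) h (ab , pp , (i , j))))))))
    place-likely ab@(a , b) pp@(p , p′) π@((u , w) , (i , j)) = gold-pair {u} {w} {i} {j} λ gl gr → begin
      V * (V * Hn)
        ≤⟨ Disturbance.undisturbed-likely (record { cells = cells ; r = r ; z = zz u w ; st = rd ; st-bound = rd-upper
             ; a = a ; b = b ; p = p ; p′ = p′ ; i = i ; γ = γ ; F = F ; K = K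
             ; μ≤γ = ≤-trans (≤-≡ (μ-bound u w (zz u w i)) (cong (λ x → mL x + mR x) (proj₁ (gold-zz u w (gl , gr))))) γ≥
             ; F₂≤F = ≤-trans (F₂-bound u w) F≥ ; K-bound = K-bound }) small ⟩
      2 * ∑ starts (λ A → ∑ starts (λ B → ∑ Hs (λ h → 𝟙 (und? (A , B) h))))
        ≡⟨ cong (2 *_) (trans (sym (∑-× starts starts (λ AB → ∑ Hs (λ h → 𝟙 (und? AB h)))))
             (∑-cong SS (λ AB → sym (Run.arrivals (run ((u , w) , AB)) a b p p′ i j)))) ⟩
      2 * ∑ SS (λ AB → N * (N * ∑ Hs (f AB)))
        ≡⟨ cong (2 *_) (trans (∑-*ˡ SS N _) (cong (N *_) (∑-*ˡ SS N _))) ⟩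
      2 * (N * (N * ∑ SS (λ AB → ∑ Hs (f AB))))
        ≤⟨ *-monoʳ-≤ 2 (*-monoʳ-≤ N (*-monoʳ-≤ N (∑-mono SS (λ AB → ∑-mono Hs (λ h → under (gl , gr) AB h))))) ⟩
      2 * (N * (N * ∑ SS (λ AB → ∑ Hs (λ h → 𝟙 (found? ((u , w) , AB) h (ab , pp , (i , j))))))) ∎
      where
      und? : ∀ AB h → Dec _
      und? AB h = Run.undisturbed? (run ((u , w) , AB)) a b p p′ i h
      f : Starts × Starts → HashFun M N → ℕ
      f AB@(A , B) h = 𝟙 (und? AB h) * 𝟙 (walk (zz u w) h (from A a) (suc (toℕ p)) Fin.≟ i)
                       * 𝟙 (walk (zz u w) h (from B b) (suc (toℕ p′)) Fin.≟ j)

      under : _ × _ → ∀ AB h → f AB h ≤ 𝟙 (found? ((u , w) , AB) h (ab , pp , (i , j)))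
      under g AB@(A , B) h = ≡-≤ (trans (*-assoc (𝟙 (und? AB h)) _ _) (cong (𝟙 (und? AB h) *_) (sym (𝟙-× wa wb))))
        (𝟙*≤ (und? AB h) (λ ok → 𝟙-mono (wa ×-dec wb) (found? ((u , w) , AB) h (ab , pp , (i , j))) (λ e → g , ok , e)))
        where
        wa = walk (zz u w) h (from A a) (suc (toℕ p)) Fin.≟ i
        wb = walk (zz u w) h (from B b) (suc (toℕ p′)) Fin.≟ j

    -- 72 = 6 · 6 · 2, from the two shifts and from the probability of being undisturbed. By
    -- uniqueness of the place nothing is counted twice, so the contributions of all places add up.
    X-likely : B * Γ * Hn ≤ 72 * (N * (N * ∑ Hs (λ h → ∑ draws (X h))))
    X-likely = begin
      B * Γ * Hn
        ≡⟨ trans (cong (λ b → b * Γ * Hn) B≡) (pull q V c r (mL z*) (mR z*) Hn) ⟩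
      c * c * (r * r * (q * mL z* * (q * mR z*) * (V * (V * Hn))))
        ≤⟨ *-monoʳ-≤ (c * c) (*-monoʳ-≤ (r * r) (*-monoˡ-≤ (V * (V * Hn)) (*-mono-≤ (lower zL true lefts) (lower zR false rights)))) ⟩
      c * c * (r * r * (6 * GL * (6 * GR) * (V * (V * Hn))))
        ≡⟨ pull₂ (c * c) (r * r) GL GR (V * (V * Hn)) ⟩
      36 * (c * c * (r * r * (GL * GR * (V * (V * Hn)))))
        ≡⟨ cong (36 *_) unfold ⟨
      36 * ∑ CC (λ ab → ∑ RR (λ pp → ∑ golds (λ π → weight π * (V * (V * Hn)))))
        ≤⟨ *-monoʳ-≤ 36 (∑-mono CC (λ ab → ∑-mono RR (λ pp → ∑-mono golds (λ π → ≤-≡ (≤-trans (place-likely ab pp π)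
             (≤-≡ (*-monoˡ-≤ _ (weight≤1 π)) (*-identityˡ _))) refl)))) ⟩
      36 * ∑ CC (λ ab → ∑ RR (λ pp → ∑ golds (λ π → 2 * (N * (N * S ab pp π)))))
        ≡⟨ cong (36 *_) (trans (∑-cong CC (λ ab → trans (∑-cong RR (λ pp → out golds _)) (out RR _))) (out CC _)) ⟩
      36 * (2 * (N * (N * ∑ CC (λ ab → ∑ RR (λ pp → ∑ golds (S ab pp))))))
        ≡⟨ trans (sym (*-assoc 36 2 (N * (N * ∑ CC (λ ab → ∑ RR (λ pp → ∑ golds (S ab pp))))))) (cong (λ s → 72 * (N * (N * s))) reorder) ⟩
      72 * (N * (N * ∑ Hs (λ h → ∑ draws (X h)))) ∎
      where
      S : Fin c × Fin c → Fin r × Fin r → Gold → ℕ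
      S ab pp (uw , ij) = ∑ SS (λ AB → ∑ Hs (λ h → 𝟙 (found? (uw , AB) h (ab , pp , ij))))

      weight≤1 : ∀ π → weight π ≤ 1
      weight≤1 ((u , w) , (i , j)) = *-mono-≤ (𝟙≤1 (goldL? u i)) (𝟙≤1 (goldR? w j))

      out : {Y : Set} (ys : List Y) (f : Y → ℕ) → ∑ ys (λ y → 2 * (N * (N * f y))) ≡ 2 * (N * (N * ∑ ys f))
      out ys f = trans (∑-*ˡ ys 2 _) (cong (2 *_) (trans (∑-*ˡ ys N _) (cong (N *_) (∑-*ˡ ys N f))))

      pull : ∀ q v c r x y h → q * q * (v * v) * (c * c * (r * r) * (x * y)) * h
             ≡ c * c * (r * r * (q * x * (q * y) * (v * (v * h))))
      pull = solve-∀
      pull₂ : ∀ c r x y v → c * (r * (6 * x * (6 * y) * v)) ≡ 36 * (c * (r * (x * y * v)))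
      pull₂ = solve-∀

      copies : ∀ n (x : ℕ) → ∑ (cartesianProduct (allFin n) (allFin n)) (λ _ → x) ≡ n * n * x
      copies n x = trans (∑-const (cartesianProduct (allFin n) (allFin n)) x)
        (cong (_* x) (trans (length-× (allFin n) (allFin n)) (cong₂ _*_ (length-allFin n) (length-allFin n))))

      unfold : ∑ CC (λ ab → ∑ RR (λ pp → ∑ golds (λ π → weight π * (V * (V * Hn))))) ≡ c * c * (r * r * (GL * GR * (V * (V * Hn))))
      unfold = trans (copies c _) (cong (c * c *_) (trans (copies r _) (cong (r * r *_)
        (trans (∑-*ʳ golds (V * (V * Hn)) weight) (cong (_* (V * (V * Hn))) ∑-weight)))))

      reorder : ∑ CC (λ ab → ∑ RR (λ pp → ∑ golds (S ab pp))) ≡ ∑ Hs (λ h → ∑ draws (X h))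
      reorder = sym (trans (∑-swap Hs draws X) (trans (∑-× QQ SS _) (trans (∑-cong QQ (λ uw → trans (∑-cong SS (λ AB →
          trans (∑-swap Hs places _) (trans (∑-× CC (cartesianProduct RR NN) _) (∑-cong CC (λ ab → ∑-× RR NN _)))))
        (trans (∑-swap SS CC _) (∑-cong CC (λ ab → trans (∑-swap SS RR _) (∑-cong RR (λ pp → ∑-swap SS NN _)))))))
        (trans (∑-swap QQ CC _) (∑-cong CC (λ ab → trans (∑-swap QQ RR _) (∑-cong RR (λ pp → sym (∑-× QQ NN _)))))))))

  -- The second moment

  Ends Times : Set
  Ends = Fin N × Fin N
  Times = Fin r × Fin r

  visits : Gold → Ends → Times → HashFun M N → List (Fin N)
  visits ((u , w) , _) (s , t) (p , p′) h = visited (zz u w) z* h s (suc (toℕ p)) ++ visited (zz u w) z* h t (suc (toℕ p′))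

  abstract
    hit : Gold → Ends → Times → HashFun M N → ℕ
    hit ((u , w) , (i , j)) (s , t) (p , p′) h = 𝟙 (hit? (zz u w) z* s (toℕ p) i t (toℕ p′) j h)

    hit-def : ∀ u w i j s t p p′ h → 𝟙 (hit? (zz u w) z* s (toℕ p) i t (toℕ p′) j h) ≡ hit ((u , w) , (i , j)) (s , t) (p , p′) h
    hit-def u w i j s t p p′ h = refl

    seen : Gold → Ends → Times → Fin N → HashFun M N → ℕ
    seen π st o v h = 𝟙 (_∈?_ Fin._≟_ v (visits π st o h))

    seen-def : ∀ π st o v h → 𝟙 (_∈?_ Fin._≟_ v (visits π st o h)) ≡ seen π st o v h
    seen-def π st o v h = refl

  ends : (Starts × Starts) × (Fin c × Fin c) → Ends
  ends ((A , B) , (a , b)) = from A a , from B b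

  -- For the upper bound a success is weakened to a clean hit, which involves only the two
  -- successful chains and forgets all others.
  found-hit : ∀ uw AB h ab pp ij → 𝟙 (found? (uw , AB) h (ab , pp , ij)) ≤ weight (uw , ij) * hit (uw , ij) (ends (AB , ab)) pp h
  found-hit (u , w) (A , B) h (a , b) (p , p′) (i , j) = ≤-trans
    (𝟙-mono (found? ((u , w) , (A , B)) h ((a , b) , (p , p′) , (i , j)))
      ((goldL? u i ×-dec goldR? w j) ×-dec hit? (zz u w) z* s (toℕ p) i t (toℕ p′) j h) to)
    (≤-reflexive (trans (𝟙-× (goldL? u i ×-dec goldR? w j) _) (cong₂ _*_ (𝟙-× (goldL? u i) (goldR? w j)) (hit-def u w i j s t p p′ h))))
    where
    s = from A a
    t = from B b
    z = zz u w

    to : Found ((u , w) , (A , B)) h ((a , b) , (p , p′) , (i , j)) →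
         IsGold u w i j
         × Hit z z* s (toℕ p) i t (toℕ p′) j h
    to (gold , und , e , e′) = gold ,
      ((fresh-acc z h t P′ tr-a ab , fresh-apart z h s P tr-i ia (z*∈ gold h _)) ,
       (fresh-[] t P′ tr-i ib , fresh-apart z h t P′ tr-i ib (z*∈ gold h _)) ,
       (λ x x∈ → fresh-apart z h t P′ tr-a ab x∈)) , e , e′
      where
      open Run.Undisturbed und
      P = suc (toℕ p)
      P′ = suc (toℕ p′)
      tr-a = trace z h s P []
      tr-i = trace z h i (suc (r ∸ toℕ p)) []

      fresh-[] : ∀ v l acc → Fresh (trace z h v l acc) → Fresh (trace z h v l [])
      fresh-[] v zero    acc f       = tt
      fresh-[] v (suc l) acc (n , f) = (λ k → n (trace-[] z h v l acc k)) , fresh-[] v l acc f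

  -- The hits of all runs whose chains start at the two vertices.
  Z : Ends → HashFun M N → ℕ
  Z st h = ∑ golds (λ π → weight π * ∑ RR (λ o → hit π st o h))

  ∑-*-Z : (f : HashFun M N → ℕ) (st : Ends) →
          ∑ Hs (λ h → f h * Z st h) ≡ ∑ golds (λ π → weight π * ∑ RR (λ o → ∑ Hs (λ h → f h * hit π st o h)))
  ∑-*-Z f st = trans (∑-factor Hs golds f _) (∑-cong golds (λ π → trans (∑-cong Hs (λ h → *-swap (f h) (weight π) _))
    (trans (∑-*ˡ Hs (weight π) _) (cong (weight π *_) (∑-factor Hs RR f _)))))

  m₂ = (2 * q * mL z*) * (2 * q * mR z*)

  module _ (π : Gold) (st : Ends) (o : Times) where

    private
      first : HashFun M N → ℕ
      first = hit π st o

      vs = visits π st o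

      -- The two summands count the new queries and the queries of the first run that may lead to v.
      ways : Fin N → HashFun M N → ℕ
      ways v h = r + N * seen π st o v h

      length-vs : ∀ h → length (vs h) ≤ 2 * r
      length-vs h = ≡-≤ (trans (length-++ (visited z z* h s (suc (toℕ p)))) (cong₂ _+_ (length-visited z z* h s (suc (toℕ p))) (length-visited z z* h t (suc (toℕ p′)))))
        (≤-≡ (+-mono-≤ (toℕ<n p) (toℕ<n p′)) (cong (r +_) (sym (+-identityʳ r))))
        where
        z = zz (proj₁ (proj₁ π)) (proj₂ (proj₁ π))
        s = proj₁ st
        t = proj₂ st
        p = proj₁ o
        p′ = proj₂ o

      -- 3 r = r + 2 r: a new query may occur at r times, and the first run visits at most 2 r
      -- vertices. A visited vertex is gold in the second run only if the new shift gives it an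
      -- index with value z*.
      few-ways : ∀ (ζ : Fin N → Fin M) b h → ∑ (allFin q) (λ u → ∑ (allFin N) (λ i → 𝟙 (gold? ζ b u i) * ways i h)) ≤ 3 * r * (2 * q * m ζ b)
      few-ways ζ b h = begin
        ∑ Qs (λ u → ∑ Ns (λ i → G u i * ways i h))
          ≡⟨ ∑-cong Qs (λ u → trans (∑-cong Ns (λ i → trans (*-distribˡ-+ (G u i) r _) (cong₂ _+_ (*-comm (G u i) r) (*-swap (G u i) N _))))
               (trans (∑-+ Ns _ _) (cong₂ _+_ (∑-*ˡ Ns r _) (∑-*ˡ Ns N _)))) ⟩
        ∑ Qs (λ u → r * ∑ Ns (G u) + N * ∑ Ns (λ i → G u i * seen π st o i h))
          ≡⟨ trans (∑-+ Qs _ _) (cong₂ _+_ (∑-*ˡ Qs r _) (∑-*ˡ Qs N _)) ⟩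
        r * ∑ Qs (λ u → ∑ Ns (G u)) + N * ∑ Qs (λ u → ∑ Ns (λ i → G u i * seen π st o i h))
          ≡⟨ cong (λ x → r * ∑ Qs (λ u → ∑ Ns (G u)) + N * x) (∑-cong Qs (λ u → ∑-cong Ns (λ i → cong (G u i *_) (seen-def π st o i h)))) ⟨
        r * ∑ Qs (λ u → ∑ Ns (G u)) + N * ∑ Qs (λ u → ∑ Ns (λ i → G u i * 𝟙 (_∈?_ Fin._≟_ i (vs h))))
          ≤⟨ +-mono-≤ (*-monoʳ-≤ r (upper ζ b)) (≤-trans (upper-among ζ b (vs h)) (*-monoˡ-≤ _ (length-vs h))) ⟩
        r * (2 * q * m ζ b) + 2 * r * (2 * q * m ζ b)
          ≡⟨ collect r (2 * q * m ζ b) ⟩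
        3 * r * (2 * q * m ζ b) ∎
        where
        Qs = allFin q
        Ns = allFin N
        G : Fin q → Fin N → ℕ
        G u i = 𝟙 (gold? ζ b u i)
        collect : ∀ r x → r * x + 2 * r * x ≡ 3 * r * x
        collect = solve-∀

      pair-hit : (st′ : Ends) (π′@(_ , (i , j)) : Gold) →
        weight π′ * (N * (N * ∑ RR (λ o′ → ∑ Hs (λ h → first h * hit π′ st′ o′ h))))
        ≤ weight π′ * ∑ Hs (λ h → first h * (ways i h * ways j h))
      pair-hit (s′ , t′) ((u , w) , (i , j)) = gold-pair {u} {w} {i} {j} λ gl gr → subst₂ _≤_
        (cong (λ x → N * (N * x)) (∑-cong RR (λ { (p , p′) → ∑-cong Hs (λ h → cong₂ _*_ (first-def h) (hit-def u w i j s′ t′ p p′ h)) })))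
        (∑-cong Hs (λ h → cong₂ _*_ (first-def h) (cong₂ (λ x y → (r + N * x) * (r + N * y)) (seen-def π st o i h) (seen-def π st o j h))))
        (TwoRuns.both-hit (record { r = r ; z* = z* ; z₁ = zz (proj₁ (proj₁ π)) (proj₂ (proj₁ π)) ; z₂ = zz u w
          ; s₁ = proj₁ st ; t₁ = proj₂ st ; i₁ = proj₁ (proj₂ π) ; j₁ = proj₂ (proj₂ π) ; s₂ = s′ ; t₂ = t′ ; i₂ = i ; j₂ = j
          ; p₁ = toℕ (proj₁ o) ; q₁ = toℕ (proj₂ o)
          ; z₂-i₂ = proj₁ (gold-zz u w (gl , gr)) ; z₂-j₂ = proj₂ (gold-zz u w (gl , gr)) }))
        where
        first-def : ∀ h → _ ≡ first h
        first-def h = hit-def _ _ _ _ _ _ _ _ h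

    first-and-Z : ∀ st′ → N * (N * ∑ Hs (λ h → first h * Z st′ h)) ≤ 9 * (r * r * m₂) * ∑ Hs first
    first-and-Z st′ = begin
      N * (N * ∑ Hs (λ h → first h * Z st′ h))
        ≡⟨ cong (λ s → N * (N * s)) (∑-*-Z first st′) ⟩
      N * (N * ∑ golds (λ π′ → weight π′ * S π′))
        ≡⟨ trans (cong (N *_) (into N S)) (into N (λ π′ → N * S π′)) ⟩
      ∑ golds (λ π′ → weight π′ * (N * (N * S π′)))
        ≤⟨ ∑-mono golds (λ π′ → pair-hit st′ π′) ⟩
      ∑ golds (λ π′@(_ , (i , j)) → weight π′ * ∑ Hs (λ h → first h * (ways i h * ways j h)))
        ≡⟨ trans (∑-factor golds Hs weight _) (∑-cong Hs (λ h → trans (∑-cong golds (λ π′ → *-swap (weight π′) (first h) _)) (∑-*ˡ golds (first h) _))) ⟩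
      ∑ Hs (λ h → first h * ∑ golds (λ π′@(_ , (i , j)) → weight π′ * (ways i h * ways j h)))
        ≤⟨ ∑-mono Hs (λ h → *-monoʳ-≤ (first h) (≡-≤ (separate (λ i → ways i h) (λ j → ways j h))
             (*-mono-≤ (few-ways zL true h) (few-ways zR false h)))) ⟩
      ∑ Hs (λ h → first h * (3 * r * (2 * q * mL z*) * (3 * r * (2 * q * mR z*))))
        ≡⟨ ∑-*ʳ Hs _ first ⟩
      ∑ Hs first * (3 * r * (2 * q * mL z*) * (3 * r * (2 * q * mR z*)))
        ≡⟨ rearrange (∑ Hs first) r (2 * q * mL z*) (2 * q * mR z*) ⟩
      9 * (r * r * m₂) * ∑ Hs first ∎
      where
      S : Gold → ℕ
      S π′ = ∑ RR (λ o′ → ∑ Hs (λ h → first h * hit π′ st′ o′ h))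
      into : ∀ k (f : Gold → ℕ) → k * ∑ golds (λ π′ → weight π′ * f π′) ≡ ∑ golds (λ π′ → weight π′ * (k * f π′))
      into k f = trans (sym (∑-*ˡ golds k _)) (∑-cong golds (λ π′ → *-swap k (weight π′) _))
      rearrange : ∀ f r x y → f * (3 * r * x * (3 * r * y)) ≡ 9 * (r * r * (x * y)) * f
      rearrange = solve-∀

  Z-pairs : ∀ st st′ → N * (N * (N * N)) * ∑ Hs (λ h → Z st h * Z st′ h) ≤ 9 * (r * r * m₂) * (r * r * m₂) * Hn
  Z-pairs st st′ = begin
    k * ∑ Hs (λ h → Z st h * Z st′ h)
      ≡⟨ cong (k *_) (trans (∑-cong Hs (λ h → *-comm (Z st h) _)) (∑-*-Z (Z st′) st)) ⟩
    k * ∑ golds (λ π → weight π * ∑ RR (T π))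
      ≡⟨ trans (sym (∑-*ˡ golds k _)) (∑-cong golds (λ π → trans (*-swap k (weight π) _) (cong (weight π *_) (sym (∑-*ˡ RR k _))))) ⟩
    ∑ golds (λ π → weight π * ∑ RR (λ o → k * T π o))
      ≤⟨ ∑-mono golds (λ π → *-monoʳ-≤ (weight π) (≤-≡ (∑-bound RR _ (bound π)) (cong (_* C) length-RR))) ⟩
    ∑ golds (λ π → weight π * (r * r * C))
      ≡⟨ trans (∑-*ʳ golds (r * r * C) weight) (cong (_* (r * r * C)) ∑-weight) ⟩
    GL * GR * (r * r * C)
      ≤⟨ *-monoˡ-≤ (r * r * C) (*-mono-≤ (upper zL true) (upper zR false)) ⟩
    m₂ * (r * r * C)
      ≡⟨ rearrange m₂ r Hn ⟩
    9 * (r * r * m₂) * (r * r * m₂) * Hn ∎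
    where
    k = N * (N * (N * N))
    C = 9 * (r * r * m₂) * Hn

    T : Gold → Times → ℕ
    T π o = ∑ Hs (λ h → Z st′ h * hit π st o h)

    length-RR : length RR ≡ r * r
    length-RR = trans (length-× (allFin r) (allFin r)) (cong₂ _*_ (length-allFin r) (length-allFin r))

    rearrange : ∀ m r h → m * (r * r * (9 * (r * r * m) * h)) ≡ 9 * (r * r * m) * (r * r * m) * h
    rearrange = solve-∀

    bound : ∀ π o → k * T π o ≤ C
    bound π@((u , w) , (i , j)) o@(p , p′) = begin
      k * T π o
        ≡⟨ trans (assoc N (T π o)) (cong (λ x → N * (N * (N * (N * x)))) (∑-cong Hs (λ h → *-comm (Z st′ h) _))) ⟩
      N * (N * (N * (N * ∑ Hs (λ h → hit π st o h * Z st′ h))))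
        ≤⟨ *-monoʳ-≤ N (*-monoʳ-≤ N (first-and-Z π st o st′)) ⟩
      N * (N * (9 * (r * r * m₂) * ∑ Hs (hit π st o)))
        ≡⟨ out N (9 * (r * r * m₂)) _ ⟩
      9 * (r * r * m₂) * (N * (N * ∑ Hs (hit π st o)))
        ≤⟨ *-monoʳ-≤ (9 * (r * r * m₂)) (≡-≤ (cong (λ x → N * (N * x)) (∑-cong Hs (λ h → sym (hit-def u w i j _ _ p p′ h))))
             (hit-bound (zz u w) z* (proj₁ st) (toℕ p) i (proj₂ st) (toℕ p′) j)) ⟩
      C ∎
      where
      assoc : ∀ n t → n * (n * (n * n)) * t ≡ n * (n * (n * (n * t)))
      assoc = solve-∀
      out : ∀ n a f → n * (n * (a * f)) ≡ a * (n * (n * f))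
      out = solve-∀

  chains : List ((Starts × Starts) × (Fin c × Fin c))
  chains = cartesianProduct SS CC

  draws-hits : ∀ h → ∑ draws (X h) ≤ ∑ chains (λ κ → Z (ends κ) h)
  draws-hits h = begin
    ∑ draws (X h)
      ≡⟨ ∑-× QQ SS (X h) ⟩
    ∑ QQ (λ uw → ∑ SS (λ AB → X h (uw , AB)))
      ≤⟨ ∑-mono QQ (λ uw → ∑-mono SS (λ AB → bound uw AB)) ⟩
    ∑ QQ (λ uw → ∑ SS (λ AB → ∑ CC (λ ab → g uw (AB , ab))))
      ≡⟨ trans (∑-cong QQ (λ uw → sym (∑-× SS CC (g uw)))) (∑-swap QQ chains g) ⟩
    ∑ chains (λ κ → ∑ QQ (λ uw → g uw κ))
      ≡⟨ ∑-cong chains (λ κ → sym (∑-× QQ NN _)) ⟩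
    ∑ chains (λ κ → Z (ends κ) h) ∎
    where
    g : Fin q × Fin q → (Starts × Starts) × (Fin c × Fin c) → ℕ
    g uw κ = ∑ NN (λ ij → weight (uw , ij) * ∑ RR (λ o → hit (uw , ij) (ends κ) o h))

    bound : ∀ uw AB → X h (uw , AB) ≤ ∑ CC (λ ab → g uw (AB , ab))
    bound uw AB = ≡-≤ (∑-× CC (cartesianProduct RR NN) _) (∑-mono CC (λ ab → ≡-≤ (trans (∑-× RR NN _) (∑-swap RR NN _))
      (∑-mono NN (λ ij → ≤-≡ (∑-mono RR (λ pp → found-hit uw AB h ab pp ij)) (∑-*ˡ RR (weight (uw , ij)) _)))))

  -- 144 = 9 · 16, where 9 comes from the two factors 3 r of `few-ways` and 16 from four shifts,
  -- each uniform up to a factor 2.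
  second-moment : N * (N * (N * N)) * ∑ Hs (λ h → ∑ draws (X h) * ∑ draws (X h)) ≤ 144 * (B * Γ) * (B * Γ) * Hn
  second-moment = begin
    N * (N * (N * N)) * ∑ Hs (λ h → ∑ draws (X h) * ∑ draws (X h))
      ≤⟨ *-monoʳ-≤ (N * (N * (N * N))) (∑-mono Hs (λ h → *-mono-≤ (draws-hits h) (draws-hits h))) ⟩
    N * (N * (N * N)) * ∑ Hs (λ h → ∑ chains (λ κ → Z (ends κ) h) * ∑ chains (λ κ → Z (ends κ) h))
      ≤⟨ ∑-square Hs chains (λ h κ → Z (ends κ) h) (N * (N * (N * N))) _ (λ κ κ′ → Z-pairs (ends κ) (ends κ′)) ⟩
    length chains * (length chains * (9 * (r * r * m₂) * (r * r * m₂) * Hn))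
      ≡⟨ cong (λ l → l * (l * (9 * (r * r * m₂) * (r * r * m₂) * Hn))) (trans (length-× SS CC) (cong₂ _*_ (length-× starts starts)
           (trans (length-× (allFin c) (allFin c)) (cong₂ _*_ (length-allFin c) (length-allFin c))))) ⟩
    V * V * (c * c) * (V * V * (c * c) * (9 * (r * r * m₂) * (r * r * m₂) * Hn))
      ≡⟨ trans (collect q V c r (mL z*) (mR z*) Hn) (cong (λ b → 144 * (b * Γ) * (b * Γ) * Hn) (sym B≡)) ⟩
    144 * (B * Γ) * (B * Γ) * Hn ∎
    where
    collect : ∀ q v c r x y h → let m₂ = 2 * q * x * (2 * q * y) ; G = c * c * (r * r) * (x * y) in
      v * v * (c * c) * (v * v * (c * c) * (9 * (r * r * m₂) * (r * r * m₂) * h))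
      ≡ 144 * (q * q * (v * v) * G) * (q * q * (v * v) * G) * h
    collect = solve-∀

  -- The success probability at a suitable scale

  ℓ γ : ℕ
  ℓ = suc r
  γ = mL z* + mR z*

  open Repeat Hs draws X X≤1 using (p; H; hits-likely; likely-mono)

  -- `enough` and `few` place c γ at the order of cmax; only for c = 1 may it exceed cmax
  -- substantially, and then the general bound on γ has to do.
  module _ (cmax : ℕ) (F₂≤ : ∑ (allFin N) (mL ∘ zL) + ∑ (allFin N) (mR ∘ zR) ≤ 16 * N) (1≤mL : 1 ≤ mL z*) (1≤mR : 1 ≤ mR z*)
           (1≤r : 1 ≤ r) (root : C₀ * cmax * (ℓ * ℓ) ≤ N) (wide : 16 * cmax ≤ N)
           (c≤cmax : c ≤ cmax) (enough : 2 * cmax ≤ 3 * (c * γ)) (few : c * γ ≤ 2 * cmax ⊎ c ≡ 1) where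

    square≤ : ∀ {n} (z : Fin N → Fin n) (x : Fin n) (μ : Fin n → ℕ) → (∀ y → μ y ≡ ∑ (allFin N) (λ v → 𝟙 (z v Fin.≟ y))) →
      μ x * μ x ≤ ∑ (allFin N) (μ ∘ z)
    square≤ {n} z x μ e = ≤-≡ (≤-≡ (∑-∈ (allFin n) (λ y → μ y * μ y) (∈-allFin x))
      (∑-cong (allFin n) (λ y → cong (_* μ y) (e y)))) (sym (∑-fibres z μ))

    -- A single value contributes the square of its multiplicity to the second frequency moment.
    γ²≤ : γ * γ ≤ 32 * N
    γ²≤ = begin
      γ * γ ≤⟨ square-sum (mL z*) (mR z*) ⟩
      2 * (mL z* * mL z* + mR z* * mR z*) ≤⟨ *-monoʳ-≤ 2 (+-mono-≤ (square≤ zL z* mL (λ _ → refl)) (square≤ zR z* mR (λ _ → refl))) ⟩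
      2 * (∑ (allFin N) (mL ∘ zL) + ∑ (allFin N) (mR ∘ zR)) ≤⟨ *-monoʳ-≤ 2 F₂≤ ⟩
      2 * (16 * N) ≡⟨ *-assoc 2 16 N ⟨
      32 * N ∎

    cℓ² : 196608 * (c * (ℓ * ℓ)) ≤ N
    cℓ² = begin
      196608 * (c * (ℓ * ℓ)) ≤⟨ *-mono-≤ (≤-trans (≤ᵇ⇒≤ 196608 2097152 tt) C₀≥) (*-monoˡ-≤ (ℓ * ℓ) c≤cmax) ⟩
      C₀ * (cmax * (ℓ * ℓ)) ≡⟨ *-assoc C₀ cmax (ℓ * ℓ) ⟨
      C₀ * cmax * (ℓ * ℓ) ≤⟨ root ⟩
      N ∎

    cℓγ : 256 * (c * (ℓ * γ)) ≤ N
    cℓγ = by few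
      where
      by : c * γ ≤ 2 * cmax ⊎ c ≡ 1 → 256 * (c * (ℓ * γ)) ≤ N
      by (inj₁ le) = begin
        256 * (c * (ℓ * γ)) ≡⟨ cong (256 *_) (*-swap c ℓ γ) ⟩
        256 * (ℓ * (c * γ)) ≤⟨ *-monoʳ-≤ 256 (*-mono-≤ (m≤m*n ℓ ℓ) le) ⟩
        256 * (ℓ * ℓ * (2 * cmax)) ≡⟨ regroup (ℓ * ℓ) cmax ⟩
        512 * (cmax * (ℓ * ℓ)) ≤⟨ *-monoˡ-≤ (cmax * (ℓ * ℓ)) (≤-trans (≤ᵇ⇒≤ 512 2097152 tt) C₀≥) ⟩
        C₀ * (cmax * (ℓ * ℓ)) ≡⟨ *-assoc C₀ cmax (ℓ * ℓ) ⟨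
        C₀ * cmax * (ℓ * ℓ) ≤⟨ root ⟩
        N ∎
        where
        regroup : ∀ a b → 256 * (a * (2 * b)) ≡ 512 * (b * a)
        regroup = solve-∀
      -- With one chain in each phase, γ is only known to be at most the root of 32 N. Squaring the
      -- claim gives the factor 256² · 32, which `C₀` covers.
      by (inj₂ e) = ≡-≤ (cong (256 *_) (trans (cong (_* (ℓ * γ)) e) (*-identityˡ _))) (square-≤ (begin
        256 * (ℓ * γ) * (256 * (ℓ * γ)) ≡⟨ r₁ 256 ℓ γ ⟩
        65536 * (ℓ * ℓ * (γ * γ)) ≤⟨ *-monoʳ-≤ 65536 (*-monoʳ-≤ (ℓ * ℓ) γ²≤) ⟩
        65536 * (ℓ * ℓ * (32 * N)) ≡⟨ r₂ 65536 (ℓ * ℓ) 32 N ⟩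
        2097152 * (ℓ * ℓ) * N ≤⟨ *-monoˡ-≤ N (≤-trans (*-monoˡ-≤ (ℓ * ℓ) (≤-trans C₀≥ (m≤m*n C₀ cmax {{>-nonZero (≤-trans (>-nonZero⁻¹ c) c≤cmax)}}))) root) ⟩
        N * N ∎))
        where
        r₁ : ∀ x l g → x * (l * g) * (x * (l * g)) ≡ x * x * (l * l * (g * g))
        r₁ = solve-∀
        r₂ : ∀ x a y n → x * (a * (y * n)) ≡ x * y * a * n
        r₂ = solve-∀

    16c≤N : 16 * c ≤ N
    16c≤N = ≤-trans (*-monoʳ-≤ 16 c≤cmax) wide

    κ : ℕ
    κ = suc (N / cells)

    8cκ : 8 * (c * κ) ≤ N
    8cκ = *-cancelˡ-≤ 2 (begin
      2 * (8 * (c * κ)) ≡⟨ r₁ c (N / cells) ⟩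
      16 * c + N / cells * cells ≤⟨ +-mono-≤ 16c≤N (m/n*n≤m N cells) ⟩
      N + N ≡⟨ cong (N +_) (sym (+-identityʳ N)) ⟩
      2 * N ∎)
      where
      r₁ : ∀ c x → 2 * (8 * (c * suc x)) ≡ 16 * c + x * (16 * c)
      r₁ = solve-∀

    -- The terms fall into collisions between random walks, collisions with the walk from i, and
    -- clashes of table cells. Each group is at most N² / 4.
    calm : 2 * disturbance N c r γ (32 * N) κ ≤ N * N
    calm = begin
      2 * disturbance N c r γ (32 * N) κ
        ≤⟨ *-monoʳ-≤ 2 (+-monoˡ-≤ _ (m≤n*m (T₂ + (T₁ + T₁)) c)) ⟩
      2 * (c * (T₂ + (T₁ + T₁)) + (c * (T₁ + (T₂ + T₂)) + (c * (T₁ + (T₂ + T₂)) + c * (N * κ))))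
        ≡⟨ r₁ N c (4 * ℓ) γ κ 32 ⟩
      N * (96 * (c * (4 * ℓ * (4 * ℓ) * 32)) + 16 * (c * (4 * ℓ * γ)) + 2 * (c * κ))
        ≡⟨ cong (N *_) (cong₂ (λ x y → x + y + 2 * (c * κ)) (r₄ 96 c 4 ℓ 32) (r₅ 16 c 4 ℓ γ)) ⟩
      N * (49152 * (c * (ℓ * ℓ)) + 64 * (c * (ℓ * γ)) + 2 * (c * κ))
        ≤⟨ *-monoʳ-≤ N (*-cancelˡ-≤ 4 fourfold) ⟩
      N * N ∎
      where
      T₁ = 2 * (4 * ℓ * (N * γ + 4 * ℓ * (32 * N)))
      T₂ = 8 * (4 * ℓ * (4 * ℓ) * (32 * N))
      r₁ : ∀ n c d g k f → let T₁ = 2 * (d * (n * g + d * (f * n))) ; T₂ = 8 * (d * d * (f * n)) in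
        2 * (c * (T₂ + (T₁ + T₁)) + (c * (T₁ + (T₂ + T₂)) + (c * (T₁ + (T₂ + T₂)) + c * (n * k))))
        ≡ n * (96 * (c * (d * d * f)) + 16 * (c * (d * g)) + 2 * (c * k))
      r₁ = solve-∀
      r₄ : ∀ x c y l z → x * (c * (y * l * (y * l) * z)) ≡ x * (y * y * z) * (c * (l * l))
      r₄ = solve-∀
      r₅ : ∀ x c y l g → x * (c * (y * l * g)) ≡ x * y * (c * (l * g))
      r₅ = solve-∀
      fourfold : 4 * (49152 * (c * (ℓ * ℓ)) + 64 * (c * (ℓ * γ)) + 2 * (c * κ)) ≤ 4 * N
      fourfold = begin
        4 * (49152 * (c * (ℓ * ℓ)) + 64 * (c * (ℓ * γ)) + 2 * (c * κ)) ≡⟨ r₂ 4 49152 (c * (ℓ * ℓ)) 64 (c * (ℓ * γ)) 2 (c * κ) ⟩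
        196608 * (c * (ℓ * ℓ)) + 256 * (c * (ℓ * γ)) + 8 * (c * κ) ≤⟨ +-mono-≤ (+-mono-≤ cℓ² cℓγ) 8cκ ⟩
        N + N + N ≤⟨ m≤m+n _ N ⟩
        N + N + N + N ≡⟨ r₃ N ⟩
        4 * N ∎
        where
        r₂ : ∀ w a x b y c z → w * (a * x + b * y + c * z) ≡ w * a * x + w * b * y + w * c * z
        r₂ = solve-∀
        r₃ : ∀ n → n + n + n + n ≡ 4 * n
        r₃ = solve-∀

    first : B * Γ * Hn ≤ 72 * (N * (N * ∑ Hs p))
    first = X-likely γ (32 * N) κ ≤-refl (≤-≡ (*-monoʳ-≤ 2 F₂≤) (sym (*-assoc 2 16 N))) (cell-count N cells) calm

    1≤mLmR : 1 ≤ mL z* * mR z*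
    1≤mLmR = *-mono-≤ 1≤mL 1≤mR

    instance
      Γ≢0 : NonZero (Γ * 10368)
      Γ≢0 = >-nonZero (*-mono-≤ {1} {Γ} {1} {10368} (*-mono-≤ {1} {c * c * (r * r)} {1} (*-mono-≤ {1} {c * c} {1} (*-mono-≤ (>-nonZero⁻¹ c) (>-nonZero⁻¹ c)) (*-mono-≤ 1≤r 1≤r)) 1≤mLmR) (s≤s z≤n))

    -- 10368 = 72 · 144 is the product of the moment constants. It is below 256², so Γ is controlled
    -- by the square of `cℓγ`.
    Γ≤ : Γ * 10368 ≤ N * N
    Γ≤ = begin
      Γ * 10368 ≤⟨ *-mono-≤ (*-mono-≤ (*-monoʳ-≤ (c * c) (*-mono-≤ (n≤1+n r) (n≤1+n r))) (*-mono-≤ (m≤m+n (mL z*) (mR z*)) (m≤n+m (mR z*) (mL z*)))) (≤ᵇ⇒≤ 10368 65536 tt) ⟩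
      c * c * (ℓ * ℓ) * (γ * γ) * 65536 ≡⟨ r₁ 256 c ℓ γ ⟩
      256 * (c * (ℓ * γ)) * (256 * (c * (ℓ * γ))) ≤⟨ *-mono-≤ cℓγ cℓγ ⟩
      N * N ∎
      where
      r₁ : ∀ x c l g → c * c * (l * l) * (g * g) * (x * x) ≡ x * (c * (l * g)) * (x * (c * (l * g)))
      r₁ = solve-∀

    -- The number of runs whose expected number of successes is constant.
    R₀ : ℕ
    R₀ = N * N / (Γ * 10368)

    -- The program cannot know Γ and derives its number of runs from cmax ℓ² c. This is O(Γ), since
    -- mL mR ≥ γ / 2 for positive factors, r ≥ ℓ / 2, and `enough` holds.
    Γ≥ : cmax * ℓ * ℓ * c ≤ Γ * 10368
    Γ≥ = begin
      cmax * ℓ * ℓ * c ≤⟨ m≤n*m _ 2 ⟩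
      2 * (cmax * ℓ * ℓ * c) ≡⟨ r₁ cmax ℓ c ⟩
      2 * cmax * (ℓ * ℓ * c) ≤⟨ *-mono-≤ enough (*-monoˡ-≤ c (*-mono-≤ ℓ≤2r ℓ≤2r)) ⟩
      3 * (c * γ) * (2 * r * (2 * r) * c) ≤⟨ *-monoˡ-≤ (2 * r * (2 * r) * c) (*-monoʳ-≤ 3 (*-monoʳ-≤ c (sum≤product (mL z*) (mR z*) 1≤mL 1≤mR))) ⟩
      3 * (c * (2 * (mL z* * mR z*))) * (2 * r * (2 * r) * c) ≡⟨ r₂ c (mL z*) (mR z*) r ⟩
      Γ * 24 ≤⟨ *-monoʳ-≤ Γ (≤ᵇ⇒≤ 24 10368 tt) ⟩
      Γ * 10368 ∎
      where
      r₁ : ∀ a l c → 2 * (a * l * l * c) ≡ 2 * a * (l * l * c)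
      r₁ = solve-∀
      r₂ : ∀ c x y r → 3 * (c * (2 * (x * y))) * (2 * r * (2 * r) * c) ≡ c * c * (r * r) * (x * y) * 24
      r₂ = solve-∀
      ℓ≤2r : ℓ ≤ 2 * r
      ℓ≤2r = ≤-≡ (+-monoˡ-≤ r 1≤r) (cong (r +_) (sym (+-identityʳ r)))
      sum≤product : ∀ x y → 1 ≤ x → 1 ≤ y → x + y ≤ 2 * (x * y)
      sum≤product (suc x) (suc y) _ _ = ≤-≡ (m≤m+n _ (x + y + 2 * (x * y))) (r₃ x y)
        where
        r₃ : ∀ x y → suc x + suc y + (x + y + 2 * (x * y)) ≡ 2 * (suc x * suc y)
        r₃ = solve-∀

    likely₀ : Hn * B ^ R₀ ≤ loss * ∑ Hs (H R₀)
    likely₀ = subst (λ x → Hn * B ^ R₀ ≤ x * ∑ Hs (H R₀)) loss-def (hits-likely N Γ R₀ 72 144 first second-moment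
        (≡-≤ (*-assoc R₀ Γ 10368) (m/n*n≤m (N * N) (Γ * 10368)))
        (begin
          N * N ≡⟨ m≡m%n+[m/n]*n (N * N) (Γ * 10368) ⟩
          N * N % (Γ * 10368) + R₀ * (Γ * 10368) ≤⟨ +-monoˡ-≤ _ (≤-trans (<⇒≤ (m%n<n (N * N) (Γ * 10368))) (m≤n*m (Γ * 10368) R₀ {{>-nonZero (m≥n⇒m/n>0 Γ≤)}})) ⟩
          R₀ * (Γ * 10368) + R₀ * (Γ * 10368) ≡⟨ r₁ R₀ Γ ⟩
          2 * (R₀ * Γ * 10368) ∎))
      where
      r₁ : ∀ R g → R * (g * 10368) + R * (g * 10368) ≡ 2 * (R * g * 10368)
      r₁ = solve-∀

    likely : ∀ .{{_ : NonZero (cmax * ℓ * ℓ * c)}} R → N * N / (cmax * ℓ * ℓ * c) ≤ R → Hn * B ^ R ≤ loss * ∑ Hs (H R)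
    likely R R≥ = likely-mono {R₀} {R} {loss} (≤-trans (/-monoʳ-≤ (N * N) Γ≥) R≥) likely₀

-- The machine with a random tape

-- Memories are functions on all addresses, and the random words are consumed from a tape, so that the outcome
-- does not depend on the times at which they are drawn.
record State : Set where
  constructor state
  field
    program : List Instr
    mem     : ℕ → ℕ
    tape    : List ℕ

open State public

module Taped (W S : ℕ) (ε : Env) where

  open Machine W S

  wd : ℤ → ℕ
  wd x = toℕ (word x)

  private instance
    2^W≢0 : NonZero (2 ^ W)
    2^W≢0 = m^n≢0 2 W

  wd-+ : ∀ x → wd (ℤ.+ x) ≡ x % 2 ^ W
  wd-+ x = toℕ-fromℕ< _

  wd-small : ∀ {x} → x < 2 ^ W → wd (ℤ.+ x) ≡ x
  wd-small {x} lt = trans (wd-+ x) (m<n⇒m%n≡m lt)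

  -- A write beyond the memory stores 0, which is what a later read there yields.
  upd : (ℕ → ℕ) → ℕ → ℕ → (ℕ → ℕ)
  upd ρ d v a = if a ≡ᵇ d then (if d <ᵇ S then v else 0) else ρ a

  pick : {A : Set} → ℕ → A → A → A
  pick zero    x y = y
  pick (suc _) x y = x

  astep : State → State
  astep (state []                    ρ τ)       = state [] ρ τ
  astep (state (const d c     ∷ κ) ρ τ)       = state κ (upd ρ d (wd (ℤ.+ c))) τ
  astep (state (arith o d a b ∷ κ) ρ τ)       = state κ (upd ρ d (wd (eval o (ρ a) (ρ b)))) τ
  astep (state (load d a      ∷ κ) ρ τ)       = state κ (upd ρ d (wd (ℤ.+ ρ (ρ a)))) τ
  astep (state (store a b     ∷ κ) ρ τ)       = state κ (upd ρ (ρ a) (wd (ℤ.+ ρ b))) τ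
  astep (state (input d a     ∷ κ) ρ τ)       = state κ (upd ρ d (wd (Env.inputAt ε (ρ a)))) τ
  astep (state (hash d a      ∷ κ) ρ τ)       = state κ (upd ρ d (wd (ℤ.+ Env.hashAt ε (ρ a)))) τ
  -- An exhausted tape blocks the machine. Halting on every tape of length l therefore includes that
  -- at most l words are drawn.
  astep (state (rand d        ∷ κ) ρ [])      = state (rand d ∷ κ) ρ []
  astep (state (rand d        ∷ κ) ρ (x ∷ τ)) = state κ (upd ρ d x) τ
  astep (state (ifnz a p q    ∷ κ) ρ τ)       = state (pick (ρ a) p q ++ κ) ρ τ
  astep (state (while a p     ∷ κ) ρ τ)       = state (pick (ρ a) (p ++ while a p ∷ κ) κ) ρ τ

  asteps : ℕ → State → State
  asteps zero    σ = σ
  asteps (suc n) σ = asteps n (astep σ)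

  asteps-+ : ∀ m n σ → asteps (m + n) σ ≡ asteps n (asteps m σ)
  asteps-+ zero    n σ = refl
  asteps-+ (suc m) n σ = asteps-+ m n (astep σ)

  asteps-[] : ∀ n {ρ τ} → asteps n (state [] ρ τ) ≡ state [] ρ τ
  asteps-[] zero    = refl
  asteps-[] (suc n) = asteps-[] n

  asteps-stuck : ∀ n {d κ ρ} → asteps n (state (rand d ∷ κ) ρ []) ≡ state (rand d ∷ κ) ρ []
  asteps-stuck zero    = refl
  asteps-stuck (suc n) = asteps-stuck n

  _≈_ : Memory → (ℕ → ℕ) → Set
  μ ≈ ρ = ∀ a → read μ a ≡ ρ a

  read-in : ∀ μ {a} (a<S : a < S) → read μ a ≡ toℕ (lookup μ (fromℕ< a<S))
  read-in μ {a} a<S with a <? S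
  ... | yes p = cong (toℕ ∘ lookup μ) (fromℕ<-cong a a refl p a<S)
  ... | no ¬p = contradiction a<S ¬p

  read-out : ∀ μ {a} → ¬ a < S → read μ a ≡ 0
  read-out μ {a} a≮S with a <? S
  ... | yes p = contradiction p a≮S
  ... | no _  = wd-small (m^n>0 2 W)

  ≈-write : ∀ {μ ρ} d v → μ ≈ ρ → write μ d v ≈ upd ρ d (toℕ v)
  ≈-write {μ} {ρ} d v s a with d <? S
  ... | no d≮S = trans (s a) (lemma (a ≡ᵇ d) refl)
    where
    d≮ : (d <ᵇ S) ≡ false
    d≮ with d <ᵇ S in e
    ... | false = refl
    ... | true  = contradiction (<ᵇ⇒< d S (subst Bool.T (sym e) tt)) d≮S
    lemma : ∀ b → (a ≡ᵇ d) ≡ b → ρ a ≡ (if b then (if d <ᵇ S then toℕ v else 0) else ρ a)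
    lemma false e = refl
    lemma true  e rewrite d≮ | ≡ᵇ⇒≡ a d (subst Bool.T (sym e) tt) = trans (sym (s d)) (read-out μ d≮S)
  ... | yes d<S = lemma (a ≡ᵇ d) refl
    where
    d< : (d <ᵇ S) ≡ true
    d< with d <ᵇ S in e
    ... | true  = refl
    ... | false = contradiction (<⇒<ᵇ d<S) (subst (λ b → ¬ Bool.T b) (sym e) (λ ()))
    μ′ = μ [ fromℕ< d<S ]≔ v
    lemma : ∀ b → (a ≡ᵇ d) ≡ b → read μ′ a ≡ (if b then (if d <ᵇ S then toℕ v else 0) else ρ a)
    lemma true e rewrite d< | ≡ᵇ⇒≡ a d (subst Bool.T (sym e) tt) =
      trans (read-in μ′ d<S) (cong toℕ (lookup∘update (fromℕ< d<S) μ v))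
    lemma false e = trans (other (a <? S)) (s a)
      where
      a≢d : a ≢ d
      a≢d refl = subst Bool.T e (≡⇒≡ᵇ a a refl)
      other : Dec (a < S) → read μ′ a ≡ read μ a
      other (no a≮S)  = trans (read-out μ′ a≮S) (sym (read-out μ a≮S))
      other (yes a<S) = trans (read-in μ′ a<S) (trans (cong toℕ (lookup∘update′
        (λ e′ → a≢d (trans (sym (toℕ-fromℕ< a<S)) (trans (cong toℕ e′) (toℕ-fromℕ< d<S)))) μ v)) (sym (read-in μ a<S)))

  ≈-write′ : ∀ {μ ρ d d′} {v : Word} {x} → d ≡ d′ → toℕ v ≡ x → μ ≈ ρ → write μ d v ≈ upd ρ d′ x
  ≈-write′ {d = d} {v = v} refl refl s = ≈-write d v s

  data IsRand : List Instr → Set where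
    is-rand : ∀ d κ → IsRand (rand d ∷ κ)

  isRand? : ∀ κ → Dec (IsRand κ)
  isRand? []                = no (λ ())
  isRand? (const _ _     ∷ _) = no (λ ())
  isRand? (arith _ _ _ _ ∷ _) = no (λ ())
  isRand? (load _ _      ∷ _) = no (λ ())
  isRand? (store _ _     ∷ _) = no (λ ())
  isRand? (input _ _     ∷ _) = no (λ ())
  isRand? (hash _ _      ∷ _) = no (λ ())
  isRand? (rand d        ∷ κ) = yes (is-rand d κ)
  isRand? (ifnz _ _ _    ∷ _) = no (λ ())
  isRand? (while _ _     ∷ _) = no (λ ())

  step-≈ : ∀ r κ μ ρ τ → ¬ IsRand κ → μ ≈ ρ → let σ = step ε r ⟨ κ , μ ⟩ ; σ′ = astep (state κ ρ τ) in
           code σ ≡ program σ′ × memory σ ≈ mem σ′ × tape σ′ ≡ τ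
  step-≈ r [] μ ρ τ _ s = refl , s , refl
  step-≈ r (const d c ∷ κ) μ ρ τ _ s = refl , ≈-write′ refl refl s , refl
  step-≈ r (arith o d a b ∷ κ) μ ρ τ _ s = refl , ≈-write′ refl (cong₂ (λ x y → wd (eval o x y)) (s a) (s b)) s , refl
  step-≈ r (load d a ∷ κ) μ ρ τ _ s =
    refl , ≈-write′ refl (cong (λ x → wd (ℤ.+ x)) (trans (s (read μ a)) (cong ρ (s a)))) s , refl
  step-≈ r (store a b ∷ κ) μ ρ τ _ s = refl , ≈-write′ (s a) (cong (λ x → wd (ℤ.+ x)) (s b)) s , refl
  step-≈ r (input d a ∷ κ) μ ρ τ _ s = refl , ≈-write′ refl (cong (λ x → wd (Env.inputAt ε x)) (s a)) s , refl
  step-≈ r (hash d a ∷ κ) μ ρ τ _ s = refl , ≈-write′ refl (cong (λ x → wd (ℤ.+ Env.hashAt ε x)) (s a)) s , refl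
  step-≈ r (rand d ∷ κ) μ ρ τ n s = contradiction (is-rand d κ) n
  step-≈ r (ifnz a p q ∷ κ) μ ρ τ _ s with read μ a | s a
  ... | zero  | e rewrite sym e = refl , s , refl
  ... | suc _ | e rewrite sym e = refl , s , refl
  step-≈ r (while a p ∷ κ) μ ρ τ _ s with read μ a | s a
  ... | zero  | e rewrite sym e = refl , s , refl
  ... | suc _ | e rewrite sym e = refl , s , refl

  taped : ∀ {l} → Vec Word l → List ℕ
  taped []       = []
  taped (x ∷ xs) = toℕ x ∷ taped xs

  Done : ℕ → ℕ → List Instr → (ℕ → ℕ) → Set
  Done T l κ ρ = (τ : Vec Word l) → program (asteps T (state κ ρ (taped τ))) ≡ []

  someWord : Word
  someWord = word (ℤ.+ 0)

  rand-impossible : ∀ T d κ ρ → ¬ Done (suc T) 0 (rand d ∷ κ) ρ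
  rand-impossible T d κ ρ done with trans (sym (cong program (asteps-stuck (suc T) {d} {κ} {ρ}))) (done [])
  ... | ()

  private
    -- Only rand looks at the tape.
    split : ∀ ρ τ₀ τ κ → ¬ IsRand κ →
            astep (state κ ρ τ) ≡ state (program (astep (state κ ρ τ₀))) (mem (astep (state κ ρ τ₀))) τ
    split ρ τ₀ τ []                  _ = refl
    split ρ τ₀ τ (const _ _     ∷ _) _ = refl
    split ρ τ₀ τ (arith _ _ _ _ ∷ _) _ = refl
    split ρ τ₀ τ (load _ _      ∷ _) _ = refl
    split ρ τ₀ τ (store _ _     ∷ _) _ = refl
    split ρ τ₀ τ (input _ _     ∷ _) _ = refl
    split ρ τ₀ τ (hash _ _      ∷ _) _ = refl
    split ρ τ₀ τ (rand d        ∷ κ) n = contradiction (is-rand d κ) n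
    split ρ τ₀ τ (ifnz _ _ _    ∷ _) _ = refl
    split ρ τ₀ τ (while _ _     ∷ _) _ = refl

    next : ∀ T l κ ρ τ₀ → ¬ IsRand κ → Done (suc T) l κ ρ →
           Done T l (program (astep (state κ ρ τ₀))) (mem (astep (state κ ρ τ₀)))
    next T l κ ρ τ₀ n done τ = trans (cong (λ σ → program (asteps T σ)) (sym (split ρ τ₀ (taped τ) κ n))) (done τ)

    blank : ℕ → List ℕ
    blank l = taped (Vec.replicate l someWord)

  halts : ∀ T l κ μ ρ → μ ≈ ρ → Done T l κ ρ → (rs : Vec Word T) → Halted (steps ε rs ⟨ κ , μ ⟩)
  halts zero    l κ μ ρ s done []       = done (Vec.replicate l someWord)
  halts (suc T) l κ μ ρ s done (r ∷ rs) with isRand? κ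
  ... | no n with step-≈ r κ μ ρ (blank l) n s
  ... | e , s′ , _ = subst (λ c → Halted (steps ε rs c)) (cong (λ c → ⟨ c , memory (step ε r ⟨ κ , μ ⟩) ⟩) (sym e))
                         (halts T l _ _ _ s′ (next T l κ ρ (blank l) n done) rs)
  halts (suc T) zero    _ μ ρ s done (r ∷ rs) | yes (is-rand d κ) = contradiction done (rand-impossible T d κ ρ)
  halts (suc T) (suc l) _ μ ρ s done (r ∷ rs) | yes (is-rand d κ) =
    halts T l κ _ _ (≈-write d r s) (λ τ → done (r ∷ τ)) rs

  words : List Word
  words = allFin (2 ^ W)

  -- Random words drawn during the computation may be replaced by a tape that is drawn in advance.
  tape-count : (G : (ℕ → ℕ) → ℕ) → (∀ {ρ ρ′} → (∀ a → ρ a ≡ ρ′ a) → G ρ ≡ G ρ′) →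
    ∀ T l κ μ ρ → μ ≈ ρ → Done T l κ ρ →
    (2 ^ W) ^ l * ∑ (vectors words T) (λ rs → G (read (memory (steps ε rs ⟨ κ , μ ⟩))))
    ≡ (2 ^ W) ^ T * ∑ (vectors words l) (λ τ → G (mem (asteps T (state κ ρ (taped τ)))))
  tape-count G G-cong zero l κ μ ρ s done = begin-equality
    (2 ^ W) ^ l * (G (read μ) + 0) ≡⟨ cong ((2 ^ W) ^ l *_) (trans (+-identityʳ _) (G-cong s)) ⟩
    (2 ^ W) ^ l * G ρ ≡⟨ cong (_* G ρ) (trans (length-vectors words l) (cong (_^ l) (length-allFin (2 ^ W)))) ⟨
    length (vectors words l) * G ρ ≡⟨ ∑-const (vectors words l) (G ρ) ⟨
    ∑ (vectors words l) (λ _ → G ρ) ≡⟨ +-identityʳ _ ⟨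
    1 * ∑ (vectors words l) (λ _ → G ρ) ∎
  tape-count G G-cong (suc T) l κ μ ρ s done with isRand? κ
  ... | no n = begin-equality
    Q ^ l * ∑ (vectors words (suc T)) (λ rs → G (read (memory (steps ε rs ⟨ κ , μ ⟩))))
      ≡⟨ cong (Q ^ l *_) (∑-vectors-suc words T _) ⟩
    Q ^ l * ∑ words (λ r → ∑ (vectors words T) (λ rs → G (read (memory (steps ε rs (step ε r ⟨ κ , μ ⟩))))))
      ≡⟨ ∑-*ˡ words (Q ^ l) _ ⟨
    ∑ words (λ r → Q ^ l * ∑ (vectors words T) (λ rs → G (read (memory (steps ε rs (step ε r ⟨ κ , μ ⟩))))))
      ≡⟨ ∑-cong words one ⟩
    ∑ words (λ r → Q ^ T * ∑ (vectors words l) (λ τ → G (mem (asteps (suc T) (state κ ρ (taped τ))))))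
      ≡⟨ trans (∑-const words _) (cong (_* (Q ^ T * ∑ (vectors words l) (λ τ → G (mem (asteps (suc T) (state κ ρ (taped τ))))))) (length-allFin Q)) ⟩
    Q * (Q ^ T * ∑ (vectors words l) (λ τ → G (mem (asteps (suc T) (state κ ρ (taped τ))))))
      ≡⟨ *-assoc Q (Q ^ T) _ ⟨
    Q ^ suc T * ∑ (vectors words l) (λ τ → G (mem (asteps (suc T) (state κ ρ (taped τ))))) ∎
    where
    Q = 2 ^ W
    one : ∀ r → Q ^ l * ∑ (vectors words T) (λ rs → G (read (memory (steps ε rs (step ε r ⟨ κ , μ ⟩)))))
          ≡ Q ^ T * ∑ (vectors words l) (λ τ → G (mem (asteps (suc T) (state κ ρ (taped τ)))))
    one r with step-≈ r κ μ ρ (blank l) n s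
    ... | e , s′ , _ = trans
      (cong (λ c → Q ^ l * ∑ (vectors words T) (λ rs → G (read (memory (steps ε rs c)))))
        (cong (λ c → ⟨ c , memory (step ε r ⟨ κ , μ ⟩) ⟩) e))
      (trans (tape-count G G-cong T l _ _ _ s′ (next T l κ ρ (blank l) n done))
        (cong (Q ^ T *_) (∑-cong (vectors words l) (λ τ → cong (G ∘ mem ∘ asteps T) (sym (split ρ (blank l) (taped τ) κ n))))))
  tape-count G G-cong (suc T) zero    _ μ ρ s done | yes (is-rand d κ) = contradiction done (rand-impossible T d κ ρ)
  tape-count G G-cong (suc T) (suc l) _ μ ρ s done | yes (is-rand d κ) = begin-equality
    Q ^ suc l * ∑ (vectors words (suc T)) (λ rs → G (read (memory (steps ε rs ⟨ rand d ∷ κ , μ ⟩))))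
      ≡⟨ cong (Q ^ suc l *_) (∑-vectors-suc words T _) ⟩
    Q * Q ^ l * ∑ words (λ r → ∑ (vectors words T) (λ rs → G (read (memory (steps ε rs ⟨ κ , write μ d r ⟩)))))
      ≡⟨ trans (*-assoc Q (Q ^ l) _) (cong (Q *_) (sym (∑-*ˡ words (Q ^ l) _))) ⟩
    Q * ∑ words (λ r → Q ^ l * ∑ (vectors words T) (λ rs → G (read (memory (steps ε rs ⟨ κ , write μ d r ⟩)))))
      ≡⟨ cong (Q *_) (∑-cong words (λ r → tape-count G G-cong T l κ _ _ (≈-write d r s) (λ τ → done (r ∷ τ)))) ⟩
    Q * ∑ words (λ r → Q ^ T * ∑ (vectors words l) (λ τ → G (mem (asteps T (state κ (upd ρ d (toℕ r)) (taped τ))))))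
      ≡⟨ cong (Q *_) (∑-*ˡ words (Q ^ T) _) ⟩
    Q * (Q ^ T * ∑ words (λ r → ∑ (vectors words l) (λ τ → G (mem (asteps T (state κ (upd ρ d (toℕ r)) (taped τ)))))))
      ≡⟨ *-assoc Q (Q ^ T) _ ⟨
    Q ^ suc T * ∑ words (λ r → ∑ (vectors words l) (λ τ → G (mem (asteps T (state κ (upd ρ d (toℕ r)) (taped τ))))))
      ≡⟨ cong (Q ^ suc T *_) (∑-vectors-suc words l _) ⟨
    Q ^ suc T * ∑ (vectors words (suc l)) (λ τ → G (mem (asteps (suc T) (state (rand d ∷ κ) ρ (taped τ))))) ∎
    where
    Q = 2 ^ W

-- A program logic with execution times

module Logic (W S₀ : ℕ) (2≤Q : 2 ≤ 2 ^ W) (ε : Env) where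

  open Machine W (300 + S₀) using (eval; word)
  open Taped W (300 + S₀) ε public

  Q : ℕ
  Q = 2 ^ W

  Memᶠ Tape : Set
  Memᶠ = ℕ → ℕ
  Tape = List ℕ

  -- The field `run` holds for every remaining code, so that executions can be composed. The cost is
  -- only bounded, which allows branches of different lengths.
  record Exec (p : Program) (ρ : Memᶠ) (τ : Tape) (B : ℕ) (Post : Memᶠ → Tape → Set) : Set where
    constructor exec
    field
      cost  : ℕ
      cost≤ : cost ≤ B
      ρ′    : Memᶠ
      τ′    : Tape
      run   : ∀ κ → asteps cost (state (p ++ κ) ρ τ) ≡ state κ ρ′ τ′
      post  : Post ρ′ τ′

  private variable
    p q k : Program
    ρ : Memᶠ
    τ : Tape
    B B₁ B₂ : ℕ
    Post P₁ P₂ : Memᶠ → Tape → Set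

  done : Post ρ τ → Exec [] ρ τ 0 Post
  done x = exec 0 z≤n _ _ (λ κ → refl) x

  within : B₁ ≤ B₂ → Exec p ρ τ B₁ Post → Exec p ρ τ B₂ Post
  within le (exec c c≤ ρ′ τ′ r x) = exec c (≤-trans c≤ le) ρ′ τ′ r x

  after : (∀ {ρ′ τ′} → P₁ ρ′ τ′ → P₂ ρ′ τ′) → Exec p ρ τ B P₁ → Exec p ρ τ B P₂
  after f (exec c c≤ ρ′ τ′ r x) = exec c c≤ ρ′ τ′ r (f x)

  infixr 4 _⨾_

  _⨾_ : Exec p ρ τ B₁ P₁ → (∀ {ρ′ τ′} → P₁ ρ′ τ′ → Exec q ρ′ τ′ B₂ Post) → Exec (p ++ q) ρ τ (B₁ + B₂) Post
  _⨾_ {p = p} {ρ} {τ} {q = q} (exec c c≤ ρ₁ τ₁ r x) f with f x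
  ... | exec c′ c′≤ ρ₂ τ₂ r′ y = exec (c + c′) (+-mono-≤ c≤ c′≤) ρ₂ τ₂ (λ κ →
    trans (cong (λ l → asteps (c + c′) (state l ρ τ)) (++-assoc p q κ))
      (trans (asteps-+ c c′ _) (trans (cong (asteps c′) (r (q ++ κ))) (r′ κ)))) y

  first-step : ∀ {i ρ₁ τ₁} → (∀ κ → astep (state (i ∷ κ) ρ τ) ≡ state κ ρ₁ τ₁) →
               Exec k ρ₁ τ₁ B Post → Exec (i ∷ k) ρ τ (suc B) Post
  first-step {k = k} e (exec c c≤ ρ′ τ′ r x) =
    exec (suc c) (s≤s c≤) ρ′ τ′ (λ κ → trans (cong (asteps c) (e (k ++ κ))) (r κ)) x

  module _ {d : ℕ} where

    writeᵢ : ∀ {i v x} → (∀ κ → astep (state (i ∷ κ) ρ τ) ≡ state κ (upd ρ d v) τ) → v ≡ x →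
             Exec k (upd ρ d x) τ B Post → Exec (i ∷ k) ρ τ (suc B) Post
    writeᵢ e refl = first-step e

    constᵢ : ∀ {c} → c < Q → Exec k (upd ρ d c) τ B Post → Exec (const d c ∷ k) ρ τ (suc B) Post
    constᵢ lt = writeᵢ (λ κ → refl) (wd-small lt)

    module _ {a b x y : ℕ} where

      addᵢ : ρ a ≡ x → ρ b ≡ y → x + y < Q → Exec k (upd ρ d (x + y)) τ B Post → Exec (arith add d a b ∷ k) ρ τ (suc B) Post
      addᵢ refl refl lt = writeᵢ (λ κ → refl) (wd-small lt)

      mulᵢ : ρ a ≡ x → ρ b ≡ y → x * y < Q → Exec k (upd ρ d (x * y)) τ B Post → Exec (arith mul d a b ∷ k) ρ τ (suc B) Post
      mulᵢ refl refl lt = writeᵢ (λ κ → refl) (wd-small lt)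

      subᵢ : ρ a ≡ x → ρ b ≡ y → y ≤ x → x < Q → Exec k (upd ρ d (x ∸ y)) τ B Post → Exec (arith sub d a b ∷ k) ρ τ (suc B) Post
      subᵢ {ρ = ρ} refl refl le lt = writeᵢ (λ κ → refl)
        (trans (cong wd (trans (ℤP.m-n≡m⊖n (ρ a) (ρ b)) (ℤP.⊖-≥ le))) (wd-small (≤-<-trans (m∸n≤m (ρ a) (ρ b)) lt)))

      lessᵢ : ρ a ≡ x → ρ b ≡ y → Exec k (upd ρ d (𝟙 (x <? y))) τ B Post → Exec (arith less d a b ∷ k) ρ τ (suc B) Post
      lessᵢ {ρ = ρ} refl refl = writeᵢ (λ κ → refl) flag
        where
        flag : wd (eval less (ρ a) (ρ b)) ≡ 𝟙 (ρ a <? ρ b)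
        flag with ρ a <? ρ b
        ... | yes _ = wd-small 2≤Q
        ... | no _  = wd-small (≤-trans (s≤s z≤n) 2≤Q)

      quotᵢ : .{{_ : NonZero y}} → ρ a ≡ x → ρ b ≡ y → x < Q →
              Exec k (upd ρ d (x / y)) τ B Post → Exec (arith quot d a b ∷ k) ρ τ (suc B) Post
      quotᵢ refl e lt = writeᵢ (λ κ → refl) (trans (cong (λ y → wd (eval quot x y)) e) (value-of y))
        where
        value-of : ∀ y .{{_ : NonZero y}} → wd (eval quot x y) ≡ x / y
        value-of (suc y) = wd-small (≤-<-trans (m/n≤m x (suc y)) lt)

      remᵢ : .{{_ : NonZero y}} → ρ a ≡ x → ρ b ≡ y → y < Q →
             Exec k (upd ρ d (x % y)) τ B Post → Exec (arith rem d a b ∷ k) ρ τ (suc B) Post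
      remᵢ refl e lt = writeᵢ (λ κ → refl) (trans (cong (λ y → wd (eval rem x y)) e) (value-of y lt))
        where
        value-of : ∀ y .{{_ : NonZero y}} → y < Q → wd (eval rem x y) ≡ x % y
        value-of (suc y) lt = wd-small (<-trans (m%n<n x (suc y)) lt)

    module _ {a x y : ℕ} where

      loadᵢ : ρ a ≡ x → ρ x ≡ y → y < Q → Exec k (upd ρ d y) τ B Post → Exec (load d a ∷ k) ρ τ (suc B) Post
      loadᵢ refl e lt = writeᵢ (λ κ → refl) (trans (cong (λ x → wd (ℤ.+ x)) e) (wd-small lt))

      inputᵢ : ρ a ≡ x → wd (Env.inputAt ε x) ≡ y → Exec k (upd ρ d y) τ B Post → Exec (input d a ∷ k) ρ τ (suc B) Post
      inputᵢ refl e = writeᵢ (λ κ → refl) e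

      hashᵢ : ρ a ≡ x → Env.hashAt ε x ≡ y → y < Q → Exec k (upd ρ d y) τ B Post → Exec (hash d a ∷ k) ρ τ (suc B) Post
      hashᵢ refl e lt = writeᵢ (λ κ → refl) (trans (cong (λ x → wd (ℤ.+ x)) e) (wd-small lt))

    randᵢ : ∀ {x} → Exec k (upd ρ d x) τ B Post → Exec (rand d ∷ k) ρ (x ∷ τ) (suc B) Post
    randᵢ = first-step (λ κ → refl)

  storeᵢ : ∀ {a b x y} → ρ a ≡ x → ρ b ≡ y → y < Q → Exec k (upd ρ x y) τ B Post → Exec (store a b ∷ k) ρ τ (suc B) Post
  storeᵢ {a = a} refl refl lt = writeᵢ (λ κ → refl) (wd-small lt)

  branch : ∀ {a l} → pick (ρ a) p q ≡ l → Exec (l ++ k) ρ τ B Post → Exec (ifnz a p q ∷ k) ρ τ (suc B) Post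
  branch {ρ = ρ} {k = k} {τ = τ} {l = l} e (exec c c≤ ρ′ τ′ r x) = exec (suc c) (s≤s c≤) ρ′ τ′ (λ κ → trans (cong (asteps c)
    (cong (λ l → state l ρ τ) (trans (cong (_++ (k ++ κ)) e) (sym (++-assoc l k κ))))) (r κ)) x

  ifᵢ : ∀ {a} → (ρ a ≢ 0 → Exec p ρ τ B₁ P₁) → (ρ a ≡ 0 → Exec q ρ τ B₁ P₁) →
        (∀ {ρ′ τ′} → P₁ ρ′ τ′ → Exec k ρ′ τ′ B₂ Post) → Exec (ifnz a p q ∷ k) ρ τ (suc (B₁ + B₂)) Post
  ifᵢ {ρ = ρ} {p = p} {q = q} {a = a} then-branch else-branch continue with ρ a in e
  ... | zero  = branch {a = a} (cong (λ y → pick y p q) e) (else-branch refl ⨾ continue)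
  ... | suc _ = branch {a = a} (cong (λ y → pick y p q) e) (then-branch (λ ()) ⨾ continue)

  stop : ∀ {a} → ρ a ≡ 0 → Post ρ τ → Exec (while a p ∷ []) ρ τ 1 Post
  stop {ρ = ρ} {τ = τ} {p = p} {a = a} e x =
    exec 1 ≤-refl ρ τ (λ κ → cong (λ l → state l ρ τ) (cong (λ y → pick y (p ++ while a p ∷ κ) κ) e)) x

  loop : ∀ {a} → ρ a ≢ 0 → Exec (p ++ while a p ∷ []) ρ τ B Post → Exec (while a p ∷ []) ρ τ (suc B) Post
  loop {ρ = ρ} {p = p} {τ = τ} {a = a} nz (exec c c≤ ρ′ τ′ r x) = exec (suc c) (s≤s c≤) ρ′ τ′ (λ κ → trans (cong (asteps c)
      (cong (λ l → state l ρ τ) (trans (enter (ρ a) nz κ) (sym (++-assoc p (while a p ∷ []) κ))))) (r κ)) x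
    where
    enter : ∀ y → y ≢ 0 → ∀ κ → pick y (p ++ while a p ∷ κ) κ ≡ p ++ while a p ∷ κ
    enter zero    n κ = contradiction refl n
    enter (suc _) n κ = refl

  -- Procedures use the lowest registers; Frame r says that registers from r on, and arrays, are unchanged.
  Frame : ℕ → Memᶠ → Memᶠ → Set
  Frame r ρ ρ′ = ∀ a → ρ′ (r + a) ≡ ρ (r + a)

  -- The registers are the addresses below 300; tables start at address 300.
  RFrame : ℕ → Memᶠ → Memᶠ → Set
  RFrame r ρ ρ′ = ∀ a → {Bool.T (r + a <ᵇ 300)} → ρ′ (r + a) ≡ ρ (r + a)

  upd-same : ∀ {ρ d v} → d < 300 + S₀ → upd ρ d v d ≡ v
  upd-same {ρ} {d} {v} lt with d ≡ᵇ d | ≡⇒≡ᵇ d d refl | d <ᵇ 300 + S₀ | <⇒<ᵇ lt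
  ... | true | _ | true | _ = refl

  upd-other : ∀ {ρ d v a} → a ≢ d → upd ρ d v a ≡ ρ a
  upd-other {d = d} {a = a} a≢d with a ≡ᵇ d in e
  ... | false = refl
  ... | true  = contradiction (≡ᵇ⇒≡ a d (subst Bool.T (sym e) tt)) a≢d

  upd-table : ∀ {ρ x v a} → Bool.T (a <ᵇ 300) → upd ρ (300 + x) v a ≡ ρ a
  upd-table {ρ} {x} {v} {a} lt = upd-other {ρ} {300 + x} {v} λ e → <⇒≱ (<ᵇ⇒< a 300 lt) (≤-≡ (m≤m+n 300 x) (sym e))

  movᵢ : ∀ {d a x} → ρ (suc a) ≡ x → x < Q → Exec k (upd (upd ρ 0 0) d x) τ B Post →
         Exec (const 0 0 ∷ arith add d (suc a) 0 ∷ k) ρ τ (suc (suc B)) Post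
  movᵢ {a = a} refl lt e = constᵢ (≤-trans (s≤s z≤n) 2≤Q) (writeᵢ (λ κ → refl)
    (trans (cong (λ y → wd (ℤ.+ y)) (+-identityʳ _)) (wd-small lt)) e)

  decᵢ : ∀ {c j} → ρ (suc c) ≡ suc j → suc j < Q → Exec k (upd (upd ρ 0 1) (suc c) j) τ B Post →
         Exec (const 0 1 ∷ arith sub (suc c) (suc c) 0 ∷ k) ρ τ (suc (suc B)) Post
  decᵢ e lt = constᵢ 2≤Q ∘ subᵢ e refl (s≤s z≤n) lt

-- Register 0 is scratch space for constant operands throughout.
mov : Reg → Reg → Program
mov d a = const 0 0 ∷ arith add d a 0 ∷ []

dec : Reg → Program
dec c = const 0 1 ∷ arith sub c c 0 ∷ []

-- The program

-- After the initialisation, register 40 holds n, 41 N, 42 k m, 43 the target modulo k m, 44 N / 2,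
-- 46 the address of the second half of the lists, 47 the target, 48 cmax and 49 ℓ. Registers 32 and
-- 33 hold the shifts, 36 the number c of chains and 38 the number of cells. Here register 1 holds
-- the index and 2 the address of the first list; 3 receives the sum.
sumCode : ℕ → Program
sumCode K = const 3 0 ∷ const 4 K ∷ while 4
  (arith rem 5 1 40 ∷ arith add 5 5 2 ∷ input 6 5 ∷ arith add 3 3 6 ∷ arith quot 1 1 40 ∷ arith add 2 2 40 ∷
   const 0 1 ∷ arith sub 4 4 0 ∷ []) ∷ []

-- Register 7 holds the current vertex.
stepCode : ℕ → Program
stepCode K = arith less 8 44 7 ∷
  ifnz 8 (arith add 1 7 33 ∷ arith rem 1 1 41 ∷ const 0 0 ∷ arith add 2 46 0 ∷
          (sumCode K ++ arith add 0 43 42 ∷ arith sub 3 0 3 ∷ []))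
         (arith add 1 7 32 ∷ arith rem 1 1 41 ∷ const 2 4 ∷ sumCode K) ∷
  arith rem 3 3 42 ∷ const 0 1 ∷ arith add 3 3 0 ∷ hash 7 3 ∷ []

-- Tests the pair of vertices in registers 12 and 13, and records the indices of a solution in registers 10 and 11.
checkCode : ℕ → Program
checkCode K = arith add 1 12 32 ∷ arith rem 1 1 41 ∷ const 0 0 ∷ arith add 8 1 0 ∷ const 2 4 ∷
  (sumCode K ++ const 0 0 ∷ arith add 9 3 0 ∷ arith add 1 13 33 ∷ arith rem 1 1 41 ∷ arith add 7 1 0 ∷ arith add 2 46 0 ∷
  (sumCode K ++ arith add 3 3 9 ∷ arith less 4 3 47 ∷ arith less 5 47 3 ∷ arith add 4 4 5 ∷
   ifnz 4 [] (const 0 0 ∷ arith add 10 8 0 ∷ arith add 11 7 0 ∷ []) ∷ []))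

-- Register 9 counts the steps of the walk from the vertex in register 7.
walkCode : ℕ → Program
walkCode K = while 9 (stepCode K ++ dec 9) ∷ []

-- Registers 24 and 20 hold the starts of two chains that meet, the first one after as many steps as register 49
-- tells, the second one with as many steps left as register 25 tells, of twice that number.
locateCode : ℕ → Program
locateCode K = arith less 8 25 49 ∷
  ifnz 8 (arith sub 14 49 25 ∷ const 15 0 ∷ []) (const 14 0 ∷ arith sub 15 25 49 ∷ []) ∷
  mov 7 20 ++ mov 9 14 ++ walkCode K ++ mov 13 7 ++ mov 7 24 ++ mov 9 15 ++ walkCode K ++ mov 12 7 ++ mov 14 49 ++
  while 14 (checkCode K ++ mov 7 12 ++ stepCode K ++ mov 12 7 ++ mov 7 13 ++ stepCode K ++ mov 13 7 ++ dec 14) ∷ []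

startCode : Program
startCode = rand 20 ∷ arith rem 20 20 41 ∷ const 0 1 ∷ arith add 20 20 0 ∷ mov 7 20

-- The address of the table entry of the vertex in register 7.
slotCode : Program
slotCode = arith rem 26 7 38 ∷ arith add 26 26 26 ∷ const 0 300 ∷ arith add 26 26 0 ∷ []

chainCode : ℕ → Program
chainCode K = startCode ++ mov 9 49 ++ walkCode K ++ slotCode ++ store 26 7 ∷ const 0 1 ∷ arith add 26 26 0 ∷ store 26 20 ∷ []

probeCode : ℕ → Program
probeCode K = while 22 (stepCode K ++ dec 22 ++ slotCode ++
  load 27 26 ∷ arith less 28 27 7 ∷ arith less 29 7 27 ∷ arith add 28 28 29 ∷
  ifnz 28 [] (const 0 1 ∷ arith add 26 26 0 ∷ load 24 26 ∷ mov 25 22 ++ const 22 0 ∷ const 23 1 ∷ []) ∷ []) ∷ []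

lookCode : ℕ → Program
lookCode K = startCode ++ const 23 0 ∷ arith add 22 49 49 ∷ probeCode K ++ ifnz 23 (locateCode K) [] ∷ []

-- Entries of earlier runs belong to other shifts and would lead to false matches.
clearCode : Program
clearCode = mov 30 38 ++ const 31 300 ∷ while 30 (const 0 0 ∷ store 31 0 ∷ const 0 2 ∷ arith add 31 31 0 ∷ dec 30) ∷ []

firstCode secondCode runCode : ℕ → Program
firstCode K = while 30 (chainCode K ++ dec 30) ∷ []
secondCode K = while 30 (lookCode K ++ dec 30) ∷ []
runCode K = rand 32 ∷ arith rem 32 32 41 ∷ rand 33 ∷ arith rem 33 33 41 ∷
  clearCode ++ mov 30 36 ++ firstCode K ++ mov 30 36 ++ secondCode K

-- The root is searched by increments; time linear in X = N / (`C₀` cmax) is affordable, as this is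
-- less than the cost of a scale.
growCode inputCode : Program
growCode = while 2 (const 0 1 ∷ arith add 3 0 49 ∷ arith mul 4 3 3 ∷ arith less 5 1 4 ∷ ifnz 5 [] (mov 49 3) ∷ dec 2) ∷ []

-- For j ≥ X and r = 0, the predecessor of the largest number that does not exceed 1 or the square root of X.
grow : (X j r : ℕ) → ℕ
grow X zero    r = r
grow X (suc j) r = grow X j (if Dec.does (X <? (2 + r) * (2 + r)) then r else suc r)

module _ {X : ℕ} where

  grow≥ : ∀ j r → r ≤ grow X j r
  grow≥ zero    r = ≤-refl
  grow≥ (suc j) r with Dec.does (X <? (2 + r) * (2 + r))
  ... | true  = grow≥ j r
  ... | false = ≤-trans (n≤1+n r) (grow≥ j (suc r))

  grow≤ : ∀ j r → grow X j r ≤ r + j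
  grow≤ zero    r = m≤m+n r 0
  grow≤ (suc j) r with Dec.does (X <? (2 + r) * (2 + r))
  ... | true  = ≤-trans (grow≤ j r) (+-monoʳ-≤ r (n≤1+n j))
  ... | false = ≤-≡ (grow≤ j (suc r)) (sym (+-suc r j))

  grow-upper : ∀ {Y} → X ≤ Y → ∀ j r → suc r * suc r ≤ Y → suc (grow X j r) * suc (grow X j r) ≤ Y
  grow-upper X≤Y zero    r le = le
  grow-upper {Y} X≤Y (suc j) r le = by (X <? (2 + r) * (2 + r))
    where
    by : (b : Dec (X < (2 + r) * (2 + r))) → let r′ = if Dec.does b then r else suc r in suc (grow X j r′) * suc (grow X j r′) ≤ Y
    by (yes _) = grow-upper X≤Y j r le
    by (no ≥)  = grow-upper X≤Y j (suc r) (≤-trans (≮⇒≥ ≥) X≤Y)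

  grow-lower : ∀ j r → X ≤ r + j → X < (2 + grow X j r) * (2 + grow X j r)
  grow-lower zero    r le = s≤s (≤-trans le (≡-≤ (+-identityʳ r) (≤-trans (n≤1+n r) (m≤m+n (suc r) _))))
  grow-lower (suc j) r le = by (X <? (2 + r) * (2 + r))
    where
    by : (b : Dec (X < (2 + r) * (2 + r))) → let r′ = if Dec.does b then r else suc r in X < (2 + grow X j r′) * (2 + grow X j r′)
    by (yes lt) = <-≤-trans lt (*-mono-≤ (+-monoʳ-≤ 2 (grow≥ j r)) (+-monoʳ-≤ 2 (grow≥ j r)))
    by (no _)   = grow-lower j (suc r) (≤-≡ le (+-suc r j))

powerCode : ℕ → Program
powerCode K = const 41 1 ∷ const 1 K ∷ while 1 (arith mul 41 40 41 ∷ dec 1) ∷ []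

inputCode = const 0 0 ∷ input 40 0 ∷ const 0 1 ∷ input 42 0 ∷ const 0 2 ∷ input 48 0 ∷ const 0 3 ∷ input 47 0 ∷ []

prepareCode : (k K C₁ : ℕ) → Program
prepareCode k K C₁ = const 0 k ∷ arith mul 42 0 42 ∷ arith rem 43 47 42 ∷ const 0 2 ∷ arith quot 44 41 0 ∷
  const 0 K ∷ arith mul 46 0 40 ∷ const 0 4 ∷ arith add 46 46 0 ∷
  const 0 C₁ ∷ arith quot 48 48 0 ∷ const 0 1 ∷ arith add 48 48 0 ∷ []

rootCode : (C₀ : ℕ) → Program
rootCode C₀ = const 0 C₀ ∷ arith mul 1 0 48 ∷ arith quot 1 41 1 ∷ const 49 1 ∷ mov 2 1

sizesCode : Program
sizesCode = arith mul 34 41 41 ∷ arith mul 35 48 49 ∷ arith mul 35 35 49 ∷ mov 36 48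

initCode : (k K C₀ C₁ : ℕ) → Program
initCode k K C₀ C₁ = inputCode ++ powerCode K ++ prepareCode k K C₁ ++ rootCode C₀ ++ growCode ++ sizesCode

-- With 0 in place of both vertices the shifts themselves become the indices tested, so this checks
-- a random pair of indices.
guessCode : ℕ → Program
guessCode K = rand 32 ∷ arith rem 32 32 41 ∷ rand 33 ∷ arith rem 33 33 41 ∷ const 12 0 ∷ const 13 0 ∷ checkCode K

-- The number of runs at scale c is about N² / (cmax ℓ² c), while a run costs about c ℓ: all scales
-- cost the same up to constants.
runsCode scaleCode scalesCode : ℕ → Program
runsCode K = while 37 (runCode K ++ dec 37) ∷ []
scaleCode K = const 0 16 ∷ arith mul 38 0 36 ∷ arith mul 1 35 36 ∷ arith quot 37 34 1 ∷ const 0 1 ∷ arith add 37 37 0 ∷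
  runsCode K ++ const 0 2 ∷ arith quot 36 36 0 ∷ []
scalesCode K = while 36 (scaleCode K) ∷ []

-- The digits of the two indices found become the output. Registers 100 + k to 106 + k lie above the output.

digitsCode : ℕ → Program
digitsCode k = while (103 + k)
  (arith rem (104 + k) (100 + k) (105 + k) ∷ arith add (104 + k) (104 + k) (101 + k) ∷ input (104 + k) (104 + k) ∷
   store (102 + k) (104 + k) ∷ arith quot (100 + k) (100 + k) (105 + k) ∷ arith add (101 + k) (101 + k) (105 + k) ∷
   const (104 + k) 1 ∷ arith add (102 + k) (102 + k) (104 + k) ∷ arith sub (103 + k) (103 + k) (104 + k) ∷ []) ∷ []

copyCode outputCode : ℕ → ℕ → Program
copyCode k K = mov (100 + k) 10 ++ mov (106 + k) 11 ++ mov (105 + k) 40 ++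
  const (101 + k) 4 ∷ const (102 + k) 0 ∷ const (103 + k) K ∷ []
outputCode k K = copyCode k K ++ digitsCode k ++
  const (104 + k) 0 ∷ arith add (100 + k) (106 + k) (104 + k) ∷ const (103 + k) K ∷ digitsCode k

solver : (k K C₀ C₁ : ℕ) → Program
solver k K C₀ C₁ = initCode k K C₀ C₁ ++ guessCode K ++ scalesCode K ++ outputCode k K

-- Half sums, and the vertices that stand for them

module Halves {k n m : ℕ} (K N : ℕ) .{{_ : NonZero n}} .{{_ : NonZero N}} .{{_ : NonZero (k * m)}}
              (lists : Lists k n m) (tm : ℕ) where

  M : ℕ
  M = k * m

  entry : ℕ → ℕ
  entry a = lookupOr 0 (Vec.concat (values lists)) a

  -- The sum of the entries selected by the digits of I in base n, from K consecutive lists.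
  sumAt : ℕ → ℕ → ℕ → ℕ
  sumAt zero    off I = 0
  sumAt (suc j) off I = entry (off + I % n) + sumAt j (off + n) (I / n)

  sumL sumR : ℕ → ℕ
  sumL = sumAt K 0
  sumR = sumAt K (K * n)

  -- Two halves that form a solution receive the same value. M is added before the subtraction to
  -- keep it exact, as a half sum is at most M.
  zL zR : Fin N → Fin M
  zL I = fromℕ< (m%n<n (sumL (toℕ I)) M)
  zR J = fromℕ< (m%n<n (tm + M ∸ sumR (toℕ J)) M)

  item : Fin N → Fin N → Fin N
  item ρ v = fromℕ< (m%n<n (value v + toℕ ρ) N)

  left : Fin N → Bool
  left v = Dec.does (value v ≤? N / 2)

  zρ : (ρ σ : Fin N) → Fin N → Fin M
  zρ ρ σ v = if left v then zL (item ρ v) else zR (item σ v)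

  entry≤m : ∀ a → entry a ≤ m
  entry≤m a with a <? k * n
  ... | no _  = z≤n
  ... | yes p = bounded (Vec.concat (values lists)) all (fromℕ< p)
    where
    bounded : ∀ {l} (xs : Vec ℕ l) → All (_≤ m) xs → ∀ i → lookup xs i ≤ m
    bounded (x ∷ xs) (p ∷ ps) zero    = p
    bounded (x ∷ xs) (p ∷ ps) (suc i) = bounded xs ps i
    all : All (_≤ m) (Vec.concat (values lists))
    all = flat lists
      where
      row : ∀ {l} (xs : Vec (Fin m) l) → All (_≤ m) (Vec.map value xs)
      row []       = []
      row (x ∷ xs) = toℕ<n x ∷ row xs
      flat : ∀ {l} (xss : Vec (Vec (Fin m) n) l) → All (_≤ m) (Vec.concat (Vec.map (Vec.map value) xss))
      flat []         = []
      flat (xs ∷ xss) = ++⁺ (row xs) (flat xss)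

  sumAt≤ : ∀ j off I → sumAt j off I ≤ j * m
  sumAt≤ zero    off I = z≤n
  sumAt≤ (suc j) off I = +-mono-≤ (entry≤m (off + I % n)) (sumAt≤ j (off + n) (I / n))

lookupOr-toℕ : ∀ {A : Set} {l} (d : A) (xs : Vec A l) (i : Fin l) → lookupOr d xs (toℕ i) ≡ lookup xs i
lookupOr-toℕ {l = l} d xs i with toℕ i <? l
... | yes p = cong (lookup xs) (fromℕ<-toℕ i p)
... | no ¬p = contradiction (toℕ<n i) ¬p

sumT : ℕ → (ℕ → ℕ) → ℕ
sumT j f = Vec.sum (Vec.tabulate {n = j} (f ∘ toℕ))

sumT-cong : ∀ j {f g : ℕ → ℕ} → (∀ i → i < j → f i ≡ g i) → sumT j f ≡ sumT j g
sumT-cong j e = cong Vec.sum (tabulate-cong (λ i → e (toℕ i) (toℕ<n i)))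

sumT-+ : ∀ a b f → sumT (a + b) f ≡ sumT a f + sumT b (f ∘ (a +_))
sumT-+ zero    b f = refl
sumT-+ (suc a) b f = trans (cong (f 0 +_) (sumT-+ a b (f ∘ suc))) (sym (+-assoc (f 0) _ _))

take-++ : ∀ {A : Set} {b} a (x : Vec A a) (y : Vec A b) → Vec.take a (x Vec.++ y) ≡ x
take-++ zero    []      y = refl
take-++ (suc a) (x ∷ v) y = cong (x ∷_) (take-++ a v y)

drop-++ : ∀ {A : Set} {b} a (x : Vec A a) (y : Vec A b) → Vec.drop a (x Vec.++ y) ≡ y
drop-++ zero    []      y = refl
drop-++ (suc a) (x ∷ v) y = drop-++ a v y

-- The program tries the scales c, c / 2, c / 4 and so on; suc c′ is one of the first j positive
-- numbers among these.
data Reaches (c′ : ℕ) : ℕ → ℕ → Set where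
  now   : ∀ {j} → Reaches c′ (suc j) (suc c′)
  later : ∀ {j c} → Reaches c′ j (suc c / 2) → Reaches c′ (suc j) (suc c)

-- Resources

n<2^bits : ∀ n → n < 2 ^ bits n
n<2^bits n = ≰⇒> (λ le → <-irrefl refl (≡-≤ (sym (⌊log₂[2^n]⌋≡n (bits n))) (⌊log₂⌋-mono-≤ le)))

sumTime stepTime checkTime syncTime walkFactor locateFactor lookFactor runFactor timeFactor : ℕ → ℕ
sumTime K = suc (suc (K * 9 + 1))
stepTime K = suc (suc ((6 + sumTime K) + 4))
checkTime K = 5 + (sumTime K + (6 + (sumTime K + 8)))
syncTime K = checkTime K + (2 + (stepTime K + (4 + (stepTime K + 5))))
walkFactor K = stepTime K + 3 + 1
locateFactor K = walkFactor K + walkFactor K + syncTime K + 19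
lookFactor K = (stepTime K + 19) + (stepTime K + 19) + locateFactor K + 10
runFactor K = walkFactor K + lookFactor K + 148
timeFactor K = (46 + K * 4) + (6 + checkTime K) + 1 + 2 * (runFactor K + 13) + (14 + K * 20)

-- The size conditions of the program: no address or intermediate result overflows a word, and a
-- table of 16 c cells with two words each fits into the memory for every c up to s / C₁ + 1.
record Fits (k n m N K s W S₀ : ℕ) : Set where
  field
    2≤Q   : 2 ≤ 2 ^ W
    N+N<Q : N + N < 2 ^ W
    M+M<Q : k * m + k * m < 2 ^ W
    adr<Q : 4 + (k * n + n) < 2 ^ W
    tab<Q : ∀ x → x < 300 + S₀ → x < 2 ^ W
    C₁<Q  : C₁ < 2 ^ W
    C₀<Q  : C₀ * ((2 + N) * ((2 + N) * (2 + N))) < 2 ^ W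
    K+K≡k : K + K ≡ k
    0<K   : 0 < K
    N≡    : N ≡ n ^ K
    s≤N   : s ≤ N
    tables : 32 * (s / C₁ + 1) + k < S₀

  K+K≤k : K + K ≤ k
  K+K≤k = ≤-reflexive K+K≡k

  0<k : 0 < k
  0<k = ≤-trans 0<K (≤-trans (m≤m+n K K) K+K≤k)

  k<S₀ : k < S₀
  k<S₀ = ≤-<-trans (m≤n+m k (32 * (s / C₁ + 1))) tables

  N≤Q : N ≤ 2 ^ W
  N≤Q = ≤-trans (m≤m+n N N) (<⇒≤ N+N<Q)

record Job : Set where
  field
    k n m N K s W S₀ : ℕ
    n≢0   : NonZero n
    N≢0   : NonZero N
    km≢0  : NonZero (k * m)
    fits  : Fits k n m N K s W S₀
    lists : Lists k n m
    t     : ℤ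
    h     : HashFun (k * m) N

absorb : ∀ {u} a b → 1 ≤ u → u * a + b ≤ u * (a + b)
absorb {u} a b 1≤u = ≤-≡ (+-monoʳ-≤ (u * a) (≡-≤ (sym (*-identityˡ b)) (*-monoˡ-≤ b 1≤u))) (sym (*-distribˡ-+ u a b))

module Costs (K ℓ : ℕ) (ℓ≥1 : 1 ≤ ℓ) where

  walkTime locateTime lookTime chainTime : ℕ
  walkTime = ℓ * (stepTime K + 3) + 1
  locateTime = suc (suc (2 + (4 + (walkTime + (6 + (walkTime + (4 + (ℓ * syncTime K + 1))))))))
  lookTime = 6 + (2 + ((ℓ + ℓ) * suc (stepTime K + (2 + (4 + (5 + 7)))) + 1 + suc (locateTime + 0)))
  chainTime = 6 + (2 + (walkTime + (4 + 4)))

  walk≤ : walkTime ≤ ℓ * walkFactor K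
  walk≤ = absorb (stepTime K + 3) 1 ℓ≥1

  locate≤ : locateTime ≤ ℓ * locateFactor K
  locate≤ = begin
    locateTime ≡⟨ collect walkTime (ℓ * syncTime K) ⟩
    walkTime + walkTime + ℓ * syncTime K + 19
      ≤⟨ +-monoˡ-≤ 19 (+-monoˡ-≤ (ℓ * syncTime K) (+-mono-≤ walk≤ walk≤)) ⟩
    ℓ * walkFactor K + ℓ * walkFactor K + ℓ * syncTime K + 19
      ≡⟨ factor ℓ (walkFactor K) (syncTime K) ⟩
    ℓ * (walkFactor K + walkFactor K + syncTime K) + 19
      ≤⟨ absorb _ 19 ℓ≥1 ⟩
    ℓ * locateFactor K ∎
    where
    collect : ∀ w y → suc (suc (2 + (4 + (w + (6 + (w + (4 + (y + 1)))))))) ≡ w + w + y + 19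
    collect = solve-∀
    factor : ∀ l w y → l * w + l * w + l * y + 19 ≡ l * (w + w + y) + 19
    factor = solve-∀

  look≤ : lookTime ≤ ℓ * lookFactor K
  look≤ = begin
    lookTime ≡⟨ collect ℓ (stepTime K) locateTime ⟩
    ℓ * (stepTime K + 19 + (stepTime K + 19)) + locateTime + 10
      ≤⟨ +-monoˡ-≤ 10 (+-monoʳ-≤ _ locate≤) ⟩
    ℓ * (stepTime K + 19 + (stepTime K + 19)) + ℓ * locateFactor K + 10
      ≡⟨ cong (_+ 10) (*-distribˡ-+ ℓ _ (locateFactor K)) ⟨
    ℓ * (stepTime K + 19 + (stepTime K + 19) + locateFactor K) + 10
      ≤⟨ absorb _ 10 ℓ≥1 ⟩
    ℓ * lookFactor K ∎
    where
    collect : ∀ l w y → 6 + (2 + ((l + l) * suc (w + (2 + (4 + (5 + 7)))) + 1 + suc (y + 0))) ≡ l * (w + 19 + (w + 19)) + y + 10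
    collect = solve-∀

  run≤ : ∀ {c} → 1 ≤ c →
    4 + (3 + (16 * c * 7 + 1 + (2 + (c * (chainTime + 3) + 1 + (2 + (c * (lookTime + 3) + 1)))))) ≤ c * ℓ * runFactor K
  run≤ {c} c≥1 = begin
    4 + (3 + (16 * c * 7 + 1 + (2 + (c * (chainTime + 3) + 1 + (2 + (c * (lookTime + 3) + 1))))))
      ≡⟨ collect c walkTime lookTime ⟩
    c * (walkTime + lookTime + 134) + 14
      ≤⟨ absorb (walkTime + lookTime + 134) 14 c≥1 ⟩
    c * (walkTime + lookTime + 134 + 14)
      ≡⟨ cong (c *_) (+-assoc (walkTime + lookTime) 134 14) ⟩
    c * (walkTime + lookTime + 148)
      ≤⟨ *-monoʳ-≤ c (+-monoˡ-≤ 148 (+-mono-≤ walk≤ look≤)) ⟩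
    c * (ℓ * walkFactor K + ℓ * lookFactor K + 148)
      ≡⟨ cong (λ x → c * (x + 148)) (*-distribˡ-+ ℓ (walkFactor K) (lookFactor K)) ⟨
    c * (ℓ * (walkFactor K + lookFactor K) + 148)
      ≤⟨ *-monoʳ-≤ c (absorb (walkFactor K + lookFactor K) 148 ℓ≥1) ⟩
    c * (ℓ * runFactor K)
      ≡⟨ *-assoc c ℓ (runFactor K) ⟨
    c * ℓ * runFactor K ∎
    where
    collect : ∀ c w y → 4 + (3 + (16 * c * 7 + 1 + (2 + (c * (6 + (2 + (w + (4 + 4))) + 3) + 1 + (2 + (c * (y + 3) + 1))))))
              ≡ c * (w + y + 134) + 14
    collect = solve-∀

  scale≤ : ∀ {c u y} x → 1 ≤ c → x ≤ c * ℓ * runFactor K → 1 ≤ y → y * (c * ℓ) ≤ 2 * u →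
    suc (6 + (y * (x + 3) + 1 + 2)) ≤ u * (2 * (runFactor K + 13))
  scale≤ {c} {u} {y} x c≥1 x≤ y≥1 yc≤ = begin
    suc (6 + (y * (x + 3) + 1 + 2)) ≡⟨ collect (y * (x + 3)) ⟩
    y * (x + 3) + 10 ≤⟨ absorb _ 10 y≥1 ⟩
    y * (x + 3 + 10) ≡⟨ cong (y *_) (+-assoc x 3 10) ⟩
    y * (x + 13) ≤⟨ *-monoʳ-≤ y (≤-trans (+-monoˡ-≤ 13 x≤) (absorb (runFactor K) 13 (*-mono-≤ c≥1 ℓ≥1))) ⟩
    y * (c * ℓ * (runFactor K + 13)) ≡⟨ *-assoc y (c * ℓ) _ ⟨
    y * (c * ℓ) * (runFactor K + 13) ≤⟨ *-monoˡ-≤ _ yc≤ ⟩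
    2 * u * (runFactor K + 13) ≡⟨ regroup u (runFactor K + 13) ⟩
    u * (2 * (runFactor K + 13)) ∎
    where
    collect : ∀ x → suc (6 + (x + 1 + 2)) ≡ x + 10
    collect = solve-∀
    regroup : ∀ u f → 2 * u * f ≡ u * (2 * f)
    regroup = solve-∀

  whole≤ : ∀ {u X s} j → 1 ≤ u → X ≤ u → s ≤ u * (1 + j * (2 * (runFactor K + 13))) →
    8 + (suc (suc (K * 4 + 1)) + (13 + (6 + (X * 10 + 1 + 5)))) + (6 + checkTime K + (s + (9 + (K * 10 + 1 + (3 + (K * 10 + 1))))))
    ≤ timeFactor K * ((j + 1) * u)
  whole≤ {u} {X} {s} j 1≤u X≤u s≤ = begin
    8 + (suc (suc (K * 4 + 1)) + (13 + (6 + (X * 10 + 1 + 5)))) + (g + (s + o))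
      ≡⟨ collect K X g s ⟩
    X * 10 + s + (36 + K * 4 + g + (14 + K * 20))
      ≤⟨ +-monoˡ-≤ _ (+-mono-≤ (*-monoˡ-≤ 10 X≤u) s≤) ⟩
    u * 10 + u * (1 + j * f) + (36 + K * 4 + g + (14 + K * 20))
      ≡⟨ cong (_+ (36 + K * 4 + g + (14 + K * 20))) (*-distribˡ-+ u 10 (1 + j * f)) ⟨
    u * (10 + (1 + j * f)) + (36 + K * 4 + g + (14 + K * 20))
      ≤⟨ absorb (10 + (1 + j * f)) _ 1≤u ⟩
    u * (10 + (1 + j * f) + (36 + K * 4 + g + (14 + K * 20)))
      ≤⟨ *-monoʳ-≤ u (≤-≡ (m≤m+n _ (j * (46 + K * 4 + g + 1 + (14 + K * 20)) + f)) (spread K g j f)) ⟩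
    u * (timeFactor K * (j + 1))
      ≡⟨ rotate u (timeFactor K) (j + 1) ⟩
    timeFactor K * ((j + 1) * u) ∎
    where
    g = 6 + checkTime K
    f = 2 * (runFactor K + 13)
    o = 9 + (K * 10 + 1 + (3 + (K * 10 + 1)))
    collect : ∀ K X g s → 8 + (suc (suc (K * 4 + 1)) + (13 + (6 + (X * 10 + 1 + 5)))) + (g + (s + (9 + (K * 10 + 1 + (3 + (K * 10 + 1))))))
            ≡ X * 10 + s + (36 + K * 4 + g + (14 + K * 20))
    collect = solve-∀
    spread : ∀ K g j f → 10 + (1 + j * f) + (36 + K * 4 + g + (14 + K * 20)) + (j * (46 + K * 4 + g + 1 + (14 + K * 20)) + f)
             ≡ (46 + K * 4 + g + 1 + f + (14 + K * 20)) * (j + 1)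
    spread = solve-∀
    rotate : ∀ u f j → u * (f * j) ≡ f * (j * u)
    rotate = solve-∀

-- The probabilistic setup of a given instance

module Instance {k n m N : ℕ} (K W : ℕ) .{{_ : NonZero n}} .{{_ : NonZero N}} .{{_ : NonZero (k * m)}}
                (lists : Lists k n m) (2≤N : 2 ≤ N) (N≤Q : N ≤ 2 ^ W) (tm : ℕ) (z* : Fin (k * m)) (c r : ℕ) {{_ : NonZero c}} where

  open Halves K N lists tm

  half : ℕ
  half = N / 2

  half≤N : half ≤ N
  half≤N = m/n≤m N 2

  N≤3half : N ≤ 3 * half
  N≤3half = begin
    N ≡⟨ m≡m%n+[m/n]*n N 2 ⟩
    N % 2 + half * 2 ≤⟨ +-monoˡ-≤ (half * 2) (≤-trans (m<1+n⇒m≤n (m%n<n N 2)) (m≥n⇒m/n>0 2≤N)) ⟩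
    half + half * 2 ≡⟨ shift half ⟩
    3 * half ∎
    where
    shift : ∀ h → h + h * 2 ≡ 3 * h
    shift = solve-∀

  side : Bool → ℕ → ℕ
  side b x = 𝟙 (Dec.does (suc x ≤? half) Bool.≟ b)

  holds : ∀ {P : Set} (P? : Dec P) → P → 𝟙 (Dec.does P? Bool.≟ true) ≡ 1
  holds (yes _) p = refl
  holds (no ¬p) p = contradiction p ¬p

  fails : ∀ {P : Set} (P? : Dec P) → ¬ P → 𝟙 (Dec.does P? Bool.≟ false) ≡ 1
  fails (yes p) ¬p = contradiction p ¬p
  fails (no _)  ¬p = refl

  side-true : ∀ x → x < half → side true x ≡ 1
  side-true x lt = holds (suc x ≤? half) lt

  side-false : ∀ x → half ≤ x → side false x ≡ 1
  side-false x le = fails (suc x ≤? half) (λ p → <-irrefl refl (≤-trans p le))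

  split : ∀ b → ∑ (allFin N) (side b ∘ toℕ) ≡ ∑ (allFin half) (side b ∘ toℕ) + ∑ (allFin (N ∸ half)) (λ x → side b (half + toℕ x))
  split b = trans (cong (λ l → ∑ (allFin l) (side b ∘ toℕ)) (sym (m+[n∸m]≡n half≤N))) (∑-allFin-+ half (N ∸ half) (side b))

  ones : ∀ l (f : Fin l → ℕ) → (∀ x → f x ≡ 1) → ∑ (allFin l) f ≡ l
  ones l f e = trans (∑-cong (allFin l) e) (trans (∑-const (allFin l) 1) (trans (*-identityʳ _) (length-allFin l)))

  lefts : N ≤ 3 * ∑ (allFin N) (λ v → 𝟙 (left v Bool.≟ true))
  lefts = ≤-trans N≤3half (*-monoʳ-≤ 3 (≡-≤ (sym (ones half _ (λ x → side-true (toℕ x) (toℕ<n x))))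
    (≤-≡ (m≤m+n _ _) (sym (split true)))))

  rights : N ≤ 3 * ∑ (allFin N) (λ v → 𝟙 (left v Bool.≟ false))
  rights = ≤-trans N≤3half (*-monoʳ-≤ 3 (≤-trans half≤ (≡-≤ (sym (ones (N ∸ half) _ (λ x → side-false (half + toℕ x) (m≤m+n half (toℕ x)))))
    (≤-≡ (m≤n+m _ _) (sym (split false))))))
    where
    half≤ : half ≤ N ∸ half
    half≤ = ≡-≤ (sym (m+n∸n≡m half half)) (∸-monoˡ-≤ half (≡-≤ (double half) (m/n*n≤m N 2)))
      where
      double : ∀ h → h + h ≡ h * 2
      double = solve-∀

  setup : Setup
  setup = record
    { c = c ; r = r ; N≢0 = >-nonZero (≤-trans (s≤s z≤n) 2≤N) ; q≢0 = m^n≢0 2 W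
    ; zL = zL ; zR = zR ; z* = z* ; left = left ; rd = λ u → residue N (toℕ u) ; item = item
    ; rd-upper = λ f → residue-upper f N≤Q ; rd-lower = λ f → residue-lower f N≤Q
    ; item-injectiveʳ = λ ρ v w e → toℕ-injective (%-injective (1 + toℕ ρ) (toℕ<n v) (toℕ<n w)
        (trans (shift v ρ) (trans (same {ρ} {ρ} {v} {w} e) (sym (shift w ρ)))))
    ; item-injectiveˡ = λ v ρ σ e → toℕ-injective (%-injective (value v) (toℕ<n ρ) (toℕ<n σ)
        (trans (cong (_% N) (+-comm (toℕ ρ) (value v))) (trans (same {ρ} {σ} {v} {v} e) (cong (_% N) (+-comm (value v) (toℕ σ))))))
    ; lefts = lefts ; rights = rights }
    where
    same : ∀ {ρ σ v w} → item ρ v ≡ item σ w → (value v + toℕ ρ) % N ≡ (value w + toℕ σ) % N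
    same e = trans (sym (toℕ-fromℕ< _)) (trans (cong toℕ e) (toℕ-fromℕ< _))
    shift : ∀ (v ρ : Fin N) → (toℕ v + (1 + toℕ ρ)) % N ≡ (value v + toℕ ρ) % N
    shift v ρ = cong (_% N) (+-suc (toℕ v) (toℕ ρ))

-- Correctness of the program

module Solver (σ : Job) where

  open Job σ
  open Fits fits

  private instance
    n-nonzero : NonZero n
    n-nonzero = n≢0

    N-nonzero : NonZero N
    N-nonzero = N≢0

    km-nonzero : NonZero (k * m)
    km-nonzero = km≢0

  open Logic W S₀ 2≤Q (env s lists t h) public

  tw tm : ℕ
  tw = wd t
  tm = tw % (k * m)

  open Halves K N lists tm public

  -- The indices of a solution. Their bound ensures that they survive being copied.
  record Pair (I J : ℕ) : Set where
    constructor pair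
    field
      I<Q : I < Q
      J<Q : J < Q
      sum≡ : sumL I + sumR J ≡ tw

  record Consts (ρ : Memᶠ) : Set where
    field
      r40 : ρ 40 ≡ n
      r41 : ρ 41 ≡ N
      r42 : ρ 42 ≡ M
      r43 : ρ 43 ≡ tm
      r44 : ρ 44 ≡ N / 2
      r46 : ρ 46 ≡ 4 + K * n
      r47 : ρ 47 ≡ tw

  Consts-frame : ∀ {ρ ρ′} → RFrame 40 ρ ρ′ → Consts ρ → Consts ρ′
  Consts-frame f c = record { r40 = trans (f 0) r40 ; r41 = trans (f 1) r41 ; r42 = trans (f 2) r42
    ; r43 = trans (f 3) r43 ; r44 = trans (f 4) r44 ; r46 = trans (f 6) r46 ; r47 = trans (f 7) r47 }
    where open Consts c

  1<Q : 1 < Q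
  1<Q = 2≤Q

  0<Q : 0 < Q
  0<Q = ≤-trans (s≤s z≤n) 2≤Q

  lit<Q : ∀ x → {Bool.T (x <ᵇ 300)} → x < Q
  lit<Q x {lt} = tab<Q x (≤-trans (<ᵇ⇒< x 300 lt) (m≤m+n 300 S₀))

  n<Q : n < Q
  n<Q = ≤-<-trans (≤-trans (m≤n+m n (k * n)) (m≤n+m _ 4)) adr<Q

  m<Q : m ≤ M → m < Q
  m<Q m≤M = ≤-<-trans (≤-trans m≤M (m≤m+n M M)) M+M<Q

  entry<Q : ∀ a → entry a < Q
  entry<Q a = ≤-<-trans (entry≤m a) (m<Q (m≤n*m m k {{k≢0}}))
    where
    k≢0 : NonZero k
    k≢0 = m*n≢0⇒m≢0 k

  digit-address : ∀ off I → I % n + (4 + off) ≡ 4 + (off + I % n)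
  digit-address off I = trans (+-comm (I % n) (4 + off)) (+-assoc 4 off (I % n))

  -- There are suc j lists of n entries from address 4 + off on.
  module _ {j off : ℕ} (a< : 4 + off + suc j * n < Q) where

    next-row<Q : 4 + off + n < Q
    next-row<Q = ≤-<-trans (+-monoʳ-≤ (4 + off) (m≤m+n n (j * n))) a<

    digit<Q : ∀ I → I % n + (4 + off) < Q
    digit<Q I = ≤-<-trans (≡-≤ (+-comm (I % n) (4 + off)) (+-monoʳ-≤ (4 + off) (<⇒≤ (m%n<n I n)))) next-row<Q

    last-row<Q : 4 + (off + n) + j * n < Q
    last-row<Q = subst (_< Q) (shift off n j) a<
      where
      shift : ∀ o n j → 4 + o + (n + j * n) ≡ 4 + (o + n) + j * n
      shift = solve-∀

  sumLoop : ∀ j {ρ τ} off I acc → ρ 40 ≡ n → ρ 4 ≡ j → ρ 1 ≡ I → ρ 2 ≡ 4 + off → ρ 3 ≡ acc →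
    I < Q → 4 + off + j * n < Q → acc + sumAt j off I < Q → j < Q →
    Exec (while 4 (arith rem 5 1 40 ∷ arith add 5 5 2 ∷ input 6 5 ∷ arith add 3 3 6 ∷ arith quot 1 1 40 ∷
                   arith add 2 2 40 ∷ const 0 1 ∷ arith sub 4 4 0 ∷ []) ∷ []) ρ τ (j * 9 + 1)
         (λ ρ′ τ′ → τ′ ≡ τ × Frame 7 ρ ρ′ × ρ′ 3 ≡ acc + sumAt j off I)
  sumLoop zero    off I acc r40 r4 r1 r2 r3 I< a< s< j< = stop r4 (refl , (λ _ → refl) , trans r3 (sym (+-identityʳ acc)))
  sumLoop (suc j) {ρ} off I acc r40 r4 r1 r2 r3 I< a< s< j< =
    loop (λ e → 1+n≢0 (trans (sym r4) e))
      (remᵢ {x = I} {y = n} r1 r40 n<Q (addᵢ {x = I % n} {y = 4 + off} refl r2 (digit<Q {j} {off} a< I) (inputᵢ {x = I % n + (4 + off)} refl (trans (cong (λ x → wd (Env.inputAt (env s lists t h) x)) (digit-address off I))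
          (wd-small (entry<Q (off + I % n)))) (addᵢ {x = acc} {y = entry (off + I % n)} r3 refl s₁< (quotᵢ {x = I} {y = n} r1 r40 I< (addᵢ r2 r40 (next-row<Q {j} {off} a<) (constᵢ 1<Q
          (subᵢ {x = suc j} {y = 1} r4 refl (s≤s z≤n) j<
      (after (λ { (e , f , v) → e , f , trans v (+-assoc acc (entry (off + I % n)) _) })
        (sumLoop j (off + n) (I / n) (acc + entry (off + I % n)) r40 refl refl (+-assoc 4 off n) refl
          (≤-<-trans (m/n≤m I n) I<) (last-row<Q {j} {off} a<)
          (subst (_< Q) (sym (+-assoc acc (entry (off + I % n)) _)) s<) (<-trans (n<1+n j) j<)))))))))))
    where
    s₁< : acc + entry (off + I % n) < Q
    s₁< = ≤-<-trans (+-monoʳ-≤ acc (m≤m+n (entry (off + I % n)) _)) s<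

  K*m≤M : K * m ≤ M
  K*m≤M = *-monoˡ-≤ m (≤-trans (m≤m+n K K) K+K≤k)

  M<Q : M < Q
  M<Q = ≤-<-trans (m≤m+n M M) M+M<Q

  N<Q : N < Q
  N<Q = ≤-<-trans (m≤m+n N N) N+N<Q

  sum<Q : ∀ j off I → j ≤ K → sumAt j off I < Q
  sum<Q j off I j≤K = ≤-<-trans (≤-trans (sumAt≤ j off I) (≤-trans (*-monoˡ-≤ m j≤K) K*m≤M)) M<Q

  sumCost : ℕ
  sumCost = suc (suc (K * 9 + 1))

  k<Q : k < Q
  k<Q = ≤-<-trans (≤-trans (m≤m*n k n) (≤-trans (m≤m+n (k * n) n) (m≤n+m _ 4))) adr<Q

  K<Q : K < Q
  K<Q = ≤-<-trans (≤-trans (m≤m+n K K) K+K≤k) k<Q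

  4+K*n<Q : 4 + K * n < Q
  4+K*n<Q = ≤-<-trans (+-monoʳ-≤ 4 (≤-trans (*-monoˡ-≤ n (≤-trans (m≤m+n K K) K+K≤k)) (m≤m+n (k * n) n))) adr<Q

  sumExec : ∀ {ρ τ} off I → Consts ρ → ρ 1 ≡ I → ρ 2 ≡ 4 + off → I < Q → off ≤ K * n →
            Exec (sumCode K) ρ τ sumCost (λ ρ′ τ′ → τ′ ≡ τ × Frame 7 ρ ρ′ × ρ′ 3 ≡ sumAt K off I)
  sumExec off I c r1 r2 I< off≤ = constᵢ 0<Q (constᵢ K<Q (sumLoop K off I 0 (Consts.r40 c) refl r1 r2 refl I<
    (≤-<-trans (+-monoʳ-≤ 4 (≤-trans (+-monoˡ-≤ (K * n) off≤) (≡-≤ (sym (*-distribʳ-+ n K K))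
      (≤-trans (*-monoˡ-≤ n K+K≤k) (m≤m+n (k * n) n))))) adr<Q) (sum<Q K off I ≤-refl) K<Q))

  hash-value : (x : Fin M) → Env.hashAt (env s lists t h) (suc (toℕ x)) ≡ value (lookup h x)
  hash-value x = trans (lookupOr-toℕ 0 (Vec.map value h) x) (lookup-map x value h)

  value<Q : (v : Fin N) → value v < Q
  value<Q v = ≤-<-trans (toℕ<n v) N<Q

  rem<Q : ∀ x → x % N < Q
  rem<Q x = <-trans (m%n<n x N) N<Q

  shift<Q : ∀ {x} (ρ̂ : Fin N) → x ≤ N → x + toℕ ρ̂ < Q
  shift<Q ρ̂ x≤N = ≤-<-trans (+-mono-≤ x≤N (<⇒≤ (toℕ<n ρ̂))) N+N<Q

  tm<M : tm < M
  tm<M = m%n<n tw M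

  base<Q : 4 + K * n + 0 < Q
  base<Q = subst (_< Q) (sym (+-identityʳ (4 + K * n))) 4+K*n<Q

  module Shifted (ρ̂ ρ̃ : Fin N) where

    Shifts : Memᶠ → Set
    Shifts ρ = ρ 32 ≡ toℕ ρ̂ × ρ 33 ≡ toℕ ρ̃

    next : Fin N → Fin N
    next v = lookup h (zρ ρ̂ ρ̃ v)

    stepCost : ℕ
    stepCost = suc (suc ((6 + sumCost) + 4))

    stepExec : ∀ {ρ τ} v → Consts ρ → Shifts ρ → ρ 7 ≡ value v →
               Exec (stepCode K) ρ τ stepCost (λ ρ′ τ′ → τ′ ≡ τ × Frame 9 ρ ρ′ × ρ′ 7 ≡ value (next v))
    stepExec {ρ} {τ} v c (r32 , r33) r7 = lessᵢ (Consts.r44 c) r7 (ifᵢ {P₁ = P₁} right-branch left-branch finish)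
      where
      open Consts c

      P₁ : Memᶠ → Tape → Set
      P₁ ρ′ τ′ = τ′ ≡ τ × Frame 9 ρ ρ′ × ρ′ 3 % M ≡ toℕ (zρ ρ̂ ρ̃ v)

      side : ∀ {b} → Dec.does (value v ≤? N / 2) ≡ b → zρ ρ̂ ρ̃ v ≡ (if b then zL (item ρ̂ v) else zR (item ρ̃ v))
      side e = cong (λ b → if b then zL (item ρ̂ v) else zR (item ρ̃ v)) e

      does-no : ∀ {P : Set} (P? : Dec P) → ¬ P → Dec.does P? ≡ false
      does-no (yes p) ¬p = contradiction p ¬p
      does-no (no _)  _  = refl

      does-yes : ∀ {P : Set} (P? : Dec P) → P → Dec.does P? ≡ true
      does-yes (yes _) _ = refl
      does-yes (no ¬p) p = contradiction p ¬p

      zL-value : sumL ((value v + toℕ ρ̂) % N) % M ≡ toℕ (zL (item ρ̂ v))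
      zL-value = sym (trans (toℕ-fromℕ< _) (cong (λ I → sumL I % M) (toℕ-fromℕ< _)))

      zR-value : (tm + M ∸ sumR ((value v + toℕ ρ̃) % N)) % M ≡ toℕ (zR (item ρ̃ v))
      zR-value = sym (trans (toℕ-fromℕ< _) (cong (λ I → (tm + M ∸ sumR I) % M) (toℕ-fromℕ< _)))

      left-branch : 𝟙 (N / 2 <? value v) ≡ 0 → Exec _ (upd ρ 8 (𝟙 (N / 2 <? value v))) τ (6 + sumCost) P₁
      left-branch e = within (+-monoˡ-≤ sumCost (m≤m+n 3 3)) (addᵢ r7 r32 (shift<Q ρ̂ (toℕ<n v)) (remᵢ {x = value v + toℕ ρ̂} refl r41 N<Q (constᵢ (lit<Q 4)
        (after (λ { (e₁ , f , e₃) → e₁ , (λ a → f (2 + a)) , trans (cong (_% M) e₃) (trans zL-value (cong toℕ (sym (side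
            (does-yes (value v ≤? N / 2) (≮⇒≥ (𝟙≡0 (N / 2 <? value v) e))))))) })
          (sumExec 0 ((value v + toℕ ρ̂) % N) (Consts-frame (λ a → refl) c) refl refl (rem<Q _) z≤n)))))

      right-branch : 𝟙 (N / 2 <? value v) ≢ 0 → Exec _ (upd ρ 8 (𝟙 (N / 2 <? value v))) τ (6 + sumCost) P₁
      right-branch nz = within (≤-reflexive (count sumCost)) (addᵢ r7 r33 (shift<Q ρ̃ (toℕ<n v)) (remᵢ {x = value v + toℕ ρ̃} refl r41 N<Q (constᵢ 0<Q
        (addᵢ {x = 4 + K * n} {y = 0} r46 refl base<Q
        (sumExec (K * n) ((value v + toℕ ρ̃) % N) (Consts-frame (λ a → refl) c) refl (+-identityʳ (4 + K * n)) (rem<Q _) ≤-refl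
         ⨾ λ { {ρ′} (refl , f , e₃) → addᵢ (trans (f 36) r43) (trans (f 35) r42) tm+M<Q
           (subᵢ {x = tm + M} refl e₃ sum≤ tm+M<Q (done (refl , (λ a → f (2 + a)) ,
             trans zR-value (cong toℕ (sym (side (does-no (value v ≤? N / 2) (<⇒≱ (𝟙-holds (N / 2 <? value v) nz)))))))))})))))
        where
        count : ∀ s → 4 + (s + 2) ≡ 6 + s
        count = solve-∀
        tm+M<Q : tm + M < Q
        tm+M<Q = <-trans (+-monoˡ-< M tm<M) M+M<Q
        sum≤ : sumR ((value v + toℕ ρ̃) % N) ≤ tm + M
        sum≤ = ≤-trans (sumAt≤ K (K * n) _) (≤-trans K*m≤M (m≤n+m M tm))

      finish : ∀ {ρ′ τ′} → P₁ ρ′ τ′ → Exec _ ρ′ τ′ 4 _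
      finish {ρ′} (refl , f , e) = remᵢ {x = ρ′ 3} {y = M} refl (trans (f 33) r42) M<Q (constᵢ 1<Q (addᵢ {x = toℕ (zρ ρ̂ ρ̃ v)} {y = 1} e refl z<Q
        (hashᵢ (+-comm (toℕ (zρ ρ̂ ρ̃ v)) 1) (hash-value (zρ ρ̂ ρ̃ v)) (value<Q (next v)) (done (refl , (λ a → f a) , refl)))))
        where
        z<Q : toℕ (zρ ρ̂ ρ̃ v) + 1 < Q
        z<Q = ≤-<-trans (≡-≤ (+-comm _ 1) (toℕ<n (zρ ρ̂ ρ̃ v))) M<Q

    Good : Memᶠ → Set
    Good ρ = Pair (ρ 10) (ρ 11)

    checkCost : ℕ
    checkCost = 5 + (sumCost + (6 + (sumCost + 8)))

    -- Registers 10 and 11 are written only after a passed test, hence a pair found earlier is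
    -- replaced at most by another correct pair.
    checkExec : ∀ {ρ τ} x y → Consts ρ → Shifts ρ → ρ 12 ≡ x → ρ 13 ≡ y → x ≤ N → y ≤ N →
      Exec (checkCode K) ρ τ checkCost (λ ρ′ τ′ → τ′ ≡ τ × Frame 12 ρ ρ′ × (Good ρ → Good ρ′)
        × (sumL ((x + toℕ ρ̂) % N) + sumR ((y + toℕ ρ̃) % N) ≡ tw → Good ρ′))
    checkExec {ρ} {τ} x y c (r32 , r33) r12 r13 x≤ y≤ =
      addᵢ {x = x} {y = toℕ ρ̂} r12 r32 (shift<Q ρ̂ x≤) (remᵢ {x = x + toℕ ρ̂} {y = N} refl r41 N<Q (constᵢ 0<Q (addᵢ {x = I} {y = 0} refl refl I+0< (constᵢ (lit<Q 4)
      (sumExec 0 I (Consts-frame {ρ} (λ a → refl) c) refl refl (rem<Q (x + toℕ ρ̂)) z≤n ⨾ λ { {ρ₁} (refl , f , e₃) →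
      constᵢ 0<Q (addᵢ {x = sumL I} {y = 0} e₃ refl sL+0< (addᵢ {x = y} {y = toℕ ρ̃} (trans (f 6) r13) (trans (f 26) r33) (shift<Q ρ̃ y≤)
      (remᵢ {x = y + toℕ ρ̃} {y = N} refl (trans (f 34) r41) N<Q (addᵢ {x = J} {y = 0} refl refl J+0< (addᵢ {x = 4 + K * n} {y = 0} (trans (f 39) r46) refl base<Q
      (sumExec (K * n) J (Consts-frame {ρ} (λ a → f (33 + a)) c) refl (+-identityʳ (4 + K * n)) (rem<Q (y + toℕ ρ̃)) ≤-refl ⨾ λ { {ρ₂} (refl , g , e₃′) →
      addᵢ {x = sumR J} {y = sumL I + 0} e₃′ (trans (g 2) refl) sum< (lessᵢ {x = total} {y = tw} refl (trans (g 40) (trans (f 40) r47))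
      (lessᵢ {x = tw} {y = total} (trans (g 40) (trans (f 40) r47)) refl
      (addᵢ {x = 𝟙 (total <? tw)} {y = 𝟙 (tw <? total)} refl refl flags< (ifᵢ {P₁ = Post} (λ nz → within z≤n (done (refl , (λ a → trans (g (5 + a)) (f (5 + a))) ,
          (λ good → subst₂ Pair (sym (trans (g 3) (f 3))) (sym (trans (g 4) (f 4))) good) ,
          λ e → contradiction (flags-0 e) nz)))
        (λ z → constᵢ 0<Q (addᵢ {x = I + 0} {y = 0} (trans (g 1) (f 1)) refl I+0+0< (addᵢ {x = J + 0} {y = 0} (trans (g 0) refl) refl J+0+0<
          (done (refl , (λ a → trans (g (5 + a)) (f (5 + a))) , (λ _ → pair I+0+0< J+0+0< (found z)) , λ _ → pair I+0+0< J+0+0< (found z))))))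
        done))))}))))))})))))
      where
      open Consts c
      I = (x + toℕ ρ̂) % N
      J = (y + toℕ ρ̃) % N
      Post : Memᶠ → Tape → Set
      Post ρ′ τ′ = τ′ ≡ τ × Frame 12 ρ ρ′ × (Good ρ → Good ρ′) × (sumL I + sumR J ≡ tw → Good ρ′)

      I+0< : I + 0 < Q
      I+0< = subst (_< Q) (sym (+-identityʳ I)) (rem<Q _)
      J+0< : J + 0 < Q
      J+0< = subst (_< Q) (sym (+-identityʳ J)) (rem<Q _)
      I+0+0< : I + 0 + 0 < Q
      I+0+0< = subst (_< Q) (sym (+-identityʳ (I + 0))) I+0<
      J+0+0< : J + 0 + 0 < Q
      J+0+0< = subst (_< Q) (sym (+-identityʳ (J + 0))) J+0<
      sL+0< : sumL I + 0 < Q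
      sL+0< = subst (_< Q) (sym (+-identityʳ (sumL I))) (sum<Q K 0 I ≤-refl)
      total = sumR J + (sumL I + 0)
      sum< : total < Q
      sum< = ≤-<-trans (+-mono-≤ (≤-trans (sumAt≤ K (K * n) J) K*m≤M)
        (≡-≤ (+-identityʳ (sumL I)) (≤-trans (sumAt≤ K 0 I) K*m≤M))) M+M<Q
      flags = 𝟙 (total <? tw) + 𝟙 (tw <? total)
      flags< : flags < Q
      flags< = ≤-<-trans (+-mono-≤ (𝟙≤1 (total <? tw)) (𝟙≤1 (tw <? total))) (lit<Q 2)
      flags-0 : sumL I + sumR J ≡ tw → flags ≡ 0
      flags-0 e = cong₂ _+_ (𝟙-no (total <? tw) (<-irrefl eq)) (𝟙-no (tw <? total) (<-irrefl (sym eq)))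
        where
        eq : total ≡ tw
        eq = trans (trans (+-comm (sumR J) _) (cong (_+ sumR J) (+-identityʳ (sumL I)))) e
      found : flags ≡ 0 → sumL (I + 0 + 0) + sumR (J + 0 + 0) ≡ tw
      found z = trans (cong₂ (λ a b → sumL a + sumR b) (trans (+-identityʳ _) (+-identityʳ I)) (trans (+-identityʳ _) (+-identityʳ J)))
        (trans (trans (+-comm (sumL I) (sumR J)) (cong (sumR J +_) (sym (+-identityʳ (sumL I)))))
          (≤-antisym (≮⇒≥ (𝟙≡0 (tw <? total) (m+n≡0⇒n≡0 (𝟙 (total <? tw)) z))) (≮⇒≥ (𝟙≡0 (total <? tw) (m+n≡0⇒m≡0 _ z)))))

  -- Chains, the table, and the two phases of a run

  record Chains : Set where
    field
      r cells : ℕ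
      {{cells≢0}} : NonZero cells
      room : cells + cells < S₀
      2ℓ<Q : suc r + suc r < 2 ^ W
      û ŵ : ℕ

    ℓ : ℕ
    ℓ = suc r

    ρ̂ ρ̃ : Fin N
    ρ̂ = fromℕ< (m%n<n û N)
    ρ̃ = fromℕ< (m%n<n ŵ N)

    open Shifted ρ̂ ρ̃

    z : Fin N → Fin M
    z = zρ ρ̂ ρ̃

    W′ : Fin N → ℕ → Fin N
    W′ = walk z h

    walk-next : ∀ v l → W′ (next v) l ≡ W′ v (suc l)
    walk-next v zero    = refl
    walk-next v (suc l) = cong (λ u → lookup h (z u)) (walk-next v l)

    walk-+ : ∀ v l l′ → W′ (W′ v l) l′ ≡ W′ v (l + l′)
    walk-+ v zero    l′ = refl
    walk-+ v (suc l) l′ = trans (walk-next (W′ v l) l′) (trans (walk-+ v l (suc l′)) (cong (W′ v) (+-suc l l′)))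

    ℓ<Q : ℓ < Q
    ℓ<Q = ≤-<-trans (m≤m+n ℓ ℓ) 2ℓ<Q

    record Setting (ρ : Memᶠ) : Set where
      field
        consts : Consts ρ
        shifts : Shifts ρ
        r38    : ρ 38 ≡ cells
        r49    : ρ 49 ≡ ℓ

    Setting-frame : ∀ {ρ ρ′} → RFrame 32 ρ ρ′ → Setting ρ → Setting ρ′
    Setting-frame f c = record { consts = Consts-frame (λ a {lt} → f (8 + a) {lt}) consts
      ; shifts = trans (f 0) (proj₁ shifts) , trans (f 1) (proj₂ shifts) ; r38 = trans (f 6) r38 ; r49 = trans (f 17) r49 }
      where open Setting c

    walkCost : ℕ → ℕ
    walkCost l = l * (stepCost + 3) + 1

    walkExec : ∀ l {ρ τ} v → Setting ρ → ρ 7 ≡ value v → ρ 9 ≡ l → l < Q →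
               Exec (walkCode K) ρ τ (walkCost l) (λ ρ′ τ′ → τ′ ≡ τ × Frame 10 ρ ρ′ × ρ′ 7 ≡ value (W′ v l))
    walkExec zero    v c r7 r9 l< = stop r9 (refl , (λ _ → refl) , r7)
    walkExec (suc l) {ρ} v c r7 r9 l< = within (≤-reflexive (cost stepCost (l * (stepCost + 3))))
      (loop (λ e → 1+n≢0 (trans (sym r9) e)) (stepExec v (Setting.consts c) (Setting.shifts c) r7 ⨾ λ { {ρ₁} (refl , f , e) →
        decᵢ (trans (f 0) r9) l< (after (λ { (refl , g , e′) → refl , (λ a → trans (g a) (f (1 + a))) ,
            trans e′ (cong value (walk-next v l)) })
          (walkExec l (next v) (Setting-frame (λ a → f (23 + a)) c) e refl (<-trans (n<1+n l) l<))) }))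
      where
      cost : ∀ s w → suc (s + suc (suc (w + 1))) ≡ s + 3 + w + 1
      cost = solve-∀

    walkExec≤ : ∀ l {ρ τ} v → l ≤ ℓ → Setting ρ → ρ 7 ≡ value v → ρ 9 ≡ l →
                Exec (walkCode K) ρ τ (walkCost ℓ) (λ ρ′ τ′ → τ′ ≡ τ × Frame 10 ρ ρ′ × ρ′ 7 ≡ value (W′ v l))
    walkExec≤ l v l≤ c r7 r9 = within (+-monoˡ-≤ 1 (*-monoˡ-≤ (stepCost + 3) l≤)) (walkExec l v c r7 r9 (≤-<-trans l≤ ℓ<Q))

    Gold : Fin N → Fin N → Set
    Gold v u = sumL ((value v + toℕ ρ̂) % N) + sumR ((value u + toℕ ρ̃) % N) ≡ tw

    Good-via : ∀ {a b a′ b′} → a′ ≡ a → b′ ≡ b → Pair a b → Pair a′ b′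
    Good-via e e′ = subst₂ Pair (sym e) (sym e′)

    syncCost : ℕ
    syncCost = checkCost + (2 + (stepCost + (4 + (stepCost + 5))))

    syncExec : ∀ l {ρ τ} v u → Setting ρ → ρ 12 ≡ value v → ρ 13 ≡ value u → ρ 14 ≡ l → l < Q →
      Exec (while 14 (checkCode K ++ mov 7 12 ++ stepCode K ++ mov 12 7 ++ mov 7 13 ++ stepCode K ++ mov 13 7 ++ dec 14) ∷ []) ρ τ
           (l * syncCost + 1)
           (λ ρ′ τ′ → τ′ ≡ τ × Frame 15 ρ ρ′ × (Good ρ → Good ρ′) × (∀ o → o < l → Gold (W′ v o) (W′ u o) → Good ρ′))
    syncExec zero    v u c r12 r13 r14 l< = stop r14 (refl , (λ _ → refl) , id , λ o ())
    syncExec (suc l) {ρ} v u c r12 r13 r14 l< = within (≤-reflexive (cost checkCost stepCost (l * syncCost)))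
      (loop (λ e → 1+n≢0 (trans (sym r14) e))
        (checkExec (value v) (value u) (Setting.consts c) (Setting.shifts c) r12 r13 (toℕ<n v) (toℕ<n u) ⨾ λ { {ρ₁} (refl , f , keep , gold) →
         movᵢ (trans (f 0) r12) (value<Q v) (let c₁ = Setting-frame (λ a → f (20 + a)) c in
         stepExec v (Setting.consts c₁) (Setting.shifts c₁) refl ⨾ λ { {ρ₂} (refl , g , e) →
         movᵢ e (value<Q (next v)) (movᵢ (trans (g 4) (trans (f 1) r13)) (value<Q u)
         (let c₂ = Setting-frame (λ a → trans (g (23 + a)) (f (20 + a))) c in
         stepExec u (Setting.consts c₂) (Setting.shifts c₂) refl ⨾ λ { {ρ₃} (refl , k , e′) →
         movᵢ e′ (value<Q (next u)) (decᵢ (trans (k 5) (trans (g 5) (trans (f 2) r14))) l<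
         (after (λ { (refl , F , keep′ , gold′) → refl , (λ a → trans (F a) (trans (k (6 + a)) (trans (g (6 + a)) (f (3 + a))))) ,
             (λ good → keep′ (Good-via (trans (k 1) (g 1)) (trans (k 2) (g 2)) (keep good))) ,
             λ { zero    o< G → keep′ (Good-via (trans (k 1) (g 1)) (trans (k 2) (g 2)) (gold G))
               ; (suc o) (s≤s o<) G → gold′ o o< (subst₂ Gold (sym (walk-next v o)) (sym (walk-next u o)) G) } })
           (syncExec l (next v) (next u) (Setting-frame (λ a → trans (k (23 + a)) (trans (g (23 + a)) (f (20 + a)))) c)
              (k 3) refl refl (<-trans (n<1+n l) l<)))) })) }) }))
      where
      cost : ∀ c s w → suc (c + suc (suc (s + suc (suc (suc (suc (s + suc (suc (suc (suc (w + 1))))))))))) ≡ c + (2 + (s + (4 + (s + 5)))) + w + 1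
      cost = solve-∀

    locateCost : ℕ
    locateCost = suc (suc (2 + (4 + (walkCost ℓ + (6 + (walkCost ℓ + (4 + (ℓ * syncCost + 1))))))))

    -- o counts the steps of the first chain after the chains are aligned.
    locateExec : ∀ {ρ τ} x u j → Setting ρ → ρ 24 ≡ value x → ρ 20 ≡ value u → ρ 25 ≡ j → j < ℓ + ℓ →
      Exec (locateCode K) ρ τ locateCost (λ ρ′ τ′ → τ′ ≡ τ × Frame 16 ρ ρ′ × (Good ρ → Good ρ′)
        × (∀ o → o < ℓ → Gold (W′ (W′ x (j ∸ ℓ)) o) (W′ (W′ u (ℓ ∸ j)) o) → Good ρ′))
    locateExec {ρ} {τ} x u j c r24 r20 r25 j< =
      lessᵢ r25 r49 (ifᵢ {P₁ = P₁}
        (λ nz → let lt = <⇒≤ (𝟙-holds (j <? ℓ) nz) in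
          subᵢ r49 r25 lt ℓ<Q (constᵢ 0<Q (done (refl , (λ _ → refl) , refl , refl , refl , sym (m≤n⇒m∸n≡0 lt)))))
        (λ e → let le = ≮⇒≥ (𝟙≡0 (j <? ℓ) e) in
          constᵢ 0<Q (subᵢ r25 r49 le left<Q (done (refl , (λ _ → refl) , refl , refl , sym (m≤n⇒m∸n≡0 le) , refl))))
        λ { {ρ₁} (refl , f , k₁₀ , k₁₁ , r14 , r15) →
          movᵢ (trans (f 4) r20) (value<Q u) (movᵢ r14 d₁<Q
          (walkExec≤ (ℓ ∸ j) u (m∸n≤m ℓ j) (Setting-frame (λ a → f (16 + a)) c) refl refl ⨾ λ { {ρ₂} (refl , g , e) →
          movᵢ e (value<Q _) (movᵢ (trans (g 14) (trans (f 8) r24)) (value<Q x) (movᵢ (trans (g 5) r15) d₂<Q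
          (walkExec≤ (j ∸ ℓ) x (m≤n+o⇒m∸n≤o j ℓ (<⇒≤ j<)) (Setting-frame (λ a → trans (g (22 + a)) (f (16 + a))) c) refl refl ⨾ λ { {ρ₃} (refl , k , e′) →
          movᵢ e′ (value<Q _) (movᵢ (trans (k 39) (trans (g 39) (trans (f 33) r49))) ℓ<Q
          (after (λ { (refl , F , keep , gold) → refl ,
               (λ a → trans (F (1 + a)) (trans (k (6 + a)) (trans (g (6 + a)) (f a)))) ,
               (λ good → keep (Good-via (trans (k 0) (trans (g 0) k₁₀)) (trans (k 1) (trans (g 1) k₁₁)) good)) , gold })
            (syncExec ℓ (W′ x (j ∸ ℓ)) (W′ u (ℓ ∸ j)) (Setting-frame (λ a → trans (k (22 + a)) (trans (g (22 + a)) (f (16 + a)))) c)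
              refl (k 3) refl ℓ<Q))) }))) })) })
      where
      open Setting c
      left<Q : j < Q
      left<Q = <-trans j< 2ℓ<Q
      d₁<Q : ℓ ∸ j < Q
      d₁<Q = ≤-<-trans (m∸n≤m ℓ j) ℓ<Q
      d₂<Q : j ∸ ℓ < Q
      d₂<Q = ≤-<-trans (m∸n≤m j ℓ) left<Q
      P₁ : Memᶠ → Tape → Set
      P₁ ρ′ τ′ = τ′ ≡ τ × Frame 16 ρ ρ′ × ρ′ 10 ≡ ρ 10 × ρ′ 11 ≡ ρ 11 × ρ′ 14 ≡ ℓ ∸ j × ρ′ 15 ≡ j ∸ ℓ

    rdℕ : ℕ → Fin N
    rdℕ x = fromℕ< (m%n<n x N)

    cellOf : Fin N → ℕ
    cellOf v = value v % cells

    cellOf< : ∀ v → cellOf v < cells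
    cellOf< v = m%n<n (value v) cells

    end : Fin N → Fin N
    end v = W′ v ℓ

    slot<S : ∀ {i} → i < cells → 300 + suc (i + i) < 300 + S₀
    slot<S {i} i< = +-monoʳ-< 300 (≡-≤ (cong suc (sym (+-suc i i))) (≤-trans (+-mono-≤ i< i<) (<⇒≤ room)))

    slot<Q : ∀ {i} → i < cells → 300 + suc (i + i) < Q
    slot<Q i< = tab<Q _ (slot<S i<)

    even≢odd′ : ∀ i j → i + i ≢ suc (j + j)
    even≢odd′ i j e = even≢odd i j (trans (cong (i +_) (+-identityʳ i)) (trans e (cong (λ y → suc (j + y)) (sym (+-identityʳ j)))))

    double-injective : ∀ {i j} → i + i ≡ j + j → i ≡ j
    double-injective {i} {j} e with <-cmp i j
    ... | tri< lt _ _ = contradiction e (<⇒≢ (+-mono-< lt lt))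
    ... | tri≈ _ eq _ = eq
    ... | tri> _ _ gt = contradiction (sym e) (<⇒≢ (+-mono-< gt gt))

    startExec : ∀ {x τ ρ P B k} → Setting ρ →
      Exec k (upd (upd (upd (upd (upd (upd ρ 20 x) 20 (x % N)) 0 1) 20 (value (rdℕ x))) 0 0) 7 (value (rdℕ x))) τ B P →
      Exec (startCode ++ k) ρ (x ∷ τ) (6 + B) P
    startExec {x} c e = randᵢ (remᵢ {x = x} {y = N} refl (Consts.r41 (Setting.consts c)) N<Q (constᵢ 1<Q
      (writeᵢ (λ κ → refl) (trans (cong (λ y → wd (ℤ.+ y)) start) (wd-small (value<Q (rdℕ x)))) (movᵢ {x = value (rdℕ x)} refl (value<Q (rdℕ x)) e))))
      where
      start : x % N + 1 ≡ value (rdℕ x)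
      start = trans (+-comm (x % N) 1) (cong suc (sym (toℕ-fromℕ< (m%n<n x N))))

    slotExec : ∀ {v τ ρ P B k} → ρ 7 ≡ value v → ρ 38 ≡ cells →
      Exec k (upd (upd (upd (upd ρ 26 (cellOf v)) 26 (cellOf v + cellOf v)) 0 300) 26 (300 + (cellOf v + cellOf v))) τ B P →
      Exec (slotCode ++ k) ρ τ (4 + B) P
    slotExec {v} r7 r38 e = remᵢ r7 r38 (≤-<-trans (≤-trans (m≤m+n cells cells) (≤-trans (<⇒≤ room) (m≤n+m S₀ 299))) (tab<Q (299 + S₀) ≤-refl))
      (addᵢ {x = cellOf v} {y = cellOf v} refl refl (≤-<-trans (m≤n+m (cellOf v + cellOf v) 300) s<) (constᵢ (<-≤-trans (s≤s (m≤m+n 300 _)) s<)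
        (writeᵢ (λ κ → refl) (trans (cong (λ y → wd (ℤ.+ y)) (+-comm (cellOf v + cellOf v) 300)) (wd-small s<)) e)))
      where
      s< : 300 + (cellOf v + cellOf v) < Q
      s< = <-trans (+-monoʳ-< 300 (n<1+n _)) (slot<Q (cellOf< v))

    chainCost : ℕ
    chainCost = 6 + (2 + (walkCost ℓ + (4 + 4)))

    Entered : Memᶠ → Memᶠ → Fin N → Set
    Entered ρ ρ′ a = (ρ′ (300 + (cellOf (end a) + cellOf (end a))) ≡ value (end a)
                     × ρ′ (300 + suc (cellOf (end a) + cellOf (end a))) ≡ value a)
      × (∀ i → i ≢ cellOf (end a) → ρ′ (300 + (i + i)) ≡ ρ (300 + (i + i)) × ρ′ (300 + suc (i + i)) ≡ ρ (300 + suc (i + i)))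

    chainExec : ∀ {ρ τ} x → Setting ρ →
      Exec (chainCode K) ρ (x ∷ τ) chainCost (λ ρ′ τ′ → τ′ ≡ τ × RFrame 27 ρ ρ′ × (ρ′ 10 ≡ ρ 10 × ρ′ 11 ≡ ρ 11) × Entered ρ ρ′ (rdℕ x))
    chainExec {ρ} {τ} x c = startExec c (movᵢ r49 ℓ<Q
      (walkExec≤ ℓ a ≤-refl (Setting-frame (λ b → refl) c) refl refl ⨾ λ { {ρ₁} (refl , f , e) →
       slotExec e (trans (f 28) r38) (storeᵢ {x = 300 + (j + j)} {y = value (end a)} refl e (value<Q (end a)) (constᵢ 1<Q (writeᵢ (λ κ → refl) address
       (storeᵢ {x = A′} refl (trans (upd-table {slotted ρ₁} {j + j} {value (end a)} {20} tt) (f 10)) (value<Q a)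
       (done (refl , (λ b {lt} → trans (low ρ₁ b lt) (f (17 + b))) , (f 0 , f 1) ,
         ((new₀ ρ₁ , new₁ ρ₁) , λ i i≢ →
            trans (other ρ₁ (i + i) (λ e → i≢ (double-injective e)) (even≢odd′ i j)) (f (290 + (i + i))) ,
            trans (other ρ₁ (suc (i + i)) (λ e → even≢odd′ j i (sym e)) (λ e → i≢ (double-injective (suc-injective e))))
              (f (290 + suc (i + i)))))))))) }))
      where
      open Setting c
      a = rdℕ x
      j = cellOf (end a)
      A = 300 + (j + j)
      A′ = 300 + suc (j + j)
      A≢ : ∀ {y y′} → y ≢ y′ → 300 + y ≢ 300 + y′
      A≢ n e = n (+-cancelˡ-≡ 300 _ _ e)

      slotted entered₁ entered₂ entered₃ : Memᶠ → Memᶠ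
      slotted ρ₁ = upd (upd (upd (upd ρ₁ 26 j) 26 (j + j)) 0 300) 26 A
      entered₁ ρ₁ = upd (slotted ρ₁) A (value (end a))
      entered₂ ρ₁ = upd (upd (entered₁ ρ₁) 0 1) 26 A′
      entered₃ ρ₁ = upd (entered₂ ρ₁) A′ (value a)

      low : ∀ ρ₁ b → Bool.T (27 + b <ᵇ 300) → entered₃ ρ₁ (27 + b) ≡ ρ₁ (27 + b)
      low ρ₁ b lt = trans (upd-table {entered₂ ρ₁} {suc (j + j)} {value a} {27 + b} lt)
                          (upd-table {slotted ρ₁} {j + j} {value (end a)} {27 + b} lt)

      other : ∀ ρ₁ y → y ≢ j + j → y ≢ suc (j + j) → entered₃ ρ₁ (300 + y) ≡ ρ₁ (300 + y)
      other ρ₁ y n n′ = trans (upd-other {entered₂ ρ₁} {A′} {value a} {300 + y} (A≢ n′))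
                              (upd-other {slotted ρ₁} {A} {value (end a)} {300 + y} (A≢ n))

      new₀ : ∀ ρ₁ → entered₃ ρ₁ A ≡ value (end a)
      new₀ ρ₁ = trans (upd-other {entered₂ ρ₁} {A′} {value a} {A} (A≢ (even≢odd′ j j)))
                      (upd-same {slotted ρ₁} {A} {value (end a)} (<-trans (+-monoʳ-< 300 (n<1+n _)) (slot<S (cellOf< (end a)))))

      new₁ : ∀ ρ₁ → entered₃ ρ₁ A′ ≡ value a
      new₁ ρ₁ = upd-same {entered₂ ρ₁} {A′} {value a} (slot<S (cellOf< (end a)))

      address : wd (ℤ.+ (300 + (j + j) + 1)) ≡ A′
      address = trans (cong (λ y → wd (ℤ.+ y)) (trans (+-comm (300 + (j + j)) 1) (sym (+-suc 300 (j + j))))) (wd-small (slot<Q (cellOf< (end a))))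

    Same : Memᶠ → Memᶠ → Set
    Same ρ ρ′ = ρ′ 10 ≡ ρ 10 × ρ′ 11 ≡ ρ 11

    tableᵉ tableˢ : Memᶠ → ℕ → ℕ
    tableᵉ ρ i = ρ (300 + (i + i))
    tableˢ ρ i = ρ (300 + suc (i + i))

    -- 0 can mark vacant cells because vertices are represented by positive numbers.
    data Cell (In : Fin N → Set) (ρ : Memᶠ) (i : ℕ) : Set where
      vacant : tableᵉ ρ i ≡ 0 → Cell In ρ i
      filled  : ∀ v → In v → tableᵉ ρ i ≡ value (end v) → tableˢ ρ i ≡ value v → Cell In ρ i

    -- Every cell is vacant or holds the end and the start of one of the chains.
    Table : (Fin N → Set) → Memᶠ → Set
    Table In ρ = ∀ i → i < cells → Cell In ρ i

    Table-frame : ∀ {In ρ ρ′} → Frame 300 ρ ρ′ → Table In ρ → Table In ρ′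
    Table-frame {In} {ρ} {ρ′} f T i i< = moved (T i i<)
      where
      moved : Cell In ρ i → Cell In ρ′ i
      moved (vacant z)       = vacant (trans (f (i + i)) z)
      moved (filled v p e e′) = filled v p (trans (f (i + i)) e) (trans (f (suc (i + i))) e′)

    Slot : Memᶠ → Fin N → Set
    Slot ρ v = tableᵉ ρ (cellOf (end v)) ≡ value (end v) × tableˢ ρ (cellOf (end v)) ≡ value v

    AllDiff : Fin N → List ℕ → Set
    AllDiff v []       = ⊤
    AllDiff v (x ∷ ws) = cellOf (end (rdℕ x)) ≢ cellOf (end v) × AllDiff v ws

    -- Some chain from v is entered and no later one takes its cell, so that its entry survives the
    -- first phase.
    data Lasts (v : Fin N) : List ℕ → Set where
      now   : ∀ {x ws} → rdℕ x ≡ v → AllDiff v ws → Lasts v (x ∷ ws)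
      later : ∀ {x ws} → Lasts v ws → Lasts v (x ∷ ws)

    entered-Table : ∀ {In ρ ρ′} a → Entered ρ ρ′ a → Table In ρ → Table (λ v → In v ⊎ v ≡ a) ρ′
    entered-Table {In} {ρ} {ρ′} a entered T i i< = cell i entered (i ≟ cellOf (end a)) (T i i<)
      where
      cell : ∀ i → Entered ρ ρ′ a → Dec (i ≡ cellOf (end a)) → Cell In ρ i → Cell (λ v → In v ⊎ v ≡ a) ρ′ i
      cell _ ((e , e′) , _) (yes refl) _            = filled a (inj₂ refl) e e′
      cell i (_ , other) (no i≢) (vacant z)          = vacant (trans (proj₁ (other i i≢)) z)
      cell i (_ , other) (no i≢) (filled v p e e′)    = filled v (inj₁ p) (trans (proj₁ (other i i≢)) e) (trans (proj₂ (other i i≢)) e′)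

    entered-Slot : ∀ {ρ ρ′} a v → Entered ρ ρ′ a → cellOf (end a) ≢ cellOf (end v) → Slot ρ v → Slot ρ′ v
    entered-Slot a v (_ , other) ne (p , q) =
      trans (proj₁ (other (cellOf (end v)) (ne ∘ sym))) p , trans (proj₂ (other (cellOf (end v)) (ne ∘ sym))) q

    table-weaken : ∀ {In In′} ρ → (∀ {v} → In v → In′ v) → Table In ρ → Table In′ ρ
    table-weaken {In} {In′} ρ f T i i< = weaken (T i i<)
      where
      weaken : Cell In ρ i → Cell In′ ρ i
      weaken (vacant z)       = vacant z
      weaken (filled v p e e′) = filled v (f p) e e′

    -- The disjunction at the end is the invariant for survival: either the entry of v is in place
    -- and no remaining chain takes its cell, or its last chain is still to come.
    firstExec : ∀ ws rest {ρ} In → Setting ρ → ρ 30 ≡ length ws → length ws < Q → Table In ρ →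
      Exec (firstCode K) ρ (ws ++ rest) (length ws * (chainCost + 3) + 1)
        (λ ρ′ τ′ → τ′ ≡ rest × RFrame 31 ρ ρ′ × Same ρ ρ′ × Table (λ v → In v ⊎ (∃[ x ] x ∈ ws × v ≡ rdℕ x)) ρ′
          × (∀ v → (Slot ρ v × AllDiff v ws) ⊎ Lasts v ws → Slot ρ′ v))
    firstExec []       rest {ρ} In c r30 l< T = stop r30 (refl , (λ _ → refl) , (refl , refl) , table-weaken ρ inj₁ T ,
      λ { v (inj₁ (p , _)) → p })
    firstExec (x ∷ ws) rest {ρ} In c r30 l< T = within (≤-reflexive (cost chainCost (length ws * (chainCost + 3))))
      (loop (λ e → 1+n≢0 (trans (sym r30) e)) (chainExec x c ⨾ λ { {ρ₁} (refl , f , (e₁₀ , e₁₁) , entered) →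
        decᵢ (trans (f 3) r30) l< (after (λ { {ρ′} (refl , g , (e₁₀′ , e₁₁′) , T′ , slots) →
            refl , (λ a {lt} → trans (g a {lt}) (f (4 + a) {lt})) , (trans e₁₀′ e₁₀ , trans e₁₁′ e₁₁) ,
            table-weaken ρ′ (λ { (inj₁ (inj₁ p)) → inj₁ p ; (inj₁ (inj₂ e)) → inj₂ (x , here refl , e)
                            ; (inj₂ (y , y∈ , e)) → inj₂ (y , there y∈ , e) }) T′ ,
            λ { v (inj₁ (p , (ne , d))) → slots v (inj₁ (entered-Slot {ρ} {ρ₁} (rdℕ x) v entered ne p , d))
              ; v (inj₂ (now refl d)) → slots v (inj₁ (proj₁ entered , d))
              ; v (inj₂ (later l)) → slots v (inj₂ l) } })
          (firstExec ws rest (λ v → In v ⊎ v ≡ rdℕ x) (Setting-frame (λ a {lt} → f (5 + a) {lt}) c) refl (<-trans (n<1+n _) l<)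
            (Table-frame {λ v → In v ⊎ v ≡ rdℕ x} {ρ₁} (λ a → refl) (entered-Table {In} {ρ} {ρ₁} (rdℕ x) entered T)))) }))
      where
      cost : ∀ c w → suc (c + suc (suc (w + 1))) ≡ c + 3 + w + 1
      cost = solve-∀

    clearLoop : ∀ j i {ρ τ} → i + j ≡ cells → ρ 30 ≡ j → ρ 31 ≡ 300 + (i + i) → (∀ i′ → i′ < i → tableᵉ ρ i′ ≡ 0) →
      Exec (while 30 (const 0 0 ∷ store 31 0 ∷ const 0 2 ∷ arith add 31 31 0 ∷ dec 30) ∷ []) ρ τ (j * 7 + 1)
        (λ ρ′ τ′ → τ′ ≡ τ × RFrame 32 ρ ρ′ × Same ρ ρ′ × (∀ i′ → i′ < cells → tableᵉ ρ′ i′ ≡ 0))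
    clearLoop zero    i e r30 r31 T = stop r30 (refl , (λ _ → refl) , (refl , refl) ,
      λ i′ lt → T i′ (≤-≡ lt (trans (sym e) (+-identityʳ i))))
    clearLoop (suc j) i {ρ} e r30 r31 T = loop (λ e′ → 1+n≢0 (trans (sym r30) e′))
      (constᵢ 0<Q (storeᵢ {y = 0} r31 refl 0<Q (constᵢ (lit<Q 2) (writeᵢ (λ κ → refl) (address r31′)
      (decᵢ (trans (upd-table {ρ₁} {i + i} {0} {30} tt) r30) (j<Q)
      (after (λ { (refl , f , (e₁₀ , e₁₁) , T′) → refl ,
          (λ a {lt} → trans (f a {lt}) (upd-table {ρ₁} {i + i} {0} {32 + a} lt)) , (e₁₀ , e₁₁) , T′ })
        (clearLoop j (suc i) (trans (sym (+-suc i j)) e) refl refl cleared)))))))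
      where
      ρ₁ : Memᶠ
      ρ₁ = upd ρ 0 0
      i<cells : i < cells
      i<cells = ≤-≡ (m≤m+n (suc i) j) (trans (sym (+-suc i j)) e)
      j<Q : suc j < Q
      j<Q = ≤-<-trans (≤-trans (m≤n+m (suc j) i) (≡-≤ e (≤-trans (m≤m+n cells cells) (≤-trans (<⇒≤ room) (m≤n+m S₀ 299)))))
              (tab<Q (299 + S₀) ≤-refl)
      r31′ : upd ρ₁ (300 + (i + i)) 0 31 ≡ 300 + (i + i)
      r31′ = trans (upd-table {ρ₁} {i + i} {0} {31} tt) r31
      address : ∀ {y} → y ≡ 300 + (i + i) → wd (ℤ.+ (y + 2)) ≡ 300 + (suc i + suc i)
      address refl = trans (cong (λ y → wd (ℤ.+ y)) (shift i)) (wd-small (subst (_< Q) (cong (300 +_) (cong suc (sym (+-suc i i)))) s<))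
        where
        shift : ∀ i → 300 + (i + i) + 2 ≡ 300 + (suc i + suc i)
        shift i = trans (+-assoc 300 (i + i) 2) (cong (300 +_) (trans (+-comm (i + i) 2) (cong suc (sym (+-suc i i)))))
        s< : 300 + suc (suc (i + i)) < Q
        s< = tab<Q _ (+-monoʳ-< 300 (≤-<-trans (≡-≤ (cong suc (sym (+-suc i i))) (+-mono-≤ i<cells i<cells)) room))
      cleared : ∀ i′ → i′ < suc i → upd ρ₁ (300 + (i + i)) 0 (300 + (i′ + i′)) ≡ 0
      cleared i′ i′< = by (i′ ≟ i)
        where
        by : Dec (i′ ≡ i) → upd ρ₁ (300 + (i + i)) 0 (300 + (i′ + i′)) ≡ 0
        by (yes refl) = upd-same {ρ₁} {300 + (i + i)} {0} (<-trans (+-monoʳ-< 300 (n<1+n _)) (slot<S i<cells))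
        by (no i′≢i)  = trans (upd-other {ρ₁} {300 + (i + i)} {0} {300 + (i′ + i′)} (λ e → i′≢i (double-injective (+-cancelˡ-≡ 300 _ _ e))))
                          (T i′ (≤∧≢⇒< (m<1+n⇒m≤n i′<) i′≢i))

    Match : Memᶠ → Fin N → Set
    Match ρ v = tableᵉ ρ (cellOf v) ≡ value v

    module _ {In : Fin N → Set} {ρ : Memᶠ} (T : Table In ρ) where

      tableᵉ<Q : ∀ {i} → i < cells → tableᵉ ρ i < Q
      tableᵉ<Q {i} i< = small (T i i<)
        where
        small : Cell In ρ i → tableᵉ ρ i < Q
        small (vacant z)      = subst (_< Q) (sym z) 0<Q
        small (filled v _ e _) = subst (_< Q) (sym e) (value<Q (end v))

      matched : ∀ v → Match ρ v → Σ[ x ∈ Fin N ] tableˢ ρ (cellOf v) ≡ value x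
      matched v e = holder (T (cellOf v) (cellOf< v))
        where
        holder : Cell In ρ (cellOf v) → Σ[ x ∈ Fin N ] tableˢ ρ (cellOf v) ≡ value x
        holder (vacant z)       = contradiction (trans (sym e) z) (λ ())
        holder (filled x _ _ e′) = x , e′

    probeCost : ℕ
    probeCost = stepCost + (2 + (4 + (5 + 7)))

    -- What the search along the chain of v finds within j steps, judged by the table in ρ.
    record Probed (ρ : Memᶠ) (v : Fin N) (j : ℕ) (ρ′ : Memᶠ) : Set where
      field
        outcome : ρ′ 23 ≡ ρ 23 ⊎ (Σ[ x ∈ Fin N ] ρ′ 24 ≡ value x × ρ′ 25 < j)
        first-match : ∀ o (x : Fin N) → o < j → (∀ o′ → o′ < o → ¬ Match ρ (W′ v (suc o′))) → Match ρ (W′ v (suc o)) →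
                      tableˢ ρ (cellOf (W′ v (suc o))) ≡ value x → ρ′ 23 ≡ 1 × ρ′ 24 ≡ value x × ρ′ 25 ≡ j ∸ suc o

    probeExec : ∀ j {In ρ τ} v → Setting ρ → ρ 7 ≡ value v → ρ 22 ≡ j → j < Q → Table In ρ →
      Exec (probeCode K) ρ τ (j * suc probeCost + 1)
        (λ ρ′ τ′ → τ′ ≡ τ × Frame 30 ρ ρ′ × Same ρ ρ′ × ρ′ 20 ≡ ρ 20 × Probed ρ v j ρ′)
    probeExec zero    v c r7 r22 j< T = stop r22 (refl , (λ _ → refl) , (refl , refl) , refl ,
      record { outcome = inj₁ refl ; first-match = λ o x () })
    probeExec (suc j) {In} {ρ} {τ} v c r7 r22 j< T = within (≤-reflexive (cost stepCost (j * suc probeCost)))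
      (loop (λ e → 1+n≢0 (trans (sym r22) e))
        (stepExec v (Setting.consts c) (Setting.shifts c) r7 ⨾ λ { {ρ₁} (refl , f , r7₁) →
         decᵢ (trans (f 13) r22) j< (slotExec r7₁ (trans (f 29) (Setting.r38 c))
         (loadᵢ {x = 300 + (i + i)} {y = y} refl (f (291 + (i + i))) (tableᵉ<Q {In} {ρ} T (cellOf< u)) (lessᵢ {x = tableᵉ ρ i} {y = value u} refl r7₁ (lessᵢ {x = value u} {y = tableᵉ ρ i} r7₁ refl
         (addᵢ {x = 𝟙 (tableᵉ ρ i <? value u)} {y = 𝟙 (value u <? tableᵉ ρ i)} refl refl flags< (ifᵢ {P₁ = P₁}
           (λ nz → within z≤n (done (refl , (λ a → f (21 + a)) , (f 1 , f 2) , f 11 , inj₁ ((λ m → nz (no-flags m)) , r7₁ , refl , f 14))))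
           (λ z → let x = proj₁ (start-of z) ; ex = proj₂ (start-of z) in
             constᵢ 1<Q (writeᵢ (λ κ → refl) address (loadᵢ {x = 300 + suc (i + i)} {y = value x} refl (trans (f (291 + suc (i + i))) ex) (value<Q x)
             (movᵢ {x = j} refl (<-trans (n<1+n j) j<) (constᵢ 0<Q (constᵢ 1<Q
               (done (refl , (λ a → f (21 + a)) , (f 1 , f 2) , f 11 , inj₂ (match z , refl , refl , (x , refl , ex) , refl)))))))))
           λ { {ρ₂} (refl , g , g₁ , g₂ , inj₁ (nm , r7₂ , r22₂ , r23₂)) →
               after (λ { (refl , k , (k₁₀ , k₁₁) , k₂ , pr) → refl , (λ a → trans (k a) (g a)) ,
                   (trans k₁₀ (proj₁ g₁) , trans k₁₁ (proj₂ g₁)) , trans k₂ g₂ , miss g nm r23₂ pr })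
                 (probeExec j u (Setting-frame (λ a → g (2 + a)) c) r7₂ r22₂ (<-trans (n<1+n j) j<) (Table-frame {In} {ρ} (λ a → g (270 + a)) T))
             ; {ρ₂} (refl , g , g₁ , g₂ , inj₂ (m , r22₂ , r23₂ , (x , r24₂ , ex) , r25₂)) →
               within (m≤n+m 1 _) (stop r22₂ (refl , g , g₁ , g₂ , hit m r23₂ r24₂ ex r25₂)) })))))) }))
      where
      cost : ∀ s w → suc (s + suc (suc (4 + suc (suc (suc (suc (suc (7 + (w + 1))))))))) ≡ suc (s + (2 + (4 + (5 + 7)))) + w + 1
      cost = solve-∀
      u = next v
      i = cellOf u
      y = tableᵉ ρ i
      flags = 𝟙 (y <? value u) + 𝟙 (value u <? y)
      flags< : flags < Q
      flags< = ≤-<-trans (+-mono-≤ (𝟙≤1 (y <? value u)) (𝟙≤1 (value u <? y))) (lit<Q 2)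
      no-flags : Match ρ u → flags ≡ 0
      no-flags e = cong₂ _+_ (𝟙-no (y <? value u) (<-irrefl e)) (𝟙-no (value u <? y) (<-irrefl (sym e)))
      match : flags ≡ 0 → Match ρ u
      match z = ≤-antisym (≮⇒≥ (𝟙≡0 (value u <? y) (m+n≡0⇒n≡0 (𝟙 (y <? value u)) z))) (≮⇒≥ (𝟙≡0 (y <? value u) (m+n≡0⇒m≡0 _ z)))
      start-of : flags ≡ 0 → Σ[ x ∈ Fin N ] tableˢ ρ i ≡ value x
      start-of z = matched {In} {ρ} T u (match z)
      address : wd (ℤ.+ (300 + (i + i) + 1)) ≡ 300 + suc (i + i)
      address = trans (cong (λ y → wd (ℤ.+ y)) (trans (+-comm (300 + (i + i)) 1) (sym (+-suc 300 (i + i))))) (wd-small (slot<Q (cellOf< u)))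

      P₁ : Memᶠ → Tape → Set
      P₁ ρ′ τ′ = τ′ ≡ τ × Frame 30 ρ ρ′ × Same ρ ρ′ × ρ′ 20 ≡ ρ 20
        × ((¬ Match ρ u × ρ′ 7 ≡ value u × ρ′ 22 ≡ j × ρ′ 23 ≡ ρ 23)
           ⊎ (Match ρ u × ρ′ 22 ≡ 0 × ρ′ 23 ≡ 1 × (Σ[ x ∈ Fin N ] ρ′ 24 ≡ value x × tableˢ ρ i ≡ value x) × ρ′ 25 ≡ j))

      miss : ∀ {ρ₂ ρ′} → Frame 30 ρ ρ₂ → ¬ Match ρ u → ρ₂ 23 ≡ ρ 23 → Probed ρ₂ u j ρ′ → Probed ρ v (suc j) ρ′
      miss {ρ₂} {ρ′} g nm e pr = record
        { outcome = [ (λ e′ → inj₁ (trans e′ e)) , (λ { (x , p , lt) → inj₂ (x , p , m<n⇒m<1+n lt) }) ]′ outcome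
        ; first-match = λ { zero    x o< nms m s → contradiction m nm
                          ; (suc o) x (s≤s o<) nms m s → first-match o x o<
                              (λ o′ lt m′ → nms (suc o′) (s≤s lt) (subst (Match ρ) (walk-next v (suc o′))
                                 (trans (sym (g (270 + (cellOf (W′ u (suc o′)) + cellOf (W′ u (suc o′)))))) m′)))
                              (trans (g (270 + (cellOf (W′ u (suc o)) + cellOf (W′ u (suc o))))) (subst (Match ρ) (sym (walk-next v (suc o))) m))
                              (trans (g (270 + suc (cellOf (W′ u (suc o)) + cellOf (W′ u (suc o)))))
                                 (subst (λ w → tableˢ ρ (cellOf w) ≡ value x) {W′ v (suc (suc o))} {W′ u (suc o)} (sym (walk-next v (suc o))) s)) } }
        where open Probed pr

      hit : ∀ {ρ′ x} → Match ρ u → ρ′ 23 ≡ 1 → ρ′ 24 ≡ value x → tableˢ ρ i ≡ value x → ρ′ 25 ≡ j → Probed ρ v (suc j) ρ′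
      hit {ρ′} {x} m e₂₃ e₂₄ ex e₂₅ = record
        { outcome = inj₂ (x , e₂₄ , ≤-reflexive (cong suc e₂₅))
        ; first-match = λ { zero    x′ o< nms m′ s → e₂₃ , trans e₂₄ (trans (sym ex) s) , e₂₅
                          ; (suc o) x′ o< nms m′ s → contradiction m (nms 0 (s≤s z≤n)) } }

    lookCost : ℕ
    lookCost = 6 + (2 + ((ℓ + ℓ) * suc probeCost + 1 + suc (locateCost + 0)))

    -- The chain from b meets a chain of the table in such a way that aligning the two reveals a solution.
    record Reveals (ρ : Memᶠ) (b : Fin N) : Set where
      field
        o      : ℕ
        x      : Fin N
        o<     : o < ℓ + ℓ
        before : ∀ o′ → o′ < o → ¬ Match ρ (W′ b (suc o′))
        match  : Match ρ (W′ b (suc o))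
        start  : tableˢ ρ (cellOf (W′ b (suc o))) ≡ value x
        o₁     : ℕ
        o₁<    : o₁ < ℓ
        gold   : Gold (W′ (W′ x (ℓ + ℓ ∸ suc o ∸ ℓ)) o₁) (W′ (W′ b (ℓ ∸ (ℓ + ℓ ∸ suc o))) o₁)

    Reveals-frame : ∀ {ρ ρ′ b} → (∀ a → ρ′ (300 + a) ≡ ρ (300 + a)) → Reveals ρ b → Reveals ρ′ b
    Reveals-frame f rv = record
      { o = o ; x = x ; o< = o< ; before = λ o′ lt m → before o′ lt (trans (sym (f _)) m)
      ; match = trans (f _) match ; start = trans (f _) start ; o₁ = o₁ ; o₁< = o₁< ; gold = gold }
      where open Reveals rv

    lookExec : ∀ {In ρ τ} w → Setting ρ → Table In ρ →
      Exec (lookCode K) ρ (w ∷ τ) lookCost (λ ρ′ τ′ → τ′ ≡ τ × Frame 30 ρ ρ′ × (Good ρ → Good ρ′) × (Reveals ρ (rdℕ w) → Good ρ′))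
    lookExec {In} {ρ} {τ} w c T = startExec c (constᵢ 0<Q (addᵢ r49 r49 2ℓ<Q
      (probeExec (ℓ + ℓ) {In} b (Setting-frame (λ a → refl) c) refl refl 2ℓ<Q (Table-frame {In} {ρ} (λ a → refl) T) ⨾ λ { {ρ₁} (refl , f , same , r20 , pr) →
       ifᵢ {P₁ = P₁}
         (λ nz → let p = found nz pr in
           after (λ { (refl , g , keep , gold) → refl , (λ a → trans (g (14 + a)) (f a)) ,
               (λ good → keep (Good-via (proj₁ same) (proj₂ same) good)) , (λ rv → gold (Reveals.o₁ rv) (Reveals.o₁< rv) (aligned p pr rv)) })
             (locateExec (proj₁ p) b (ρ₁ 25) (Setting-frame (λ a → f (2 + a)) c) (proj₁ (proj₂ p)) r20 refl (proj₂ (proj₂ p))))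
         (λ z → within z≤n (done (refl , f , Good-via (proj₁ same) (proj₂ same) ,
           λ rv → contradiction (trans (sym (proj₁ (exact pr rv))) z) (λ ()))))
         done })))
      where
      open Setting c
      b = rdℕ w

      P₁ : Memᶠ → Tape → Set
      P₁ ρ′ τ′ = τ′ ≡ τ × Frame 30 ρ ρ′ × (Good ρ → Good ρ′) × (Reveals ρ b → Good ρ′)

      ρ₀ : Memᶠ
      ρ₀ = upd (upd (upd (upd (upd (upd (upd (upd ρ 20 w) 20 (w % N)) 0 1) 20 (value b)) 0 0) 7 (value b)) 23 0) 22 (ℓ + ℓ)

      found : ∀ {ρ₁} → ρ₁ 23 ≢ 0 → Probed ρ₀ b (ℓ + ℓ) ρ₁ → Σ[ x ∈ Fin N ] ρ₁ 24 ≡ value x × ρ₁ 25 < ℓ + ℓ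
      found nz pr = [ (λ e → contradiction e nz) , id ]′ (Probed.outcome pr)

      exact : ∀ {ρ₁} → Probed ρ₀ b (ℓ + ℓ) ρ₁ → (rv : Reveals ρ b) →
              ρ₁ 23 ≡ 1 × ρ₁ 24 ≡ value (Reveals.x rv) × ρ₁ 25 ≡ ℓ + ℓ ∸ suc (Reveals.o rv)
      exact pr rv = Probed.first-match pr o x o< before match start
        where open Reveals rv

      aligned : ∀ {ρ₁} (p : Σ[ x ∈ Fin N ] ρ₁ 24 ≡ value x × ρ₁ 25 < ℓ + ℓ) → Probed ρ₀ b (ℓ + ℓ) ρ₁ → (rv : Reveals ρ b) →
                Gold (W′ (W′ (proj₁ p) (ρ₁ 25 ∸ ℓ)) (Reveals.o₁ rv)) (W′ (W′ b (ℓ ∸ ρ₁ 25)) (Reveals.o₁ rv))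
      aligned (x′ , e₂₄ , _) pr rv = subst₂ (λ x l → Gold (W′ (W′ x (l ∸ ℓ)) o₁) (W′ (W′ b (ℓ ∸ l)) o₁))
        (toℕ-injective (suc-injective (trans (sym (proj₁ (proj₂ (exact pr rv)))) e₂₄))) (sym (proj₂ (proj₂ (exact pr rv)))) gold
        where open Reveals rv

    secondExec : ∀ ws rest {In ρ} → Setting ρ → ρ 30 ≡ length ws → length ws < Q → Table In ρ →
      Exec (secondCode K) ρ (ws ++ rest) (length ws * (lookCost + 3) + 1)
        (λ ρ′ τ′ → τ′ ≡ rest × Frame 31 ρ ρ′ × (Good ρ → Good ρ′) × (∀ w → w ∈ ws → Reveals ρ (rdℕ w) → Good ρ′))
    secondExec []       rest c r30 l< T = stop r30 (refl , (λ _ → refl) , id , λ w ())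
    secondExec (w ∷ ws) rest {In} {ρ} c r30 l< T = within (≤-reflexive (cost lookCost (length ws * (lookCost + 3))))
      (loop (λ e → 1+n≢0 (trans (sym r30) e)) (lookExec w c T ⨾ λ { {ρ₁} (refl , f , keep , reveal) →
        decᵢ (trans (f 0) r30) l< (after (λ { (refl , g , keep′ , reveal′) → refl , (λ a → trans (g a) (f (1 + a))) ,
            (λ good → keep′ (keep good)) ,
            λ { w′ (here refl) rv → keep′ (reveal rv)
              ; w′ (there i) rv → reveal′ w′ i (Reveals-frame (λ a → f (270 + a)) rv) } })
          (secondExec ws rest {In} (Setting-frame (λ a → f (2 + a)) c) refl (<-trans (n<1+n _) l<)
            (Table-frame {In} {ρ} (λ a → f (270 + a)) T))) }))
      where
      cost : ∀ c w → suc (c + suc (suc (w + 1))) ≡ c + 3 + w + 1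
      cost = solve-∀

    cells<Q : cells < Q
    cells<Q = ≤-<-trans (≤-trans (m≤m+n cells cells) (≤-trans (<⇒≤ room) (m≤n+m S₀ 299))) (tab<Q (299 + S₀) ≤-refl)

    runCost : ℕ → ℕ
    runCost c = 4 + (3 + (cells * 7 + 1 + (2 + (c * (chainCost + 3) + 1 + (2 + (c * (lookCost + 3) + 1))))))

    StartsOf : List ℕ → Fin N → Set
    StartsOf as v = ∃[ x ] x ∈ as × v ≡ rdℕ x

    -- Quantifying over all tables with the guaranteed properties makes success a condition on the
    -- drawn words and not on the memory.
    Successful : List ℕ → List ℕ → Set
    Successful as bs = Σ[ y ∈ ℕ ] y ∈ bs × (∀ ρ → Table (StartsOf as) ρ → (∀ v → Lasts v as → Slot ρ v) → Reveals ρ (rdℕ y))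

    runExec : ∀ {ρ} as bs rest → Consts ρ → ρ 38 ≡ cells → ρ 49 ≡ ℓ → ρ 36 ≡ length as → length as ≡ length bs → length as < Q →
      Exec (runCode K) ρ (û ∷ ŵ ∷ as ++ (bs ++ rest)) (runCost (length as))
        (λ ρ′ τ′ → τ′ ≡ rest × RFrame 34 ρ ρ′ × (Good ρ → Good ρ′) × (Successful as bs → Good ρ′))
    runExec {ρ} as bs rest c r38 r49 r36 len len<Q =
      randᵢ (remᵢ {x = û} {y = N} refl (Consts.r41 c) N<Q (randᵢ (remᵢ {x = ŵ} {y = N} refl (Consts.r41 c) N<Q
      (movᵢ r38 cells<Q (constᵢ (lit<300) (clearLoop cells 0 refl refl refl (λ i′ ()) ⨾ λ { {ρ₁} (refl , f , (f₁₀ , f₁₁) , cleared) →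
       movᵢ (trans (f 4) r36) len<Q
      (firstExec as (bs ++ rest) (λ _ → ⊥) (Setting-frame {ρ₀} (λ a {lt} → f a {lt}) setting) refl len<Q (λ i i< → vacant (cleared i i<)) ⨾
       λ { {ρ₂} (refl , g , (g₁₀ , g₁₁) , T , slots) →
       movᵢ (trans (g 5) (trans (f 4) r36)) len<Q
      (within (≤-reflexive (cong (λ l → l * (lookCost + 3) + 1) (sym len)))
      (after (λ { (refl , k , keep , reveal) → refl , (λ a {lt} → trans (k (3 + a)) (trans (g (3 + a) {lt}) (f (2 + a) {lt}))) ,
          (λ good → keep (Good-via (trans g₁₀ f₁₀) (trans g₁₁ f₁₁) good)) ,
          λ { (y , y∈ , rv) → reveal y y∈ (Reveals-frame {ρ₂} (λ a → refl) (rv ρ₂ (starts {ρ₂} T) (λ v l → slots v (inj₂ l)))) } })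
        (secondExec bs rest {StartsOf as} (Setting-frame {ρ₀} (λ a {lt} → trans (g (1 + a) {lt}) (f a {lt})) setting) len (subst (_< Q) len len<Q)
          (Table-frame {StartsOf as} {ρ₂} (λ a → refl) (starts {ρ₂} T))))) }) }))))))
      where
      lit<300 : 300 < Q
      lit<300 = tab<Q 300 (+-monoʳ-< 300 (≤-trans (s≤s z≤n) room))

      ρ₀ : Memᶠ
      ρ₀ = upd (upd (upd (upd ρ 32 û) 32 (û % N)) 33 ŵ) 33 (ŵ % N)

      setting : Setting ρ₀
      setting = record { consts = Consts-frame {ρ} (λ a → refl) c
        ; shifts = sym (toℕ-fromℕ< (m%n<n û N)) , sym (toℕ-fromℕ< (m%n<n ŵ N)) ; r38 = r38 ; r49 = r49 }

      starts : ∀ {ρ₂} → Table (λ v → ⊥ ⊎ StartsOf as v) ρ₂ → Table (StartsOf as) ρ₂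
      starts {ρ₂} = table-weaken {λ v → ⊥ ⊎ StartsOf as v} {StartsOf as} ρ₂ (λ { (inj₂ p) → p })

    ∈-taped : ∀ {c} (A : Vec (Fin Q) c) x → toℕ (lookup A x) ∈ taped A
    ∈-taped (y ∷ A) zero    = here refl
    ∈-taped (y ∷ A) (suc x) = there (∈-taped A x)

    taped-∈ : ∀ {c} (A : Vec (Fin Q) c) {y} → y ∈ taped A → ∃[ x ] y ≡ toℕ (lookup A x)
    taped-∈ (y ∷ A) (here e)  = zero , e
    taped-∈ (y ∷ A) (there i) with taped-∈ A i
    ... | x , e = suc x , e

    taped-lasts : ∀ {c} (A : Vec (Fin Q) c) a →
      (∀ x → x ≢ a → cellOf (end (rdℕ (toℕ (lookup A x)))) ≢ cellOf (end (rdℕ (toℕ (lookup A a))))) →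
      Lasts (rdℕ (toℕ (lookup A a))) (taped A)
    taped-lasts (y ∷ A) zero    ne = now refl (all-diff A (λ x → ne (suc x) (λ ())))
      where
      all-diff : ∀ {c} (A : Vec (Fin Q) c) {v} → (∀ x → cellOf (end (rdℕ (toℕ (lookup A x)))) ≢ cellOf (end v)) → AllDiff v (taped A)
      all-diff []      ne = tt
      all-diff (y ∷ A) ne = ne zero , all-diff A (ne ∘ suc)
    taped-lasts (y ∷ A) (suc a) ne = later (taped-lasts A a (λ x x≢a → ne (suc x) (λ { refl → x≢a refl })))

    module _ {c} (A B : Vec (Fin Q) c) (a b : Fin c) (p p′ : Fin r) (i j : Fin N) where

      private
        st : Vec (Fin Q) c → Fin c → Fin N
        st A x = rdℕ (toℕ (lookup A x))

        run : Run N M c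
        run = record { cells = cells ; r = r ; z = z ; as = st A ; bs = st B }

      -- The link between the probabilistic event and the program. After i and j the two walks
      -- coincide, since z i = z j, so the second one runs into the stored end of the first.
      -- Freshness excludes earlier matches, and the remaining number of steps tells how to align
      -- the walks.
      undisturbed-successful : Run.Undisturbed run a b p p′ i h → W′ (st A a) (suc (toℕ p)) ≡ i → W′ (st B b) (suc (toℕ p′)) ≡ j →
        z i ≡ z j → Gold i j → Successful (taped A) (taped B)
      undisturbed-successful und arrive-i arrive-j zi≡zj gold-ij =
        toℕ (lookup B b) , ∈-taped B b , λ ρ T slots → reveals ρ T (slots x (taped-lasts A a (λ y y≢a e →
          Run.Undisturbed.ends und y y≢a (trans e (cong cellOf end-x)))))
        where
        open Run.Undisturbed und

        x y₀ : Fin N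
        x = st A a
        y₀ = st B b

        P Q′ tail : ℕ
        P = suc (toℕ p)
        Q′ = suc (toℕ p′)
        tail = r ∸ toℕ p

        P+tail : P + tail ≡ ℓ
        P+tail = cong suc (m+[n∸m]≡n (<⇒≤ (toℕ<n p)))

        tail>0 : 0 < tail
        tail>0 = m<n⇒0<n∸m (toℕ<n p)

        end-x : end x ≡ W′ i tail
        end-x = trans (cong (W′ x) (sym P+tail)) (trans (sym (walk-+ x P tail)) (cong (λ v → W′ v tail) arrive-i))

        -- The two chains run together after i and j.
        from-j : ∀ l → W′ y₀ (Q′ + suc l) ≡ W′ i (suc l)
        from-j l = trans (sym (walk-+ y₀ Q′ (suc l))) (trans (cong (λ v → W′ v (suc l)) arrive-j)
          (trans (sym (walk-next j l)) (trans (cong (λ v → W′ v l) (cong (lookup h) (sym zi≡zj))) (walk-next i l))))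

        z-from-j : ∀ l → z (W′ y₀ (Q′ + l)) ≡ z (W′ i l)
        z-from-j zero    = trans (cong (z ∘ W′ y₀) (+-identityʳ Q′)) (trans (cong z arrive-j) (sym zi≡zj))
        z-from-j (suc l) = cong z (from-j l)

        trI trB : List (Fin M)
        trI = trace z h i (suc tail) []
        trB = trace z h y₀ Q′ []

        o : ℕ
        o = toℕ p′ + tail

        meet : W′ y₀ (suc o) ≡ end x
        meet = trans (helper tail tail>0) (sym end-x)
          where
          helper : ∀ l → 0 < l → W′ y₀ (Q′ + l) ≡ W′ i l
          helper (suc l) _ = from-j l

        o<2ℓ : o < ℓ + ℓ
        o<2ℓ = ≤-trans (+-mono-≤ (toℕ<n p′) (m∸n≤m r (toℕ p))) (+-mono-≤ (n≤1+n r) (n≤1+n r))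

        -- Before the meeting the second chain stays away from the ends of all first chains.
        early : ∀ o′ → o′ < o → ∀ v → v ∈ taped A → W′ y₀ (suc o′) ≢ end (rdℕ v)
        early o′ o′< v v∈ = at (taped-∈ A v∈)
          where
          -- Four cases: the stored chain is that of a or another one, and the second walk has not
          -- yet arrived at j or has. After j, its values are those of the walk from i.
          apart : ∀ x′ → Dec (x′ ≡ a) → Dec (suc o′ < Q′) → W′ y₀ (suc o′) ≢ end (st A x′)
          apart x′ (yes refl) (yes lt) e = fresh-disjoint z h y₀ {suc o′} {Q′} trI lt ib (subst (_∈ trace z h i (suc tail) []) (cong z (sym (trans e end-x)))
                                      (walk-∈-trace z h i {tail} [] ≤-refl))
          apart x′ (yes refl) (no ge) e = fresh-∉ z h i {tail} {suc tail} [] ≤-refl (fresh-acc z h x P trI ia)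
                  (subst (_∈ trace z h i tail []) (trans (sym (z-from-j (suc o′ ∸ Q′))) (cong z (trans (cong (W′ y₀) (m+[n∸m]≡n (≮⇒≥ ge))) (trans e end-x))))
                    (walk-∈-trace z h i [] (+-cancelˡ-< Q′ _ _ (≤-<-trans (≤-reflexive (m+[n∸m]≡n (≮⇒≥ ge))) (s≤s o′<)))))
          apart x′ (no x′≢a) (yes lt) e = fresh-apart z h (st A x′) (suc (ℓ + ℓ)) trB (proj₂ (proj₂ (as-ok x′ x′≢a)))
                  (walk-∈-trace z h y₀ {suc o′} [] lt) (subst (_∈ trace z h (st A x′) (suc (ℓ + ℓ)) []) (cong z (sym e)) (walk-∈-trace z h (st A x′) {ℓ} [] (s≤s (m≤m+n ℓ ℓ))))
          apart x′ (no x′≢a) (no ge) e = fresh-apart z h (st A x′) (suc (ℓ + ℓ)) trI (proj₁ (as-ok x′ x′≢a))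
                  (subst (_∈ trace z h i (suc tail) []) (trans (sym (z-from-j (suc o′ ∸ Q′))) (cong (z ∘ W′ y₀) (m+[n∸m]≡n (≮⇒≥ ge))))
                    (walk-∈-trace z h i {suc o′ ∸ Q′} {suc tail} [] (m<n⇒m<1+n (+-cancelˡ-< Q′ _ _ (≤-<-trans (≤-reflexive (m+[n∸m]≡n (≮⇒≥ ge))) (s≤s o′<))))))
                  (subst (_∈ trace z h (st A x′) (suc (ℓ + ℓ)) []) (cong z (sym e)) (walk-∈-trace z h (st A x′) {ℓ} [] (s≤s (m≤m+n ℓ ℓ))))

          at : (∃[ x′ ] v ≡ toℕ (lookup A x′)) → W′ y₀ (suc o′) ≢ end (rdℕ v)
          at (x′ , eq) e = apart x′ (x′ Fin.≟ a) (suc o′ <? Q′) (trans e (cong (end ∘ rdℕ) eq))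

        [m+n]∸[o+n]≡m∸o : ∀ m n o → m + n ∸ (o + n) ≡ m ∸ o
        [m+n]∸[o+n]≡m∸o m n o = trans (cong₂ _∸_ (+-comm m n) (+-comm o n)) ([m+n]∸[m+o]≡n∸o n m o)

        remaining : ℓ + ℓ ∸ suc o ≡ ℓ + P ∸ Q′
        remaining = trans (cong (λ l → ℓ + l ∸ suc o) (sym P+tail)) (trans (cong (_∸ (Q′ + tail)) (sym (+-assoc ℓ P tail)))
                      ([m+n]∸[o+n]≡m∸o (ℓ + P) tail Q′))

        ahead-x : ℓ + ℓ ∸ suc o ∸ ℓ ≡ P ∸ Q′
        ahead-x = trans (cong (_∸ ℓ) remaining) (trans (∸-+-assoc (ℓ + P) Q′ ℓ) (trans (cong (_∸ (Q′ + ℓ)) (+-comm ℓ P)) ([m+n]∸[o+n]≡m∸o P ℓ Q′)))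

        ahead-y : ℓ ∸ (ℓ + ℓ ∸ suc o) ≡ Q′ ∸ P
        ahead-y = trans (cong (ℓ ∸_) remaining) (by (≤-total P Q′))
          where
          by : P ≤ Q′ ⊎ Q′ ≤ P → ℓ ∸ (ℓ + P ∸ Q′) ≡ Q′ ∸ P
          by (inj₁ P≤Q) = trans (cong (ℓ ∸_) (trans (cong₂ _∸_ (+-comm ℓ P) (sym (m+[n∸m]≡n P≤Q))) ([m+n]∸[m+o]≡n∸o P ℓ (Q′ ∸ P))))
            (m∸[m∸n]≡n (≤-trans (m∸n≤m Q′ P) (≤-trans (toℕ<n p′) (n≤1+n r))))
          by (inj₂ Q≤P) = trans (m≤n⇒m∸n≡0 (≤-≡ (m≤m+n ℓ (P ∸ Q′)) (sym (+-∸-assoc ℓ Q≤P)))) (sym (m≤n⇒m∸n≡0 Q≤P))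

        -- Aligned by their distance from the meeting point, the walks reach i and j at the same
        -- time. The longer approach is shortened by the difference, which leaves the minimum of the
        -- two.
        o₁ : ℕ
        o₁ = P ⊓ Q′

        align : ∀ {P Q} → (P ∸ Q) + P ⊓ Q ≡ P
        align {P} {Q} = trans (cong ((P ∸ Q) +_) (⊓-comm P Q)) (trans (+-comm (P ∸ Q) (Q ⊓ P)) (m⊓n+n∸m≡n Q P))

        reveals : ∀ ρ → Table (StartsOf (taped A)) ρ → Slot ρ x → Reveals ρ y₀
        reveals ρ T (slotᵉ , slotˢ) = record
          { o = o ; x = x ; o< = o<2ℓ
          ; before = λ o′ lt m → not-yet o′ lt m (T (cellOf (W′ y₀ (suc o′))) (cellOf< _))
          ; match = subst (Match ρ) {end x} {W′ y₀ (suc o)} (sym meet) slotᵉ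
          ; start = subst (λ v → tableˢ ρ (cellOf v) ≡ value x) {end x} {W′ y₀ (suc o)} (sym meet) slotˢ
          ; o₁ = o₁ ; o₁< = s≤s (≤-trans (m⊓n≤m P Q′) (toℕ<n p))
          ; gold = subst₂ Gold (sym (trans (walk-+ x (ℓ + ℓ ∸ suc o ∸ ℓ) o₁) (trans (cong (W′ x) (trans (cong (_+ o₁) ahead-x) (align {P} {Q′}))) arrive-i)))
                               (sym (trans (walk-+ y₀ (ℓ ∸ (ℓ + ℓ ∸ suc o)) o₁) (trans (cong (W′ y₀) (trans (cong₂ _+_ ahead-y (⊓-comm P Q′)) (align {Q′} {P}))) arrive-j)))
                               gold-ij }
          where
          not-yet : ∀ o′ → o′ < o → Match ρ (W′ y₀ (suc o′)) → Cell (StartsOf (taped A)) ρ (cellOf (W′ y₀ (suc o′))) → ⊥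
          not-yet o′ lt m (vacant e) = contradiction (trans (sym m) e) (λ ())
          not-yet o′ lt m (filled v (y , y∈ , refl) e _) = early o′ lt y y∈ (toℕ-injective (suc-injective (trans (sym m) e)))

  -- Initialisation

  cmax : ℕ
  cmax = s / C₁ + 1

  instance
    cmax≢0 : NonZero cmax
    cmax≢0 = ≢-nonZero (λ e → 1+n≢0 (trans (+-comm 1 _) e))

    C₀cmax≢0 : NonZero (C₀ * cmax)
    C₀cmax≢0 = m*n≢0 C₀ cmax

  X r ℓ : ℕ
  X = N / (C₀ * cmax)
  r = grow X X 0
  ℓ = suc r

  cube : ℕ
  cube = (2 + N) * ((2 + N) * (2 + N))

  cube<Q : cube < Q
  cube<Q = ≤-<-trans (m≤n*m cube C₀) C₀<Q

  cmax≤ : cmax ≤ 1 + N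
  cmax≤ = ≡-≤ (+-comm (s / C₁) 1) (s≤s (≤-trans (m/n≤m s C₁) s≤N))

  X≤N : X ≤ N
  X≤N = m/n≤m N (C₀ * cmax)

  ≤cube : ∀ {x y} → x ≤ 2 + N → y ≤ 2 + N → x * y ≤ cube
  ≤cube x≤ y≤ = ≤-trans (*-mono-≤ x≤ y≤) (m≤n*m _ (2 + N))

  ℓ≤ : ℓ ≤ 1 + N
  ℓ≤ = s≤s (≤-trans (grow≤ X 0) X≤N)

  powerLoop : ∀ j {ρ τ} → ρ 40 ≡ n → ρ 1 ≡ j → ρ 41 * n ^ j ≡ N → j < Q →
    Exec (while 1 (arith mul 41 40 41 ∷ dec 1) ∷ []) ρ τ (j * 4 + 1)
      (λ ρ′ τ′ → τ′ ≡ τ × ρ′ 41 ≡ N × Frame 42 ρ ρ′ × ρ′ 40 ≡ n × (∀ a → {Bool.T (2 + a <ᵇ 40)} → ρ′ (2 + a) ≡ ρ (2 + a)))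
  powerLoop zero    r40 r1 e j< = stop r1 (refl , trans (sym (*-identityʳ _)) e , (λ _ → refl) , r40 , λ _ → refl)
  powerLoop (suc j) {ρ} r40 r1 e j< = loop (λ z → 1+n≢0 (trans (sym r1) z))
    (mulᵢ {x = n} {y = ρ 41} r40 refl (≤-<-trans small N<Q) (decᵢ r1 j<
    (after (λ { (refl , e₁ , f , e₂ , g) → refl , e₁ , f , e₂ , λ a {lt} → trans (g a {lt}) (low a lt) })
      (powerLoop j r40 refl (trans (shift n (ρ 41) (n ^ j)) e) (<-trans (n<1+n j) j<)))))
    where
    shift : ∀ n a p → n * a * p ≡ a * (n * p)
    shift = solve-∀
    small : n * ρ 41 ≤ N
    small = ≤-≡ (m≤m*n (n * ρ 41) (n ^ j) {{m^n≢0 n j}}) (trans (shift n (ρ 41) (n ^ j)) e)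
    low : ∀ a → Bool.T (2 + a <ᵇ 40) → upd (upd (upd ρ 41 (n * ρ 41)) 0 1) 1 j (2 + a) ≡ ρ (2 + a)
    low a lt = upd-other {upd (upd ρ 0 1) 1 j} {41} {n * ρ 41} {2 + a} (λ e → <⇒≱ (<ᵇ⇒< (2 + a) 40 lt) (≤-≡ (n≤1+n 40) (sym e)))

  growLoop : ∀ j r {ρ τ} → ρ 1 ≡ X → ρ 2 ≡ j → ρ 49 ≡ suc r → r + j ≤ X → j < Q →
    Exec growCode ρ τ (j * 10 + 1)
      (λ ρ′ τ′ → τ′ ≡ τ × ρ′ 49 ≡ suc (grow X j r) × (∀ a → {Bool.T (6 + a <ᵇ 49)} → ρ′ (6 + a) ≡ ρ (6 + a)))
  growLoop zero    r r1 r2 r49 b j< = stop r2 (refl , r49 , λ _ → refl)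
  growLoop (suc j) r {ρ} {τ} r1 r2 r49 b j< = loop (λ z → 1+n≢0 (trans (sym r2) z))
    (constᵢ 1<Q (addᵢ {x = 1} {y = suc r} refl r49 l<Q (mulᵢ {x = 2 + r} {y = 2 + r} refl refl l²<Q (lessᵢ {x = X} {y = (2 + r) * (2 + r)} r1 refl (ifᵢ {P₁ = P₁}
      (λ nz → within z≤n (done (refl , r1 , r2 , trans r49 (cong suc (sym (if-true next? (𝟙-holds next? nz)))) , λ a → refl)))
      (λ z → movᵢ {x = 2 + r} refl l<Q (done (refl , r1 , r2 , cong suc (sym (if-false next? (𝟙≡0 next? z))) , λ a {lt} →
         upd-other {ρ} {49} {2 + r} {6 + a} (λ e → <⇒≱ (<ᵇ⇒< (6 + a) 49 lt) (≤-reflexive (sym e))))))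
      λ { {ρ₁} (refl , e₁ , e₂ , e₃ , f) → decᵢ e₂ j< (after (λ { (refl , e , g) → refl , e , λ a {lt} → trans (g a {lt}) (f a {lt}) })
        (growLoop j r′ {τ = τ} e₁ refl e₃ b′ (<-trans (n<1+n j) j<))) })))))
    where
    next? = X <? (2 + r) * (2 + r)
    r′ = if Dec.does next? then r else suc r

    if-true : ∀ {P : Set} (P? : Dec P) → P → (if Dec.does P? then r else suc r) ≡ r
    if-true (yes _) p = refl
    if-true (no n) p = contradiction p n

    if-false : ∀ {P : Set} (P? : Dec P) → ¬ P → (if Dec.does P? then r else suc r) ≡ suc r
    if-false (yes p) n = contradiction p n
    if-false (no _) n = refl

    b′ : r′ + j ≤ X
    b′ = by (Dec.does next?)
      where
      by : ∀ c → (if c then r else suc r) + j ≤ X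
      by true  = ≤-trans (+-monoʳ-≤ r (n≤1+n j)) b
      by false = ≡-≤ (sym (+-suc r j)) b

    2+r≤ : 2 + r ≤ 2 + N
    2+r≤ = s≤s (s≤s (≤-trans (m≤m+n r (suc j)) (≤-trans b X≤N)))
    l²<Q : (2 + r) * (2 + r) < Q
    l²<Q = ≤-<-trans (≤cube 2+r≤ 2+r≤) cube<Q
    l<Q : 2 + r < Q
    l<Q = ≤-<-trans (m≤m*n (2 + r) (2 + r)) l²<Q

    P₁ : Memᶠ → Tape → Set
    P₁ ρ′ τ′ = τ′ ≡ τ × ρ′ 1 ≡ X × ρ′ 2 ≡ suc j × ρ′ 49 ≡ suc r′ × (∀ a → {Bool.T (6 + a <ᵇ 49)} → ρ′ (6 + a) ≡ ρ (6 + a))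

  C₀cmax<Q : C₀ * cmax < Q
  C₀cmax<Q = ≤-<-trans (*-monoʳ-≤ C₀ (≤-trans (≤-trans cmax≤ (n≤1+n _)) (m≤m*n (2 + N) _ {{m*n≢0 (2 + N) (2 + N)}}))) C₀<Q

  N²<Q : N * N < Q
  N²<Q = ≤-<-trans (≤cube (≤-trans (n≤1+n N) (n≤1+n _)) (≤-trans (n≤1+n N) (n≤1+n _))) cube<Q

  cmaxℓ<Q : cmax * ℓ < Q
  cmaxℓ<Q = ≤-<-trans (≤cube (≤-trans cmax≤ (n≤1+n _)) (≤-trans ℓ≤ (n≤1+n _))) cube<Q

  cmaxℓ²<Q : cmax * ℓ * ℓ < Q
  cmaxℓ²<Q = ≤-<-trans (≡-≤ (*-assoc cmax ℓ ℓ) (*-mono-≤ (≤-trans cmax≤ (n≤1+n _))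
    (*-mono-≤ (≤-trans ℓ≤ (n≤1+n _)) (≤-trans ℓ≤ (n≤1+n _))))) cube<Q

  s<Q : s < Q
  s<Q = ≤-<-trans s≤N N<Q

  record Ready (ρ : Memᶠ) : Set where
    field
      consts : Consts ρ
      r34 : ρ 34 ≡ N * N
      r35 : ρ 35 ≡ cmax * ℓ * ℓ
      r49 : ρ 49 ≡ ℓ

  initCost : ℕ
  initCost = 8 + (suc (suc (K * 4 + 1)) + (13 + (6 + (X * 10 + 1 + 5))))

  m≤M : m ≤ M
  m≤M = m≤n*m m k {{m*n≢0⇒m≢0 k}}
  2+N<Q : 2 + N < Q
  2+N<Q = ≤-<-trans (m≤m*n (2 + N) _ {{m*n≢0 (2 + N) (2 + N)}}) cube<Q
  K*n<Q : K * n < Q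
  K*n<Q = ≤-<-trans (m≤n+m (K * n) 4) 4+K*n<Q

  record Inputs (ρ : Memᶠ) : Set where
    field
      r40 : ρ 40 ≡ n
      r42 : ρ 42 ≡ m
      r47 : ρ 47 ≡ wd t
      r48 : ρ 48 ≡ s

  inputExec : ∀ {ρ τ} → Exec inputCode ρ τ 8 (λ ρ′ τ′ → τ′ ≡ τ × Inputs ρ′)
  inputExec {ρ} {τ} =
    constᵢ 0<Q (inputᵢ {x = 0} {y = n} refl (wd-small n<Q)
    (constᵢ 1<Q (inputᵢ {x = 1} {y = m} refl (wd-small (m<Q m≤M))
    (constᵢ (lit<Q 2) (inputᵢ {x = 2} {y = s} refl (wd-small s<Q)
    (constᵢ (lit<Q 3) (inputᵢ {x = 3} {y = wd t} refl refl
    (done (refl , record { r40 = refl ; r42 = refl ; r47 = refl ; r48 = refl })))))))))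

  powerExec : ∀ {ρ τ} → Inputs ρ → Exec (powerCode K) ρ τ (suc (suc (K * 4 + 1)))
    (λ ρ′ τ′ → τ′ ≡ τ × Inputs ρ′ × ρ′ 41 ≡ N)
  powerExec {ρ} {τ} i = constᵢ 1<Q (constᵢ K<Q (after
    (λ { (refl , r41 , f , r40 , g) → refl , record { r40 = r40 ; r42 = trans (f 0) (Inputs.r42 i) ; r47 = trans (f 5) (Inputs.r47 i) ; r48 = trans (f 6) (Inputs.r48 i) } , r41 })
    (powerLoop K (Inputs.r40 i) refl (trans (+-identityʳ _) (sym N≡)) K<Q)))

  record Prepared (ρ : Memᶠ) : Set where
    field
      consts : Consts ρ
      r48 : ρ 48 ≡ cmax

  preparedExec : ∀ {ρ τ} → Inputs ρ → ρ 41 ≡ N → Exec (prepareCode k K C₁) ρ τ 13 (λ ρ′ τ′ → τ′ ≡ τ × Prepared ρ′)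
  preparedExec {ρ} {τ} i r41 =
    constᵢ k<Q (mulᵢ {x = k} {y = m} refl (Inputs.r42 i) M<Q (remᵢ {x = wd t} {y = k * m} (Inputs.r47 i) refl M<Q
    (constᵢ (lit<Q 2) (quotᵢ {x = N} {y = 2} r41 refl N<Q
    (constᵢ K<Q (mulᵢ {x = K} {y = n} refl (Inputs.r40 i) K*n<Q
    (constᵢ (lit<Q 4) (addᵢ {x = K * n} {y = 4} refl refl (subst (_< Q) (+-comm 4 (K * n)) 4+K*n<Q)
    (constᵢ C₁<Q (quotᵢ {x = s} {y = C₁} (Inputs.r48 i) refl s<Q
    (constᵢ 1<Q (addᵢ {x = s / C₁} {y = 1} refl refl (≤-<-trans (≤-trans cmax≤ (n≤1+n _)) 2+N<Q)
    (done (refl , record { consts = record { r40 = Inputs.r40 i ; r41 = r41 ; r42 = refl ; r43 = refl ; r44 = refl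
                                           ; r46 = +-comm (K * n) 4 ; r47 = Inputs.r47 i } ; r48 = refl }))))))))))))))

  sizesExec : ∀ {ρ₁ τ} → Prepared ρ₁ → Exec (rootCode C₀ ++ growCode ++ sizesCode) ρ₁ τ (6 + (X * 10 + 1 + 5))
    (λ ρ′ τ′ → τ′ ≡ τ × Ready ρ′ × ρ′ 36 ≡ cmax)
  sizesExec {ρ₁} {τ} prepared =
    constᵢ (≤-<-trans (m≤m*n C₀ cmax) C₀cmax<Q) (mulᵢ {x = C₀} {y = cmax} refl r48 C₀cmax<Q (quotᵢ {x = N} {y = C₀ * cmax} r41 refl N<Q
    (constᵢ 1<Q (movᵢ {x = X} refl (≤-<-trans X≤N N<Q)
    (growLoop X 0 {τ = τ} refl refl refl ≤-refl (≤-<-trans X≤N N<Q) ⨾ λ { {ρ₂} (refl , r49 , g₂) →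
    mulᵢ {x = N} {y = N} (trans (g₂ 35) r41) (trans (g₂ 35) r41) N²<Q (mulᵢ {x = cmax} {y = ℓ} (trans (g₂ 42) r48) r49 cmaxℓ<Q
    (mulᵢ {x = cmax * ℓ} {y = ℓ} refl r49 cmaxℓ²<Q
    (movᵢ {x = cmax} (trans (g₂ 42) r48) (≤-<-trans (≤-trans cmax≤ (n≤1+n _)) 2+N<Q)
    (done (refl , record { consts = record { r40 = trans (g₂ 34) r40 ; r41 = trans (g₂ 35) r41 ; r42 = trans (g₂ 36) r42 ; r43 = trans (g₂ 37) r43 ; r44 = trans (g₂ 38) r44
                                           ; r46 = trans (g₂ 40) r46 ; r47 = trans (g₂ 41) r47 }
      ; r34 = refl ; r35 = refl ; r49 = r49 } , refl))))) })))))
    where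
    open Prepared prepared
    open Consts consts

  initExec : ∀ {ρ τ} → Exec (initCode k K C₀ C₁) ρ τ initCost (λ ρ′ τ′ → τ′ ≡ τ × Ready ρ′ × ρ′ 36 ≡ cmax)
  initExec = inputExec ⨾ λ { (refl , i) → powerExec i ⨾ λ { (refl , i′ , e₄₁) → preparedExec i′ e₄₁ ⨾ λ { (refl , prepared) → sizesExec prepared } } }

  Good₀ : Memᶠ → Set
  Good₀ ρ = Pair (ρ 10) (ρ 11)

  guessCost : ℕ
  guessCost = 6 + Shifted.checkCost (fromℕ< (m%n<n 0 N)) (fromℕ< (m%n<n 0 N))

  guessExec : ∀ {ρ} u w rest → Consts ρ → Exec (guessCode K) ρ (u ∷ w ∷ rest) guessCost
    (λ ρ′ τ′ → τ′ ≡ rest × RFrame 34 ρ ρ′ × (sumL (u % N) + sumR (w % N) ≡ tw → Good₀ ρ′))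
  guessExec {ρ} u w rest c = randᵢ (remᵢ {x = u} {y = N} refl (Consts.r41 c) N<Q (randᵢ (remᵢ {x = w} {y = N} refl (Consts.r41 c) N<Q (constᵢ 0<Q (constᵢ 0<Q
    (after (λ { (refl , f , _ , found) → refl , (λ a → f (22 + a)) , λ e → found (subst₂ (λ I J → sumL I + sumR J ≡ tw) (sym (index u)) (sym (index w)) e) })
      (Shifted.checkExec ρ̂ ρ̃ 0 0 (Consts-frame {ρ} (λ a → refl) c) (sym (toℕ-fromℕ< (m%n<n u N)) , sym (toℕ-fromℕ< (m%n<n w N))) refl refl z≤n z≤n)))))))
    where
    ρ̂ ρ̃ : Fin N
    ρ̂ = fromℕ< (m%n<n u N)
    ρ̃ = fromℕ< (m%n<n w N)
    index : ∀ x → toℕ (fromℕ< (m%n<n x N)) % N ≡ x % N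
    index x = trans (cong (_% N) (toℕ-fromℕ< (m%n<n x N))) (m%n%n≡m%n x N)

  -- Runs and scales, with the random words that they consume

  Block : ℕ → Set
  Block c = (Fin Q × Fin Q) × (Vec (Fin Q) c × Vec (Fin Q) c)

  flatB : ∀ {c} → Block c → List ℕ
  flatB ((u , w) , (A , B)) = toℕ u ∷ toℕ w ∷ taped A ++ taped B

  flatR : ∀ {c R} → Vec (Block c) R → List ℕ
  flatR []       = []
  flatR (b ∷ bs) = flatB b ++ flatR bs

  length-taped : ∀ {l} (A : Vec (Fin Q) l) → length (taped A) ≡ l
  length-taped []      = refl
  length-taped (x ∷ A) = cong suc (length-taped A)

  2ℓ<Q : ℓ + ℓ < Q
  2ℓ<Q = ≤-<-trans (≤-trans (+-mono-≤ ℓ≤ ℓ≤) (≡-≤ (twice N) (≤cube {2} (s≤s (s≤s z≤n)) (n≤1+n (1 + N))))) cube<Q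
    where
    twice : ∀ N → 1 + N + (1 + N) ≡ 2 * (1 + N)
    twice = solve-∀

  cells : ℕ → ℕ
  cells c = 16 * suc c

  module _ (c : ℕ) (c≤ : suc c ≤ cmax) where

    room : cells c + cells c < S₀
    room = ≤-<-trans (≡-≤ (double c) (≤-trans (*-monoʳ-≤ 32 c≤) (m≤m+n _ k))) tables
      where
      double : ∀ c → 16 * suc c + 16 * suc c ≡ 32 * suc c
      double = solve-∀

    chains : ℕ → ℕ → Chains
    chains û ŵ = record { r = r ; cells = cells c ; room = room ; 2ℓ<Q = 2ℓ<Q ; û = û ; ŵ = ŵ }

    Success₁ : Block (suc c) → Set
    Success₁ ((u , w) , (A , B)) = Chains.Successful (chains (toℕ u) (toℕ w)) (taped A) (taped B)

    runCost₁ : ℕ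
    runCost₁ = Chains.runCost (chains 0 0) (suc c)

    c<Q : suc c < Q
    c<Q = ≤-<-trans (≤-trans c≤ (≤-trans cmax≤ (n≤1+n _))) (≤-<-trans (m≤m*n (2 + N) _ {{m*n≢0 (2 + N) (2 + N)}}) cube<Q)

    runsExec : ∀ {R} (bs : Vec (Block (suc c)) R) rest {ρ} → Consts ρ → ρ 38 ≡ cells c → ρ 49 ≡ ℓ → ρ 36 ≡ suc c → ρ 37 ≡ R → R < Q →
      Exec (runsCode K) ρ (flatR bs ++ rest) (R * (runCost₁ + 3) + 1)
        (λ ρ′ τ′ → τ′ ≡ rest × RFrame 38 ρ ρ′ × (ρ′ 34 ≡ ρ 34 × ρ′ 35 ≡ ρ 35 × ρ′ 36 ≡ ρ 36)
          × (Good₀ ρ → Good₀ ρ′) × (∀ i → Success₁ (lookup bs i) → Good₀ ρ′))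
    runsExec [] rest cs r38 r49 r36 r37 R< = stop r37 (refl , (λ _ → refl) , (refl , refl , refl) , id , λ ())
    runsExec {suc R} (b@((u , w) , (A , B)) ∷ bs) rest {ρ} cs r38 r49 r36 r37 R< =
      within (≤-reflexive (cost runCost₁ (R * (runCost₁ + 3))))
      (loop (λ e → 1+n≢0 (trans (sym r37) e)) (one ⨾ λ { {ρ₁} (refl , f , keep , succ) →
        decᵢ (trans (f 3) r37) R< (after (λ { (refl , g , (e₁ , e₂ , e₃) , keep′ , succ′) →
            refl , (λ a {lt} → trans (g a {lt}) (f (4 + a) {lt})) , (trans e₁ (f 0) , trans e₂ (f 1) , trans e₃ (f 2)) ,
            (λ good → keep′ (keep good)) , λ { zero y → keep′ (succ y) ; (suc i) y → succ′ i y } })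
          (runsExec bs rest (Consts-frame {ρ} (λ a {lt} → f (6 + a) {lt}) cs) (trans (f 4) r38) (trans (f 15) r49) (trans (f 2) r36) refl
            (<-trans (n<1+n R) R<))) }))
      where
      cost : ∀ c w → suc (c + suc (suc (w + 1))) ≡ c + 3 + w + 1
      cost = solve-∀

      regroup : flatB b ++ (flatR bs ++ rest) ≡ (flatB b ++ flatR bs) ++ rest
      regroup = sym (++-assoc (flatB b) (flatR bs) rest)

      one : Exec (runCode K) ρ ((flatB b ++ flatR bs) ++ rest) runCost₁
        (λ ρ′ τ′ → τ′ ≡ flatR bs ++ rest × RFrame 34 ρ ρ′ × (Good₀ ρ → Good₀ ρ′) × (Success₁ b → Good₀ ρ′))
      one = subst (λ τ → Exec (runCode K) ρ τ runCost₁ (λ ρ′ τ′ → τ′ ≡ flatR bs ++ rest × RFrame 34 ρ ρ′ × (Good₀ ρ → Good₀ ρ′) × (Success₁ b → Good₀ ρ′)))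
        (trans (cong (λ l → toℕ u ∷ toℕ w ∷ l) (sym (++-assoc (taped A) (taped B) (flatR bs ++ rest)))) regroup)
        (within (≤-reflexive (cong (Chains.runCost (chains (toℕ u) (toℕ w))) (length-taped A)))
          (Chains.runExec (chains (toℕ u) (toℕ w)) (taped A) (taped B) (flatR bs ++ rest) cs r38 r49 (trans r36 (sym (length-taped A)))
            (trans (length-taped A) (sym (length-taped B))) (subst (_< Q) (sym (length-taped A)) c<Q)))

  ℓ≥1 : 1 ≤ ℓ
  ℓ≥1 = s≤s z≤n

  instance
    ℓ≢0 : NonZero ℓ
    ℓ≢0 = >-nonZero ℓ≥1

    cmaxℓ≢0 : NonZero (cmax * ℓ)
    cmaxℓ≢0 = m*n≢0 cmax ℓ

    cmaxℓ²≢0 : NonZero (cmax * ℓ * ℓ)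
    cmaxℓ²≢0 = m*n≢0 (cmax * ℓ) ℓ

    weight≢0 : ∀ {c} → NonZero (cmax * ℓ * ℓ * suc c)
    weight≢0 {c} = m*n≢0 (cmax * ℓ * ℓ) (suc c)

  -- The number of runs with suc c chains in each phase.
  R : ℕ → ℕ
  R c = N * N / (cmax * ℓ * ℓ * suc c) + 1

  TapeOf : ℕ → ℕ → Set
  TapeOf zero    c       = ⊤
  TapeOf (suc j) zero    = ⊤
  TapeOf (suc j) (suc c) = Vec (Block (suc c)) (R c) × TapeOf j (suc c / 2)

  flatT : ∀ j c → TapeOf j c → List ℕ
  flatT zero    c       _        = []
  flatT (suc j) zero    _        = []
  flatT (suc j) (suc c) (bs , T) = flatR bs ++ flatT j (suc c / 2) T

  half≤ : ∀ c → suc c / 2 ≤ suc c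
  half≤ c = m/n≤m (suc c) 2

  HitBy : ∀ j c → c ≤ cmax → TapeOf j c → Set
  HitBy zero    c       le T        = ⊥
  HitBy (suc j) zero    le T        = ⊥
  HitBy (suc j) (suc c) le (bs , T) = (∃[ i ] Success₁ c le (lookup bs i)) ⊎ HitBy j (suc c / 2) (≤-trans (half≤ c) le) T

  scaleCost : ∀ c → suc c ≤ cmax → ℕ
  scaleCost c le = suc (6 + (R c * (runCost₁ c le + 3) + 1 + 2))

  scalesCost : ∀ (j c : ℕ) → c ≤ cmax → ℕ
  scalesCost zero    c       le = 1
  scalesCost (suc j) zero    le = 1
  scalesCost (suc j) (suc c) le = scaleCost c le + scalesCost j (suc c / 2) (≤-trans (half≤ c) le)

  weight≤ : ∀ c → suc c ≤ cmax → cmax * ℓ * ℓ * suc c ≤ (1 + N + N) * (1 + N)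
  weight≤ c c≤ = *-mono-≤ (begin
    cmax * ℓ * ℓ ≡⟨ *-assoc cmax ℓ ℓ ⟩
    cmax * (ℓ * ℓ) ≤⟨ *-monoʳ-≤ cmax (grow-upper (n≤1+n X) X 0 (s≤s z≤n)) ⟩
    cmax * (1 + X) ≡⟨ *-distribˡ-+ cmax 1 X ⟩
    cmax * 1 + cmax * X ≤⟨ +-mono-≤ (≡-≤ (*-identityʳ cmax) cmax≤) cmaxX≤ ⟩
    1 + N + N ∎) (≤-trans c≤ cmax≤)
    where
    cmaxX≤ : cmax * X ≤ N
    cmaxX≤ = ≤-trans (*-monoˡ-≤ X (m≤n*m cmax C₀)) (≡-≤ (*-comm (C₀ * cmax) X) (m/n*n≤m N (C₀ * cmax)))

  weight<Q : ∀ c → suc c ≤ cmax → cmax * ℓ * ℓ * suc c < Q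
  weight<Q c c≤ = ≤-<-trans (≤-trans (weight≤ c c≤) (≤-≡ (m≤m+n _ (4 * N * N + N * N * N + (9 * N + 7)))
    (sq N))) cube<Q
    where
    sq : ∀ N → (1 + N + N) * (1 + N) + (4 * N * N + N * N * N + (9 * N + 7)) ≡ (2 + N) * ((2 + N) * (2 + N))
    sq = solve-∀

  -- The number j bounds the halvings: c < 2 ^ j guarantees that they exhaust c.
  scalesExec : ∀ j c (le : c ≤ cmax) → c < 2 ^ j → (T : TapeOf j c) → ∀ rest {ρ} → Ready ρ → ρ 36 ≡ c →
    Exec (scalesCode K) ρ (flatT j c T ++ rest) (scalesCost j c le)
      (λ ρ′ τ′ → τ′ ≡ rest × Ready ρ′ × (Good₀ ρ → Good₀ ρ′) × (HitBy j c le T → Good₀ ρ′))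
  scalesExec zero    c       le lt T rest rd r36 = stop (trans r36 (n<1⇒n≡0 lt)) (refl , rd , id , λ ())
  scalesExec (suc j) zero    le lt T rest rd r36 = stop r36 (refl , rd , id , λ ())
  scalesExec (suc j) (suc c) le lt (bs , T) rest {ρ} rd r36 = subst (λ τ → Exec (scalesCode K) ρ τ (scalesCost (suc j) (suc c) le) Post)
    (sym (++-assoc (flatR bs) (flatT j (suc c / 2) T) rest))
    (within (≤-reflexive (cost (R c * (runCost₁ c le + 3)) (scalesCost j (suc c / 2) (≤-trans (half≤ c) le))))
    (loop (λ e → 1+n≢0 (trans (sym r36) e))
    (constᵢ (lit<Q 16) (mulᵢ {x = 16} {y = suc c} refl r36 cells<Q (mulᵢ {x = cmax * ℓ * ℓ} {y = suc c} r35 r36 (weight<Q c le) (quotᵢ {x = N * N} {y = cmax * ℓ * ℓ * suc c} r34 refl N²<Q (constᵢ 1<Q (addᵢ {x = N * N / (cmax * ℓ * ℓ * suc c)} {y = 1} refl refl R<Q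
    (runsExec c le bs (flatT j (suc c / 2) T ++ rest) (Consts-frame {ρ} (λ a → refl) consts) refl r49 r36 refl R<Q ⨾ λ { {ρ₁} (refl , f , (e₁ , e₂ , e₃) , keep , succ) →
    constᵢ (lit<Q 2) (quotᵢ {x = suc c} {y = 2} (trans e₃ r36) refl (c<Q c le)
    (after (λ { (refl , rd′ , keep′ , hit) → refl , rd′ , (λ good → keep′ (keep good)) , [ (λ { (i , y) → keep′ (succ i y) }) , hit ]′ })
      (scalesExec j (suc c / 2) (≤-trans (half≤ c) le) (halve {2 ^ j} lt) T rest
        (record { consts = Consts-frame {ρ} (λ a {lt} → f (2 + a) {lt}) consts ; r34 = trans e₁ r34 ; r35 = trans e₂ r35 ; r49 = trans (f 11) r49 }) refl))) })))))))))
    where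
    open Ready rd
    Post : Memᶠ → Tape → Set
    Post ρ′ τ′ = τ′ ≡ rest × Ready ρ′ × (Good₀ ρ → Good₀ ρ′) × (HitBy (suc j) (suc c) le (bs , T) → Good₀ ρ′)
    cost : ∀ r w → suc (6 + (r + 1 + suc (suc w))) ≡ suc (6 + (r + 1 + 2)) + w
    cost = solve-∀
    cells<Q : 16 * suc c < Q
    cells<Q = ≤-<-trans (≤-trans (m≤m+n (16 * suc c) (16 * suc c)) (≤-trans (<⇒≤ (room c le)) (m≤n+m S₀ 299))) (tab<Q (299 + S₀) ≤-refl)
    R<Q : R c < Q
    R<Q = ≤-<-trans (≤-trans (+-monoˡ-≤ 1 (m/n≤m (N * N) (cmax * ℓ * ℓ * suc c))) (≤-trans (m≤m+n (N * N + 1) (3 * N + 1)) (≡-≤ (sq N) (≤cube ≤-refl (n≤1+n _))))) cube<Q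
      where
      sq : ∀ N → N * N + 1 + (3 * N + 1) ≡ (2 + N) * (1 + N)
      sq = solve-∀
    halve : ∀ {x} → suc c < 2 * x → suc c / 2 < x
    halve {x} lt = m<n*o⇒m/o<n (subst (suc c <_) (*-comm 2 x) lt)

  -- Writing the output

  _[_↦_] : Memᶠ → ℕ → ℕ → Memᶠ
  (g [ p ↦ v ]) a = if a ≡ᵇ p then v else g a

  -- The addresses involved depend on k, so reads after updates do not simplify by computation. A
  -- view keeps the contents of the seven registers above the output in a vector, and those of the
  -- output cells in a function g.
  record View (ρ : Memᶠ) (xs : Vec ℕ 7) (g : Memᶠ) : Set where
    constructor view
    field
      regs  : ∀ i → ρ (toℕ i + (100 + k)) ≡ lookup xs i
      outs : ∀ a → a < k → ρ a ≡ g a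

  set : ∀ (i : Fin 7) {ρ xs g v} → View ρ xs g → View (upd ρ (toℕ i + (100 + k)) v) (xs [ i ]≔ v) g
  set i {ρ} {xs} {g} {v} (view rs cs) = view regs outs
    where
    d = toℕ i + (100 + k)
    inside : d < 300 + S₀
    inside = +-mono-<-≤ (≤-trans (toℕ<n i) (m≤m+n 7 193)) (+-monoʳ-≤ 100 (<⇒≤ k<S₀))
    regs : ∀ j → upd ρ d v (toℕ j + (100 + k)) ≡ lookup (xs [ i ]≔ v) j
    regs j with j Fin.≟ i
    ... | yes refl = trans (upd-same {ρ} inside) (sym (lookup∘update i xs v))
    ... | no j≢i   = trans (upd-other {ρ} {d} {v} (λ e → j≢i (toℕ-injective (+-cancelʳ-≡ (100 + k) (toℕ j) (toℕ i) e))))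
                       (trans (rs j) (sym (lookup∘update′ j≢i xs v)))
    outs : ∀ a → a < k → upd ρ d v a ≡ g a
    outs a a<k = trans (upd-other {ρ} {d} {v} (<⇒≢ (<-≤-trans a<k (≤-trans (m≤n+m k 100) (m≤n+m (100 + k) (toℕ i)))))) (cs a a<k)

  put : ∀ {ρ xs g p v} → View ρ xs g → p < k → View (upd ρ p v) xs (g [ p ↦ v ])
  put {ρ} {xs} {g} {p} {v} (view rs cs) p<k = view regs (λ a a<k → outs a (cs a a<k))
    where
    regs : ∀ j → upd ρ p v (toℕ j + (100 + k)) ≡ lookup xs j
    regs j = trans (upd-other {ρ} {p} {v} (≢-sym (<⇒≢ (<-≤-trans p<k (≤-trans (m≤n+m k 100) (m≤n+m (100 + k) (toℕ j))))))) (rs j)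
    outs : ∀ a → ρ a ≡ g a → upd ρ p v a ≡ (g [ p ↦ v ]) a
    outs a e = cong₂ (λ x y → if a ≡ᵇ p then x else y) (inside (p <ᵇ 300 + S₀) (<⇒<ᵇ (<-≤-trans p<k (≤-trans (<⇒≤ k<S₀) (m≤n+m S₀ 300))))) e
      where
      inside : ∀ b → Bool.T b → (if b then v else 0) ≡ v
      inside true _ = refl

  view₀ : ∀ {ρ} → View ρ (Vec.tabulate (λ i → ρ (toℕ i + (100 + k)))) ρ
  view₀ {ρ} = view (λ i → sym (lookup∘tabulate (λ i → ρ (toℕ i + (100 + k))) i)) (λ _ _ → refl)

  fill : (j p off I : ℕ) → Memᶠ → Memᶠ
  fill zero    p off I g = g
  fill (suc j) p off I g = fill j (suc p) (off + n) (I / n) (g [ p ↦ entry (off + I % n) ])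

  digitsExec : ∀ j {ρ τ} p off I {x J g} → View ρ (I ∷ 4 + off ∷ p ∷ j ∷ x ∷ n ∷ J ∷ []) g →
    p + j ≤ k → I < Q → 4 + off + j * n < Q →
    Exec (digitsCode k) ρ τ (j * 10 + 1) (λ ρ′ τ′ → τ′ ≡ τ × Σ[ I′ ∈ ℕ ] Σ[ x′ ∈ ℕ ]
      View ρ′ (I′ ∷ 4 + (off + j * n) ∷ p + j ∷ 0 ∷ x′ ∷ n ∷ J ∷ []) (fill j p off I g))
  digitsExec zero    {ρ} p off I {x} {J} {g} V b I< a< = stop (View.regs V 3F) (refl , I , x ,
    subst₂ (λ a q → View ρ (I ∷ 4 + a ∷ q ∷ 0 ∷ x ∷ n ∷ J ∷ []) g) (sym (+-identityʳ off)) (sym (+-identityʳ p)) V)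
  digitsExec (suc j) {ρ} {τ} p off I {x} {J} {g} V b I< a< = loop (λ e → 1+n≢0 (trans (sym (regs V 3F)) e))
    (remᵢ {x = I} {y = n} (regs V 0F) (regs V 5F) n<Q (let V = set 4F V in
     addᵢ {x = I % n} {y = 4 + off} (regs V 4F) (regs V 1F) (digit<Q {j} {off} a< I) (let V = set 4F V in
     inputᵢ {x = I % n + (4 + off)} {y = entry (off + I % n)} (regs V 4F)
       (trans (cong (λ x → wd (Env.inputAt (env s lists t h) x)) (digit-address off I)) (wd-small (entry<Q (off + I % n)))) (let V = set 4F V in
     storeᵢ {x = p} {y = entry (off + I % n)} (regs V 2F) (regs V 4F) (entry<Q (off + I % n)) (let V = put V p<k in
     quotᵢ {x = I} {y = n} (regs V 0F) (regs V 5F) I< (let V = set 0F V in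
     addᵢ {x = 4 + off} {y = n} (regs V 1F) (regs V 5F) (next-row<Q {j} {off} a<) (let V = set 1F V in
     constᵢ 1<Q (let V = set 4F V in
     addᵢ {x = p} {y = 1} (regs V 2F) (regs V 4F) p+1<Q (let V = set 2F V in
     subᵢ {x = suc j} {y = 1} (regs V 3F) (regs V 4F) (s≤s z≤n) sj<Q (rest (set 3F V)))))))))))
    where
    open View

    g′ = g [ p ↦ entry (off + I % n) ]

    p<k : p < k
    p<k = ≤-trans (≡-≤ (+-comm 1 p) (+-monoʳ-≤ p (s≤s z≤n))) b
    p+1<Q : p + 1 < Q
    p+1<Q = ≤-<-trans (≡-≤ (+-comm p 1) p<k) k<Q
    sj<Q : suc j < Q
    sj<Q = ≤-<-trans (≤-trans (m≤n+m (suc j) p) b) k<Q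

    rest : ∀ {ρ′} → View ρ′ (I / n ∷ 4 + off + n ∷ p + 1 ∷ j ∷ 1 ∷ n ∷ J ∷ []) g′ →
      Exec (digitsCode k) ρ′ τ (j * 10 + 1) (λ ρ′ τ′ → τ′ ≡ τ × Σ[ I′ ∈ ℕ ] Σ[ x′ ∈ ℕ ]
        View ρ′ (I′ ∷ 4 + (off + suc j * n) ∷ p + suc j ∷ 0 ∷ x′ ∷ n ∷ J ∷ []) (fill (suc j) p off I g))
    rest {ρ′} V = after (λ { {ρ″} (e , I′ , x′ , V′) → e , I′ , x′ ,
          subst₂ (λ a q → View ρ″ (I′ ∷ 4 + a ∷ q ∷ 0 ∷ x′ ∷ n ∷ J ∷ []) (fill (suc j) p off I g)) (+-assoc off n (j * n)) (sym (+-suc p j)) V′ })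
      (digitsExec j (suc p) (off + n) (I / n)
        (subst₂ (λ a q → View ρ′ (I / n ∷ a ∷ q ∷ j ∷ 1 ∷ n ∷ J ∷ []) g′) (+-assoc 4 off n) (+-comm p 1) V)
        (≡-≤ (sym (+-suc p j)) b) (≤-<-trans (m/n≤m I n) I<) (last-row<Q {j} {off} a<))

  outputCost : ℕ
  outputCost = 9 + (K * 10 + 1 + (3 + (K * 10 + 1)))

  -- What `mov` makes of a content that is not yet known to fit into a word.
  low : ℕ → ℕ
  low x = wd (ℤ.+ (x + 0))

  outputExec : ∀ {ρ τ} → Consts ρ → Exec (outputCode k K) ρ τ outputCost (λ ρ′ τ′ → τ′ ≡ τ × Σ[ g ∈ Memᶠ ]
    (∀ a → a < k → ρ′ a ≡ fill K K (K * n) (low (ρ 11)) (fill K 0 0 (low (ρ 10)) g) a))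
  outputExec {ρ} {τ} c = copy ⨾ λ { {ρ₁} (refl , x , g , V) → digitsExec K 0 0 I V (≤-trans (m≤m+n K K) K+K≤k) (toℕ<n _) 4+K*n<Q ⨾
    λ { {ρ₂} (refl , I′ , x′ , V) → constᵢ 0<Q (let V = set 4F V in addᵢ {x = J} {y = 0} (View.regs V 6F) (View.regs V 4F) J<Q (let V = set 0F V in
      constᵢ K<Q (after (λ { (e , _ , _ , V′) → e , g , View.outs V′ })
        (digitsExec K K (K * n) J (cast (set 3F V)) K+K≤k (toℕ<n _) K2n<Q)))) } }
    where
    I = low (ρ 10)
    J = low (ρ 11)

    J<Q : J + 0 < Q
    J<Q = subst (_< Q) (sym (+-identityʳ J)) (toℕ<n _)
    K2n<Q : 4 + K * n + K * n < Q
    K2n<Q = ≤-<-trans (+-monoʳ-≤ 4 (≡-≤ (sym (*-distribʳ-+ n K K)) (≤-trans (*-monoˡ-≤ n K+K≤k) (m≤m+n (k * n) n)))) adr<Q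

    cast : ∀ {ρ g a p x} → View ρ (J + 0 ∷ a ∷ p ∷ K ∷ x ∷ n ∷ J ∷ []) g → View ρ (J ∷ a ∷ p ∷ K ∷ x ∷ n ∷ J ∷ []) g
    cast {ρ} {g} {a} {p} {x} = subst (λ y → View ρ (y ∷ a ∷ p ∷ K ∷ x ∷ n ∷ J ∷ []) g) (+-identityʳ J)

    copy : Exec (copyCode k K) ρ τ 9 (λ ρ′ τ′ → τ′ ≡ τ × Σ[ x ∈ ℕ ] Σ[ g ∈ Memᶠ ] View ρ′ (I ∷ 4 + 0 ∷ 0 ∷ K ∷ x ∷ n ∷ J ∷ []) g)
    copy = constᵢ 0<Q (let V = view₀ in writeᵢ (λ κ → refl) refl (let V = set 0F V in
      constᵢ 0<Q (let V = put V 0<k in writeᵢ (λ κ → refl) refl (let V = set 6F V in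
      constᵢ 0<Q (let V = put V 0<k in addᵢ {x = n} {y = 0} (Consts.r40 c) refl n+0< (let V = set 5F V in
      constᵢ (lit<Q 4) (let V = set 1F V in constᵢ 0<Q (let V = set 2F V in constᵢ K<Q (let V = set 3F V in
      done (refl , _ , _ , cast′ V))))))))))
      where
      n+0< : n + 0 < Q
      n+0< = subst (_< Q) (sym (+-identityʳ n)) n<Q
      cast′ : ∀ {ρ g a b c d x} → View ρ (a ∷ b ∷ c ∷ d ∷ x ∷ n + 0 ∷ J ∷ []) g → View ρ (a ∷ b ∷ c ∷ d ∷ x ∷ n ∷ J ∷ []) g
      cast′ {ρ} {g} {a} {b} {c} {d} {x} = subst (λ y → View ρ (a ∷ b ∷ c ∷ d ∷ x ∷ y ∷ J ∷ []) g) (+-identityʳ n)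

  -- Solutions and the indices of their halves

  pickAt : (i off I : ℕ) → ℕ
  pickAt zero    off I = entry (off + I % n)
  pickAt (suc i) off I = pickAt i (off + n) (I / n)

  fill-below : ∀ j p off I g {a} → a < p → fill j p off I g a ≡ g a
  fill-below zero    p off I g a<p = refl
  fill-below (suc j) p off I g {a} a<p = trans (fill-below j (suc p) (off + n) (I / n) _ (m<n⇒m<1+n a<p)) (other (a ≡ᵇ p) refl)
    where
    other : ∀ b → (a ≡ᵇ p) ≡ b → (if b then entry (off + I % n) else g a) ≡ g a
    other false _ = refl
    other true  e = contradiction (≡ᵇ⇒≡ a p (subst Bool.T (sym e) tt)) (<⇒≢ a<p)

  fill-at : ∀ j p off I g i → i < j → fill j p off I g (p + i) ≡ pickAt i off I
  fill-at (suc j) p off I g zero    i<j = trans (cong (fill (suc j) p off I g) (+-identityʳ p))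
    (trans (fill-below j (suc p) (off + n) (I / n) _ ≤-refl) (same (p ≡ᵇ p) (≡⇒≡ᵇ p p refl)))
    where
    same : ∀ b → Bool.T b → (if b then entry (off + I % n) else g p) ≡ entry (off + I % n)
    same true _ = refl
  fill-at (suc j) p off I g (suc i) (s≤s i<j) = trans (cong (fill (suc j) p off I g) (+-suc p i))
    (fill-at j (suc p) (off + n) (I / n) _ i i<j)

  sum-picks : ∀ j off I → sumT j (λ i → pickAt i off I) ≡ sumAt j off I
  sum-picks zero    off I = refl
  sum-picks (suc j) off I = cong (entry (off + I % n) +_) (sum-picks j (off + n) (I / n))

  pick-entry : ∀ i off I → Σ[ d ∈ Fin n ] pickAt i off I ≡ entry (off + (i * n + toℕ d))
  pick-entry zero    off I = fromℕ< (m%n<n I n) , cong (λ x → entry (off + x)) (sym (toℕ-fromℕ< (m%n<n I n)))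
  pick-entry (suc i) off I with pick-entry i (off + n) (I / n)
  ... | d , e = d , trans e (cong entry (shift off n (i * n) (toℕ d)))
    where
    shift : ∀ o n x d → o + n + (x + d) ≡ o + (n + x + d)
    shift = solve-∀

  entry-lookup : (x : Fin k) (d : Fin n) → entry (toℕ x * n + toℕ d) ≡ lookup (lookup (values lists) x) d
  entry-lookup x d = trans (cong entry (trans (cong (_+ toℕ d) (*-comm (toℕ x) n)) (sym (toℕ-combine x d))))
    (trans (lookupOr-toℕ 0 (Vec.concat (values lists)) (Fin.combine x d)) (lookup-concat (values lists) x d))

  module _ {out g : ℕ → ℕ} {I J : ℕ} (written : ∀ a → a < k → out a ≡ fill K K (K * n) J (fill K 0 0 I g) a) where

    out-left : ∀ i → i < K → out i ≡ pickAt i 0 I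
    out-left i i<K = trans (written i (<-≤-trans i<K (≤-trans (m≤m+n K K) K+K≤k)))
      (trans (fill-below K K (K * n) J (fill K 0 0 I g) i<K) (fill-at K 0 0 I g i i<K))

    out-right : ∀ i → i < K → out (K + i) ≡ pickAt i (K * n) J
    out-right i i<K = trans (written (K + i) (<-≤-trans (+-monoʳ-< K i<K) K+K≤k)) (fill-at K K (K * n) J (fill K 0 0 I g) i i<K)

    out-sum : sumT k out ≡ sumL I + sumR J
    out-sum = trans (trans (cong (λ k → sumT k out) (sym K+K≡k)) (sumT-+ K K out)) (cong₂ _+_
      (trans (sumT-cong K out-left) (sum-picks K 0 I)) (trans (sumT-cong K out-right) (sum-picks K (K * n) J)))

    out-entry : ∀ i → i < k → Σ[ d ∈ Fin n ] out i ≡ entry (i * n + toℕ d)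
    out-entry i i<k with i <? K
    ... | yes i<K with pick-entry i 0 I
    ...   | d , e = d , trans (out-left i i<K) e
    out-entry i i<k | no i≮K with pick-entry (i ∸ K) (K * n) J
    ...   | d , e = d , trans (cong out (sym i≡)) (trans (out-right (i ∸ K) i∸K<K) (trans e (cong entry
              (trans (shift K (i ∸ K) n (toℕ d)) (cong (λ x → x * n + toℕ d) i≡)))))
      where
      i≡ : K + (i ∸ K) ≡ i
      i≡ = m+[n∸m]≡n (≮⇒≥ i≮K)
      i∸K<K : i ∸ K < K
      i∸K<K = +-cancelˡ-< K _ _ (subst₂ _<_ (sym i≡) (sym K+K≡k) i<k)
      shift : ∀ K x n d → K * n + (x * n + d) ≡ (K + x) * n + d
      shift = solve-∀

    out-picks : Picks (Vec.tabulate {n = k} (out ∘ toℕ)) (values lists)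
    out-picks = subst (Picks (Vec.tabulate (out ∘ toℕ))) (tabulate∘lookup (values lists)) (Pointwise.tabulate⁺ one)
      where
      one : ∀ (x : Fin k) → out (toℕ x) Vec∈.∈ lookup (values lists) x
      one x with out-entry (toℕ x) (toℕ<n x)
      ... | d , e = subst (Vec∈._∈ lookup (values lists) x) (sym (trans e (entry-lookup x d))) (∈-lookup d (lookup (values lists) x))

  module _ (xs : Vec ℕ k) (picks : Picks xs (values lists)) (sum≡t : ℤ.+ Vec.sum xs ≡ t) where

    index : ∀ x → lookup xs x Vec∈.∈ lookup (values lists) x
    index x = Pointwise.lookup picks x

    digit : ℕ → ℕ
    digit i with i <? k
    ... | yes i<k = toℕ (VecAny.index (index (fromℕ< i<k)))
    ... | no _    = 0

    digit<n : ∀ i → digit i < n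
    digit<n i with i <? k
    ... | yes i<k = toℕ<n (VecAny.index (index (fromℕ< i<k)))
    ... | no _    = >-nonZero⁻¹ n

    digit-toℕ : ∀ x → digit (toℕ x) ≡ toℕ (VecAny.index (index x))
    digit-toℕ x with toℕ x <? k
    ... | yes p = cong (λ y → toℕ (VecAny.index (index y))) (fromℕ<-toℕ x p)
    ... | no ¬p = contradiction (toℕ<n x) ¬p

    entry-digit : ∀ x → entry (toℕ x * n + digit (toℕ x)) ≡ lookup xs x
    entry-digit x = trans (cong (λ d → entry (toℕ x * n + d)) (digit-toℕ x))
      (trans (entry-lookup x (VecAny.index (index x))) (sym (VecAnyP.lookup-index (index x))))

    number : ℕ → (ℕ → ℕ) → ℕ
    number zero    d = 0
    number (suc j) d = d 0 + number j (d ∘ suc) * n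

    number< : ∀ j d → (∀ i → d i < n) → number j d < n ^ j
    number< zero    d d<n = s≤s z≤n
    number< (suc j) d d<n = begin-strict
      d 0 + number j (d ∘ suc) * n <⟨ +-monoˡ-< (number j (d ∘ suc) * n) (d<n 0) ⟩
      suc (number j (d ∘ suc)) * n ≤⟨ *-monoˡ-≤ n (number< j (d ∘ suc) (d<n ∘ suc)) ⟩
      n ^ j * n ≡⟨ *-comm (n ^ j) n ⟩
      n ^ suc j ∎

    sumAt-number : ∀ j off d → (∀ i → d i < n) → sumAt j off (number j d) ≡ sumT j (λ i → entry (off + (i * n + d i)))
    sumAt-number zero    off d d<n = refl
    sumAt-number (suc j) off d d<n = cong₂ _+_ (cong (λ x → entry (off + x)) first)
      (trans (cong (sumAt j (off + n)) rest) (trans (sumAt-number j (off + n) (d ∘ suc) (d<n ∘ suc))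
        (sumT-cong j (λ i _ → cong entry (shift off n (i * n) (d (suc i)))))))
      where
      x = number j (d ∘ suc)
      first : (d 0 + x * n) % n ≡ d 0
      first = trans ([m+kn]%n≡m%n (d 0) x n) (m<n⇒m%n≡m (d<n 0))
      rest : (d 0 + x * n) / n ≡ x
      rest = trans (+-distrib-/-∣ʳ (d 0) (divides x refl)) (cong₂ _+_ (m<n⇒m/n≡0 (d<n 0)) (m*n/n≡m x n))
      shift : ∀ o n x d → o + n + (x + d) ≡ o + (n + x + d)
      shift = solve-∀

    I₀ J₀ : ℕ
    I₀ = number K digit
    J₀ = number K (digit ∘ (K +_))

    sums : sumL I₀ + sumR J₀ ≡ Vec.sum xs
    sums = begin-equality
      sumL I₀ + sumR J₀ ≡⟨ cong₂ _+_ (sumAt-number K 0 digit digit<n) (sumAt-number K (K * n) (digit ∘ (K +_)) (λ i → digit<n (K + i))) ⟩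
      sumT K f + sumT K (λ i → entry (K * n + (i * n + digit (K + i)))) ≡⟨ cong (sumT K f +_) (sumT-cong K (λ i _ → cong entry (shift K i n (digit (K + i))))) ⟩
      sumT K f + sumT K (f ∘ (K +_)) ≡⟨ sumT-+ K K f ⟨
      sumT (K + K) f ≡⟨ cong (λ k → sumT k f) K+K≡k ⟩
      sumT k f ≡⟨ cong Vec.sum (tabulate-cong entry-digit) ⟩
      Vec.sum (Vec.tabulate (lookup xs)) ≡⟨ cong Vec.sum (tabulate∘lookup xs) ⟩
      Vec.sum xs ∎
      where
      f : ℕ → ℕ
      f i = entry (i * n + digit i)
      shift : ∀ K x n d → K * n + (x * n + d) ≡ (K + x) * n + d
      shift = solve-∀

    sum≤M : Vec.sum xs ≤ M
    sum≤M = ≡-≤ (sym sums) (≤-≡ (+-mono-≤ (sumAt≤ K 0 I₀) (sumAt≤ K (K * n) J₀))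
      (trans (sym (*-distribʳ-+ m K K)) (cong (_* m) K+K≡k)))

    tw≡ : tw ≡ Vec.sum xs
    tw≡ = trans (cong wd (sym sum≡t)) (wd-small (≤-<-trans sum≤M M<Q))

    t≡tw : t ≡ ℤ.+ tw
    t≡tw = trans (sym sum≡t) (cong ℤ.+_ (sym tw≡))

  -- The machine sees the target only modulo 2 ^ W. Solvability brings t into the range of a word,
  -- so that a pair with sum `tw` has sum t.
  output-correct : Solvable lists t → ∀ {out g I J} → (∀ a → a < k → out a ≡ fill K K (K * n) J (fill K 0 0 I g) a) →
    sumL I + sumR J ≡ tw → IsSolution lists t (Vec.tabulate (out ∘ toℕ))
  output-correct (xs , picks , e) written e′ = out-picks written , trans (cong ℤ.+_ (trans (out-sum written) e′)) (sym (t≡tw xs picks e))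

  solvable-indices : Solvable lists t → Σ[ I ∈ ℕ ] Σ[ J ∈ ℕ ] I < n ^ K × J < n ^ K × sumL I + sumR J ≡ tw
  solvable-indices (xs , picks , e) = I₀ xs picks e , J₀ xs picks e , number< xs picks e K _ (digit<n xs picks e) ,
    number< xs picks e K _ (λ i → digit<n xs picks e (K + i)) , trans (sums xs picks e) (sym (tw≡ xs picks e))

  -- From random tapes to counts of successes

  open Machine W (300 + S₀) using (Word; steps; start; output; read; Halted; memory)

  total-cost : ℕ → ℕ
  total-cost j = initCost + (guessCost + (scalesCost j cmax ≤-refl + outputCost))

  width : ℕ → ℕ
  width c = 2 + (c + c)

  blocks : ∀ c → List (Block c)
  blocks c = cartesianProduct (cartesianProduct words words) (cartesianProduct (vectors words c) (vectors words c))

  taped-++ : ∀ {a b} (x : Vec Word a) (y : Vec Word b) → taped (x Vec.++ y) ≡ taped x ++ taped y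
  taped-++ []      y = refl
  taped-++ (a ∷ x) y = cong (toℕ a ∷_) (taped-++ x y)

  taped-split : ∀ a {b} (x : Vec Word (a + b)) → taped (Vec.take a x) ++ taped (Vec.drop a x) ≡ taped x
  taped-split a x = trans (sym (taped-++ (Vec.take a x) (Vec.drop a x))) (cong taped (take++drop≡id a x))

  ∑-take : ∀ a b (F : Vec Word a → ℕ) → ∑ (vectors words (a + b)) (F ∘ Vec.take a) ≡ Q ^ b * ∑ (vectors words a) F
  ∑-take a b F = trans (∑-vectors-++ words a b _) (trans (∑-cong (vectors words a) (λ x →
    trans (∑-cong (vectors words b) (λ y → cong F (take-++ a x y))) (trans (∑-const (vectors words b) (F x)) (cong (_* F x) size))))
    (∑-*ˡ (vectors words a) (Q ^ b) F))
    where
    size : length (vectors words b) ≡ Q ^ b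
    size = trans (length-vectors words b) (cong (_^ b) (length-allFin Q))

  ∑-drop : ∀ a b (F : Vec Word b → ℕ) → ∑ (vectors words (a + b)) (F ∘ Vec.drop a) ≡ Q ^ a * ∑ (vectors words b) F
  ∑-drop a b F = trans (∑-vectors-++ words a b _) (trans (∑-cong (vectors words a) (λ x →
    ∑-cong (vectors words b) (λ y → cong F (drop-++ a x y)))) (trans (∑-const (vectors words a) (∑ (vectors words b) F)) (cong (_* ∑ (vectors words b) F) size)))
    where
    size : length (vectors words a) ≡ Q ^ a
    size = trans (length-vectors words a) (cong (_^ a) (length-allFin Q))

  toBlock : ∀ c → Vec Word (width c) → Block c
  toBlock c (u ∷ w ∷ x) = (u , w) , (Vec.take c x , Vec.drop c x)

  flatB-toBlock : ∀ c x → flatB (toBlock c x) ≡ taped x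
  flatB-toBlock c (u ∷ w ∷ x) = cong (λ l → toℕ u ∷ toℕ w ∷ l) (taped-split c x)

  ∑-toBlock : ∀ c (G : Block c → ℕ) → ∑ (vectors words (width c)) (G ∘ toBlock c) ≡ ∑ (blocks c) G
  ∑-toBlock c G = begin-equality
    ∑ (vectors words (width c)) (G ∘ toBlock c)
      ≡⟨ trans (∑-vectors-suc words (suc (c + c)) _) (∑-cong words (λ u → ∑-vectors-suc words (c + c) _)) ⟩
    ∑ words (λ u → ∑ words (λ w → ∑ (vectors words (c + c)) (λ x → G ((u , w) , (Vec.take c x , Vec.drop c x)))))
      ≡⟨ ∑-cong words (λ u → ∑-cong words (λ w → trans (∑-vectors-++ words c c _) (∑-cong (vectors words c) (λ x →
           ∑-cong (vectors words c) (λ y → cong₂ (λ a b → G ((u , w) , (a , b))) (take-++ c x y) (drop-++ c x y)))))) ⟩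
    ∑ words (λ u → ∑ words (λ w → ∑ (vectors words c) (λ x → ∑ (vectors words c) (λ y → G ((u , w) , (x , y))))))
      ≡⟨ ∑-cong words (λ u → ∑-cong words (λ w → ∑-× (vectors words c) (vectors words c) (λ p → G ((u , w) , p)))) ⟨
    ∑ words (λ u → ∑ words (λ w → ∑ (cartesianProduct (vectors words c) (vectors words c)) (λ p → G ((u , w) , p))))
      ≡⟨ ∑-× words words _ ⟨
    ∑ (cartesianProduct words words) (λ p → ∑ (cartesianProduct (vectors words c) (vectors words c)) (λ p′ → G (p , p′)))
      ≡⟨ ∑-× (cartesianProduct words words) _ G ⟨
    ∑ (blocks c) G ∎

  toBlocks : ∀ c R → Vec Word (R * width c) → Vec (Block c) R
  toBlocks c zero    x = []
  toBlocks c (suc R) x = toBlock c (Vec.take (width c) x) ∷ toBlocks c R (Vec.drop (width c) x)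

  flatR-toBlocks : ∀ c R x → flatR (toBlocks c R x) ≡ taped x
  flatR-toBlocks c zero    [] = refl
  flatR-toBlocks c (suc R) x  = trans (cong₂ _++_ (flatB-toBlock c (Vec.take (width c) x)) (flatR-toBlocks c R (Vec.drop (width c) x)))
    (taped-split (width c) x)

  ∑-toBlocks : ∀ c R (G : Vec (Block c) R → ℕ) → ∑ (vectors words (R * width c)) (G ∘ toBlocks c R) ≡ ∑ (vectors (blocks c) R) G
  ∑-toBlocks c zero    G = refl
  ∑-toBlocks c (suc R) G = begin-equality
    ∑ (vectors words (width c + R * width c)) (G ∘ toBlocks c (suc R))
      ≡⟨ trans (∑-vectors-++ words (width c) (R * width c) _) (∑-cong (vectors words (width c)) (λ x → ∑-cong (vectors words (R * width c)) (λ y →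
           cong₂ (λ a b → G (toBlock c a ∷ toBlocks c R b)) (take-++ (width c) x y) (drop-++ (width c) x y)))) ⟩
    ∑ (vectors words (width c)) (λ x → ∑ (vectors words (R * width c)) (λ y → G (toBlock c x ∷ toBlocks c R y)))
      ≡⟨ ∑-cong (vectors words (width c)) (λ x → ∑-toBlocks c R (λ bs → G (toBlock c x ∷ bs))) ⟩
    ∑ (vectors words (width c)) (λ x → ∑ (vectors (blocks c) R) (λ bs → G (toBlock c x ∷ bs)))
      ≡⟨ ∑-toBlock c (λ b → ∑ (vectors (blocks c) R) (λ bs → G (b ∷ bs))) ⟩
    ∑ (blocks c) (λ b → ∑ (vectors (blocks c) R) (λ bs → G (b ∷ bs)))
      ≡⟨ ∑-vectors-suc (blocks c) R G ⟨
    ∑ (vectors (blocks c) (suc R)) G ∎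

  tapeLength : ℕ → ℕ → ℕ
  tapeLength zero    c       = 0
  tapeLength (suc j) zero    = 0
  tapeLength (suc j) (suc c) = R c * width (suc c) + tapeLength j (suc c / 2)

  toTape : ∀ j c → Vec Word (tapeLength j c) → TapeOf j c
  toTape zero    c       _ = tt
  toTape (suc j) zero    _ = tt
  toTape (suc j) (suc c) x = toBlocks (suc c) (R c) (Vec.take (R c * width (suc c)) x) ,
                             toTape j (suc c / 2) (Vec.drop (R c * width (suc c)) x)

  flatT-toTape : ∀ j c x → flatT j c (toTape j c x) ≡ taped x
  flatT-toTape zero    c       [] = refl
  flatT-toTape (suc j) zero    [] = refl
  flatT-toTape (suc j) (suc c) x  = trans (cong₂ _++_ (flatR-toBlocks (suc c) (R c) _) (flatT-toTape j (suc c / 2) _))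
    (taped-split (R c * width (suc c)) x)

  part : ∀ {c′ j c} → Reaches c′ j c → TapeOf j c → Vec (Block (suc c′)) (R c′)
  part now       (bs , T) = bs
  part (later i) (bs , T) = part i T

  -- The words of the other scales are independent of those considered and contribute only their
  -- number.
  ∑-part : ∀ {c′ j c} (i : Reaches c′ j c) (E : Vec (Block (suc c′)) (R c′) → ℕ) →
    Q ^ (R c′ * width (suc c′)) * ∑ (vectors words (tapeLength j c)) (λ x → E (part i (toTape j c x)))
    ≡ Q ^ tapeLength j c * ∑ (vectors (blocks (suc c′)) (R c′)) E
  ∑-part {c′} {suc j} {suc c′} now E = begin-equality
    Q ^ a * ∑ (vectors words (a + b)) (λ x → E (toBlocks (suc c′) (R c′) (Vec.take a x)))
      ≡⟨ cong (Q ^ a *_) (trans (∑-take a b (E ∘ toBlocks (suc c′) (R c′))) (cong (Q ^ b *_) (∑-toBlocks (suc c′) (R c′) E))) ⟩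
    Q ^ a * (Q ^ b * total)
      ≡⟨ trans (sym (*-assoc (Q ^ a) (Q ^ b) total)) (cong (_* total) (sym (^-distribˡ-+-* Q a b))) ⟩
    Q ^ (a + b) * total ∎
    where
    a = R c′ * width (suc c′)
    b = tapeLength j (suc c′ / 2)
    total = ∑ (vectors (blocks (suc c′)) (R c′)) E
  ∑-part {c′} {suc j} {suc c} (later i) E = begin-equality
    Q ^ w * ∑ (vectors words (a + b)) (λ x → E (part i (toTape j (suc c / 2) (Vec.drop a x))))
      ≡⟨ cong (Q ^ w *_) (∑-drop a b (λ x → E (part i (toTape j (suc c / 2) x)))) ⟩
    Q ^ w * (Q ^ a * ∑ (vectors words b) (λ x → E (part i (toTape j (suc c / 2) x))))
      ≡⟨ *-swap (Q ^ w) (Q ^ a) _ ⟩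
    Q ^ a * (Q ^ w * ∑ (vectors words b) (λ x → E (part i (toTape j (suc c / 2) x))))
      ≡⟨ cong (Q ^ a *_) (∑-part i E) ⟩
    Q ^ a * (Q ^ b * total)
      ≡⟨ trans (sym (*-assoc (Q ^ a) (Q ^ b) total)) (cong (_* total) (sym (^-distribˡ-+-* Q a b))) ⟩
    Q ^ (a + b) * total ∎
    where
    w = R c′ * width (suc c′)
    a = R c * width (suc c)
    b = tapeLength j (suc c / 2)
    total = ∑ (vectors (blocks (suc c′)) (R c′)) E

  part-hit : ∀ {c′ j c} (i : Reaches c′ j c) (le : c ≤ cmax) (le′ : suc c′ ≤ cmax) T →
    (∃[ x ] Success₁ c′ le′ (lookup (part i T) x)) → HitBy j c le T
  part-hit {c′} now le le′ T (x , y) = inj₁ (x , subst (λ le → Success₁ c′ le (lookup (proj₁ T) x)) (≤-irrelevant le′ le) y)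
  part-hit (later i) le le′ T hit = inj₂ (part-hit i (≤-trans (half≤ _) le) le′ (proj₂ T) hit)

  module _ (j : ℕ) (cmax<2^j : cmax < 2 ^ j) (time : ℕ)
           (time≥ : total-cost j ≤ time) where

    tapeSize : ℕ
    tapeSize = 2 + tapeLength j cmax

    P : Program
    P = solver k K C₀ C₁

    Lucky : ℕ → ℕ → TapeOf j cmax → Set
    Lucky u w T = sumL (u % N) + sumR (w % N) ≡ tw ⊎ HitBy j cmax ≤-refl T

    Solves : Memᶠ → Set
    Solves ρ = IsSolution lists t (Vec.tabulate {n = k} (ρ ∘ toℕ))

    solverExec : ∀ {ρ} u w T → Exec P ρ (u ∷ w ∷ flatT j cmax T ++ []) time
      (λ ρ′ τ′ → Solvable lists t → Lucky u w T → Solves ρ′)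
    solverExec u w T = within time≥ (initExec ⨾ λ { {ρ₁} (refl , ready , r36) →
      guessExec u w (flatT j cmax T ++ []) (Ready.consts ready) ⨾ λ { {ρ₂} (refl , f , guess) →
      scalesExec j cmax ≤-refl cmax<2^j T [] (record { consts = Consts-frame {ρ₁} {ρ₂} (λ a {lt} → f (6 + a) {lt}) (Ready.consts ready)
        ; r34 = trans (f 0) (Ready.r34 ready) ; r35 = trans (f 1) (Ready.r35 ready) ; r49 = trans (f 15) (Ready.r49 ready) }) (trans (f 2) r36)
        ⨾ λ { {ρ₃} (refl , ready′ , keep , hit) →
      after (λ { (_ , g , written) solvable lucky → done-when ρ₃ g written solvable ([ (λ e → keep (guess e)) , hit ]′ lucky) })
        (outputExec (Ready.consts ready′)) } } })
      where
      low≡ : ∀ {x} → x < Q → low x ≡ x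
      low≡ {x} x<Q = trans (cong (λ y → wd (ℤ.+ y)) (+-identityʳ x)) (wd-small x<Q)

      done-when : ∀ ρ₃ g {ρ′ : Memᶠ} → (∀ a → a < k → ρ′ a ≡ fill K K (K * n) (low (ρ₃ 11)) (fill K 0 0 (low (ρ₃ 10)) g) a) →
        Solvable lists t → Good₀ ρ₃ → Solves ρ′
      done-when ρ₃ g {ρ′} written solvable (pair I<Q J<Q e) = output-correct solvable {ρ′} {g} written
        (trans (cong₂ (λ I J → sumL I + sumR J) (low≡ I<Q) (low≡ J<Q)) e)

    outcome : (τ : Vec Word tapeSize) → Σ[ ρ′ ∈ Memᶠ ] Σ[ τ′ ∈ Tape ] asteps time (state P (λ _ → 0) (taped τ)) ≡ state [] ρ′ τ′
      × (∀ {u w x} → τ ≡ u ∷ w ∷ x → Solvable lists t → Lucky (toℕ u) (toℕ w) (toTape j cmax x) → Solves ρ′)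
    outcome (u ∷ w ∷ x) = from (solverExec {λ _ → 0} (toℕ u) (toℕ w) (toTape j cmax x))
      where
      τ₀ = toℕ u ∷ toℕ w ∷ flatT j cmax (toTape j cmax x) ++ []
      Post : Memᶠ → Tape → Set
      Post ρ′ τ′ = Solvable lists t → Lucky (toℕ u) (toℕ w) (toTape j cmax x) → Solves ρ′
      from : Exec P (λ _ → 0) τ₀ time Post → _
      from (exec cost cost≤ ρ′ τ′ run post) = ρ′ , τ′ ,
        trans (cong (λ l → asteps time (state P (λ _ → 0) (toℕ u ∷ toℕ w ∷ l))) (trans (sym (flatT-toTape j cmax x)) (sym (++-identityʳ _))))
          (trans (cong₂ (λ t p → asteps t (state p (λ _ → 0) τ₀)) (sym (m+[n∸m]≡n cost≤)) (sym (++-identityʳ P)))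
            (trans (asteps-+ cost (time ∸ cost) _) (trans (cong (asteps (time ∸ cost)) (run [])) (asteps-[] (time ∸ cost))))) ,
        λ { refl → post }

    finished : Done time tapeSize P (λ _ → 0)
    finished τ = cong program (proj₁ (proj₂ (proj₂ (outcome τ))))

    read-start : memory (start P) ≈ (λ _ → 0)
    read-start a = by (a <? 300 + S₀)
      where
      by : Dec (a < 300 + S₀) → read (memory (start P)) a ≡ 0
      by (yes p) = trans (read-in (memory (start P)) p) (trans (cong toℕ (lookup-replicate (fromℕ< p) _)) (wd-small (≤-trans (s≤s z≤n) 2≤Q)))
      by (no n)  = read-out (memory (start P)) n

    solver-halts : ∀ rs → Halted (steps (env s lists t h) rs (start P))
    solver-halts = halts time tapeSize P _ _ read-start finished

    Succeeds : Vec Word time → Set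
    Succeeds rs = IsSolution lists t (output k (steps (env s lists t h) rs (start P)))

    succeeds? : Decidable Succeeds
    succeeds? rs = isSolution? lists t (output k (steps (env s lists t h) rs (start P)))

    successes₀ : ℕ
    successes₀ = ∑ (vectors words time) (λ rs → 𝟙 (succeeds? rs))

    -- The condition F is judged on a tape drawn in advance; `tape-count` transfers its frequency to
    -- the machine that is offered a new word in every step.
    lucky-count : (F : Vec Word tapeSize → ℕ) → (∀ τ → F τ ≤ 1) →
      (∀ u w x → F (u ∷ w ∷ x) ≢ 0 → Lucky (toℕ u) (toℕ w) (toTape j cmax x)) → Solvable lists t →
      Q ^ time * ∑ (vectors words tapeSize) F ≤ Q ^ tapeSize * successes₀
    lucky-count F F≤1 lucky solvable = begin
      Q ^ time * ∑ (vectors words tapeSize) F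
        ≤⟨ *-monoʳ-≤ (Q ^ time) (∑-mono (vectors words tapeSize) below) ⟩
      Q ^ time * ∑ (vectors words tapeSize) (λ τ → G (mem (asteps time (state P (λ _ → 0) (taped τ)))))
        ≡⟨ tape-count G (λ e → 𝟙-eq (tabulate-cong (e ∘ toℕ))) time tapeSize P (memory (start P)) _ read-start finished ⟨
      Q ^ tapeSize * successes₀ ∎
      where
      G : Memᶠ → ℕ
      G ρ = 𝟙 (isSolution? lists t (Vec.tabulate {n = k} (ρ ∘ toℕ)))

      𝟙-eq : ∀ {xs ys : Vec ℕ k} → xs ≡ ys → 𝟙 (isSolution? lists t xs) ≡ 𝟙 (isSolution? lists t ys)
      𝟙-eq refl = refl

      below : ∀ τ → F τ ≤ G (mem (asteps time (state P (λ _ → 0) (taped τ))))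
      below τ@(u ∷ w ∷ x) = by (F τ) refl (outcome τ)
        where
        by : ∀ v → F τ ≡ v → _ → v ≤ G (mem (asteps time (state P (λ _ → 0) (taped τ))))
        by zero    e _ = z≤n
        by (suc v) e (ρ′ , τ′ , e′ , post) = ≤-≡ (subst (_≤ 1) e (F≤1 τ)) (sym (trans (cong (G ∘ mem) e′)
          (𝟙-yes (isSolution? lists t _) (post refl solvable (lucky u w x (λ z → 1+n≢0 (trans (sym e) z)))))))

    guess-success : Solvable lists t →
      Q ^ time * ∑ words (λ u → ∑ words (λ w → 𝟙 (sumL (toℕ u % N) + sumR (toℕ w % N) ≟ tw))) ≤ Q * Q * successes₀
    guess-success solvable = *-cancelˡ-≤ (Q ^ l) {{m^n≢0 Q l {{m^n≢0 2 W}}}} (begin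
      Q ^ l * (Q ^ time * guesses)
        ≡⟨ *-swap (Q ^ l) (Q ^ time) guesses ⟩
      Q ^ time * (Q ^ l * guesses)
        ≡⟨ cong (Q ^ time *_) count ⟨
      Q ^ time * ∑ (vectors words tapeSize) F
        ≤⟨ lucky-count F F≤1 (λ u w x nz → inj₁ (𝟙-holds (test u w) nz)) solvable ⟩
      Q ^ tapeSize * successes₀
        ≡⟨ regroup Q (Q ^ l) successes₀ ⟩
      Q ^ l * (Q * Q * successes₀) ∎)
      where
      l = tapeLength j cmax
      test : ∀ u w → Dec (sumL (toℕ {Q} u % N) + sumR (toℕ {Q} w % N) ≡ tw)
      test u w = sumL (toℕ u % N) + sumR (toℕ w % N) ≟ tw
      guesses = ∑ words (λ u → ∑ words (λ w → 𝟙 (test u w)))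
      F : Vec Word tapeSize → ℕ
      F (u ∷ w ∷ x) = 𝟙 (test u w)
      F≤1 : ∀ τ → F τ ≤ 1
      F≤1 (u ∷ w ∷ x) = 𝟙≤1 (test u w)
      size : length (vectors words l) ≡ Q ^ l
      size = trans (length-vectors words l) (cong (_^ l) (length-allFin Q))
      count : ∑ (vectors words tapeSize) F ≡ Q ^ l * guesses
      count = trans (∑-vectors-suc words (suc l) F) (trans (∑-cong words (λ u → trans (∑-vectors-suc words l _)
        (trans (∑-cong words (λ w → trans (∑-const (vectors words l) (𝟙 (test u w))) (cong (_* 𝟙 (test u w)) size)))
          (∑-*ˡ words (Q ^ l) _)))) (∑-*ˡ words (Q ^ l) _))
      regroup : ∀ q l x → q * (q * l) * x ≡ l * (q * q * x)
      regroup = solve-∀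

    scale-success : ∀ {c′} → Reaches c′ j cmax → (le : suc c′ ≤ cmax) → {E : Vec (Block (suc c′)) (R c′) → Set} (E? : Decidable E) →
      (∀ bs → E bs → ∃[ x ] Success₁ c′ le (lookup bs x)) → Solvable lists t →
      Q ^ time * ∑ (vectors (blocks (suc c′)) (R c′)) (λ bs → 𝟙 (E? bs)) ≤ Q ^ (R c′ * width (suc c′)) * successes₀
    scale-success {c′} i le {E} E? hit solvable = *-cancelˡ-≤ (Q * Q * Q ^ l) {{m*n≢0 (Q * Q) (Q ^ l) {{m*n≢0 Q Q {{m^n≢0 2 W}} {{m^n≢0 2 W}}}} {{m^n≢0 Q l {{m^n≢0 2 W}}}}}} (begin
      Q * Q * Q ^ l * (Q ^ time * ∑ (vectors (blocks (suc c′)) (R c′)) (λ bs → 𝟙 (E? bs)))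
        ≡⟨ r₁ Q (Q ^ l) (Q ^ time) _ ⟩
      Q ^ time * (Q * Q * (Q ^ l * ∑ (vectors (blocks (suc c′)) (R c′)) (λ bs → 𝟙 (E? bs))))
        ≡⟨ cong (λ x → Q ^ time * (Q * Q * x)) (∑-part i (λ bs → 𝟙 (E? bs))) ⟨
      Q ^ time * (Q * Q * (Q ^ b * ∑ (vectors words l) (λ x → 𝟙 (E? (part i (toTape j cmax x))))))
        ≡⟨ r₂ Q (Q ^ time) (Q ^ b) _ ⟩
      Q ^ b * (Q ^ time * (Q * (Q * ∑ (vectors words l) (λ x → 𝟙 (E? (part i (toTape j cmax x)))))))
        ≡⟨ cong (λ x → Q ^ b * (Q ^ time * x)) count ⟨
      Q ^ b * (Q ^ time * ∑ (vectors words tapeSize) F)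
        ≤⟨ *-monoʳ-≤ (Q ^ b) (lucky-count F F≤1 (λ u w x nz → inj₂ (part-hit i ≤-refl le (toTape j cmax x)
             (hit _ (𝟙-holds (E? (part i (toTape j cmax x))) nz)))) solvable) ⟩
      Q ^ b * (Q ^ tapeSize * successes₀)
        ≡⟨ r₃ (Q ^ b) Q (Q ^ l) successes₀ ⟩
      Q * Q * Q ^ l * (Q ^ b * successes₀) ∎)
      where
      l = tapeLength j cmax
      b = R c′ * width (suc c′)
      F : Vec Word tapeSize → ℕ
      F (u ∷ w ∷ x) = 𝟙 (E? (part i (toTape j cmax x)))
      F≤1 : ∀ τ → F τ ≤ 1
      F≤1 (u ∷ w ∷ x) = 𝟙≤1 (E? (part i (toTape j cmax x)))
      count : ∑ (vectors words tapeSize) F ≡ Q * (Q * ∑ (vectors words l) (λ x → 𝟙 (E? (part i (toTape j cmax x)))))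
      rest = ∑ (vectors words l) (λ x → 𝟙 (E? (part i (toTape j cmax x))))
      constant : ∀ x → ∑ words (λ _ → x) ≡ Q * x
      constant x = trans (∑-const words x) (cong (_* x) (length-allFin Q))
      count = trans (∑-vectors-suc words (suc l) F) (trans (∑-cong words (λ u → trans (∑-vectors-suc words l _) (constant rest))) (constant (Q * rest)))
      r₁ : ∀ q l t x → q * q * l * (t * x) ≡ t * (q * q * (l * x))
      r₁ = solve-∀
      r₂ : ∀ q t b x → t * (q * q * (b * x)) ≡ b * (t * (q * (q * x)))
      r₂ = solve-∀
      r₃ : ∀ b q l x → b * (q * (q * l) * x) ≡ q * q * l * (b * x)
      r₃ = solve-∀

  -- The running time

  U : ℕ
  U = N * N / (cmax * ℓ)

  module _ (cmaxℓ≤N : cmax * ℓ ≤ N) where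

    cmaxℓ≤U : cmax * ℓ ≤ U
    cmaxℓ≤U = ≡-≤ (sym (m*n/n≡m (cmax * ℓ) (cmax * ℓ))) (/-monoˡ-≤ (cmax * ℓ) (*-mono-≤ cmaxℓ≤N cmaxℓ≤N))

    1≤U : 1 ≤ U
    1≤U = ≤-trans (>-nonZero⁻¹ (cmax * ℓ)) cmaxℓ≤U

    ℓ≤N : ℓ ≤ N
    ℓ≤N = ≤-trans (m≤n*m ℓ cmax) cmaxℓ≤N

    X≤U : X ≤ U
    X≤U = ≡-≤ (sym (m*n/n≡m X (cmax * ℓ))) (/-monoˡ-≤ (cmax * ℓ) (begin
      X * (cmax * ℓ) ≡⟨ *-assoc X cmax ℓ ⟨
      X * cmax * ℓ ≤⟨ *-mono-≤ (≤-trans (*-monoʳ-≤ X (m≤n*m cmax C₀)) (m/n*n≤m N (C₀ * cmax) {{m*n≢0 C₀ cmax}})) ℓ≤N ⟩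
      N * N ∎))

    -- Up to rounding, the cost c ℓ of a run cancels in the number of runs. The additional run costs
    -- at most cmax ℓ, which is at most U because cmax ℓ ≤ N.
    runs≤ : ∀ c → suc c ≤ cmax → R c * (suc c * ℓ) ≤ 2 * U
    runs≤ c c≤ = begin
      R c * (suc c * ℓ) ≡⟨ expand (N * N / (cmax * ℓ * ℓ * suc c)) (suc c * ℓ) ⟩
      N * N / (cmax * ℓ * ℓ * suc c) * (suc c * ℓ) + suc c * ℓ ≤⟨ +-mono-≤ main (≤-trans (*-monoˡ-≤ ℓ c≤) cmaxℓ≤U) ⟩
      U + U ≡⟨ cong (U +_) (sym (+-identityʳ U)) ⟩
      2 * U ∎
      where
      y = N * N / (cmax * ℓ * ℓ * suc c)
      expand : ∀ y z → (y + 1) * z ≡ y * z + z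
      expand = solve-∀
      main : y * (suc c * ℓ) ≤ U
      main = ≡-≤ (sym (m*n/n≡m (y * (suc c * ℓ)) (cmax * ℓ))) (/-monoˡ-≤ (cmax * ℓ)
        (≡-≤ (regroup y (suc c) ℓ cmax) (m/n*n≤m (N * N) (cmax * ℓ * ℓ * suc c))))
        where
        regroup : ∀ y c l a → y * (c * l) * (a * l) ≡ y * (a * l * l * c)
        regroup = solve-∀

    scale≤ : ∀ c le → scaleCost c le ≤ U * (2 * (runFactor K + 13))
    scale≤ c le = Costs.scale≤ K ℓ ℓ≥1 {suc c} {U} (runCost₁ c le) (s≤s z≤n) (Costs.run≤ K ℓ ℓ≥1 {suc c} (s≤s z≤n))
      (m≤n+m 1 (N * N / (cmax * ℓ * ℓ * suc c))) (runs≤ c le)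

    scales≤ : ∀ j c le → scalesCost j c le ≤ U * (1 + j * (2 * (runFactor K + 13)))
    scales≤ zero    c       le = ≤-≡ 1≤U (sym (*-identityʳ U))
    scales≤ (suc j) zero    le = ≤-trans 1≤U (m≤m*n U _)
    scales≤ (suc j) (suc c) le = ≤-≡ (+-mono-≤ (scale≤ c le) (scales≤ j (suc c / 2) (≤-trans (half≤ c) le))) (regroup U (2 * (runFactor K + 13)) j)
      where
      regroup : ∀ u f j → u * f + u * (1 + j * f) ≡ u * (1 + suc j * f)
      regroup = solve-∀

    cost≤ : ∀ j → total-cost j ≤ timeFactor K * ((j + 1) * U)
    cost≤ j = Costs.whole≤ K ℓ ℓ≥1 {U} j 1≤U X≤U (scales≤ j cmax ≤-refl)

  -- Equal values and solutions

  module Golden (2≤N : 2 ≤ N) (I₀ J₀ : Fin N) where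

    private instance
      Q≢0 : NonZero (2 ^ W)
      Q≢0 = m^n≢0 2 W

    z* : Fin M
    z* = zL I₀

    module _ (solution : sumL (toℕ I₀) + sumR (toℕ J₀) ≡ tw) where

      sumR≤ : ∀ J → sumR J ≤ tm + M
      sumR≤ J = ≤-trans (sumAt≤ K (K * n) J) (≤-trans K*m≤M (m≤n+m M tm))

      total≤M : ∀ I J → sumL I + sumR J ≤ M
      total≤M I J = ≤-trans (+-mono-≤ (sumAt≤ K 0 I) (sumAt≤ K (K * n) J))
        (≡-≤ (sym (*-distribʳ-+ m K K)) (*-monoˡ-≤ m K+K≤k))

      entry>0 : ∀ {a} → a < k * n → 0 < entry a
      entry>0 {a} a< = subst (0 <_) (sym (trans (cong entry (sym (toℕ-fromℕ< a<))) (lookupOr-toℕ 0 (Vec.concat (values lists)) (fromℕ< a<))))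
        (positive lists (fromℕ< a<))
        where
        row : ∀ {l} (xs : Vec (Fin m) l) i → 0 < lookup (Vec.map value xs) i
        row (x ∷ xs) zero    = s≤s z≤n
        row (x ∷ xs) (suc i) = row xs i
        positive : ∀ {l} (xss : Vec (Vec (Fin m) n) l) i → 0 < lookup (Vec.concat (Vec.map (Vec.map value) xss)) i
        positive (xs ∷ xss) i = subst (λ x → 0 < x) (sym (lookup-splitAt n (Vec.map value xs) _ i)) (cases (Fin.splitAt n i))
          where
          cases : ∀ y → 0 < [ lookup (Vec.map value xs) , lookup (Vec.concat (Vec.map (Vec.map value) xss)) ]′ y
          cases (inj₁ i) = row xs i
          cases (inj₂ i) = positive xss i

      sumL>0 : ∀ I → 0 < sumL I
      sumL>0 I = go K 0<K (≤-trans (m≤m+n K K) K+K≤k)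
        where
        go : ∀ j → 0 < j → j ≤ k → 0 < sumAt j 0 I
        go (suc j) _ j≤k = ≤-trans (entry>0 (<-≤-trans (m%n<n I n) (m≤n*m n k {{>-nonZero (≤-trans (s≤s z≤n) j≤k)}}))) (m≤m+n _ _)

      congruent : ∀ I J → zL I ≡ z* → zR J ≡ z* → (sumL (toℕ I) + sumR (toℕ J)) % M ≡ tw % M
      congruent I J eL eR = begin-equality
        (sumL (toℕ I) + sumR (toℕ J)) % M ≡⟨ %-+ {M} {sumL (toℕ I)} {tm + M ∸ sumR (toℕ J)} (sumR (toℕ J)) (trans (value-of (sumL (toℕ I))) (trans (cong toℕ (trans eL (sym eR))) (sym (value-of _)))) ⟩
        (tm + M ∸ sumR (toℕ J) + sumR (toℕ J)) % M ≡⟨ cong (_% M) (m∸n+n≡m (sumR≤ (toℕ J))) ⟩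
        (tm + M) % M ≡⟨ [m+n]%n≡m%n tm M ⟩
        tm % M ≡⟨ m%n%n≡m%n tw M ⟩
        tw % M ∎
        where
        value-of : ∀ x → x % M ≡ toℕ (residue M x)
        value-of x = sym (toℕ-fromℕ< _)

      -- All entries are positive, so both sums lie between 1 and M, where a residue modulo M
      -- determines the number. Thus every pair with the common value z* is a solution, not only the
      -- given one.
      golden : ∀ I J → zL I ≡ z* → zR J ≡ z* → sumL (toℕ I) + sumR (toℕ J) ≡ tw
      golden I J eL eR = same _ _ (≤-trans (sumL>0 (toℕ I)) (m≤m+n _ _)) (total≤M _ _)
        (≤-≡ (≤-trans (sumL>0 (toℕ I₀)) (m≤m+n _ _)) solution) (≡-≤ (sym solution) (total≤M _ _)) (congruent I J eL eR)
        where
        same : ∀ a b → 0 < a → a ≤ M → 0 < b → b ≤ M → a % M ≡ b % M → a ≡ b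
        same (suc a) (suc b) _ a≤ _ b≤ e = cong suc (%-injective 1 a≤ b≤ (trans (cong (_% M) (+-comm a 1)) (trans e (cong (_% M) (+-comm 1 b)))))

      zR-J₀ : zR J₀ ≡ z*
      zR-J₀ = toℕ-injective (trans (toℕ-fromℕ< _) (trans (%-cancel {M} {tm + M ∸ sumR (toℕ J₀)} {sumL (toℕ I₀)} (sumR (toℕ J₀)) (begin-equality
        (tm + M ∸ sumR (toℕ J₀) + sumR (toℕ J₀)) % M ≡⟨ cong (_% M) (m∸n+n≡m (sumR≤ (toℕ J₀))) ⟩
        (tm + M) % M ≡⟨ [m+n]%n≡m%n tm M ⟩
        tm % M ≡⟨ m%n%n≡m%n tw M ⟩
        tw % M ≡⟨ cong (_% M) solution ⟨
        (sumL (toℕ I₀) + sumR (toℕ J₀)) % M ∎)) (sym (toℕ-fromℕ< _))))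

      module _ (c : ℕ) (c≤ : suc c ≤ cmax) where

        setup : Setup
        setup = Instance.setup K W lists 2≤N N≤Q tm z* (suc c) r

        found-successful : ∀ y → Setup.X setup h y ≢ 0 → Success₁ c c≤ y
        found-successful y@((u , w) , (A , B)) nz = from (∑≢0 (Setup.places setup) (λ π → 𝟙 (Setup.found? setup y h π)) nz)
          where
          reached : ∀ {a b p p′ i j} → Setup.Found setup y h ((a , b) , (p , p′) , (i , j)) → Success₁ c c≤ y
          reached {a} {b} {p} {p′} {i} {j} (gs@(gl , gr) , und , arrive-i , arrive-j) =
            Chains.undisturbed-successful (chains c c≤ (toℕ u) (toℕ w))
              A B a b p p′ i j und arrive-i arrive-j (trans (proj₁ (Setup.gold-zz setup u w gs)) (sym (proj₂ (Setup.gold-zz setup u w gs))))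
              (subst₂ (λ I J → sumL I + sumR J ≡ tw) (toℕ-fromℕ< _) (toℕ-fromℕ< _)
                (golden (Halves.item K N lists tm (residue N (toℕ u)) i) (Halves.item K N lists tm (residue N (toℕ w)) j) (proj₂ gl) (proj₂ gr)))

          from : Σ[ π ∈ Setup.Place setup ] 𝟙 (Setup.found? setup y h π) ≢ 0 → Success₁ c c≤ y
          from (((a , b) , (p , p′) , (i , j)) , nz′) = reached (𝟙-holds (Setup.found? setup y h ((a , b) , (p , p′) , (i , j))) nz′)

-- Coincidences among the half sums of random lists

∑-resample : ∀ {A : Set} (xs : List A) {n k} (f : Vec (Vec A n) k → ℕ) (i : Fin k) (p : Fin n) →
  length xs * ∑ (vectors (vectors xs n) k) f
  ≡ ∑ (vectors (vectors xs n) k) (λ w → ∑ xs (λ y → f (w [ i ]≔ (lookup w i [ p ]≔ y))))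
∑-resample xs {n} {suc k} f zero p = begin-equality
  length xs * ∑ (vectors (vectors xs n) (suc k)) f
    ≡⟨ cong (length xs *_) (trans (∑-vectors-suc (vectors xs n) k f) (∑-swap (vectors xs n) (vectors (vectors xs n) k) _)) ⟩
  length xs * ∑ (vectors (vectors xs n) k) (λ w → ∑ (vectors xs n) (λ v → f (v ∷ w)))
    ≡⟨ trans (sym (∑-*ˡ (vectors (vectors xs n) k) (length xs) _)) (∑-cong (vectors (vectors xs n) k) one) ⟩
  ∑ (vectors (vectors xs n) k) (λ w → ∑ (vectors xs n) (λ v → ∑ xs (λ y → f ((v [ p ]≔ y) ∷ w))))
    ≡⟨ trans (∑-vectors-suc (vectors xs n) k _) (∑-swap (vectors xs n) (vectors (vectors xs n) k) _) ⟨
  ∑ (vectors (vectors xs n) (suc k)) (λ w → ∑ xs (λ y → f (w [ zero ]≔ (lookup w zero [ p ]≔ y)))) ∎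
  where
  one : ∀ w → length xs * ∑ (vectors xs n) (λ v → f (v ∷ w)) ≡ ∑ (vectors xs n) (λ v → ∑ xs (λ y → f ((v [ p ]≔ y) ∷ w)))
  one w = trans (sym (trans (∑-cong (vectors xs n) (λ v → ∑-const xs (f (v ∷ w)))) (∑-*ˡ (vectors xs n) (length xs) _)))
    (sym (∑-exchange xs p (λ v _ → f (v ∷ w))))
∑-resample xs {n} {suc k} f (suc i) p = begin-equality
  length xs * ∑ (vectors (vectors xs n) (suc k)) f
    ≡⟨ trans (cong (length xs *_) (∑-vectors-suc (vectors xs n) k f)) (sym (∑-*ˡ (vectors xs n) (length xs) _)) ⟩
  ∑ (vectors xs n) (λ v → length xs * ∑ (vectors (vectors xs n) k) (λ w → f (v ∷ w)))
    ≡⟨ ∑-cong (vectors xs n) (λ v → ∑-resample xs (λ w → f (v ∷ w)) i p) ⟩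
  ∑ (vectors xs n) (λ v → ∑ (vectors (vectors xs n) k) (λ w → ∑ xs (λ y → f (v ∷ w [ i ]≔ (lookup w i [ p ]≔ y)))))
    ≡⟨ ∑-vectors-suc (vectors xs n) k _ ⟨
  ∑ (vectors (vectors xs n) (suc k)) (λ w → ∑ xs (λ y → f (w [ suc i ]≔ (lookup w (suc i) [ p ]≔ y)))) ∎

sumT-except : ∀ j {f g : ℕ → ℕ} i₀ → i₀ < j → (∀ i → i < j → i ≢ i₀ → f i ≡ g i) → sumT j f + g i₀ ≡ sumT j g + f i₀
sumT-except (suc j) {f} {g} zero     i₀< e = trans (cong (λ x → f 0 + x + g 0) (sumT-cong j (λ i i< → e (suc i) (s≤s i<) (λ ()))))
  (swap (f 0) (sumT j (g ∘ suc)) (g 0))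
  where
  swap : ∀ a b c → a + b + c ≡ c + b + a
  swap = solve-∀
sumT-except (suc j) {f} {g} (suc i₀) (s≤s i₀<) e = trans (+-assoc (f 0) _ _) (trans (cong₂ _+_ (e 0 (s≤s z≤n) (λ ()))
  (sumT-except j i₀ i₀< (λ i i< ne → e (suc i) (s≤s i<) (ne ∘ suc-injective)))) (sym (+-assoc (g 0) _ _)))

module Coincidences (k n m K o N : ℕ) .{{_ : NonZero n}} .{{_ : NonZero N}} .{{_ : NonZero (k * m)}}
                    (N≡ : N ≡ n ^ K) (o+K≤k : o + K ≤ k) where

  sumOf : Lists k n m → ℕ → ℕ
  sumOf w = Halves.sumAt K N w 0 K (o * n)

  entryOf : Lists k n m → ℕ → ℕ
  entryOf w = Halves.entry K N w 0

  digit : ℕ → ℕ → Fin n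
  digit zero    I = fromℕ< (m%n<n I n)
  digit (suc i) I = digit i (I / n)

  sum-digits : ∀ w j off I → Halves.sumAt K N w 0 j off I ≡ sumT j (λ i → entryOf w (off + (i * n + toℕ (digit i I))))
  sum-digits w zero    off I = refl
  sum-digits w (suc j) off I = cong₂ _+_ (cong (λ x → entryOf w (off + x)) (sym (toℕ-fromℕ< (m%n<n I n))))
    (trans (sum-digits w j (off + n) (I / n)) (sumT-cong j (λ i _ → cong (entryOf w) (shift off n (i * n) (toℕ (digit i (I / n)))))))
    where
    shift : ∀ o n x d → o + n + (x + d) ≡ o + (n + x + d)
    shift = solve-∀

  differing-digit : ∀ j I J → I < n ^ j → J < n ^ j → I ≢ J → Σ[ i ∈ ℕ ] i < j × digit i I ≢ digit i J
  differing-digit zero    I J I< J< I≢J = contradiction (trans (n<1⇒n≡0 I<) (sym (n<1⇒n≡0 J<))) I≢J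
  differing-digit (suc j) I J I< J< I≢J with I % n ≟ J % n
  ... | no ne = zero , s≤s z≤n , λ e → ne (trans (sym (toℕ-fromℕ< _)) (trans (cong toℕ e) (toℕ-fromℕ< _)))
  ... | yes e with differing-digit j (I / n) (J / n) (m<n*o⇒m/o<n (<-≤-trans I< (≤-reflexive (*-comm n (n ^ j)))))
                     (m<n*o⇒m/o<n (<-≤-trans J< (≤-reflexive (*-comm n (n ^ j)))))
                     (λ e′ → I≢J (trans (m≡m%n+[m/n]*n I n) (trans (cong₂ (λ x y → x + y * n) e e′) (sym (m≡m%n+[m/n]*n J n)))))
  ...   | i , i<j , ne = suc i , s≤s i<j , ne

  place : ∀ {i} → i < K → Fin k
  place {i} i<K = fromℕ< (<-≤-trans (+-monoʳ-< o i<K) o+K≤k)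

  entry-at : ∀ w {i} (i<K : i < K) (d : Fin n) → entryOf w (o * n + (i * n + toℕ d)) ≡ value (lookup (lookup w (place i<K)) d)
  entry-at w {i} i<K d = trans (cong (entryOf w) address) (trans (lookupOr-toℕ 0 (Vec.concat (values w)) (Fin.combine (place i<K) d))
    (trans (lookup-concat (values w) (place i<K) d) (trans (cong (λ v → lookup v d) (lookup-map (place i<K) (Vec.map value) w))
      (lookup-map d value (lookup w (place i<K))))))
    where
    address : o * n + (i * n + toℕ d) ≡ toℕ (Fin.combine (place i<K) d)
    address = trans (shift o n i (toℕ d)) (trans (cong (λ x → n * x + toℕ d) (sym (toℕ-fromℕ< _))) (sym (toℕ-combine (place i<K) d)))
      where
      shift : ∀ o n i d → o * n + (i * n + d) ≡ n * (o + i) + d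
      shift = solve-∀

  coincident? : ∀ I J w → Dec (sumOf w I ≡ sumOf w J)
  coincident? I J w = sumOf w I ≟ sumOf w J

  sample : List (Lists k n m)
  sample = vectors (vectors (allFin m) n) k

  -- Different indices differ in some digit. Redrawing the entry that I selects there shifts the sum
  -- at I and leaves the sum at J alone, so at most one of the m values produces a coincidence.
  coincidence-rare : ∀ I J → I < N → J < N → I ≢ J → m * ∑ sample (λ w → 𝟙 (coincident? I J w)) ≤ length sample
  coincidence-rare I J I< J< I≢J with differing-digit K I J (subst (I <_) N≡ I<) (subst (J <_) N≡ J<) I≢J
  ... | i₀ , i₀<K , ne = begin
    m * ∑ sample (λ w → 𝟙 (coincident? I J w))
      ≡⟨ cong (_* ∑ sample (λ w → 𝟙 (coincident? I J w))) (length-allFin m) ⟨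
    length (allFin m) * ∑ sample (λ w → 𝟙 (coincident? I J w))
      ≡⟨ ∑-resample (allFin m) _ (place i₀<K) p₀ ⟩
    ∑ sample (λ w → ∑ (allFin m) (λ y → 𝟙 (coincident? I J (with-entry w y))))
      ≤⟨ ∑-bound sample _ (λ w → ∑-unique _ (λ y → 𝟙≤1 (coincident? I J (with-entry w y)))
           (λ y y′ a b → unique w y y′ (𝟙-holds (coincident? I J (with-entry w y)) a) (𝟙-holds (coincident? I J (with-entry w y′)) b))) ⟩
    length sample * 1
      ≡⟨ *-identityʳ _ ⟩
    length sample ∎
    where
    p₀ : Fin n
    p₀ = digit i₀ I

    with-entry : Lists k n m → Fin m → Lists k n m
    with-entry w y = w [ place i₀<K ]≔ (lookup w (place i₀<K) [ p₀ ]≔ y)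

    term : Lists k n m → ℕ → ℕ → ℕ
    term w H i = entryOf w (o * n + (i * n + toℕ (digit i H)))

    place-injective : ∀ {i j} (i<K : i < K) (j<K : j < K) → place i<K ≡ place j<K → i ≡ j
    place-injective i<K j<K e = +-cancelˡ-≡ o _ _ (trans (sym (toℕ-fromℕ< _)) (trans (cong toℕ e) (toℕ-fromℕ< _)))

    elsewhere : ∀ w y H {i} → i < K → i ≢ i₀ → term (with-entry w y) H i ≡ term w H i
    elsewhere w y H {i} i<K i≢ = trans (entry-at (with-entry w y) i<K (digit i H))
      (trans (cong (λ v → value (lookup v (digit i H))) (lookup∘update′ (i≢ ∘ place-injective i<K i₀<K) w _)) (sym (entry-at w i<K (digit i H))))

    -- The sum at J does not involve the resampled entry.
    unaffected : ∀ w y → sumOf (with-entry w y) J ≡ sumOf w J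
    unaffected w y = trans (sum-digits (with-entry w y) K (o * n) J) (trans (sumT-cong K same) (sym (sum-digits w K (o * n) J)))
      where
      same : ∀ i → i < K → term (with-entry w y) J i ≡ term w J i
      same i i<K with i ≟ i₀
      ... | no i≢ = elsewhere w y J i<K i≢
      ... | yes refl = trans (entry-at (with-entry w y) i₀<K (digit i₀ J)) (trans (cong (λ v → value (lookup v (digit i₀ J))) (lookup∘update (place i₀<K) w _))
              (trans (cong value (lookup∘update′ (ne ∘ sym) (lookup w (place i₀<K)) y)) (sym (entry-at w i₀<K (digit i₀ J)))))

    changed : ∀ w y → sumOf (with-entry w y) I + term w I i₀ ≡ sumOf w I + value y
    changed w y = trans (cong (_+ term w I i₀) (sum-digits (with-entry w y) K (o * n) I))
      (trans (sumT-except K {term (with-entry w y) I} {term w I} i₀ i₀<K (λ i i<K i≢ → elsewhere w y I i<K i≢))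
        (cong₂ _+_ (sym (sum-digits w K (o * n) I)) new))
      where
      new : term (with-entry w y) I i₀ ≡ value y
      new = trans (entry-at (with-entry w y) i₀<K p₀) (cong value (trans (cong (λ v → lookup v p₀) (lookup∘update (place i₀<K) w _))
        (lookup∘update p₀ (lookup w (place i₀<K)) y)))

    unique : ∀ w y y′ → sumOf (with-entry w y) I ≡ sumOf (with-entry w y) J → sumOf (with-entry w y′) I ≡ sumOf (with-entry w y′) J → y ≡ y′
    unique w y y′ e e′ = toℕ-injective (suc-injective (+-cancelˡ-≡ (sumOf w I) _ _ (trans (sym (changed w y))
      (trans (cong (_+ term w I i₀) (trans (trans e (unaffected w y)) (sym (trans e′ (unaffected w y′))))) (changed w y′)))))

  coincidences : Lists k n m → ℕ
  coincidences w = ∑ (allFin N) (λ I → ∑ (allFin N) (λ J → 𝟙 (coincident? (toℕ I) (toℕ J) w)))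

  -- The diagonal contributes N, and the other pairs at most N² / m ≤ N.
  coincidences-mean : .{{_ : NonZero m}} → N ≤ m → ∑ sample coincidences ≤ 2 * N * length sample
  coincidences-mean N≤m = *-cancelˡ-≤ m (begin
    m * ∑ sample coincidences
      ≡⟨ cong (m *_) (trans (∑-swap sample (allFin N) _) (∑-cong (allFin N) (λ I → ∑-swap sample (allFin N) _))) ⟩
    m * ∑ (allFin N) (λ I → ∑ (allFin N) (λ J → ∑ sample (λ w → 𝟙 (coincident? (toℕ I) (toℕ J) w))))
      ≡⟨ trans (sym (∑-*ˡ (allFin N) m _)) (∑-cong (allFin N) (λ I → sym (∑-*ˡ (allFin N) m _))) ⟩
    ∑ (allFin N) (λ I → ∑ (allFin N) (λ J → m * ∑ sample (λ w → 𝟙 (coincident? (toℕ I) (toℕ J) w))))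
      ≤⟨ ∑-mono (allFin N) (λ I → ∑-mono (allFin N) (λ J → pair I J (J Fin.≟ I))) ⟩
    ∑ (allFin N) (λ I → ∑ (allFin N) (λ J → 𝟙 (J Fin.≟ I) * (m * S) + S))
      ≡⟨ ∑-cong (allFin N) (λ I → trans (∑-+ (allFin N) _ _) (cong₂ _+_ (∑-δ I (λ _ → m * S)) (trans (∑-const (allFin N) S) (cong (_* S) (length-allFin N))))) ⟩
    ∑ (allFin N) (λ I → m * S + N * S)
      ≡⟨ trans (∑-const (allFin N) _) (cong (_* (m * S + N * S)) (length-allFin N)) ⟩
    N * (m * S + N * S)
      ≤⟨ *-monoʳ-≤ N (+-monoʳ-≤ (m * S) (*-monoˡ-≤ S N≤m)) ⟩
    N * (m * S + m * S)
      ≡⟨ regroup N m S ⟩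
    m * (2 * N * S) ∎)
    where
    S = length sample
    regroup : ∀ n m s → n * (m * s + m * s) ≡ m * (2 * n * s)
    regroup = solve-∀
    pair : ∀ (I J : Fin N) (d : Dec (J ≡ I)) → m * ∑ sample (λ w → 𝟙 (coincident? (toℕ I) (toℕ J) w)) ≤ 𝟙 d * (m * S) + S
    pair I J (no J≢I) = coincidence-rare (toℕ I) (toℕ J) (toℕ<n I) (toℕ<n J) (λ e → J≢I (sym (toℕ-injective e)))
    pair I J (yes _)  = ≤-trans (*-monoʳ-≤ m (≤-≡ (∑-bound sample _ (λ w → 𝟙≤1 (coincident? (toℕ I) (toℕ J) w))) (*-identityʳ S)))
      (≡-≤ (sym (+-identityʳ (m * S))) (m≤m+n _ S))

  few? : ∀ w → Dec (coincidences w ≤ 8 * N)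
  few? w = coincidences w ≤? 8 * N

  -- Markov's inequality: 8 N is four times the bound on the mean.
  mostly-few : .{{_ : NonZero m}} → N ≤ m → 4 * ∑ sample (λ w → 𝟙 (¬? (few? w))) ≤ length sample
  mostly-few N≤m = *-cancelˡ-≤ (2 * N) {{m*n≢0 2 N}} (begin
    2 * N * (4 * ∑ sample (λ w → 𝟙 (¬? (few? w)))) ≡⟨ trans (regroup N (∑ sample (λ w → 𝟙 (¬? (few? w))))) (sym (∑-*ˡ sample (8 * N) _)) ⟩
    ∑ sample (λ w → 8 * N * 𝟙 (¬? (few? w))) ≤⟨ ∑-mono sample (λ w → ≡-≤ (*-comm (8 * N) _) (𝟙*≤ (¬? (few? w)) (λ ≰ → <⇒≤ (≰⇒> ≰)))) ⟩
    ∑ sample coincidences ≤⟨ coincidences-mean N≤m ⟩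
    2 * N * length sample ∎)
    where
    regroup : ∀ n x → 2 * n * (4 * x) ≡ 8 * n * x
    regroup = solve-∀

halving : ∀ {x} → 2 ≤ x → x ≤ 3 * (x / 2)
halving {x} 2≤x = begin
  x ≡⟨ m≡m%n+[m/n]*n x 2 ⟩
  x % 2 + x / 2 * 2 ≤⟨ +-monoˡ-≤ (x / 2 * 2) (≤-trans (m<1+n⇒m≤n (m%n<n x 2)) (m≥n⇒m/n>0 2≤x)) ⟩
  x / 2 + x / 2 * 2 ≡⟨ shift (x / 2) ⟩
  3 * (x / 2) ∎
  where
  shift : ∀ h → h + h * 2 ≡ 3 * h
  shift = solve-∀

-- Some scale matches the number γ of vertices with the value of a solution up to a constant.
suitable-scale : ∀ (cmax γ j c : ℕ) → 0 < c → c ≤ cmax → c < 2 ^ j → 2 * cmax ≤ 3 * (c * γ) →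
  Σ[ c′ ∈ ℕ ] Reaches c′ j c × suc c′ ≤ cmax × 2 * cmax ≤ 3 * (suc c′ * γ) × (suc c′ * γ ≤ 2 * cmax ⊎ suc c′ ≡ 1)
suitable-scale cmax γ zero    (suc c) _ c≤ (s≤s ()) enough
suitable-scale cmax γ (suc j) (suc zero) _ c≤ c< enough = 0 , now , c≤ , enough , inj₂ refl
suitable-scale cmax γ (suc j) (suc (suc c)) _ c≤ c< enough = by (suc (suc c) * γ ≤? 2 * cmax)
  where
  C = suc (suc c)
  by : Dec (C * γ ≤ 2 * cmax) → _
  by (yes few) = suc c , now , c≤ , enough , inj₁ few
  -- Halving with rounding divides a number of at least 2 by at most 3. This is where the 3 of the
  -- lower bound comes from.
  by (no many) with suitable-scale cmax γ j (C / 2) (m≥n⇒m/n>0 {C} {2} (s≤s (s≤s z≤n))) (≤-trans (m/n≤m C 2) c≤)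
                      (m<n*o⇒m/o<n (subst (C <_) (*-comm 2 (2 ^ j)) c<))
                      (≤-trans (<⇒≤ (≰⇒> many)) (≤-≡ (*-monoˡ-≤ γ (halving {C} (s≤s (s≤s z≤n)))) (*-assoc 3 (C / 2) γ)))
  ... | c′ , reaches , rest = c′ , later reaches , rest

hashed : (σ : Job) → HashFun (Job.k σ * Job.m σ) (Job.N σ) → Job
hashed σ h = record
  { n≢0 = n≢0 ; N≢0 = N≢0 ; km≢0 = km≢0 ; fits = fits ; lists = lists ; t = t ; h = h }
  where open Job σ hiding (h)

-- The success probability for fixed lists

module Fixed (σ : Job) .{{_ : NonZero (Job.m σ)}} (j : ℕ) (cmax<2^j : Job.s σ / C₁ + 1 < 2 ^ j)
             (time : ℕ) (time≥ : ∀ h → Solver.total-cost (hashed σ h) j ≤ time) where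

  open Job σ hiding (h)
  open Fits fits

  private instance
    n-nonzero : NonZero n
    n-nonzero = n≢0

    N-nonzero : NonZero N
    N-nonzero = N≢0

    km-nonzero : NonZero (k * m)
    km-nonzero = km≢0

  Hs = functions N (k * m)

  private instance
    Q≢0 : NonZero (2 ^ W)
    Q≢0 = m^n≢0 2 W

  successes : HashFun (k * m) N → ℕ
  successes h = Solver.successes₀ (hashed σ h) j cmax<2^j time (time≥ h)

  Q = 2 ^ W
  M = k * m

  tw tm : ℕ
  tw = toℕ (Machine.word W (300 + S₀) t)
  tm = tw % M

  open Halves K N lists tm using (sumL; sumR; zL; zR; sumAt≤)

  indices : Solvable lists t → Σ[ I ∈ Fin N ] Σ[ J ∈ Fin N ] sumL (toℕ I) + sumR (toℕ J) ≡ tw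
  indices solvable with Solver.solvable-indices (hashed σ h₀) solvable
    where
    h₀ : HashFun (k * m) N
    h₀ = Vec.replicate (k * m) (residue N 0)
  ... | I , J , I< , J< , e = fromℕ< I<N , fromℕ< J<N , trans (cong₂ (λ I J → sumL I + sumR J) (toℕ-fromℕ< I<N) (toℕ-fromℕ< J<N)) e
    where
    I<N = subst (I <_) (sym N≡) I<
    J<N = subst (J <_) (sym N≡) J<

  -- The initial guess: each of the two indices of a solution is drawn with probability at least 1 /
  -- (2 N).
  small-success : Solvable lists t → ∀ h → Q ^ time ≤ 4 * (N * N) * successes h
  small-success solvable h = go (indices solvable)
    where
    go : Σ[ I ∈ Fin N ] Σ[ J ∈ Fin N ] sumL (toℕ I) + sumR (toℕ J) ≡ tw → Q ^ time ≤ 4 * (N * N) * successes h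
    go (I , J , e) = *-cancelˡ-≤ (Q * Q) {{m*n≢0 Q Q}} (begin
      Q * Q * Q ^ time ≡⟨ r₁ Q (Q ^ time) ⟩
      Q ^ time * (Q * 1 * (Q * 1)) ≤⟨ *-monoʳ-≤ (Q ^ time) (*-mono-≤ (share I) (share J)) ⟩
      Q ^ time * (2 * N * hits I * (2 * N * hits J)) ≡⟨ r₂ (Q ^ time) N (hits I) (hits J) ⟩
      4 * (N * N) * (Q ^ time * (hits I * hits J)) ≤⟨ *-monoʳ-≤ (4 * (N * N)) (*-monoʳ-≤ (Q ^ time) pairs) ⟩
      4 * (N * N) * (Q ^ time * guesses) ≤⟨ *-monoʳ-≤ (4 * (N * N)) (Solver.guess-success (hashed σ h) j cmax<2^j time (time≥ h) solvable) ⟩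
      4 * (N * N) * (Q * Q * successes h) ≡⟨ *-swap (4 * (N * N)) (Q * Q) (successes h) ⟩
      Q * Q * (4 * (N * N) * successes h) ∎)
      where
      r₁ : ∀ q t → q * q * t ≡ t * (q * 1 * (q * 1))
      r₁ = solve-∀
      r₂ : ∀ t n x y → t * (2 * n * x * (2 * n * y)) ≡ 4 * (n * n) * (t * (x * y))
      r₂ = solve-∀
      hits : Fin N → ℕ
      hits I = ∑ (allFin Q) (λ u → 𝟙 (residue N (toℕ u) Fin.≟ I))
      test : ∀ u w → Dec (sumL (toℕ {Q} u % N) + sumR (toℕ {Q} w % N) ≡ tw)
      test u w = sumL (toℕ u % N) + sumR (toℕ w % N) ≟ tw
      guesses = ∑ (allFin Q) (λ u → ∑ (allFin Q) (λ w → 𝟙 (test u w)))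
      share : ∀ I → Q * 1 ≤ 2 * N * hits I
      share I = subst (λ x → Q * x ≤ 2 * N * hits I) (∑-δ₁ I) (residue-lower (λ v → 𝟙 (v Fin.≟ I)) N≤Q)
      pairs : hits I * hits J ≤ guesses
      pairs = ≡-≤ (sym (∑-*-∑ (allFin Q) (allFin Q) _ _)) (∑-mono (allFin Q) (λ u → ∑-mono (allFin Q) (λ w →
        ≡-≤ (sym (𝟙-× (residue N (toℕ u) Fin.≟ I) (residue N (toℕ w) Fin.≟ J)))
          (𝟙-mono ((residue N (toℕ u) Fin.≟ I) ×-dec (residue N (toℕ w) Fin.≟ J)) (test u w) (λ { (p , q) →
            trans (cong₂ (λ x y → sumL x + sumR y) (index u p) (index w q)) e })))))
        where
        index : ∀ u {I} → residue N (toℕ u) ≡ I → toℕ u % N ≡ toℕ I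
        index u refl = sym (toℕ-fromℕ< _)

  cmax = s / C₁ + 1

  instance
    cmax≢0 : NonZero cmax
    cmax≢0 = ≢-nonZero (λ e → 1+n≢0 (trans (+-comm 1 _) e))

    C₀cmax≢0 : NonZero (C₀ * cmax)
    C₀cmax≢0 = m*n≢0 C₀ cmax

  module Large (large : 8 * C₀ ≤ N) (solvable : Solvable lists t)
               (few-left : Coincidences.coincidences k n m K 0 N N≡ (≤-≡ (m≤m+n K K) K+K≡k) lists ≤ 8 * N)
               (few-right : Coincidences.coincidences k n m K K N N≡ (≤-reflexive K+K≡k) lists ≤ 8 * N) where

    2≤N : 2 ≤ N
    2≤N = ≤-trans (≤-trans (≤ᵇ⇒≤ 2 8 tt) (m≤m*n 8 C₀)) large

    I₀ J₀ : Fin N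
    I₀ = proj₁ (indices solvable)
    J₀ = proj₁ (proj₂ (indices solvable))

    solution : sumL (toℕ I₀) + sumR (toℕ J₀) ≡ tw
    solution = proj₂ (proj₂ (indices solvable))

    z* : Fin M
    z* = zL I₀

    mL mR : Fin M → ℕ
    mL x = ∑ (allFin N) (λ I → 𝟙 (zL I Fin.≟ x))
    mR x = ∑ (allFin N) (λ J → 𝟙 (zR J Fin.≟ x))

    K*m<M : K * m < M
    K*m<M = <-≤-trans (m<n+m (K * m) (*-mono-≤ 0<K (>-nonZero⁻¹ m))) (≤-reflexive (trans (sym (*-distribʳ-+ m K K)) (cong (_* m) K+K≡k)))

    sums-agree : ∀ o {I J} → Halves.sumAt K N lists tm K o I % M ≡ Halves.sumAt K N lists tm K o J % M →
      Halves.sumAt K N lists tm K o I ≡ Halves.sumAt K N lists tm K o J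
    sums-agree o {I} {J} e = trans (sym (m<n⇒m%n≡m (≤-<-trans (sumAt≤ K o I) K*m<M))) (trans e (m<n⇒m%n≡m (≤-<-trans (sumAt≤ K o J) K*m<M)))

    residues : ∀ {x y} → residue M x ≡ residue M y → x % M ≡ y % M
    residues e = trans (sym (toℕ-fromℕ< _)) (trans (cong toℕ e) (toℕ-fromℕ< _))

    zL-sums : ∀ I J → zL I ≡ zL J → sumL (toℕ I) ≡ sumL (toℕ J)
    zL-sums I J e = sums-agree 0 (residues e)

    zR-sums : ∀ I J → zR I ≡ zR J → sumR (toℕ I) ≡ sumR (toℕ J)
    zR-sums I J e = sym (sums-agree (K * n) (%-cancel {M} {b} {a} A (subst₂ (λ x y → x % M ≡ y % M) (shift a b (sumR≤ I)) (trans (cong (A ∸ b +_) (+-comm a b)) (shift b a (sumR≤ J)))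
        (%-+ {M} {A ∸ a} {A ∸ b} (a + b) (residues e)))))
      where
      A = tm + M
      a = sumR (toℕ I)
      b = sumR (toℕ J)
      sumR≤ : ∀ J → sumR (toℕ J) ≤ A
      sumR≤ J = ≤-trans (sumAt≤ K (K * n) (toℕ J)) (≤-trans (<⇒≤ K*m<M) (m≤n+m M tm))
      shift : ∀ a b → a ≤ A → A ∸ a + (a + b) ≡ b + A
      shift a b le = trans (sym (+-assoc (A ∸ a) a b)) (trans (cong (_+ b) (m∸n+n≡m le)) (+-comm A b))

    F₂≤ : ∑ (allFin N) (mL ∘ zL) + ∑ (allFin N) (mR ∘ zR) ≤ 16 * N
    F₂≤ = ≤-≡ (+-mono-≤
        (≤-trans (∑-mono (allFin N) (λ I → ∑-mono (allFin N) (λ J → 𝟙-mono (zL J Fin.≟ zL I) (sumL (toℕ I) ≟ sumL (toℕ J)) (λ e → sym (zL-sums J I e))))) few-left)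
        (≤-trans (∑-mono (allFin N) (λ I → ∑-mono (allFin N) (λ J → 𝟙-mono (zR J Fin.≟ zR I) (sumR (toℕ I) ≟ sumR (toℕ J)) (λ e → sym (zR-sums J I e))))) few-right))
      (double N)
      where
      double : ∀ n → 8 * n + 8 * n ≡ 16 * n
      double = solve-∀

    ones : ∀ (z : Fin N → Fin M) I → z I ≡ z* → 1 ≤ ∑ (allFin N) (λ J → 𝟙 (z J Fin.≟ z*))
    ones z I e = ≡-≤ (sym (𝟙-yes (z I Fin.≟ z*) e)) (∑-∈ (allFin N) (λ J → 𝟙 (z J Fin.≟ z*)) (∈-allFin I))

    X r ℓ : ℕ
    X = N / (C₀ * cmax)
    r = grow X X 0
    ℓ = suc r

    -- Both summands of cmax = s / C₁ + 1 contribute at most N / 2, the first because 8 C₀ ≤ C₁ and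
    -- s ≤ N, the second by `large`. It follows that X ≥ 4 and r ≥ 1; with r = 0 there would be no
    -- admissible lengths.
    4C₀cmax≤N : 4 * (C₀ * cmax) ≤ N
    4C₀cmax≤N = *-cancelˡ-≤ 2 (begin
      2 * (4 * (C₀ * cmax)) ≡⟨ regroup C₀ (s / C₁) ⟩
      s / C₁ * (8 * C₀) + 8 * C₀ ≤⟨ +-mono-≤ (≤-trans (*-monoʳ-≤ (s / C₁) 8C₀≤C₁) (≤-trans (m/n*n≤m s C₁) s≤N)) large ⟩
      N + N ≡⟨ cong (N +_) (sym (+-identityʳ N)) ⟩
      2 * N ∎)
      where
      regroup : ∀ c x → 2 * (4 * (c * (x + 1))) ≡ x * (8 * c) + 8 * c
      regroup = solve-∀

    4≤X : 4 ≤ X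
    4≤X = ≡-≤ (sym (m*n/n≡m 4 (C₀ * cmax))) (/-monoˡ-≤ (C₀ * cmax) 4C₀cmax≤N)

    h₀ : HashFun M N
    h₀ = Vec.replicate M (residue N 0)

    root : C₀ * cmax * (ℓ * ℓ) ≤ N
    root = ≤-trans (*-monoʳ-≤ (C₀ * cmax) (grow-upper ≤-refl X 0 (≤-trans (s≤s z≤n) 4≤X)))
      (≡-≤ (*-comm (C₀ * cmax) X) (m/n*n≤m N (C₀ * cmax)))

    1≤r : 1 ≤ r
    1≤r = ≮⇒≥ (λ r<1 → <⇒≱ (grow-lower X 0 ≤-refl) (≤-trans (*-mono-≤ (+-monoʳ-≤ 2 (m<1+n⇒m≤n r<1)) (+-monoʳ-≤ 2 (m<1+n⇒m≤n r<1))) 4≤X))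

    γ : ℕ
    γ = mL z* + mR z*

    1≤mL : 1 ≤ mL z*
    1≤mL = ones zL I₀ refl

    zR-J₀ : zR J₀ ≡ z*
    zR-J₀ = Solver.Golden.zR-J₀ (hashed σ h₀) 2≤N I₀ J₀ solution

    1≤mR : 1 ≤ mR z*
    1≤mR = ones zR J₀ zR-J₀

    doubled : 2 * cmax ≤ 3 * (cmax * γ)
    doubled = *-mono-≤ {2} {3} {cmax} {cmax * γ} (≤ᵇ⇒≤ 2 3 tt) (m≤m*n cmax γ {{>-nonZero (≤-trans 1≤mL (m≤m+n (mL z*) (mR z*)))}})

    scale : Σ[ c′ ∈ ℕ ] Reaches c′ j cmax × suc c′ ≤ cmax × 2 * cmax ≤ 3 * (suc c′ * γ) × (suc c′ * γ ≤ 2 * cmax ⊎ suc c′ ≡ 1)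
    scale = suitable-scale cmax γ j cmax (>-nonZero⁻¹ cmax) ≤-refl cmax<2^j doubled

    module _ (c′ : ℕ) (reaches : Reaches c′ j cmax) (c≤ : suc c′ ≤ cmax) (enough : 2 * cmax ≤ 3 * (suc c′ * γ))
             (few : suc c′ * γ ≤ 2 * cmax ⊎ suc c′ ≡ 1) where

      setup : Setup
      setup = Instance.setup K W lists 2≤N N≤Q tm z* (suc c′) r

      open Repeat Hs (Setup.draws setup) (Setup.X setup) (Setup.X≤1 setup) using (B; H; Hits; hits?)

      instance
        cmaxℓ²≢0 : NonZero (cmax * ℓ * ℓ)
        cmaxℓ²≢0 = m*n≢0 (cmax * ℓ) ℓ {{m*n≢0 cmax ℓ}}

        weight≢0 : NonZero (cmax * ℓ * ℓ * suc c′)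
        weight≢0 = m*n≢0 (cmax * ℓ * ℓ) (suc c′)

      runs : ℕ
      runs = N * N / (cmax * ℓ * ℓ * suc c′) + 1

      likely : length Hs * B ^ runs ≤ loss * ∑ Hs (H runs)
      likely = Setup.likely setup cmax F₂≤ 1≤mL 1≤mR 1≤r root wide c≤ enough few runs (m≤m+n _ 1)
        where
        wide : 16 * cmax ≤ N
        wide = ≤-trans (*-monoˡ-≤ cmax (≤-trans (≤ᵇ⇒≤ 16 2097152 tt) C₀≥)) (≤-trans (m≤n*m (C₀ * cmax) 4) 4C₀cmax≤N)

      hit : ∀ h (bs : Vec ((Fin Q × Fin Q) × (Vec (Fin Q) (suc c′) × Vec (Fin Q) (suc c′))) runs) → Hits h bs →
        ∃[ x ] Solver.Success₁ (hashed σ h) c′ c≤ (lookup bs x)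
      hit h bs (x , nz) = x , Solver.Golden.found-successful (hashed σ h) 2≤N I₀ J₀ solution c′ c≤ (lookup bs x) nz

      width : ℕ
      width = 2 + (suc c′ + suc c′)

      each : ∀ h → Q ^ time * H runs h ≤ Q ^ (runs * width) * successes h
      each h = Solver.scale-success (hashed σ h) j cmax<2^j time (time≥ h) reaches c≤ (hits? h) (hit h) solvable

      block-count : B ^ runs ≡ Q ^ (runs * width)
      block-count = trans (cong (_^ runs) (trans (Setup.B≡ setup) (trans (cong (λ v → Q * Q * (v * v)) (trans (length-vectors (allFin Q) (suc c′)) (cong (_^ suc c′) (length-allFin Q))))
        (trans (cong (Q * Q *_) (sym (^-distribˡ-+-* Q (suc c′) (suc c′)))) (*-assoc Q Q _)))))
        (trans (^-*-assoc Q width runs) (cong (Q ^_) (*-comm width runs)))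

      success : Q ^ time * length Hs ≤ loss * ∑ Hs successes
      success = *-cancelˡ-≤ (Q ^ (runs * width)) {{m^n≢0 Q (runs * width)}} (begin
        b * (Q ^ time * length Hs) ≡⟨ trans (*-swap b (Q ^ time) (length Hs)) (cong (Q ^ time *_) (trans (*-comm b (length Hs)) (cong (length Hs *_) (sym block-count)))) ⟩
        Q ^ time * (length Hs * B ^ runs) ≤⟨ *-monoʳ-≤ (Q ^ time) likely ⟩
        Q ^ time * (loss * ∑ Hs (H runs)) ≡⟨ trans (*-swap (Q ^ time) loss _) (cong (loss *_) (sym (∑-*ˡ Hs (Q ^ time) (H runs)))) ⟩
        loss * ∑ Hs (λ h → Q ^ time * H runs h) ≤⟨ *-monoʳ-≤ loss (∑-mono Hs each) ⟩
        loss * ∑ Hs (λ h → b * successes h) ≡⟨ trans (cong (loss *_) (∑-*ˡ Hs b successes)) (*-swap loss b _) ⟩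
        b * (loss * ∑ Hs successes) ∎)
        where
        b = Q ^ (runs * width)

    large-success : Q ^ time * length Hs ≤ loss * ∑ Hs successes
    large-success = go scale
      where
      go : Σ[ c′ ∈ ℕ ] Reaches c′ j cmax × suc c′ ≤ cmax × 2 * cmax ≤ 3 * (suc c′ * γ) × (suc c′ * γ ≤ 2 * cmax ⊎ suc c′ ≡ 1) →
           Q ^ time * length Hs ≤ loss * ∑ Hs successes
      go (c′ , reaches , c≤ , enough , few) = success c′ reaches c≤ enough few

-- With n < 2 ^ bits n =: v, a bound x ≤ c n ^ e gives x < v ^ (c + e).
poly<v : ∀ n c e {x} → x ≤ c * n ^ e → x < (2 ^ bits n) ^ (c + e)
poly<v n c e {x} x≤ = begin-strict
  x ≤⟨ x≤ ⟩
  c * n ^ e ≤⟨ *-monoʳ-≤ c (^-monoˡ-≤ e (<⇒≤ (n<2^bits n))) ⟩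
  c * v ^ e <⟨ *-monoˡ-< (v ^ e) {{m^n≢0 v e}} (<-≤-trans (c<2^c c) (^-monoˡ-≤ c 2≤v)) ⟩
  v ^ c * v ^ e ≡⟨ ^-distribˡ-+-* v c e ⟨
  v ^ (c + e) ∎
  where
  v = 2 ^ bits n
  instance
    v≢0 : NonZero v
    v≢0 = m^n≢0 2 (bits n)
  2≤v : 2 ≤ v
  2≤v = ≡-≤ refl (*-monoʳ-≤ 2 (m^n>0 2 ⌊log₂ n ⌋))
  c<2^c : ∀ c → c < 2 ^ c
  c<2^c zero    = s≤s z≤n
  c<2^c (suc c) = ≤-trans (s≤s (c<2^c c)) (≤-trans (+-monoˡ-≤ (2 ^ c) (m^n>0 2 c)) (+-monoʳ-≤ (2 ^ c) (m≤m+n (2 ^ c) 0)))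

poly<word : ∀ n c e b {x} → c + e ≤ b → x ≤ c * n ^ e → x < 2 ^ (b * bits n)
poly<word n c e b {x} ce≤b x≤ = <-≤-trans (poly<v n c e x≤) (≤-≡ (^-monoʳ-≤ (2 ^ bits n) {{m^n≢0 2 (bits n)}} ce≤b)
  (trans (^-*-assoc 2 (bits n) b) (cong (2 ^_) (*-comm (bits n) b))))

-- Arithmetic of the resource bounds

module TimeArithmetic (N s C₀ C₁ cmax ℓ U : ℕ) .{{_ : NonZero N}} (C₀C₁≥1 : 1 ≤ 4 * C₀ * C₁) (U≤ : U * (cmax * ℓ) ≤ N * N)
                      (N≤ : N ≤ 4 * (ℓ * ℓ) * (C₀ * cmax)) (s≤ : s ≤ cmax * C₁) where

  g : ℕ
  g = 4 * C₀ * C₁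

  -- U is about N² / (cmax ℓ), where ℓ² is about N / cmax and cmax about s. Hence U² is about N³ /
  -- s.
  root : U * U * s ≤ g * (N * N * N)
  root = *-cancelˡ-≤ N (begin
    N * (U * U * s) ≤⟨ *-mono-≤ N≤ (*-monoʳ-≤ (U * U) s≤) ⟩
    4 * (ℓ * ℓ) * (C₀ * cmax) * (U * U * (cmax * C₁)) ≡⟨ r₁ ℓ C₀ cmax U C₁ ⟩
    g * (U * (cmax * ℓ) * (U * (cmax * ℓ))) ≤⟨ *-monoʳ-≤ g (*-mono-≤ U≤ U≤) ⟩
    g * (N * N * (N * N)) ≡⟨ r₂ g N ⟩
    N * (g * (N * N * N)) ∎)
    where
    r₁ : ∀ l c m u d → 4 * (l * l) * (c * m) * (u * u * (m * d)) ≡ 4 * c * d * (u * (m * l) * (u * (m * l)))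
    r₁ = solve-∀
    r₂ : ∀ g n → g * (n * n * (n * n)) ≡ n * (g * (n * n * n))
    r₂ = solve-∀

  time-bound : ∀ A j β → j + 1 ≤ 2 * β → let T = A * ((j + 1) * U) in T ^ 4 * s ^ 2 ≤ (A * 2 * g * β ^ 1) ^ 4 * N ^ 6
  time-bound A j β j≤ = begin
    T ^ 4 * s ^ 2 ≡⟨ r₁ T s ⟩
    T * T * s * (T * T * s) ≤⟨ *-mono-≤ half half ⟩
    D * D * (N * N * N) * (D * D * (N * N * N)) ≡⟨ r₂ (A * 2 * g) β N ⟩
    (A * 2 * g * β ^ 1) ^ 4 * N ^ 6 ∎
    where
    T = A * ((j + 1) * U)
    D = A * 2 * g * β
    r₁ : ∀ t s → t * (t * (t * (t * 1))) * (s * (s * 1)) ≡ t * t * s * (t * t * s)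
    r₁ = solve-∀
    r₂ : ∀ a b n → a * b * (a * b) * (n * n * n) * (a * b * (a * b) * (n * n * n)) ≡ a * (b * 1) * (a * (b * 1) * (a * (b * 1) * (a * (b * 1) * 1))) * (n * (n * (n * (n * (n * (n * 1))))))
    r₂ = solve-∀
    half : T * T * s ≤ D * D * (N * N * N)
    half = begin
      T * T * s ≡⟨ s₁ A (j + 1) U s ⟩
      A * A * ((j + 1) * (j + 1)) * (U * U * s) ≤⟨ *-mono-≤ (*-monoʳ-≤ (A * A) (*-mono-≤ j≤ j≤)) root ⟩
      A * A * (2 * β * (2 * β)) * (g * (N * N * N)) ≤⟨ *-monoʳ-≤ (A * A * (2 * β * (2 * β))) (*-monoˡ-≤ (N * N * N) (m≤m*n g g {{>-nonZero C₀C₁≥1}})) ⟩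
      A * A * (2 * β * (2 * β)) * (g * g * (N * N * N)) ≡⟨ s₂ A β g (N * N * N) ⟩
      D * D * (N * N * N) ∎
      where
      s₁ : ∀ a j u s → a * (j * u) * (a * (j * u)) * s ≡ a * a * (j * j) * (u * u * s)
      s₁ = solve-∀
      s₂ : ∀ a b g n → a * a * (2 * b * (2 * b)) * (g * g * n) ≡ a * 2 * g * b * (a * 2 * g * b) * n
      s₂ = solve-∀

-- The logarithm in the time bound is that of N⁶ / s², the fourth power of the time without
-- logarithms. As s ≤ N, this is at least N ≥ cmax and pays for the number of scales.
scales-log : ∀ N s cmax .{{_ : NonZero s}} .{{_ : NonZero (s ^ 2)}} → s ≤ N → cmax ≤ N → bits cmax + 1 ≤ 2 * bits (N ^ 6 / s ^ 2)
scales-log N s cmax s≤N cmax≤N = begin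
  bits cmax + 1 ≤⟨ +-mono-≤ (s≤s (⌊log₂⌋-mono-≤ le)) (s≤s z≤n) ⟩
  bits (N ^ 6 / s ^ 2) + bits (N ^ 6 / s ^ 2) ≡⟨ cong (bits (N ^ 6 / s ^ 2) +_) (sym (+-identityʳ _)) ⟩
  2 * bits (N ^ 6 / s ^ 2) ∎
  where
  1≤N : 1 ≤ N
  1≤N = ≤-trans (>-nonZero⁻¹ s) s≤N
  le : cmax ≤ N ^ 6 / s ^ 2
  le = ≤-trans cmax≤N (≡-≤ (sym (m*n/n≡m N (s ^ 2))) (/-monoˡ-≤ (s ^ 2) (begin
    N * s ^ 2 ≤⟨ *-monoʳ-≤ N (^-monoˡ-≤ 2 s≤N) ⟩
    N ^ 3 ≤⟨ ^-monoʳ-≤ N {{>-nonZero 1≤N}} {3} {6} (s≤s (s≤s (s≤s z≤n))) ⟩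
    N ^ 6 ∎)))

fraction-≤ : ∀ {p q} → p ℚᵘ.≤ q → ℚ.fromℚᵘ p ℚ.≤ ℚ.fromℚᵘ q
fraction-≤ {p} {q} le = ℚP.toℚᵘ-cancel-≤ (ℚᵘP.≤-respˡ-≃ (ℚᵘP.≃-sym (ℚP.toℚᵘ-fromℚᵘ p)) (ℚᵘP.≤-respʳ-≃ (ℚᵘP.≃-sym (ℚP.toℚᵘ-fromℚᵘ q)) le))

fraction-< : ∀ {p q} → p ℚᵘ.< q → ℚ.fromℚᵘ p ℚ.< ℚ.fromℚᵘ q
fraction-< {p} {q} lt = ℚP.toℚᵘ-cancel-< (ℚᵘP.<-respˡ-≃ (ℚᵘP.≃-sym (ℚP.toℚᵘ-fromℚᵘ p)) (ℚᵘP.<-respʳ-≃ (ℚᵘP.≃-sym (ℚP.toℚᵘ-fromℚᵘ q)) lt))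

unit-fraction : ℕ → ℚ
unit-fraction D = ℤ.+ 1 ℚ./ suc D

unit-fraction>0 : ∀ D → 0ℚ ℚ.< unit-fraction D
unit-fraction>0 D = fraction-< {ℚᵘ.mkℚᵘ (ℤ.+ 0) 0} {ℚᵘ.mkℚᵘ (ℤ.+ 1) D} (ℚᵘ.*<* (ℤ.+<+ (s≤s z≤n)))

Pr-lower : ∀ {A : Set} {E : A → Set} (Ω : List A) (E? : Decidable E) D → 0 < length Ω →
  length Ω ≤ D * ∑ Ω (λ ω → 𝟙 (E? ω)) → unit-fraction D ℚ.≤ Pr Ω E?
Pr-lower Ω@(x ∷ Ω′) E? D _ le = fraction-≤ {ℚᵘ.mkℚᵘ (ℤ.+ 1) D} {ℚᵘ.mkℚᵘ (ℤ.+ length (filter E? Ω)) (length Ω′)}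
  (ℚᵘ.*≤* (subst₂ ℤ._≤_ (ℤP.pos-* 1 (length Ω)) (ℤP.pos-* (length (filter E? Ω)) (suc D)) (ℤ.+≤+ (begin
    1 * length Ω ≡⟨ *-identityˡ (length Ω) ⟩
    length Ω ≤⟨ le ⟩
    D * ∑ Ω (λ ω → 𝟙 (E? ω)) ≤⟨ *-monoˡ-≤ (∑ Ω (λ ω → 𝟙 (E? ω))) (n≤1+n D) ⟩
    suc D * ∑ Ω (λ ω → 𝟙 (E? ω)) ≡⟨ trans (*-comm (suc D) (∑ Ω (λ ω → 𝟙 (E? ω)))) (cong (_* suc D) (sym (length-filter E? Ω))) ⟩
    length (filter E? Ω) * suc D ∎))))

-- The choice of parameters

module Parameters (k d : ℕ) (2∣k : 2 ∣ k) (2≤k : 2 ≤ k) where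

  K : ℕ
  K = k / 2

  K+K≡k : K + K ≡ k
  K+K≡k = trans (double K) (m/n*n≡m 2∣k)
    where
    double : ∀ x → x + x ≡ x * 2
    double = solve-∀

  0<K : 0 < K
  0<K = m≥n⇒m/n>0 2≤k

  0<k : 0 < k
  0<k = ≤-trans (s≤s z≤n) 2≤k

  -- One summand for each bound on a quantity that has to fit into a word: a number of at most c · n
  -- ^ e needs (c + e) · `bits n` bits.
  b₁ b₂ b₃ b₄ b₅ b₆ b₇ b : ℕ
  b₁ = 1 + 0
  b₂ = 2 + K
  b₃ = 2 * (k * d) + d
  b₄ = (5 + k) + 1
  b₅ = (333 + k) + K
  b₆ = C₁ + 0
  b₇ = C₀ * 27 + (K + (K + K))
  b = b₁ + (b₂ + (b₃ + (b₄ + (b₅ + (b₆ + b₇)))))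

  -- In `D` the factor 2 pays for lists with too many coincidences, `loss` for the runs if N is
  -- large, and the last summand for the initial guess if N < 8 C₀.
  g Cs Ct D : ℕ
  g = 4 * C₀ * C₁
  Cs = (333 + k) * b
  Ct = timeFactor K * 2 * g
  D = 2 * (loss + 4 * (8 * C₀ * (8 * C₀)))

  P : Program
  P = solver k K C₀ C₁

  module Sized (n m s : ℕ) .{{_ : NonZero m}} .{{_ : NonZero s}} (s≤N : s ≤ n ^ K) (N≤m : n ^ K ≤ m) (m≤ : m ≤ d * n ^ d) where

    N W cmax S₀ S j : ℕ
    N = n ^ K
    W = b * bits n
    cmax = s / C₁ + 1
    S₀ = 32 * cmax + k + 1
    S = 300 + S₀
    j = bits cmax

    1≤N : 1 ≤ N
    1≤N = ≤-trans (>-nonZero⁻¹ s) s≤N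

    instance
      N≢0 : NonZero N
      N≢0 = >-nonZero 1≤N

      n≢0 : NonZero n
      n≢0 = base n K 0<K 1≤N
        where
        base : ∀ n K → 0 < K → 1 ≤ n ^ K → NonZero n
        base zero    (suc K) _ ()
        base (suc n) K       _ _ = _

      k≢0 : NonZero k
      k≢0 = >-nonZero 0<k

      km≢0 : NonZero (k * m)
      km≢0 = m*n≢0 k m

      cmax≢0 : NonZero cmax
      cmax≢0 = >-nonZero (m≤n+m 1 (s / C₁))

      C₀cmax≢0 : NonZero (C₀ * cmax)
      C₀cmax≢0 = m*n≢0 C₀ cmax

    X ℓ : ℕ
    X = N / (C₀ * cmax)
    ℓ = suc (grow X X 0)

    instance
      cmaxℓ≢0 : NonZero (cmax * ℓ)
      cmaxℓ≢0 = m*n≢0 cmax ℓ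

    U T : ℕ
    U = N * N / (cmax * ℓ)
    T = timeFactor K * ((j + 1) * U)

    cmax≤s : cmax ≤ s
    cmax≤s = ≡-≤ (+-comm (s / C₁) 1) (m/n<m s C₁ (≤-trans (≤ᵇ⇒≤ 2 8 tt) (≤-trans (m≤m*n 8 C₀) 8C₀≤C₁)))

    cmax≤N : cmax ≤ N
    cmax≤N = ≤-trans cmax≤s s≤N

    cmaxX≤N : cmax * X ≤ N
    cmaxX≤N = ≤-trans (*-monoˡ-≤ X (m≤n*m cmax C₀)) (≡-≤ (*-comm (C₀ * cmax) X) (m/n*n≤m N (C₀ * cmax)))

    cmaxℓ≤N : cmax * ℓ ≤ N
    cmaxℓ≤N = by X refl
      where
      by : ∀ x → X ≡ x → cmax * ℓ ≤ N
      -- For X = 0 the length is still ℓ = 1, which X does not bound; then cmax ≤ N is used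
      -- directly.
      by zero    e = ≡-≤ (trans (cong (cmax *_) (cong (λ x → suc (grow x x 0)) e)) (*-identityʳ cmax)) cmax≤N
      by (suc x) e = ≤-trans (*-monoʳ-≤ cmax (≤-trans (m≤m*n ℓ ℓ) (grow-upper {X} ≤-refl X 0 (subst (1 ≤_) (sym e) (s≤s z≤n))))) cmaxX≤N

    N≤ : N ≤ 4 * (ℓ * ℓ) * (C₀ * cmax)
    N≤ = begin
      N ≡⟨ m≡m%n+[m/n]*n N (C₀ * cmax) ⟩
      N % (C₀ * cmax) + X * (C₀ * cmax) ≤⟨ +-monoˡ-≤ (X * (C₀ * cmax)) (<⇒≤ (m%n<n N (C₀ * cmax))) ⟩
      suc X * (C₀ * cmax) ≤⟨ *-monoˡ-≤ (C₀ * cmax) (≤-trans (grow-lower {X} X 0 ≤-refl) (≤-≡ (*-mono-≤ 1+ℓ≤ 1+ℓ≤) (square ℓ))) ⟩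
      4 * (ℓ * ℓ) * (C₀ * cmax) ∎
      where
      square : ∀ l → 2 * l * (2 * l) ≡ 4 * (l * l)
      square = solve-∀
      1+ℓ≤ : 1 + ℓ ≤ 2 * ℓ
      1+ℓ≤ = ≤-≡ (+-monoˡ-≤ ℓ (s≤s z≤n)) (cong (ℓ +_) (sym (+-identityʳ ℓ)))

    s≤cmaxC₁ : s ≤ cmax * C₁
    s≤cmaxC₁ = begin
      s ≡⟨ m≡m%n+[m/n]*n s C₁ ⟩
      s % C₁ + s / C₁ * C₁ ≤⟨ +-monoˡ-≤ (s / C₁ * C₁) (<⇒≤ (m%n<n s C₁)) ⟩
      suc (s / C₁) * C₁ ≡⟨ cong (_* C₁) (+-comm 1 (s / C₁)) ⟩
      cmax * C₁ ∎

    g≥1 : 1 ≤ g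
    g≥1 = *-mono-≤ {1} {4 * C₀} {1} {C₁} (*-mono-≤ {1} {4} {1} {C₀} (s≤s z≤n) (>-nonZero⁻¹ C₀)) (>-nonZero⁻¹ C₁)

    sixth : n ^ (3 * k) ≡ N ^ 6
    sixth = trans (cong (n ^_) (trans (cong (3 *_) (sym K+K≡k)) (six K))) (sym (^-*-assoc n K 6))
      where
      six : ∀ K → 3 * (K + K) ≡ K * 6
      six = solve-∀

    time : TimeBound (Cs + Ct) 1 k n s T
    time = ≤-trans (TimeArithmetic.time-bound N s C₀ C₁ cmax ℓ U g≥1 (m/n*n≤m (N * N) (cmax * ℓ)) N≤ s≤cmaxC₁ (timeFactor K) j β j≤)
      (≤-≡ (*-monoˡ-≤ (N ^ 6) (^-monoˡ-≤ 4 (*-monoˡ-≤ (β ^ 1) (m≤n+m Ct Cs)))) (cong ((((Cs + Ct) * β ^ 1) ^ 4) *_) (sym sixth)))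
      where
      instance
        s²≢0 : NonZero (s ^ 2)
        s²≢0 = m^n≢0 s 2
      β = bits (n ^ (3 * k) / s ^ 2)
      j≤ : j + 1 ≤ 2 * β
      j≤ = subst (λ x → j + 1 ≤ 2 * bits (x / s ^ 2)) (sym sixth) (scales-log N s cmax s≤N cmax≤N)

    cells≤ : ∀ x .{{_ : NonZero x}} → cmax ≤ x → S ≤ (333 + k) * x
    cells≤ x cmax≤x = begin
      300 + (32 * cmax + k + 1) ≡⟨ collect (32 * cmax) k ⟩
      32 * cmax + (301 + k) ≤⟨ +-mono-≤ (*-monoʳ-≤ 32 cmax≤x) (m≤m*n (301 + k) x) ⟩
      32 * x + (301 + k) * x ≡⟨ *-distribʳ-+ x 32 (301 + k) ⟨
      (333 + k) * x ∎
      where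
      collect : ∀ x k → 300 + (x + k + 1) ≡ x + (301 + k)
      collect = solve-∀

    space : SpaceBound (Cs + Ct) n s W S
    space = begin
      S * W ≤⟨ *-monoˡ-≤ W (cells≤ s cmax≤s) ⟩
      (333 + k) * s * (b * bits n) ≡⟨ regroup (333 + k) s b (bits n) ⟩
      Cs * (s * bits n) ≤⟨ *-monoˡ-≤ (s * bits n) (m≤m+n Cs Ct) ⟩
      (Cs + Ct) * (s * bits n) ∎
      where
      regroup : ∀ c s b l → c * s * (b * l) ≡ c * b * (s * l)
      regroup = solve-∀

    within₁ : b₁ ≤ b
    within₁ = m≤m+n b₁ _
    tail₂ : b₂ + (b₃ + (b₄ + (b₅ + (b₆ + b₇)))) ≤ b
    tail₂ = m≤n+m _ b₁
    tail₃ : b₃ + (b₄ + (b₅ + (b₆ + b₇))) ≤ b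
    tail₃ = ≤-trans (m≤n+m _ b₂) tail₂
    tail₄ : b₄ + (b₅ + (b₆ + b₇)) ≤ b
    tail₄ = ≤-trans (m≤n+m _ b₃) tail₃
    tail₅ : b₅ + (b₆ + b₇) ≤ b
    tail₅ = ≤-trans (m≤n+m _ b₄) tail₄
    tail₆ : b₆ + b₇ ≤ b
    tail₆ = ≤-trans (m≤n+m _ b₅) tail₅

    Q = 2 ^ W
    M = k * m

    2≤Q : 2 ≤ Q
    2≤Q = poly<word n 1 0 b within₁ (s≤s z≤n)

    N+N<Q : N + N < Q
    N+N<Q = poly<word n 2 K b (≤-trans (m≤m+n b₂ _) tail₂) (≤-reflexive (cong (N +_) (sym (+-identityʳ N))))

    M+M<Q : M + M < Q
    M+M<Q = poly<word n (2 * (k * d)) d b (≤-trans (m≤m+n b₃ _) tail₃) (begin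
      M + M ≡⟨ cong (M +_) (+-identityʳ M) ⟨
      2 * (k * m) ≤⟨ *-monoʳ-≤ 2 (*-monoʳ-≤ k m≤) ⟩
      2 * (k * (d * n ^ d)) ≡⟨ regroup k d (n ^ d) ⟩
      2 * (k * d) * n ^ d ∎)
      where
      regroup : ∀ k d x → 2 * (k * (d * x)) ≡ 2 * (k * d) * x
      regroup = solve-∀

    adr<Q : 4 + (k * n + n) < Q
    adr<Q = poly<word n (5 + k) 1 b (≤-trans (m≤m+n b₄ _) tail₄) (begin
      4 + (k * n + n) ≤⟨ +-monoˡ-≤ (k * n + n) (m≤m*n 4 n) ⟩
      4 * n + (k * n + n) ≡⟨ collect n k ⟩
      (5 + k) * (n * 1) ∎)
      where
      collect : ∀ n k → 4 * n + (k * n + n) ≡ (5 + k) * (n * 1)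
      collect = solve-∀

    tab<Q : ∀ x → x < 300 + S₀ → x < Q
    tab<Q x x< = <-trans x< (poly<word n (333 + k) K b (≤-trans (m≤m+n b₅ _) tail₅) (cells≤ N cmax≤N))

    C₁<Q : C₁ < Q
    C₁<Q = poly<word n C₁ 0 b (≤-trans (m≤m+n b₆ _) tail₆) (≤-reflexive (sym (*-identityʳ C₁)))

    C₀<Q : C₀ * ((2 + N) * ((2 + N) * (2 + N))) < Q
    C₀<Q = poly<word n (C₀ * 27) (K + (K + K)) b (≤-trans (m≤n+m b₇ b₆) tail₆) (begin
      C₀ * ((2 + N) * ((2 + N) * (2 + N))) ≤⟨ *-monoʳ-≤ C₀ (*-mono-≤ 2+N≤ (*-mono-≤ 2+N≤ 2+N≤)) ⟩
      C₀ * (3 * N * (3 * N * (3 * N))) ≡⟨ regroup C₀ N ⟩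
      C₀ * 27 * (N * (N * N)) ≡⟨ cong (C₀ * 27 *_) (trans (^-distribˡ-+-* n K (K + K)) (cong (N *_) (^-distribˡ-+-* n K K))) ⟨
      C₀ * 27 * n ^ (K + (K + K)) ∎)
      where
      2+N≤ : 2 + N ≤ 3 * N
      2+N≤ = ≤-≡ (+-monoˡ-≤ N (*-monoʳ-≤ 2 1≤N)) (sum N)
        where
        sum : ∀ n → 2 * n + n ≡ 3 * n
        sum = solve-∀
      regroup : ∀ c n → c * (3 * n * (3 * n * (3 * n))) ≡ c * 27 * (n * (n * n))
      regroup = solve-∀

    fits : Fits k n m N K s W S₀
    fits = record
      { 2≤Q = 2≤Q ; N+N<Q = N+N<Q ; M+M<Q = M+M<Q ; adr<Q = adr<Q ; tab<Q = tab<Q ; C₁<Q = C₁<Q ; C₀<Q = C₀<Q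
      ; K+K≡k = K+K≡k ; 0<K = 0<K ; N≡ = refl ; s≤N = s≤N ; tables = m<m+n (32 * cmax + k) (s≤s z≤n) }

    job : Lists k n m → ℤ → HashFun M N → Job
    job w t h = record { n≢0 = n≢0 ; N≢0 = N≢0 ; km≢0 = km≢0 ; fits = fits ; lists = w ; t = t ; h = h }

    cmax<2^j : cmax < 2 ^ j
    cmax<2^j = n<2^bits cmax

    enough-time : ∀ w t h → Solver.total-cost (job w t h) j ≤ T
    enough-time w t h = Solver.cost≤ (job w t h) cmaxℓ≤N j

    halts : AlwaysHalts W S T k n m N P s
    halts w t h r = Solver.solver-halts (job w t h) j cmax<2^j T (enough-time w t h) r

    open Coincidences k n m K 0 N refl (≤-≡ (m≤m+n K K) K+K≡k) using (sample)
    module L = Coincidences k n m K 0 N refl (≤-≡ (m≤m+n K K) K+K≡k)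
    module R = Coincidences k n m K K N refl (≤-reflexive K+K≡k)

    module _ (τ : Lists k n m → ℤ) where

      E? = success? W S T k n m N P s τ

      Hs : List (HashFun M N)
      Hs = functions N M

      Rs : List (Vec (Fin Q) T)
      Rs = vectors (allFin Q) T

      hits : Lists k n m → ℕ
      hits w = ∑ Hs (λ h → ∑ Rs (λ r → 𝟙 (E? (w , h , r))))

      length-Rs : length Rs ≡ Q ^ T
      length-Rs = trans (length-vectors (allFin Q) T) (cong (_^ T) (length-allFin Q))

      D₀ : ℕ
      D₀ = loss + 4 * (8 * C₀ * (8 * C₀))

      -- Unsolvable instances count as successes. For solvable ones the runs at a suitable scale
      -- succeed if N is at least 8 C₀, and otherwise the initial guess does.
      likely : ∀ w → L.coincidences w ≤ 8 * N → R.coincidences w ≤ 8 * N → Q ^ T * length Hs ≤ D₀ * hits w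
      likely w few-left few-right = by (solvable? w (τ w)) (8 * C₀ ≤? N)
        where
        module F = Fixed (job w (τ w) (Vec.replicate M (residue N 0))) j cmax<2^j T (enough-time w (τ w))
        Σ≤ : ∑ Hs F.successes ≤ hits w
        Σ≤ = ∑-mono Hs (λ h → ∑-mono Rs (λ r → 𝟙-mono (isSolution? w (τ w) _) (E? (w , h , r)) (λ x _ → x)))
        4x²≢0 : NonZero D₀
        4x²≢0 = >-nonZero (≤-trans (>-nonZero⁻¹ (4 * (8 * C₀ * (8 * C₀))) {{m*n≢0 4 _ {{_}} {{m*n≢0 (8 * C₀) (8 * C₀) {{m*n≢0 8 C₀}} {{m*n≢0 8 C₀}}}}}}) (m≤n+m _ loss))
        by : Dec (Solvable w (τ w)) → Dec (8 * C₀ ≤ N) → Q ^ T * length Hs ≤ D₀ * hits w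
        by (no unsolvable) _ = ≤-trans (≤-reflexive (sym all)) (m≤n*m (hits w) D₀ {{4x²≢0}})
          where
          all : hits w ≡ Q ^ T * length Hs
          all = trans (∑-cong Hs (λ h → trans (∑-cong Rs (λ r → 𝟙-yes (E? (w , h , r)) (λ solvable → contradiction solvable unsolvable)))
            (trans (∑-const Rs 1) (trans (*-identityʳ _) length-Rs)))) (trans (∑-const Hs (Q ^ T)) (*-comm (length Hs) (Q ^ T)))
        by (yes solvable) (yes large) = ≤-trans (F.Large.large-success large solvable few-left few-right)
          (*-mono-≤ (m≤m+n loss _) Σ≤)
        by (yes solvable) (no small) = begin
          Q ^ T * length Hs ≡⟨ *-comm (Q ^ T) (length Hs) ⟩
          length Hs * Q ^ T ≡⟨ ∑-const Hs (Q ^ T) ⟨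
          ∑ Hs (λ _ → Q ^ T) ≤⟨ ∑-mono Hs (F.small-success solvable) ⟩
          ∑ Hs (λ h → 4 * (N * N) * F.successes h) ≡⟨ ∑-*ˡ Hs (4 * (N * N)) F.successes ⟩
          4 * (N * N) * ∑ Hs F.successes ≤⟨ *-mono-≤ (≤-trans (*-monoʳ-≤ 4 (*-mono-≤ N< N<)) (m≤n+m _ loss)) Σ≤ ⟩
          D₀ * hits w ∎
          where
          N< : N ≤ 8 * C₀
          N< = <⇒≤ (≰⇒> small)

      good? : ∀ w → Dec (L.coincidences w ≤ 8 * N × R.coincidences w ≤ 8 * N)
      good? w = L.few? w ×-dec R.few? w

      good : ℕ
      good = ∑ sample (λ w → 𝟙 (good? w))

      -- Each half of the lists has too many coincidences with probability at most 1 / 4.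
      mostly-good : length sample ≤ 2 * good
      mostly-good = *-cancelˡ-≤ 2 (+-cancelʳ-≤ (2 * length sample) _ _ (begin
        2 * length sample + 2 * length sample ≡⟨ r₁ (length sample) ⟩
        4 * length sample ≤⟨ *-monoʳ-≤ 4 split ⟩
        4 * (good + (∑ sample lefts + ∑ sample rights)) ≡⟨ r₂ good (∑ sample lefts) (∑ sample rights) ⟩
        2 * (2 * good) + (4 * ∑ sample lefts + 4 * ∑ sample rights) ≤⟨ +-monoʳ-≤ (2 * (2 * good)) (+-mono-≤ (L.mostly-few N≤m) (R.mostly-few N≤m)) ⟩
        2 * (2 * good) + (length sample + length sample) ≡⟨ cong (λ x → 2 * (2 * good) + (length sample + x)) (+-identityʳ _) ⟨
        2 * (2 * good) + 2 * length sample ∎))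
        where
        lefts rights : Lists k n m → ℕ
        lefts w = 𝟙 (¬? (L.few? w))
        rights w = 𝟙 (¬? (R.few? w))
        r₁ : ∀ x → 2 * x + 2 * x ≡ 4 * x
        r₁ = solve-∀
        r₂ : ∀ g x y → 4 * (g + (x + y)) ≡ 2 * (2 * g) + (4 * x + 4 * y)
        r₂ = solve-∀
        some : ∀ {A B : Set} (a : Dec A) (b : Dec B) → 1 ≤ 𝟙 (a ×-dec b) + (𝟙 (¬? a) + 𝟙 (¬? b))
        some (yes _) (yes _) = s≤s z≤n
        some (yes _) (no _)  = s≤s z≤n
        some (no _)  b       = s≤s z≤n
        split : length sample ≤ good + (∑ sample lefts + ∑ sample rights)
        split = begin
          length sample ≡⟨ *-identityʳ _ ⟨
          length sample * 1 ≡⟨ ∑-const sample 1 ⟨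
          ∑ sample (λ _ → 1) ≤⟨ ∑-mono sample (λ w → some (L.few? w) (R.few? w)) ⟩
          ∑ sample (λ w → 𝟙 (good? w) + (lefts w + rights w)) ≡⟨ trans (∑-+ sample _ _) (cong (good +_) (∑-+ sample lefts rights)) ⟩
          good + (∑ sample lefts + ∑ sample rights) ∎

      Ω = outcomes W S T k n m N

      Σ-Ω : ∀ (f : Outcome W S T k n m N → ℕ) → ∑ Ω f ≡ ∑ sample (λ w → ∑ Hs (λ h → ∑ Rs (λ r → f (w , h , r))))
      Σ-Ω f = trans (∑-× sample (cartesianProduct Hs Rs) f) (∑-cong sample (λ w → ∑-× Hs Rs (λ x → f (w , x))))

      length-Ω : length Ω ≡ length sample * (Q ^ T * length Hs)
      length-Ω = begin-equality
        length Ω ≡⟨ trans (sym (*-identityʳ _)) (sym (∑-const Ω 1)) ⟩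
        ∑ Ω (λ _ → 1) ≡⟨ Σ-Ω (λ _ → 1) ⟩
        ∑ sample (λ _ → ∑ Hs (λ _ → ∑ Rs (λ _ → 1))) ≡⟨ ∑-const sample _ ⟩
        length sample * ∑ Hs (λ _ → ∑ Rs (λ _ → 1)) ≡⟨ cong (length sample *_) (trans (∑-const Hs _) (trans (*-comm (length Hs) _)
          (cong (_* length Hs) (trans (∑-const Rs 1) (trans (*-identityʳ _) length-Rs))))) ⟩
        length sample * (Q ^ T * length Hs) ∎

      Ω>0 : 0 < length Ω
      Ω>0 = ≤-≡ (*-mono-≤ samples>0 (*-mono-≤ (m^n>0 Q {{Q≢0}} T) Hs>0)) (sym length-Ω)
        where
        Q≢0 : NonZero Q
        Q≢0 = m^n≢0 2 W
        Hs>0 : 1 ≤ length Hs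
        Hs>0 = ≤-≡ (m^n>0 N M) (sym (length-functions N M))
        samples>0 : 1 ≤ length sample
        samples>0 = ≤-≡ (m^n>0 (m ^ n) {{m^n≢0 m n}} k) (sym (trans (length-vectors (vectors (allFin m) n) k)
          (cong (_^ k) (trans (length-vectors (allFin m) n) (cong (_^ n) (length-allFin m))))))

      success : unit-fraction D ℚ.≤ successProbability W S T k n m N P s τ
      success = Pr-lower Ω E? D Ω>0 (begin
        length Ω ≡⟨ length-Ω ⟩
        length sample * (Q ^ T * length Hs) ≤⟨ *-monoˡ-≤ _ mostly-good ⟩
        2 * good * (Q ^ T * length Hs) ≡⟨ trans (*-assoc 2 good _) (cong (2 *_) (sym (∑-*ʳ sample (Q ^ T * length Hs) _))) ⟩
        2 * ∑ sample (λ w → 𝟙 (good? w) * (Q ^ T * length Hs)) ≤⟨ *-monoʳ-≤ 2 (∑-mono sample (λ w → 𝟙*≤ (good? w) (λ { (l , r) → likely w l r }))) ⟩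
        2 * ∑ sample (λ w → D₀ * hits w) ≡⟨ trans (cong (2 *_) (∑-*ˡ sample D₀ hits)) (sym (*-assoc 2 D₀ _)) ⟩
        D * ∑ sample hits ≡⟨ cong (D *_) (Σ-Ω (λ ω → 𝟙 (E? ω))) ⟨
        D * ∑ Ω (λ ω → 𝟙 (E? ω)) ∎)

theorem5 :
  -- m ≤ poly(n) is m ≤ d · n^d; every polynomial is below such a bound for n ≥ 1.
  (k d : ℕ) → 2 ∣ k → 2 ≤ k →
  Σ[ P ∈ Program ] Σ[ b ∈ ℕ ] Σ[ C ∈ ℕ ] Σ[ e ∈ ℕ ] Σ[ c ∈ ℚ ]
    ( 0ℚ ℚ.< c
    × ((n m s : ℕ) → .{{_ : NonZero m}} → .{{_ : NonZero s}} →
       s ≤ n ^ (k / 2) → n ^ (k / 2) ≤ m → m ≤ d * n ^ d →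
       -- words of W = b · bits n = O(log n) bits
       let W = b * bits n
           N = n ^ (k / 2)
       in Σ[ S ∈ ℕ ] Σ[ T ∈ ℕ ]
            ( SpaceBound C n s W S
            × TimeBound C e k n s T
            × AlwaysHalts W S T k n m N P s
            × ((τ : Lists k n m → ℤ) →
               c ℚ.≤ successProbability W S T k n m N P s τ))))
-- The exponent 1 of the logarithm accounts for the number of scales; all other factors are
-- constants depending on k.
theorem5 k d 2∣k 2≤k = P , b , Cs + Ct , 1 , unit-fraction D , unit-fraction>0 D , λ n m s s≤N N≤m m≤ →
  let open Sized n m s s≤N N≤m m≤ in S , T , space , time , halts , success
  where open Parameters k d 2∣k 2≤k
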